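{- Let $R$ be a (fixed) connected regular graph with at least two edges. Then $R$-free Edge Deletion is NP-complete. Furthermore, $R$-free Edge Deletion is not solvable in time $2^{o(k)}\cdot |G|^{O(1)}$, unless the Exponential Time Hypothesis fails.
   Context: All graphs are simple, finite and undirected. For a fixed graph $H$, the problem $H$-free Edge Deletion is: given $(G,k)$ with $G$ a graph and $k$ a nonnegative integer (the parameter), decide whether there exists a set $F$ of at most $k$ edges of $G$ such that $G-F=(V(G),E(G)\setminus F)$ has no induced subgraph isomorphic to $H$. $|G|$ denotes $|V(G)|+|E(G)|$. A regular graph is a graph all of whose vertices have the same degree $r$ for some nonnegative integer $r$. The Exponential Time Hypothesis (ETH) is the assumption that 3-SAT cannot be solved in time $2^{o(n)}$, where $n$ is the number of variables. -}

module Defs where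

open import Data.Bool using (Bool; true; false; T; not; _∧_)
open import Data.Fin using (Fin; toℕ)
open import Data.Fin.Subset using (Subset; _∈_)
open import Data.List using (List; []; _∷_; [_]; _++_; length; filterᵇ; allFin; cartesianProduct; concatMap; map; replicate)
open import Data.List.Relation.Unary.All using (All)
open import Data.Maybe using (Maybe; just; nothing)
open import Data.Nat using (ℕ; zero; suc; _+_; _*_; _^_; _≤_; _<ᵇ_)
open import Data.Nat.Binary using (ℕᵇ; 2[1+_]; 1+[2_]; fromℕ)
open import Data.Product using (Σ; ∃; ∃-syntax; _×_; _,_; proj₁; proj₂)
open import Data.Sum using (_⊎_; inj₁; inj₂)
open import Data.Vec as Vec using (Vec)
open import Data.Vec.Relation.Unary.Any as VecAny using ()
open import Function using (_∘_)
open import Function.Bundles using (_⇔_; _↔_; Inverse)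
open import Relation.Binary.Construct.Closure.ReflexiveTransitive using (Star)
open import Relation.Binary.PropositionalEquality using (_≡_; cong; cong₂)
open import Relation.Nullary using (¬_; Reflects)

Word : Set
Word = List Bool

-- The blank is `nothing`; the input alphabet is Bool; `a` further work symbols.
Symbol : ℕ → Set
Symbol a = Maybe (Bool ⊎ Fin a)

pattern blank = nothing
pattern bit b = just (inj₁ b)

data Move : Set where
  left stay right : Move

-- A two-way infinite tape: `before` lists the cells to the left of the head,
-- nearest first, `after` those to the right; all unlisted cells are blank.
record Tape (Γ : Set) : Set where
  constructor tape
  field
    before : List Γ
    head   : Γ
    after  : List Γ

record TM : Set where
  field
    workTapes   : ℕ
    workSymbols : ℕ
    states      : ℕ
    start       : Fin states

  tapes : ℕ
  tapes = suc workTapes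

  Γ : Set
  Γ = Symbol workSymbols

  -- The machine halts when δ is `nothing`.
  field
    δ : Fin states → Vec Γ tapes → Maybe (Fin states × Vec (Γ × Move) tapes)

module _ {a : ℕ} where

  writeMove : Tape (Symbol a) → Symbol a × Move → Tape (Symbol a)
  writeMove (tape ls       _ rs)       (s , stay)  = tape ls s rs
  writeMove (tape []       _ rs)       (s , left)  = tape [] blank (s ∷ rs)
  writeMove (tape (l ∷ ls) _ rs)       (s , left)  = tape ls l (s ∷ rs)
  writeMove (tape ls       _ [])       (s , right) = tape (s ∷ ls) blank []
  writeMove (tape ls       _ (r ∷ rs)) (s , right) = tape (s ∷ ls) r rs

  blankTape : Tape (Symbol a)
  blankTape = tape [] blank []

  inputTape : Word → Tape (Symbol a)
  inputTape []      = blankTape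
  inputTape (b ∷ w) = tape [] (bit b) (map (λ c → bit c) w)

  leadingBits : List (Symbol a) → Word
  leadingBits (bit b ∷ ss) = b ∷ leadingBits ss
  leadingBits _            = []

  -- The longest bit string on the tape that starts under the head.
  outputOf : Tape (Symbol a) → Word
  outputOf (tape _ s rs) = leadingBits (s ∷ rs)

module _ (M : TM) where
  open TM M

  record Config : Set where
    constructor config
    field
      state    : Fin states
      contents : Vec (Tape Γ) tapes

  step : Config → Maybe Config
  step (config q ts) with δ q (Vec.map Tape.head ts)
  ... | nothing         = nothing
  ... | just (q′ , acts) = just (config q′ (Vec.zipWith writeMove ts acts))

  initial : Word → Config
  initial w = config start (inputTape w Vec.∷ Vec.replicate workTapes blankTape)

  output : Config → Word
  output c = outputOf (Vec.head (Config.contents c))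

  data HaltsIn : ℕ → Config → Config → Set where
    halt : ∀ {c} → step c ≡ nothing → HaltsIn zero c c
    next : ∀ {t c c′ d} → step c ≡ just c′ → HaltsIn t c′ d → HaltsIn (suc t) c d

  Outputs : Word → ℕ → Word → Set
  Outputs w t v = ∃[ s ] ∃[ d ] s ≤ t × HaltsIn s (initial w) d × output d ≡ v

-- c · n ^ e + c; up to domination these are all the polynomial bounds.
record PolyBound : Set where
  field
    coefficient exponent : ℕ

  at : ℕ → ℕ
  at n = coefficient * n ^ exponent + coefficient

open PolyBound public using (at)

PolyTime : (Word → Word) → Set
PolyTime f = Σ TM λ M → Σ PolyBound λ p → ∀ w → Outputs M w (at p (length w)) (f w)

Language : Set₁
Language = Word → Set

⟨_,_⟩ : Word → Word → Word
⟨ []    , v ⟩ = false ∷ v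
⟨ b ∷ w , v ⟩ = true ∷ b ∷ ⟨ w , v ⟩

InNP : Language → Set
InNP L = Σ (Word → Bool) λ verify → Σ PolyBound λ p →
  PolyTime ([_] ∘ verify) ×
  (∀ w → L w ⇔ (∃[ v ] length v ≤ at p (length w) × verify ⟨ w , v ⟩ ≡ true))

_≤ₚ_ : Language → Language → Set
L ≤ₚ L′ = Σ (Word → Word) λ f → PolyTime f × (∀ w → L w ⇔ L′ (f w))

NPHard : Language → Set₁
NPHard L = ∀ (L′ : Language) → InNP L′ → L′ ≤ₚ L

record Problem : Set₁ where
  field
    Instance : Set
    encode   : Instance → Word
    Yes      : Instance → Set

  language : Language
  language w = ∃[ x ] encode x ≡ w × Yes x

NPComplete : Problem → Set₁
NPComplete P = InNP (Problem.language P) × NPHard (Problem.language P)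

SolvableInTime : (P : Problem) → (Problem.Instance P → ℕ) → Set
SolvableInTime P time = Σ TM λ M → ∀ x →
  ∃[ answer ] Outputs M (encode x) (time x) [ answer ] × Reflects (Yes x) answer
  where open Problem P

-- f ∈ o(n)
Sublinear : (ℕ → ℕ) → Set
Sublinear f = ∀ c → ∃[ N ] ∀ n → N ≤ n → c * f n ≤ n

-- Solvable in time 2^{o(parameter)} · size^{O(1)}.
SubexpSolvable : (P : Problem) (parameter size : Problem.Instance P → ℕ) → Set
SubexpSolvable P parameter size = Σ (ℕ → ℕ) λ f → Σ PolyBound λ p →
  Sublinear f × SolvableInTime P (λ x → 2 ^ f (parameter x) * at p (size x))

-- (true , i) is the variable i, (false , i) its negation.
Literal : ℕ → Set
Literal n = Bool × Fin n

-- A clause may repeat a literal, so shorter non-empty clauses are covered.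
Clause : ℕ → Set
Clause n = Vec (Literal n) 3

record 3CNF : Set where
  field
    variables : ℕ
    clauses   : List (Clause variables)

Satisfiable : 3CNF → Set
Satisfiable φ = Σ (Fin variables → Bool) λ σ →
  All (VecAny.Any λ (sign , i) → σ i ≡ sign) clauses
  where open 3CNF φ

unary : ℕ → Word
unary n = replicate n true

encodeLiteral : ∀ {n} → Literal n → Word
encodeLiteral (sign , i) = sign ∷ unary (toℕ i) ++ [ false ]

encode3CNF : 3CNF → Word
encode3CNF φ = ⟨ unary variables , concatMap (concatMap encodeLiteral ∘ Vec.toList) clauses ⟩
  where open 3CNF φ

3SAT : Problem
3SAT = record { Instance = 3CNF ; encode = encode3CNF ; Yes = Satisfiable }

-- The factor polynomial in the length of the formula is needed because clauses
-- may be repeated, so that the length is not bounded in terms of the number of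
-- variables; on formulas without repeated clauses it is absorbed by 2^{o(n)}.
ETH : Set
ETH = ¬ SubexpSolvable 3SAT 3CNF.variables (length ∘ encode3CNF)

-- A set of unordered pairs of distinct elements of Fin n.
record EdgeSet (n : ℕ) : Set where
  field
    has    : Fin n → Fin n → Bool
    sym    : ∀ u v → has u v ≡ has v u
    irrefl : ∀ u → has u u ≡ false

open EdgeSet public using (has)

∣_∣ₑ : ∀ {n} → EdgeSet n → ℕ
∣_∣ₑ {n} E = length (filterᵇ (λ (u , v) → (toℕ u <ᵇ toℕ v) ∧ has E u v)
                             (cartesianProduct (allFin n) (allFin n)))

_⊆ₑ_ : ∀ {n} → EdgeSet n → EdgeSet n → Set
F ⊆ₑ E = ∀ u v → T (has F u v) → T (has E u v)

_∖ₑ_ : ∀ {n} → EdgeSet n → EdgeSet n → EdgeSet n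
E ∖ₑ F = record
  { has    = λ u v → has E u v ∧ not (has F u v)
  ; sym    = λ u v → cong₂ (λ a b → a ∧ not b) (EdgeSet.sym E u v) (EdgeSet.sym F u v)
  ; irrefl = λ u → cong (_∧ not (has F u u)) (EdgeSet.irrefl E u)
  }

record Graph : Set where
  field
    order : ℕ
    edges : EdgeSet order

  Vertex : Set
  Vertex = Fin order

  Adj : Vertex → Vertex → Set
  Adj u v = T (has edges u v)

  degree : Vertex → ℕ
  degree u = length (filterᵇ (has edges u) (allFin order))

  size : ℕ
  size = order + ∣ edges ∣ₑ

open Graph using (Vertex; Adj; edges; order)

Connected : Graph → Set
Connected G = ∀ u v → Star (Adj G) u v

Regular : Graph → Set
Regular G = ∃[ r ] ∀ u → Graph.degree G u ≡ r

ContainsInduced : Graph → Graph → Set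
ContainsInduced H G = Σ (Subset (order G)) λ S →
  Σ (Vertex H ↔ (∃[ v ] v ∈ S)) λ φ →
    let emb = λ u → proj₁ (Inverse.to φ u) in
    ∀ u v → Adj H u v ⇔ Adj G (emb u) (emb v)

_−_ : (G : Graph) → EdgeSet (order G) → Graph
G − F = record { order = order G ; edges = edges G ∖ₑ F }

encodeGraph : Graph → Word
encodeGraph G = ⟨ unary (order G) , map (λ (u , v) → has (edges G) u v) (cartesianProduct (allFin (order G)) (allFin (order G))) ⟩

-- Bijective base-2 numeration, least significant digit first, with digits
-- 1 and 2 written as false and true.
encodeℕᵇ : ℕᵇ → Word
encodeℕᵇ ℕᵇ.zero  = []
encodeℕᵇ 1+[2 n ] = false ∷ encodeℕᵇ n
encodeℕᵇ 2[1+ n ] = true ∷ encodeℕᵇ n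

_-freeEdgeDeletion : Graph → Problem
H -freeEdgeDeletion = record
  { Instance = Graph × ℕ
  ; encode   = λ (G , k) → ⟨ encodeℕᵇ (fromℕ k) , encodeGraph G ⟩
  ; Yes      = λ (G , k) → Σ (EdgeSet (order G)) λ F →
      F ⊆ₑ edges G × ∣ F ∣ₑ ≤ k × ¬ ContainsInduced H (G − F)
  }

{-# OPTIONS --safe #-}
module Submission where

-- Hardness goes through vertex cover on triangle-free graphs. In a connected r-regular graph R with r ≥ 2 some induced
-- path or triangle a–p–b has a connected complement. A triangle-free graph Q with orientation is turned into G by joining
-- a centre to every vertex of Q and completing every arc x → y to a copy of R with p the centre and a, b the ends x, y;
-- deleting the edges from the centre to a vertex cover destroys all copies, and regularity of R excludes new ones, because
-- a proper part of a glued copy never has all degrees r. Cook–Levin tableaux, read as tilings, and the reduction from CNF to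
-- vertex cover give NP-hardness. The budget is linear in the number of variables and clauses.
--
-- For the lower bound the number of clauses must first be made linear in the number n of variables. The sparsification of
-- Impagliazzo, Paturi and Zane branches on literals (or pairs of literals) that are contained in many clauses: one branch
-- adds the common part, the other the remainders. A potential bounded by 7θ·2n grows by 1 in the first branch and by θ² in
-- the second, so the tree has at most 2·(θ² + 1)^(14n/θ + 1) nodes, and every leaf has O(θ² n) clauses. A machine that does
-- not know the best θ, nor the running time of the assumed solver, tries all θ < J with time limit J for J = 0, 1, 2, …
--
-- Machines are programs on three stacks of bits. A value of PT σ τ f is a program that computes f, with polynomial bounds
-- on its running time and on the size of its result.

open import Data.Bool using (Bool; true; false; if_then_else_; not; _∧_; _∨_; T?)
open import Data.Bool.ListAction using (any; all)
open import Data.Bool.Properties using (T-≡; T-∧; T-∨)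
open import Data.Empty using (⊥; ⊥-elim)
open import Data.Fin using (Fin; zero; suc; fromℕ<)
open import Data.Fin.Properties using (toℕ-injective; toℕ<n)
open import Data.List using (List; []; _∷_; map; replicate; _++_; _ʳ++_; length; foldl; reverse; concatMap; filterᵇ; upTo; [_]; cartesianProduct; allFin)
open import Data.List.Membership.Propositional using (_∈_; _∉_; find; lose)
open import Data.List.Properties using (++-assoc; length-tabulate; length-++; length-map; ∷-injectiveˡ; length-replicate; length-upTo)
open import Data.List.Relation.Binary.Subset.Propositional using (_⊆_)
open import Data.List.Relation.Unary.All using ([]; _∷_; All)
open import Data.List.Relation.Unary.All.Properties using (all⁺; all⁻)
open import Data.List.Relation.Unary.AllPairs using ([]; _∷_)
open import Data.List.Relation.Unary.Any using (Any; here; there)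
open import Data.List.Relation.Unary.Any.Properties using (any⁺; any⁻; lookup-index)
open import Data.List.Relation.Unary.Unique.Propositional using (Unique)
open import Data.List.Relation.Unary.Unique.Propositional.Properties using (filter⁺; allFin⁺; cartesianProduct⁺; map⁺; ++⁺; upTo⁺)
open import Data.Maybe using (Maybe; just; nothing; maybe)
open import Data.Nat using (zero; suc; ℕ; _+_; _≤_; z≤n; s≤s; _*_; _^_; _∸_; _≤ᵇ_; _<ᵇ_; _⊓_; _≤?_; _<_; _<?_; _/_; NonZero)
open import Data.Nat.Binary using (ℕᵇ; 2[1+_]; 1+[2_]; fromℕ)
open import Data.Nat.Properties using (≤-trans; ≤-refl; +-mono-≤; ≤-reflexive; 1+n≰n; <ᵇ⇒<)
open import Data.Nat.Tactic.RingSolver using (solve-∀)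
open import Data.Product using (Σ; ∃-syntax; _×_; _,_; proj₁; proj₂)
open import Data.Sum using (_⊎_; inj₁; inj₂; [_,_]′)
open import Data.Unit using (⊤; tt)
open import Data.Vec using ([]; _∷_; Vec; zipWith)
open import Data.Vec.Relation.Unary.Any using (here; there)
open import Function using (_∘_; id)
open import Function.Bundles using (Equivalence; mk⇔; _⇔_)
open import Relation.Binary.Definitions using (DecidableEquality; tri<; tri≈; tri>)
open import Relation.Binary.PropositionalEquality using (_≡_; refl; sym; trans; cong; subst; cong₂; _≢_; ≢-sym; subst₂)
open import Relation.Nullary using (¬_; Dec; Reflects)
open import Defs

-- A vertex x of Q must cost one deletion however many copies pass through it; therefore all these
-- copies share the single edge from the centre to x, and the centre is the middle of the path. The
-- danger lies in unplanned copies of R. A new vertex has no neighbours outside its glued copy, so a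
-- copy of R through it uses all its r neighbours, and the connectivity of the rest of R carries
-- this on to a and b. Only the centre may be missed, when R is a cycle; then a new vertex of the
-- opposite arc y → x could close the cycle, hence arcs are never antiparallel. A copy without new
-- vertices lies in the centre and Q; it is dangerous if R contains the triangle a, p, b, hence Q
-- has no triangles. In the lower bound the f of 2^f(k) is any sublinear function, perhaps neither
-- monotone nor computable. The choice of the threshold θ may therefore enter the analysis only,
-- never the algorithm. Polynomial time refers to concrete machines; this is why every program
-- construction carries its bounds along.

module Machines where

 open import Data.Fin using (join; splitAt)
 open import Data.Fin.Properties using (splitAt-join) renaming (_≟_ to _≟ᶠ_)
 open import Data.List using (drop; head)
 open import Data.List.Properties using (map-∘)
 import Data.Maybe as Maybe
 open import Data.Product using (map₁)
 open import Data.Vec as Vec using (lookup; _[_]%=_)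
 open import Data.Vec.Properties using (lookup∘updateAt; lookup∘updateAt′; lookup-map)
 open import Function using (const)
 open import Relation.Nullary using (yes; no)

 -- Stack programs and their compilation to Turing machines

 Sym : Set
 Sym = Bool ⊎ Fin 1

 pattern 𝟎 = inj₁ false
 pattern 𝟏 = inj₁ true
 pattern # = inj₂ zero

 Store : Set
 Store = Vec (List Sym) 3

 -- `pop k f again` pops the top s of stack k (nothing if it is empty), runs f s,
 -- and starts over if again s.
 data Prog : Set where
  skip : Prog
  push : Fin 3 → Sym → Prog
  _⨾_ : Prog → Prog → Prog
  pop : Fin 3 → (Maybe Sym → Prog) → (Maybe Sym → Bool) → Prog

 infixr 4 _⨾_

 -- The constructor `slack` makes the time index an upper bound, so that estimates can replace exact
 -- counts anywhere in a derivation. A push is charged 2, because on a non-empty stack the machine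
 -- first moves left and then writes.
 data Exec : Prog → Store → ℕ → Store → Set where
  skip : ∀ {σ} → Exec skip σ 1 σ
  push : ∀ {k s σ} → Exec (push k s) σ 2 (σ [ k ]%= (s ∷_))
  _⨾_ : ∀ {p q σ σ′ σ″ t t′} → Exec p σ t σ′ → Exec q σ′ t′ σ″ → Exec (p ⨾ q) σ (t + t′) σ″
  stop : ∀ {k f g σ σ′ t} → g (head (lookup σ k)) ≡ false →
   Exec (f (head (lookup σ k))) (σ [ k ]%= drop 1) t σ′ → Exec (pop k f g) σ (suc t) σ′
  again : ∀ {k f g σ σ′ σ″ t t′} → g (head (lookup σ k)) ≡ true →
   Exec (f (head (lookup σ k))) (σ [ k ]%= drop 1) t σ′ →
   Exec (pop k f g) σ′ t′ σ″ → Exec (pop k f g) σ (suc (t + t′)) σ″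
  slack : ∀ {p σ σ′ t t′} → t ≤ t′ → Exec p σ t σ′ → Exec p σ t′ σ′

 -- A retract of `Fin card` is enough: the numbering must recover every element, but several numbers
 -- may denote the same one.
 record Finite (A : Set) : Set where
  field
   card : ℕ
   to : A → Fin card
   from : Fin card → A
   from-to : ∀ a → from (to a) ≡ a

 open Finite

 retract : ∀ {A B : Set} (f : A → B) (g : B → A) → (∀ a → g (f a) ≡ a) → Finite B → Finite A
 retract f g gf B = record
  { card = card B ; to = to B ∘ f ; from = g ∘ from B
  ; from-to = λ a → trans (cong g (from-to B (f a))) (gf a) }

 finite-⊤ : Finite ⊤
 finite-⊤ = record { card = 1 ; to = λ _ → zero ; from = λ _ → tt ; from-to = λ _ → refl }

 finite-⊎ : ∀ {A B} → Finite A → Finite B → Finite (A ⊎ B)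
 finite-⊎ A B = record
  { card = card A + card B
  ; to = λ x → join _ _ (Data.Sum.map (to A) (to B) x)
  ; from = λ i → Data.Sum.map (from A) (from B) (splitAt (card A) i)
  ; from-to = λ x → trans (cong (Data.Sum.map (from A) (from B)) (splitAt-join (card A) (card B) (Data.Sum.map (to A) (to B) x))) (back x) }
  where
  back : ∀ x → Data.Sum.map (from A) (from B) (Data.Sum.map (to A) (to B) x) ≡ x
  back (inj₁ a) = cong inj₁ (from-to A a)
  back (inj₂ b) = cong inj₂ (from-to B b)

 finite-ΣSym : (B : Maybe Sym → Set) → (∀ s → Finite (B s)) → Finite (Σ (Maybe Sym) B)
 finite-ΣSym B fin = retract f g gf
  (finite-⊎ (fin nothing) (finite-⊎ (fin (just 𝟎)) (finite-⊎ (fin (just 𝟏)) (fin (just #)))))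
  where
  f : Σ (Maybe Sym) B → B nothing ⊎ (B (just 𝟎) ⊎ (B (just 𝟏) ⊎ B (just #)))
  f (nothing , b) = inj₁ b
  f (just 𝟎 , b) = inj₂ (inj₁ b)
  f (just 𝟏 , b) = inj₂ (inj₂ (inj₁ b))
  f (just # , b) = inj₂ (inj₂ (inj₂ b))
  g : B nothing ⊎ (B (just 𝟎) ⊎ (B (just 𝟏) ⊎ B (just #))) → Σ (Maybe Sym) B
  g (inj₁ b) = nothing , b
  g (inj₂ (inj₁ b)) = just 𝟎 , b
  g (inj₂ (inj₂ (inj₁ b))) = just 𝟏 , b
  g (inj₂ (inj₂ (inj₂ b))) = just # , b
  gf : ∀ x → g (f x) ≡ x
  gf (nothing , b) = refl
  gf (just 𝟎 , b) = refl
  gf (just 𝟏 , b) = refl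
  gf (just # , b) = refl

 -- Control states. A push needs two, one of them for the move to the left; the body of a `pop`
 -- carries the popped symbol along, since this symbol decides about repetition after the body.
 St : Prog → Set
 St skip = ⊤
 St (push _ _) = ⊤ ⊎ ⊤
 St (p ⨾ q) = St p ⊎ St q
 St (pop _ f _) = ⊤ ⊎ Σ (Maybe Sym) (λ s → St (f s))

 finite-St : ∀ p → Finite (St p)
 finite-St skip = finite-⊤
 finite-St (push _ _) = finite-⊎ finite-⊤ finite-⊤
 finite-St (p ⨾ q) = finite-⊎ (finite-St p) (finite-St q)
 finite-St (pop _ f _) = finite-⊎ finite-⊤ (finite-ΣSym _ (λ s → finite-St (f s)))

 start : ∀ p → St p
 start skip = tt
 start (push _ _) = inj₁ tt
 start (p ⨾ q) = inj₁ (start p)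
 start (pop _ _ _) = inj₁ tt

 Γ₁ : Set
 Γ₁ = Symbol 1

 Tapes : Set
 Tapes = Vec (Tape Γ₁) 3

 keep : ∀ {n} → Vec Γ₁ n → Vec (Γ₁ × Move) n
 keep = Vec.map (_, stay)

 at′ : ∀ {n} → Fin n → Γ₁ × Move → Vec Γ₁ n → Vec (Γ₁ × Move) n
 at′ k x hs = keep hs [ k ]%= const x

 popMove : Γ₁ → Move
 popMove nothing = stay
 popMove (just _) = right

 enter : ∀ {A : Set} q → Maybe A → Maybe (A ⊎ St q)
 enter q m = just (maybe inj₁ (inj₂ (start q)) m)

 return : ∀ {B : Maybe Sym → Set} → (Maybe Sym → Bool) → ∀ s → Maybe (B s) → Maybe (⊤ ⊎ Σ (Maybe Sym) B)
 return g s = maybe (λ a → just (inj₂ (s , a))) (if g s then just (inj₁ tt) else nothing)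

 -- `nothing` in the first component means that the program is finished.
 nxt : ∀ p → St p → Vec Γ₁ 3 → Maybe (St p) × Vec (Γ₁ × Move) 3
 nxt skip _ hs = nothing , keep hs
 nxt (push k s) (inj₁ _) hs with lookup hs k
 ... | nothing = nothing , at′ k (just s , stay) hs
 ... | just y = just (inj₂ tt) , at′ k (just y , left) hs
 nxt (push k s) (inj₂ _) hs = nothing , at′ k (just s , stay) hs
 nxt (p ⨾ q) (inj₁ a) hs = map₁ (enter q) (nxt p a hs)
 nxt (p ⨾ q) (inj₂ b) hs = map₁ (Maybe.map inj₂) (nxt q b hs)
 nxt (pop k f g) (inj₁ _) hs =
  just (inj₂ (lookup hs k , start (f (lookup hs k)))) , at′ k (nothing , popMove (lookup hs k)) hs
 nxt (pop k f g) (inj₂ (s , a)) hs =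
  map₁ (return g s) (nxt (f s) a hs)

 data Path (p : Prog) (a : St p) (ts : Tapes) : ℕ → Tapes → Set where
  exit : ∀ {x ts′} → nxt p a (Vec.map Tape.head ts) ≡ (nothing , x) →
   ts′ ≡ zipWith writeMove ts x → Path p a ts 1 ts′
  hop : ∀ {a′ x n ts′} → nxt p a (Vec.map Tape.head ts) ≡ (just a′ , x) →
   Path p a′ (zipWith writeMove ts x) n ts′ → Path p a ts (suc n) ts′

 seq₂ : ∀ {p q b ts n ts′} → Path q b ts n ts′ → Path (p ⨾ q) (inj₂ b) ts n ts′
 seq₂ (exit eq e) = exit (cong (map₁ (Maybe.map inj₂)) eq) e
 seq₂ (hop eq r) = hop (cong (map₁ (Maybe.map inj₂)) eq) (seq₂ r)

 seq₁ : ∀ {p q a ts n ts′ n′ ts″} → Path p a ts n ts′ → Path q (start q) ts′ n′ ts″ →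
  Path (p ⨾ q) (inj₁ a) ts (n + n′) ts″
 seq₁ {q = q} (exit eq refl) r′ = hop (cong (map₁ (enter q)) eq) (seq₂ r′)
 seq₁ {q = q} (hop eq r) r′ = hop (cong (map₁ (enter q)) eq) (seq₁ r r′)

 module _ {k : Fin 3} {f : Maybe Sym → Prog} {g : Maybe Sym → Bool} {s : Maybe Sym} where

  after : Maybe (St (f s)) → Maybe (St (pop k f g))
  after = return g s

  done : ∀ {b} → g s ≡ b → after nothing ≡ (if b then just (inj₁ tt) else nothing)
  done refl = refl

  body-stop : ∀ {a ts n ts′} → g s ≡ false → Path (f s) a ts n ts′ →
   Path (pop k f g) (inj₂ (s , a)) ts n ts′
  body-stop gs (exit eq e) = exit (trans (cong (map₁ after) eq) (cong (_, _) (done gs))) e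
  body-stop gs (hop eq r) = hop (cong (map₁ after) eq) (body-stop gs r)

  body-again : ∀ {a ts n ts′ n′ ts″} → g s ≡ true → Path (f s) a ts n ts′ →
   Path (pop k f g) (inj₁ tt) ts′ n′ ts″ → Path (pop k f g) (inj₂ (s , a)) ts (n + n′) ts″
  body-again gs (exit eq refl) r′ = hop (trans (cong (map₁ after) eq) (cong (_, _) (done gs))) r′
  body-again gs (hop eq r) r′ = hop (cong (map₁ after) eq) (body-again gs r r′)

 blanks : ℕ → List Γ₁
 blanks j = replicate j nothing

 -- The top of the stack is under the head and the bottom is to the right. A pop erases the cell and
 -- moves right, so j blanks may remain listed on the left; later pushes grow back into them.
 data Rep : List Sym → Tape Γ₁ → Set where
  empty : ∀ j → Rep [] (tape (blanks j) nothing [])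
  full : ∀ j {s l} → Rep (s ∷ l) (tape (blanks j) (just s) (map just l))

 rep-head : ∀ {l t} → Rep l t → Tape.head t ≡ head l
 rep-head (empty j) = refl
 rep-head (full j) = refl

 rep-pop : ∀ {l t} → Rep l t → Rep (drop 1 l) (writeMove t (nothing , popMove (head l)))
 rep-pop (empty j) = empty j
 rep-pop (full j {s} {[]}) = empty (suc j)
 rep-pop (full j {s} {x ∷ l}) = full (suc j)

 rep-push₀ : ∀ {t} s → Rep [] t → Rep (s ∷ []) (writeMove t (just s , stay))
 rep-push₀ s (empty j) = full j

 rep-push₁ : ∀ {t} s y {l} → Rep (y ∷ l) t →
  Rep (s ∷ y ∷ l) (writeMove (writeMove t (just y , left)) (just s , stay))
 rep-push₁ s y (full zero) = full 0
 rep-push₁ s y (full (suc j)) = full j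

 RepS : Store → Tapes → Set
 RepS σ ts = ∀ k → Rep (lookup σ k) (lookup ts k)

 keep-act : ∀ {n} (ts : Vec (Tape Γ₁) n) → zipWith writeMove ts (keep (Vec.map Tape.head ts)) ≡ ts
 keep-act [] = refl
 keep-act (tape _ _ _ ∷ ts) = cong (_ ∷_) (keep-act ts)

 at-act : ∀ {n} (k : Fin n) x (ts : Vec (Tape Γ₁) n) →
  zipWith writeMove ts (at′ k x (Vec.map Tape.head ts)) ≡ ts [ k ]%= (λ t → writeMove t x)
 at-act zero x (t ∷ ts) = cong (_ ∷_) (keep-act ts)
 at-act (suc k) x (tape _ _ _ ∷ ts) = cong (_ ∷_) (at-act k x ts)

 rep-update : ∀ {σ ts} k {u v} → RepS σ ts → Rep (u (lookup σ k)) (v (lookup ts k)) →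
  RepS (σ [ k ]%= u) (ts [ k ]%= v)
 rep-update {σ} {ts} k {u} {v} R r j with j ≟ᶠ k
 ... | yes refl rewrite lookup∘updateAt k {u} σ | lookup∘updateAt k {v} ts = r
 ... | no j≢k rewrite lookup∘updateAt′ j k {u} j≢k σ | lookup∘updateAt′ j k {v} j≢k ts = R j

 lookup-head : ∀ {σ ts} → RepS σ ts → ∀ k → lookup (Vec.map Tape.head ts) k ≡ head (lookup σ k)
 lookup-head {ts = ts} R k = trans (lookup-map k Tape.head ts) (rep-head (R k))

 Reaches : Prog → Tapes → ℕ → Store → Set
 Reaches p ts t σ′ = ∃[ n ] ∃[ ts′ ] n ≤ t × Path p (start p) ts n ts′ × RepS σ′ ts′

 updated : ∀ k x {ts} {σ : Store} {u : List Sym → List Sym} → RepS σ ts → Rep (u (lookup σ k)) (writeMove (lookup ts k) x) →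
  RepS (σ [ k ]%= u) (zipWith writeMove ts (at′ k x (Vec.map Tape.head ts)))
 updated k x {ts} {σ} {u} R r rewrite at-act k x ts = rep-update {σ} {ts} k {u} R r

 popped : ∀ {σ ts} k → RepS σ ts →
  RepS (σ [ k ]%= drop 1) (zipWith writeMove ts (at′ k (nothing , popMove (head (lookup σ k))) (Vec.map Tape.head ts)))
 popped {σ} {ts} k R = updated k _ {ts} {σ} R (rep-pop (R k))

 pop-next : ∀ {k f g σ ts} → RepS σ ts →
  nxt (pop k f g) (inj₁ tt) (Vec.map Tape.head ts) ≡
  (just (inj₂ (head (lookup σ k) , start (f (head (lookup σ k))))) ,
   at′ k (nothing , popMove (head (lookup σ k))) (Vec.map Tape.head ts))
 pop-next {k} {f} {g} {σ} {ts} R =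
  cong (λ h → just (inj₂ (h , start (f h))) , at′ k (nothing , popMove h) (Vec.map Tape.head ts)) (lookup-head {σ} {ts} R k)

 push-next₀ : ∀ {k s hs} → lookup hs k ≡ nothing →
  nxt (push k s) (inj₁ tt) hs ≡ (nothing , at′ k (just s , stay) hs)
 push-next₀ eq rewrite eq = refl

 push-next₁ : ∀ {k s hs y} → lookup hs k ≡ just y →
  nxt (push k s) (inj₁ tt) hs ≡ (just (inj₂ tt) , at′ k (just y , left) hs)
 push-next₁ eq rewrite eq = refl

 simulate : ∀ {p σ t σ′} → Exec p σ t σ′ → ∀ {ts} → RepS σ ts → Reaches p ts t σ′
 simulate skip {ts} R = 1 , ts , ≤-refl , exit refl (sym (keep-act ts)) , R
 simulate (push {k} {s} {σ}) {ts} R with lookup σ k in eqσ | lookup-head {σ} {ts} R k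
 ... | [] | eqh = 1 , _ , s≤s z≤n , exit (push-next₀ eqh) refl ,
  updated k _ {ts} {σ} R (subst (λ l → Rep (s ∷ l) _) (sym eqσ) (rep-push₀ s (subst (λ l → Rep l _) eqσ (R k))))
 -- On a non-empty stack y is rewritten while the head moves left; the new top is written in the
 -- second step.
 ... | y ∷ l | eqh = 2 , _ , ≤-refl , hop (push-next₁ eqh) (exit refl refl) , R″
  where
  us : Tapes
  us = ts [ k ]%= (λ t → writeMove t (just y , left))
  R″ : RepS (σ [ k ]%= (s ∷_)) (zipWith writeMove (zipWith writeMove ts (at′ k (just y , left) (Vec.map Tape.head ts)))
   (at′ k (just s , stay) (Vec.map Tape.head (zipWith writeMove ts (at′ k (just y , left) (Vec.map Tape.head ts))))))
  R″ rewrite at-act k (just y , left) ts | at-act k (just s , stay) us = R3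
   where
   R3 : RepS (σ [ k ]%= (s ∷_)) (us [ k ]%= (λ t → writeMove t (just s , stay)))
   R3 j with j ≟ᶠ k
   ... | yes refl rewrite lookup∘updateAt k {s ∷_} σ | lookup∘updateAt k {λ t → writeMove t (just s , stay)} us
    | lookup∘updateAt k {λ t → writeMove t (just y , left)} ts =
    subst (λ l → Rep (s ∷ l) _) (sym eqσ) (rep-push₁ s y (subst (λ l → Rep l _) eqσ (R k)))
   ... | no j≢k rewrite lookup∘updateAt′ j k {s ∷_} j≢k σ | lookup∘updateAt′ j k {λ t → writeMove t (just s , stay)} j≢k us
    | lookup∘updateAt′ j k {λ t → writeMove t (just y , left)} j≢k ts = R j
 simulate (e ⨾ e′) {ts} R =
  let n , ts′ , n≤ , r , R′ = simulate e R
      n′ , ts″ , n′≤ , r′ , R″ = simulate e′ R′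
  in n + n′ , ts″ , +-mono-≤ n≤ n′≤ , seq₁ r r′ , R″
 simulate (stop {k} {f} {g} {σ} gs e) {ts} R =
  let n , ts′ , n≤ , r , R′ = simulate e (popped {σ} {ts} k R)
  in suc n , ts′ , s≤s n≤ , hop (pop-next {k} {f} {g} {σ} {ts} R) (body-stop gs r) , R′
 simulate (again {k} {f} {g} {σ} gs e e′) {ts} R =
  let n , ts′ , n≤ , r , R′ = simulate e (popped {σ} {ts} k R)
      n′ , ts″ , n′≤ , r′ , R″ = simulate e′ R′
  in suc (n + n′) , ts″ , s≤s (+-mono-≤ n≤ n′≤) , hop (pop-next {k} {f} {g} {σ} {ts} R) (body-again gs r r′) , R″
 simulate (slack t≤ e) R =
  let n , ts′ , n≤ , rest = simulate e R in n , ts′ , ≤-trans n≤ t≤ , rest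

 -- State zero is an extra halting state, so a path and the machine run that it describes have the
 -- same number of steps.
 machine : Prog → TM
 machine p = record
  { workTapes = 2 ; workSymbols = 1 ; states = suc (card fin) ; start = suc (to fin (start p)) ; δ = δ }
  where
  fin = finite-St p
  δ : Fin (suc (card fin)) → Vec Γ₁ 3 → Maybe (Fin (suc (card fin)) × Vec (Γ₁ × Move) 3)
  δ zero _ = nothing
  δ (suc q) hs = just (map₁ (maybe (suc ∘ to fin) zero) (nxt p (from fin q) hs))

 module _ (p : Prog) where
  private fin = finite-St p

  path-halts : ∀ {a ts n ts′} → Path p a ts n ts′ →
   HaltsIn (machine p) n (config (suc (to fin a)) ts) (config zero ts′)
  path-halts {a} {ts} (exit {x} eq refl) = next eq′ (halt refl)
   where
   eq′ : Defs.step (machine p) (config (suc (to fin a)) ts) ≡ just (config zero (zipWith writeMove ts x))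
   eq′ rewrite from-to fin a | eq = refl
  path-halts {a} {ts} (hop {a′} {x} eq r) = next eq′ (path-halts r)
   where
   eq′ : Defs.step (machine p) (config (suc (to fin a)) ts) ≡ just (config (suc (to fin a′)) (zipWith writeMove ts x))
   eq′ rewrite from-to fin a | eq = refl

 bits : Word → List Sym
 bits = map inj₁

 rep-input : ∀ w → Rep (bits w) (inputTape w)
 rep-input [] = empty 0
 rep-input (b ∷ w) = subst (λ l → Rep (bits (b ∷ w)) (tape [] (just (inj₁ b)) l)) (sym (map-∘ w)) (full 0)

 leading-bits : ∀ w → leadingBits {1} (map just (bits w)) ≡ w
 leading-bits [] = refl
 leading-bits (b ∷ w) = cong (b ∷_) (leading-bits w)

 rep-output : ∀ w {t} → Rep (bits w) t → outputOf t ≡ w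
 rep-output [] (empty j) = refl
 rep-output (b ∷ w) (full j) = cong (b ∷_) (leading-bits w)

 exec-outputs : ∀ {p w t v a b} → Exec p (bits w ∷ [] ∷ [] ∷ []) t (bits v ∷ a ∷ b ∷ []) → Outputs (machine p) w t v
 exec-outputs {p} {w} {t} {v} e
  with n , (t₀ ∷ ts) , n≤ , r , R ← simulate e {inputTape w ∷ blankTape ∷ blankTape ∷ []}
   (λ { zero → rep-input w ; (suc zero) → empty 0 ; (suc (suc zero)) → empty 0 })
  = n , _ , n≤ , path-halts p r , rep-output v (R zero)

-- A typed language of programs with polynomial bounds

module Programs where

 open import Data.List.Properties using (++-identityʳ)
 open import Data.Nat.Properties
 open Machines

 -- Expressions instead of functions: without subtraction each of them is monotone, and composition
 -- is substitution, so bounds combine without side conditions.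
 data Pol : Set where
  K : ℕ → Pol
  X : Pol
  _⊞_ _⊠_ : Pol → Pol → Pol

 infixl 6 _⊞_
 infixl 7 _⊠_

 ⟪_⟫ : Pol → ℕ → ℕ
 ⟪ K c ⟫ n = c
 ⟪ X ⟫ n = n
 ⟪ p ⊞ q ⟫ n = ⟪ p ⟫ n + ⟪ q ⟫ n
 ⟪ p ⊠ q ⟫ n = ⟪ p ⟫ n * ⟪ q ⟫ n

 ⟪⟫-mono : ∀ p {m n} → m ≤ n → ⟪ p ⟫ m ≤ ⟪ p ⟫ n
 ⟪⟫-mono (K c) le = ≤-refl
 ⟪⟫-mono X le = le
 ⟪⟫-mono (p ⊞ q) le = +-mono-≤ (⟪⟫-mono p le) (⟪⟫-mono q le)
 ⟪⟫-mono (p ⊠ q) le = *-mono-≤ (⟪⟫-mono p le) (⟪⟫-mono q le)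

 _⊙_ : Pol → Pol → Pol
 K c ⊙ r = K c
 X ⊙ r = r
 (p ⊞ q) ⊙ r = (p ⊙ r) ⊞ (q ⊙ r)
 (p ⊠ q) ⊙ r = (p ⊙ r) ⊠ (q ⊙ r)

 infixr 8 _⊙_

 ⊙-eval : ∀ p r n → ⟪ p ⊙ r ⟫ n ≡ ⟪ p ⟫ (⟪ r ⟫ n)
 ⊙-eval (K c) r n = refl
 ⊙-eval X r n = refl
 ⊙-eval (p ⊞ q) r n = cong₂ _+_ (⊙-eval p r n) (⊙-eval q r n)
 ⊙-eval (p ⊠ q) r n = cong₂ _*_ (⊙-eval p r n) (⊙-eval q r n)

 ⊙-≤ : ∀ p r {m n} → m ≤ ⟪ r ⟫ n → ⟪ p ⟫ m ≤ ⟪ p ⊙ r ⟫ n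
 ⊙-≤ p r {m} {n} le = ≤-trans (⟪⟫-mono p le) (≤-reflexive (sym (⊙-eval p r n)))

 ^-*-distrib : ∀ e m n → (m * n) ^ e ≡ m ^ e * n ^ e
 ^-*-distrib zero m n = refl
 ^-*-distrib (suc e) m n = trans (cong (m * n *_) (^-*-distrib e m n)) ([m*n]*[o*p]≡[m*o]*[n*p] m n (m ^ e) (n ^ e))

 private
  -- The base n + 1 is positive even at n = 0, so powers increase with the exponent and both
  -- summands fit under the exponent e + f.
  power : ∀ p → ∃[ c ] ∃[ e ] ∀ n → ⟪ p ⟫ n ≤ c * suc n ^ e
  power (K c) = c , 0 , λ n → ≤-reflexive (sym (*-identityʳ c))
  power X = 1 , 1 , λ n → ≤-trans (n≤1+n n) (≤-reflexive (sym (trans (*-identityˡ _) (*-identityʳ (suc n)))))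
  power (p ⊞ q) with c , e , h ← power p | d , f , k ← power q =
   c + d , e + f , λ n → ≤-trans
    (+-mono-≤ (≤-trans (h n) (*-monoʳ-≤ c (^-monoʳ-≤ (suc n) (m≤m+n e f))))
     (≤-trans (k n) (*-monoʳ-≤ d (^-monoʳ-≤ (suc n) (m≤n+m f e)))))
    (≤-reflexive (sym (*-distribʳ-+ (suc n ^ (e + f)) c d)))
  power (p ⊠ q) with c , e , h ← power p | d , f , k ← power q =
   c * d , e + f , λ n → ≤-trans (*-mono-≤ (h n) (k n))
    (≤-reflexive (trans ([m*n]*[o*p]≡[m*o]*[n*p] c (suc n ^ e) d (suc n ^ f))
     (cong (c * d *_) (sym (^-distribˡ-+-* (suc n) e f)))))

  -- For n ≥ 1 because n + 1 ≤ 2n; the case n = 0 is taken care of by the additive constant, as in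
  -- `PolyBound`.
  suc^≤ : ∀ e n → suc n ^ e ≤ 2 ^ e * n ^ e + 2 ^ e
  suc^≤ e zero = ≤-trans (≤-reflexive (^-zeroˡ e)) (≤-trans (m^n>0 2 e) (m≤n+m (2 ^ e) _))
  suc^≤ e (suc n) = ≤-trans (^-monoˡ-≤ e le) (≤-trans (≤-reflexive (^-*-distrib e 2 (suc n))) (m≤m+n _ _))
   where
   le : suc (suc n) ≤ 2 * suc n
   le = s≤s (≤-trans (m≤n+m (suc n) n) (+-monoʳ-≤ n (m≤m+n (suc n) 0)))

 dominate : Pol → PolyBound
 dominate p with c , e , _ ← power p = record { coefficient = c * 2 ^ e ; exponent = e }

 dominate-≤ : ∀ p n → ⟪ p ⟫ n ≤ at (dominate p) n
 dominate-≤ p n with c , e , h ← power p =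
  ≤-trans (h n) (≤-trans (*-monoʳ-≤ c (suc^≤ e n))
   (≤-reflexive (trans (*-distribˡ-+ c (2 ^ e * n ^ e) (2 ^ e)) (cong (_+ c * 2 ^ e) (sym (*-assoc c (2 ^ e) (n ^ e)))))))

 powX : ℕ → Pol
 powX zero = K 1
 powX (suc e) = X ⊠ powX e

 powX-^ : ∀ e n → ⟪ powX e ⟫ n ≡ n ^ e
 powX-^ zero n = refl
 powX-^ (suc e) n = cong (n *_) (powX-^ e n)

 polOf : PolyBound → Pol
 polOf b = K (PolyBound.coefficient b) ⊠ powX (PolyBound.exponent b) ⊞ K (PolyBound.coefficient b)

 polOf-at : ∀ b n → ⟪ polOf b ⟫ n ≡ at b n
 polOf-at b n = cong (λ z → c * z + c) (powX-^ (PolyBound.exponent b) n)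
  where c = PolyBound.coefficient b

 -- `nat` is coded in unary, so a number counts as an input of its own magnitude and a loop up to n
 -- is polynomial.
 data Ty : Set where
  𝟙 𝔹 nat : Ty
  list : Ty → Ty
  _⊗_ _⊕_ : Ty → Ty → Ty

 infixr 6 _⊗_
 infixr 5 _⊕_

 ⟦_⟧ : Ty → Set
 ⟦ 𝟙 ⟧ = ⊤
 ⟦ 𝔹 ⟧ = Bool
 ⟦ nat ⟧ = ℕ
 ⟦ list τ ⟧ = List ⟦ τ ⟧
 ⟦ σ ⊗ τ ⟧ = ⟦ σ ⟧ × ⟦ τ ⟧
 ⟦ σ ⊕ τ ⟧ = ⟦ σ ⟧ ⊎ ⟦ τ ⟧

 -- Codes are self-delimiting: a pair is a concatenation, and a program reads its argument without
 -- disturbing what lies below it on the stack.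
 put : ∀ τ → ⟦ τ ⟧ → List Sym → List Sym
 put 𝟙 _ r = r
 put 𝔹 b r = inj₁ b ∷ r
 put nat zero r = 𝟎 ∷ r
 put nat (suc n) r = 𝟏 ∷ put nat n r
 put (list τ) [] r = 𝟎 ∷ r
 put (list τ) (x ∷ xs) r = 𝟏 ∷ put τ x (put (list τ) xs r)
 put (σ ⊗ τ) (x , y) r = put σ x (put τ y r)
 put (σ ⊕ τ) (inj₁ x) r = 𝟎 ∷ put σ x r
 put (σ ⊕ τ) (inj₂ y) r = 𝟏 ∷ put τ y r

 -- An upper bound on the length of the code. The unit counts 1 although its code is empty; thus
 -- every size is positive and pays for at least one step.
 size : ∀ τ → ⟦ τ ⟧ → ℕ
 size 𝟙 _ = 1
 size 𝔹 _ = 1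
 size nat n = suc n
 size (list τ) [] = 1
 size (list τ) (x ∷ xs) = suc (size τ x + size (list τ) xs)
 size (σ ⊗ τ) (x , y) = size σ x + size τ y
 size (σ ⊕ τ) (inj₁ x) = suc (size σ x)
 size (σ ⊕ τ) (inj₂ y) = suc (size τ y)

 size>0 : ∀ τ x → 1 ≤ size τ x
 size>0 𝟙 x = ≤-refl
 size>0 𝔹 x = ≤-refl
 size>0 nat x = s≤s z≤n
 size>0 (list τ) [] = ≤-refl
 size>0 (list τ) (x ∷ xs) = s≤s z≤n
 size>0 (σ ⊗ τ) (x , y) = ≤-trans (size>0 σ x) (m≤m+n _ _)
 size>0 (σ ⊕ τ) (inj₁ x) = s≤s z≤n
 size>0 (σ ⊕ τ) (inj₂ x) = s≤s z≤n

 module _ {S : Set} (u : Bool → S → S) where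

  -- The fold of `u` over the bits of the code in reading order. The program `scan` computes it, and
  -- `walk-natural` relates it to the reversed code `edoc`.
  walk : ∀ τ → ⟦ τ ⟧ → S → S
  walk 𝟙 _ s = s
  walk 𝔹 b s = u b s
  walk nat zero s = u false s
  walk nat (suc n) s = walk nat n (u true s)
  walk (list τ) [] s = u false s
  walk (list τ) (x ∷ xs) s = walk (list τ) xs (walk τ x (u true s))
  walk (σ ⊗ τ) (x , y) s = walk τ y (walk σ x s)
  walk (σ ⊕ τ) (inj₁ x) s = walk σ x (u false s)
  walk (σ ⊕ τ) (inj₂ y) s = walk τ y (u true s)

 walk-natural : ∀ {S S′ : Set} {u : Bool → S → S} {u′ : Bool → S′ → S′} (h : S → S′) →
  (∀ b s → u′ b (h s) ≡ h (u b s)) → ∀ τ x s → walk u′ τ x (h s) ≡ h (walk u τ x s)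
 walk-natural h nat-u 𝟙 x s = refl
 walk-natural h nat-u 𝔹 x s = nat-u x s
 walk-natural h nat-u nat zero s = nat-u false s
 walk-natural {u′ = u′} h nat-u nat (suc x) s = trans (cong (walk u′ nat x) (nat-u true s)) (walk-natural h nat-u nat x _)
 walk-natural h nat-u (list τ) [] s = nat-u false s
 walk-natural {u′ = u′} h nat-u (list τ) (x ∷ xs) s =
  trans (cong (walk u′ (list τ) xs) (trans (cong (walk u′ τ x) (nat-u true s)) (walk-natural h nat-u τ x _)))
   (walk-natural h nat-u (list τ) xs _)
 walk-natural {u′ = u′} h nat-u (σ ⊗ τ) (x , y) s =
  trans (cong (walk u′ τ y) (walk-natural h nat-u σ x s)) (walk-natural h nat-u τ y _)
 walk-natural {u′ = u′} h nat-u (σ ⊕ τ) (inj₁ x) s = trans (cong (walk u′ σ x) (nat-u false s)) (walk-natural h nat-u σ x _)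
 walk-natural {u′ = u′} h nat-u (σ ⊕ τ) (inj₂ y) s = trans (cong (walk u′ τ y) (nat-u true s)) (walk-natural h nat-u τ y _)

 -- the code of a value, last bit first
 edoc : ∀ τ → ⟦ τ ⟧ → List Bool → List Bool
 edoc = walk _∷_

 edoc-put : ∀ τ x v r → bits (edoc τ x v) ʳ++ r ≡ bits v ʳ++ put τ x r
 edoc-put 𝟙 x v r = refl
 edoc-put 𝔹 x v r = refl
 edoc-put nat zero v r = refl
 edoc-put nat (suc n) v r = edoc-put nat n (true ∷ v) r
 edoc-put (list τ) [] v r = refl
 edoc-put (list τ) (x ∷ xs) v r = trans (edoc-put (list τ) xs _ r) (edoc-put τ x (true ∷ v) _)
 edoc-put (σ ⊗ τ) (x , y) v r = trans (edoc-put τ y _ r) (edoc-put σ x v _)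
 edoc-put (σ ⊕ τ) (inj₁ x) v r = edoc-put σ x (false ∷ v) r
 edoc-put (σ ⊕ τ) (inj₂ y) v r = edoc-put τ y (true ∷ v) r

 edoc-length : ∀ τ x v → length (edoc τ x v) ≤ size τ x + length v
 edoc-length 𝟙 x v = n≤1+n _
 edoc-length 𝔹 x v = ≤-refl
 edoc-length nat zero v = ≤-refl
 edoc-length nat (suc n) v = ≤-trans (edoc-length nat n (true ∷ v)) (≤-reflexive (+-suc (suc n) (length v)))
 edoc-length (list τ) [] v = ≤-refl
 edoc-length (list τ) (x ∷ xs) v = ≤-trans (edoc-length (list τ) xs _) (≤-trans (+-monoʳ-≤ s′ (edoc-length τ x (true ∷ v)))
  (≤-reflexive (trans (sym (+-assoc s′ s (suc (length v)))) (trans (cong (_+ suc (length v)) (+-comm s′ s)) (+-suc (s + s′) (length v))))))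
  where s = size τ x ; s′ = size (list τ) xs
 edoc-length (σ ⊗ τ) (x , y) v = ≤-trans (edoc-length τ y _) (≤-trans (+-monoʳ-≤ s′ (edoc-length σ x v))
  (≤-reflexive (trans (sym (+-assoc s′ s (length v))) (cong (_+ length v) (+-comm s′ s)))))
  where s = size σ x ; s′ = size τ y
 edoc-length (σ ⊕ τ) (inj₁ x) v = ≤-trans (edoc-length σ x (false ∷ v)) (≤-reflexive (+-suc _ _))
 edoc-length (σ ⊕ τ) (inj₂ y) v = ≤-trans (edoc-length τ y (true ∷ v)) (≤-reflexive (+-suc _ _))

 pattern M = zero
 pattern A = suc zero
 pattern B = suc (suc zero)

 ⟨_∣_∣_⟩ : List Sym → List Sym → List Sym → Store
 ⟨ m ∣ a ∣ b ⟩ = m ∷ a ∷ b ∷ []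

 retarget : ∀ {I : Set} (store : I → Store) {p σ t i j} → i ≡ j → Exec p σ t (store i) → Exec p σ t (store j)
 retarget store refl e = e

 onBit : (Bool → Prog) → Maybe Sym → Prog
 onBit f (just (inj₁ b)) = f b
 onBit f _ = skip

 branch : Prog → Prog → Bool → Prog
 branch p q false = p
 branch p q true = q

 onTrue onBoth never : Maybe Sym → Bool
 onTrue (just 𝟏) = true
 onTrue _ = false
 onBoth (just (inj₁ _)) = true
 onBoth _ = false
 never _ = false

 -- The recursion follows the type; this is how the end of the value is found without an end mark.
 scan : (Bool → Prog) → Ty → Prog
 scan act 𝟙 = skip
 scan act 𝔹 = pop M (onBit act) never
 scan act nat = pop M (onBit act) onTrue
 scan act (list τ) = pop M (onBit (branch (act false) (act true ⨾ scan act τ))) onTrue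
 scan act (σ ⊗ τ) = scan act σ ⨾ scan act τ
 scan act (σ ⊕ τ) = pop M (onBit (branch (act false ⨾ scan act σ) (act true ⨾ scan act τ))) never

 AB : Set
 AB = List Sym × List Sym

 module _ {act : Bool → Prog} {u : Bool → AB → AB} {c : ℕ}
  (act-exec : ∀ b {m s} → Exec (act b) ⟨ m ∣ proj₁ s ∣ proj₂ s ⟩ c ⟨ m ∣ proj₁ (u b s) ∣ proj₂ (u b s) ⟩) where

  private
   d : ℕ → ℕ
   d n = suc c * n

   d-one : ∀ {n} → 1 ≤ n → suc c ≤ d n
   d-one le = ≤-trans (≤-reflexive (sym (*-identityʳ (suc c)))) (*-monoʳ-≤ (suc c) le)

   d-suc : ∀ n → suc (c + d n) ≡ d (suc n)
   d-suc n = sym (*-suc (suc c) n)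

   d-+ : ∀ m n → d m + d n ≡ d (m + n)
   d-+ m n = sym (*-distribˡ-+ (suc c) m n)

  scan-exec : ∀ τ x {m s} → Exec (scan act τ) ⟨ put τ x m ∣ proj₁ s ∣ proj₂ s ⟩ (suc c * size τ x)
   ⟨ m ∣ proj₁ (walk u τ x s) ∣ proj₂ (walk u τ x s) ⟩
  scan-exec 𝟙 x = slack (≤-trans (s≤s z≤n) (d-one ≤-refl)) skip
  scan-exec 𝔹 b {s = s} = slack (d-one ≤-refl) (stop refl (act-exec b {s = s}))
  scan-exec nat zero {s = s} = slack (d-one ≤-refl) (stop refl (act-exec false {s = s}))
  scan-exec nat (suc n) {s = s} =
   slack (≤-reflexive (d-suc _)) (again refl (act-exec true {s = s}) (scan-exec nat n))
  scan-exec (list τ) [] {s = s} = slack (d-one ≤-refl) (stop refl (act-exec false {s = s}))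
  scan-exec (list τ) (x ∷ xs) {s = s} =
   slack (≤-reflexive (trans (cong suc (trans (+-assoc c _ _) (cong (c +_) (d-+ (size τ x) _)))) (d-suc _)))
    (again refl (act-exec true {s = s} ⨾ scan-exec τ x) (scan-exec (list τ) xs))
  scan-exec (σ ⊗ τ) (x , y) = slack (≤-reflexive (d-+ (size σ x) _)) (scan-exec σ x ⨾ scan-exec τ y)
  scan-exec (σ ⊕ τ) (inj₁ x) {s = s} = slack (≤-reflexive (d-suc _)) (stop refl (act-exec false {s = s} ⨾ scan-exec σ x))
  scan-exec (σ ⊕ τ) (inj₂ y) {s = s} = slack (≤-reflexive (d-suc _)) (stop refl (act-exec true {s = s} ⨾ scan-exec τ y))

 discard : Ty → Prog
 discard = scan (λ _ → skip)

 discard-exec : ∀ τ x {m a b n} → size τ x ≤ n → Exec (discard τ) ⟨ put τ x m ∣ a ∣ b ⟩ (2 * n) ⟨ m ∣ a ∣ b ⟩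
 discard-exec τ x {m} {a} {b} le = slack (*-monoʳ-≤ 2 le)
  (retarget (λ s → ⟨ m ∣ proj₁ s ∣ proj₂ s ⟩)
   (walk-natural {S = ⊤} {u = λ _ _ → tt} {u′ = λ _ s → s} (λ _ → a , b) (λ _ _ → refl) τ x tt)
   (scan-exec {u = λ _ s → s} (λ _ → skip) τ x))

 -- The mark `#` below the reversed code tells `backA` and `backB` where to stop, so these two need
 -- no type.
 stashA stashB : Ty → Prog
 stashA τ = push A # ⨾ scan (λ b → push A (inj₁ b)) τ
 stashB τ = push B # ⨾ scan (λ b → push B (inj₁ b)) τ

 -- how a value x is kept on an auxiliary stack
 kept : ∀ τ → ⟦ τ ⟧ → List Sym → List Sym
 kept τ x a = bits (edoc τ x []) ++ # ∷ a

 stash-time : ∀ {s n} → s ≤ n → 2 + 3 * s ≤ 2 + 3 * n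
 stash-time le = +-monoʳ-≤ 2 (*-monoʳ-≤ 3 le)

 stashA-exec : ∀ τ x {m a b n} → size τ x ≤ n → Exec (stashA τ) ⟨ put τ x m ∣ a ∣ b ⟩ (2 + 3 * n) ⟨ m ∣ kept τ x a ∣ b ⟩
 stashA-exec τ x {m} {a} {b} le = slack (stash-time le) (push ⨾
  retarget (λ s → ⟨ m ∣ proj₁ s ∣ proj₂ s ⟩)
   (walk-natural (λ v → bits v ++ # ∷ a , b) (λ _ _ → refl) τ x [])
   (scan-exec {u = λ c s → inj₁ c ∷ proj₁ s , proj₂ s} (λ _ → push) τ x))

 stashB-exec : ∀ τ x {m a b n} → size τ x ≤ n → Exec (stashB τ) ⟨ put τ x m ∣ a ∣ b ⟩ (2 + 3 * n) ⟨ m ∣ a ∣ kept τ x b ⟩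
 stashB-exec τ x {m} {a} {b} le = slack (stash-time le) (push ⨾
  retarget (λ s → ⟨ m ∣ proj₁ s ∣ proj₂ s ⟩)
   (walk-natural (λ v → a , bits v ++ # ∷ b) (λ _ _ → refl) τ x [])
   (scan-exec {u = λ c s → proj₁ s , inj₁ c ∷ proj₂ s} (λ _ → push) τ x))

 backA backB : Prog
 backA = pop A (onBit (λ b → push M (inj₁ b))) onBoth
 backB = pop B (onBit (λ b → push M (inj₁ b))) onBoth

 private
  backA-bits : ∀ v {m a b} → Exec backA ⟨ m ∣ bits v ++ # ∷ a ∣ b ⟩ (2 + 3 * length v) ⟨ bits v ʳ++ m ∣ a ∣ b ⟩
  backA-bits [] = stop refl skip
  backA-bits (c ∷ v) = slack (≤-reflexive (time (length v))) (again refl push (backA-bits v))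
   where
   time : ∀ l → 5 + 3 * l ≡ 2 + 3 * suc l
   time l = cong (2 +_) (sym (*-suc 3 l))

  backB-bits : ∀ v {m a b} → Exec backB ⟨ m ∣ a ∣ bits v ++ # ∷ b ⟩ (2 + 3 * length v) ⟨ bits v ʳ++ m ∣ a ∣ b ⟩
  backB-bits [] = stop refl skip
  backB-bits (c ∷ v) = slack (≤-reflexive (cong (2 +_) (sym (*-suc 3 (length v))))) (again refl push (backB-bits v))

  edoc-size : ∀ τ x {n} → size τ x ≤ n → length (edoc τ x []) ≤ n
  edoc-size τ x le = ≤-trans (edoc-length τ x []) (≤-trans (≤-reflexive (+-identityʳ _)) le)

 backA-exec : ∀ τ x {m a b n} → size τ x ≤ n → Exec backA ⟨ m ∣ kept τ x a ∣ b ⟩ (2 + 3 * n) ⟨ put τ x m ∣ a ∣ b ⟩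
 backA-exec τ x {m} {a} {b} le = slack (stash-time (edoc-size τ x le))
  (retarget (λ l → ⟨ l ∣ a ∣ b ⟩) (edoc-put τ x [] m) (backA-bits (edoc τ x [])))

 backB-exec : ∀ τ x {m a b n} → size τ x ≤ n → Exec backB ⟨ m ∣ a ∣ kept τ x b ⟩ (2 + 3 * n) ⟨ put τ x m ∣ a ∣ b ⟩
 backB-exec τ x {m} {a} {b} le = slack (stash-time (edoc-size τ x le))
  (retarget (λ l → ⟨ l ∣ a ∣ b ⟩) (edoc-put τ x [] m) (backB-bits (edoc τ x [])))

 duplicate : Ty → Prog
 duplicate τ = push A # ⨾ push B # ⨾ scan (λ b → push A (inj₁ b) ⨾ push B (inj₁ b)) τ ⨾ backA ⨾ backB

 duplicate-exec : ∀ τ x {m a b n} → size τ x ≤ n →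
  Exec (duplicate τ) ⟨ put τ x m ∣ a ∣ b ⟩ (2 + (2 + (5 * n + ((2 + 3 * n) + (2 + 3 * n))))) ⟨ put τ x (put τ x m) ∣ a ∣ b ⟩
 duplicate-exec τ x {m} {a} {b} le = push ⨾ push ⨾ slack (*-monoʳ-≤ 5 le)
  (retarget (λ s → ⟨ m ∣ proj₁ s ∣ proj₂ s ⟩)
   (walk-natural (λ v → bits v ++ # ∷ a , bits v ++ # ∷ b) (λ _ _ → refl) τ x [])
   (scan-exec {u = λ c s → inj₁ c ∷ proj₁ s , inj₁ c ∷ proj₂ s} (λ _ → push ⨾ push) τ x))
  ⨾ backA-exec τ x le ⨾ backB-exec τ x le

 exchange : Ty → Ty → Prog
 exchange σ τ = stashA σ ⨾ stashB τ ⨾ backA ⨾ backB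

 exchange-exec : ∀ σ τ x y {m a b n n′} → size σ x ≤ n → size τ y ≤ n′ →
  Exec (exchange σ τ) ⟨ put σ x (put τ y m) ∣ a ∣ b ⟩ ((2 + 3 * n) + ((2 + 3 * n′) + ((2 + 3 * n) + (2 + 3 * n′)))) ⟨ put τ y (put σ x m) ∣ a ∣ b ⟩
 exchange-exec σ τ x y le le′ = stashA-exec σ x le ⨾ stashB-exec τ y le′ ⨾ backA-exec σ x le ⨾ backB-exec τ y le′

 -- Execution is demanded for all m, a and b: a program leaves the other two stacks and everything
 -- below its argument as they were. This frame condition is what allows programs to be composed and
 -- paired.
 record PT (σ τ : Ty) (f : ⟦ σ ⟧ → ⟦ τ ⟧) : Set where
  field
   prog : Prog
   time growth : Pol
   exec : ∀ x {m a b} → Exec prog ⟨ put σ x m ∣ a ∣ b ⟩ (⟪ time ⟫ (size σ x)) ⟨ put τ (f x) m ∣ a ∣ b ⟩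
   grow : ∀ x → size τ (f x) ≤ ⟪ growth ⟫ (size σ x)

  exec≤ : ∀ x r {m a b n} → size σ x ≤ ⟪ r ⟫ n → Exec prog ⟨ put σ x m ∣ a ∣ b ⟩ (⟪ time ⊙ r ⟫ n) ⟨ put τ (f x) m ∣ a ∣ b ⟩
  exec≤ x r le = slack (⊙-≤ time r le) (exec x)

 open PT

 ext : ∀ {σ τ f g} → (∀ x → f x ≡ g x) → PT σ τ f → PT σ τ g
 ext {τ = τ} eq F = record
  { prog = prog F ; time = time F ; growth = growth F
  ; exec = λ x → retarget (λ y → ⟨ put τ y _ ∣ _ ∣ _ ⟩) (eq x) (exec F x)
  ; grow = λ x → subst (λ y → size τ y ≤ _) (eq x) (grow F x) }

 idP : ∀ {σ} → PT σ σ id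
 idP = record { prog = skip ; time = K 1 ; growth = X ; exec = λ _ → skip ; grow = λ _ → ≤-refl }

 infixr 9 _∘P_
 _∘P_ : ∀ {σ τ υ f g} → PT τ υ g → PT σ τ f → PT σ υ (g ∘ f)
 _∘P_ {f = f} G F = record
  { prog = prog F ⨾ prog G ; time = time F ⊞ (time G ⊙ growth F) ; growth = growth G ⊙ growth F
  ; exec = λ x → exec F x ⨾ exec≤ G (f x) (growth F) (grow F x)
  ; grow = λ x → ≤-trans (grow G (f x)) (⊙-≤ (growth G) (growth F) (grow F x)) }

 dupT : Pol
 dupT = K 2 ⊞ (K 2 ⊞ (K 5 ⊠ X ⊞ (K 2 ⊞ K 3 ⊠ X ⊞ (K 2 ⊞ K 3 ⊠ X))))

 exT : Pol → Pol → Pol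
 exT p q = K 2 ⊞ K 3 ⊠ p ⊞ (K 2 ⊞ K 3 ⊠ q ⊞ (K 2 ⊞ K 3 ⊠ p ⊞ (K 2 ⊞ K 3 ⊠ q)))

 infixr 4 _,P_
 _,P_ : ∀ {σ τ υ f g} → PT σ τ f → PT σ υ g → PT σ (τ ⊗ υ) (λ x → f x , g x)
 _,P_ {σ} {τ} {υ} {f} {g} F G = record
  { prog = duplicate σ ⨾ prog F ⨾ exchange τ σ ⨾ prog G ⨾ exchange υ τ
  ; time = dupT ⊞ (time F ⊞ (exT (growth F) X ⊞ (time G ⊞ exT (growth G) (growth F))))
  ; growth = growth F ⊞ growth G
  ; exec = λ x → duplicate-exec σ x ≤-refl ⨾ exec F x ⨾ exchange-exec τ σ (f x) x (grow F x) ≤-refl ⨾ exec G x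
   ⨾ exchange-exec υ τ (g x) (f x) (grow G x) (grow F x)
  ; grow = λ x → +-mono-≤ (grow F x) (grow G x) }

 fstP : ∀ {σ τ} → PT (σ ⊗ τ) σ proj₁
 fstP {σ} {τ} = record
  { prog = stashA σ ⨾ discard τ ⨾ backA
  ; time = K 2 ⊞ K 3 ⊠ X ⊞ (K 2 ⊠ X ⊞ (K 2 ⊞ K 3 ⊠ X)) ; growth = X
  ; exec = λ (x , y) → stashA-exec σ x (m≤m+n _ _) ⨾ discard-exec τ y (m≤n+m (size τ y) (size σ x)) ⨾ backA-exec σ x (m≤m+n _ _)
  ; grow = λ (x , y) → m≤m+n _ _ }

 sndP : ∀ {σ τ} → PT (σ ⊗ τ) τ proj₂
 sndP {σ} {τ} = record
  { prog = discard σ ; time = K 2 ⊠ X ; growth = X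
  ; exec = λ (x , y) → slack (*-monoʳ-≤ 2 (m≤m+n (size σ x) (size τ y))) (discard-exec σ x ≤-refl) ; grow = λ (x , y) → m≤n+m _ _ }

 pushes : List Bool → Prog
 pushes [] = skip
 pushes (b ∷ v) = push M (inj₁ b) ⨾ pushes v

 pushes-exec : ∀ v {m a b} → Exec (pushes v) ⟨ m ∣ a ∣ b ⟩ (1 + 2 * length v) ⟨ bits v ʳ++ m ∣ a ∣ b ⟩
 pushes-exec [] = skip
 pushes-exec (c ∷ v) = slack (≤-reflexive (cong suc (sym (*-suc 2 (length v))))) (push ⨾ pushes-exec v)

 constP : ∀ {σ} τ (c : ⟦ τ ⟧) → PT σ τ (λ _ → c)
 constP {σ} τ c = record
  { prog = discard σ ⨾ pushes (rev c) ; time = K 2 ⊠ X ⊞ K (1 + 2 * length (rev c)) ; growth = K (size τ c)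
  ; exec = λ x → discard-exec σ x ≤-refl ⨾
   retarget (λ l → ⟨ l ∣ _ ∣ _ ⟩) (edoc-put τ c [] _) (pushes-exec (rev c))
  ; grow = λ x → ≤-refl }
  where rev = λ x → edoc τ x []

 prefix : ∀ {σ τ f} (b : Bool) → (∀ x r → put τ (f x) r ≡ inj₁ b ∷ put σ x r) → (∀ x → size τ (f x) ≤ suc (size σ x)) → PT σ τ f
 prefix {σ} {τ} b eq le = record
  { prog = push M (inj₁ b) ; time = K 2 ; growth = K 1 ⊞ X
  ; exec = λ x {m} {a} {b′} → retarget (λ l → ⟨ l ∣ a ∣ b′ ⟩) (sym (eq x m)) push ; grow = le }

 sucP′ : PT nat nat suc
 sucP′ = prefix true (λ _ _ → refl) (λ _ → ≤-refl)

 consP′ : ∀ {τ} → PT (τ ⊗ list τ) (list τ) (λ (x , xs) → x ∷ xs)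
 consP′ = prefix true (λ _ _ → refl) (λ _ → ≤-refl)

 inj₁P′ : ∀ {σ τ} → PT σ (σ ⊕ τ) inj₁
 inj₁P′ = prefix false (λ _ _ → refl) (λ _ → ≤-refl)

 inj₂P′ : ∀ {σ τ} → PT τ (σ ⊕ τ) inj₂
 inj₂P′ = prefix true (λ _ _ → refl) (λ _ → ≤-refl)

 -- Values whose codes coincide are converted for free.
 recode : ∀ {σ τ f} → (∀ x r → put τ (f x) r ≡ put σ x r) → (p : Pol) → (∀ x → size τ (f x) ≤ ⟪ p ⟫ (size σ x)) → PT σ τ f
 recode {σ} {τ} eq p le = record
  { prog = skip ; time = K 1 ; growth = p
  ; exec = λ x {m} {a} {b} → retarget (λ l → ⟨ l ∣ a ∣ b ⟩) (sym (eq x m)) skip ; grow = le }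

 unitsP : PT nat (list 𝟙) (λ n → replicate n tt)
 unitsP = recode eq (K 2 ⊠ X) le
  where
  eq : ∀ n r → put (list 𝟙) (replicate n tt) r ≡ put nat n r
  eq zero r = refl
  eq (suc n) r = cong (𝟏 ∷_) (eq n r)
  le : ∀ n → size (list 𝟙) (replicate n tt) ≤ 2 * suc n
  le zero = s≤s z≤n
  le (suc n) = ≤-trans (s≤s (s≤s (le n))) (≤-reflexive (sym (*-suc 2 (suc n))))

 -- Branching on the first bit of the value of a scrutinee that lies on top of the environment.
 module _ {Γ σ τ σ₀ σ₁ : Ty} {e : ⟦ Γ ⟧ → ⟦ σ ⟧} {f : ⟦ Γ ⟧ → ⟦ τ ⟧} {f₀ : ⟦ σ₀ ⟧ → ⟦ τ ⟧} {f₁ : ⟦ σ₁ ⟧ → ⟦ τ ⟧} where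

  data Split (x : ⟦ σ ⟧) (γ : ⟦ Γ ⟧) : Set where
   case₀ : ∀ y → (∀ m → put σ x (put Γ γ m) ≡ 𝟎 ∷ put σ₀ y m) → f γ ≡ f₀ y → size σ₀ y ≤ size (σ ⊗ Γ) (x , γ) → Split x γ
   case₁ : ∀ y → (∀ m → put σ x (put Γ γ m) ≡ 𝟏 ∷ put σ₁ y m) → f γ ≡ f₁ y → size σ₁ y ≤ size (σ ⊗ Γ) (x , γ) → Split x γ

  branchP : PT Γ σ e → PT σ₀ τ f₀ → PT σ₁ τ f₁ → (∀ γ → Split (e γ) γ) → PT Γ τ f
  branchP E F₀ F₁ split = record
   { prog = prog EΓ ⨾ pop M (onBit (branch (prog F₀) (prog F₁))) never
   ; time = time EΓ ⊞ (K 1 ⊞ ((time F₀ ⊞ time F₁) ⊙ growth EΓ))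
   ; growth = (growth F₀ ⊞ growth F₁) ⊙ growth EΓ
   ; exec = λ γ → exec EΓ γ ⨾ run γ (split γ)
   ; grow = λ γ → big γ (split γ) }
   where
   EΓ = E ,P idP
   run : ∀ γ → Split (e γ) γ → ∀ {m a b} → Exec (pop M (onBit (branch (prog F₀) (prog F₁))) never)
    ⟨ put σ (e γ) (put Γ γ m) ∣ a ∣ b ⟩ (1 + ⟪ (time F₀ ⊞ time F₁) ⊙ growth EΓ ⟫ (size Γ γ)) ⟨ put τ (f γ) m ∣ a ∣ b ⟩
   run γ (case₀ y eq fy le) {m} rewrite eq m | fy =
    stop refl (slack (m≤m+n _ _) (exec≤ F₀ y (growth EΓ) (≤-trans le (grow EΓ γ))))
   run γ (case₁ y eq fy le) {m} rewrite eq m | fy =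
    stop refl (slack (m≤n+m _ _) (exec≤ F₁ y (growth EΓ) (≤-trans le (grow EΓ γ))))
   big : ∀ γ → Split (e γ) γ → size τ (f γ) ≤ ⟪ (growth F₀ ⊞ growth F₁) ⊙ growth EΓ ⟫ (size Γ γ)
   big γ (case₀ y eq fy le) rewrite fy =
    ≤-trans (≤-trans (grow F₀ y) (⊙-≤ (growth F₀) (growth EΓ) (≤-trans le (grow EΓ γ)))) (m≤m+n _ _)
   big γ (case₁ y eq fy le) rewrite fy =
    ≤-trans (≤-trans (grow F₁ y) (⊙-≤ (growth F₁) (growth EΓ) (≤-trans le (grow EΓ γ)))) (m≤n+m _ _)

 ifP : ∀ {Γ τ b f g} → PT Γ 𝔹 b → PT Γ τ f → PT Γ τ g → PT Γ τ (λ γ → if b γ then f γ else g γ)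
 ifP {Γ} {τ} {b} {f} {g} C F G = branchP C G F split
  where
  split : ∀ γ → Split (b γ) γ
  split γ with b γ in eq
  ... | false = case₀ γ (λ _ → refl) (cong (if_then f γ else g γ) eq) (n≤1+n _)
  ... | true = case₁ γ (λ _ → refl) (cong (if_then f γ else g γ) eq) (n≤1+n _)

 caseList : ∀ {A B : Set} → List A → B → (A → List A → B) → B
 caseList [] n c = n
 caseList (x ∷ xs) n c = c x xs

 caseListP : ∀ {Γ σ τ e f g} → PT Γ (list σ) e → PT Γ τ f → PT (σ ⊗ list σ ⊗ Γ) τ g →
  PT Γ τ (λ γ → caseList (e γ) (f γ) (λ x xs → g (x , xs , γ)))
 caseListP {Γ} {σ} {τ} {e} {f} {g} E F G = branchP E F G split
  where
  split : ∀ γ → Split (e γ) γ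
  split γ with e γ in eq
  ... | [] = case₀ γ (λ _ → refl) (cong (λ l → caseList l _ _) eq) (n≤1+n _)
  ... | x ∷ xs = case₁ (x , xs , γ) (λ _ → refl) (cong (λ l → caseList l (f γ) (λ x xs → g (x , xs , γ))) eq)
   (≤-trans (≤-reflexive (sym (+-assoc (size σ x) _ _))) (n≤1+n _))

 caseℕ : ∀ {B : Set} → ℕ → B → (ℕ → B) → B
 caseℕ zero z s = z
 caseℕ (suc n) z s = s n

 caseℕP : ∀ {Γ τ e f g} → PT Γ nat e → PT Γ τ f → PT (nat ⊗ Γ) τ g → PT Γ τ (λ γ → caseℕ (e γ) (f γ) (λ n → g (n , γ)))
 caseℕP {Γ} {τ} {e} {f} {g} E F G = branchP E F G split
  where
  split : ∀ γ → Split (e γ) γ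
  split γ with e γ in eq
  ... | zero = case₀ γ (λ _ → refl) (cong (λ l → caseℕ l (f γ) (λ n → g (n , γ))) eq) (n≤1+n _)
  ... | suc n = case₁ (n , γ) (λ _ → refl) (cong (λ l → caseℕ l (f γ) (λ n → g (n , γ))) eq) (n≤1+n _)

 case⊕ : ∀ {A B C : Set} → A ⊎ B → (A → C) → (B → C) → C
 case⊕ (inj₁ x) l r = l x
 case⊕ (inj₂ y) l r = r y

 case⊕P : ∀ {Γ σ υ τ e f g} → PT Γ (σ ⊕ υ) e → PT (σ ⊗ Γ) τ f → PT (υ ⊗ Γ) τ g →
  PT Γ τ (λ γ → case⊕ (e γ) (λ x → f (x , γ)) (λ y → g (y , γ)))
 case⊕P {Γ} {σ} {υ} {τ} {e} {f} {g} E F G = branchP E F G split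
  where
  split : ∀ γ → Split (e γ) γ
  split γ with e γ in eq
  ... | inj₁ x = case₀ (x , γ) (λ _ → refl) (cong (λ l → case⊕ l (λ x → f (x , γ)) (λ y → g (y , γ))) eq) (n≤1+n _)
  ... | inj₂ y = case₁ (y , γ) (λ _ → refl) (cong (λ l → case⊕ l (λ x → f (x , γ)) (λ y → g (y , γ))) eq) (n≤1+n _)

 -- The hypothesis bounds all intermediate accumulators.
 module _ {Γ σ τ : Ty} {e : ⟦ Γ ⟧ → List ⟦ σ ⟧} {z : ⟦ Γ ⟧ → ⟦ τ ⟧} {s : ⟦ σ ⊗ τ ⊗ Γ ⟧ → ⟦ τ ⟧} where

  foldF : ⟦ Γ ⟧ → List ⟦ σ ⟧ → ⟦ τ ⟧
  foldF γ = foldl (λ acc y → s (y , acc , γ)) (z γ)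

  foldP : PT Γ (list σ) e → PT Γ τ z → PT (σ ⊗ τ ⊗ Γ) τ s →
   (q : Pol) → (∀ γ ys zs → e γ ≡ ys ++ zs → size τ (foldF γ ys) ≤ ⟪ q ⟫ (size Γ γ)) →
   PT Γ τ (λ γ → foldF γ (e γ))
  foldP E Z S q bounded = record
   { prog = prog EZ ⨾ loop ⨾ prog (fstP {τ} {Γ})
   ; time = time EZ ⊞ (K 2 ⊞ growth E ⊠ each ⊞ (time (fstP {τ} {Γ}) ⊙ (q ⊞ X)))
   ; growth = q
   ; exec = λ γ → exec EZ γ ⨾
    run γ (e γ) [] (sym (++-identityʳ (e γ))) (grow E γ) [] refl ⨾ exec≤ fstP (foldF γ (e γ) , γ) (q ⊞ X)
     (+-monoˡ-≤ _ (bounded γ (e γ) [] (sym (++-identityʳ (e γ)))))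
   ; grow = λ γ → bounded γ (e γ) [] (sym (++-identityʳ (e γ))) }
   where
   EZ = E ,P (Z ,P idP)
   S′ : PT (σ ⊗ τ ⊗ Γ) (τ ⊗ Γ) (λ w → s w , proj₂ (proj₂ w))
   S′ = S ,P (sndP ∘P sndP)
   body loop : Prog
   -- The rest of the list waits on B, so that the step program finds element, accumulator and
   -- environment on top.
   body = stashA σ ⨾ stashB (list σ) ⨾ backA ⨾ prog S′ ⨾ backB
   loop = pop M (onBit (branch skip body)) onTrue
   st each : Pol
   st = K 2 ⊞ K 3 ⊠ growth E
   each = K 1 ⊞ (st ⊞ (st ⊞ (st ⊞ ((time S′ ⊙ (growth E ⊞ (q ⊞ X))) ⊞ st))))
   run : ∀ γ ys zs → e γ ≡ ys ++ zs → size (list σ) ys ≤ ⟪ growth E ⟫ (size Γ γ) → ∀ pre → e γ ≡ pre ++ ys → ∀ {m a b} →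
    Exec loop ⟨ put (list σ) ys (put τ (foldF γ pre) (put Γ γ m)) ∣ a ∣ b ⟩
     (2 + ⟪ growth E ⟫ (size Γ γ) * ⟪ each ⟫ (size Γ γ))
     ⟨ put τ (foldF γ (e γ)) (put Γ γ m) ∣ a ∣ b ⟩
   run γ ys zs _ le pre eq = slack (+-monoʳ-≤ 2 (*-monoˡ-≤ (⟪ each ⟫ (size Γ γ)) le)) (go ys le pre eq)
    where
    n = size Γ γ
    go : ∀ ys → size (list σ) ys ≤ ⟪ growth E ⟫ n → ∀ pre → e γ ≡ pre ++ ys → ∀ {m a b} →
     Exec loop ⟨ put (list σ) ys (put τ (foldF γ pre) (put Γ γ m)) ∣ a ∣ b ⟩
      (2 + size (list σ) ys * ⟪ each ⟫ n) ⟨ put τ (foldF γ (e γ)) (put Γ γ m) ∣ a ∣ b ⟩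
    go [] le pre eq rewrite trans eq (++-identityʳ pre) = slack (m≤m+n 2 _) (stop refl skip)
    go (y ∷ ys) le pre eq {m} {a} {b} = slack tm
     (again refl
      (stashA-exec σ y ly ⨾ stashB-exec (list σ) ys lys ⨾ backA-exec σ y ly ⨾
       exec≤ S′ (y , foldF γ pre , γ) (growth E ⊞ (q ⊞ X)) (+-mono-≤ ly (+-monoˡ-≤ _ (bounded γ pre (y ∷ ys) eq))) ⨾
       backB-exec (list σ) ys lys)
      (subst (λ acc → Exec loop ⟨ put (list σ) ys (put τ acc (put Γ γ m)) ∣ a ∣ b ⟩ _ _) (snoc pre)
       (go ys lys (pre ++ y ∷ []) (trans eq (sym (++-assoc pre (y ∷ []) ys))))))
     where
     ly : size σ y ≤ ⟪ growth E ⟫ n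
     ly = ≤-trans (≤-trans (m≤m+n _ _) (n≤1+n _)) le
     lys : size (list σ) ys ≤ ⟪ growth E ⟫ n
     lys = ≤-trans (≤-trans (m≤n+m _ _) (n≤1+n _)) le
     snoc : ∀ pre → foldF γ (pre ++ y ∷ []) ≡ s (y , foldF γ pre , γ)
     snoc pre = go′ (z γ) pre
      where
      go′ : ∀ w pre → foldl (λ acc y → s (y , acc , γ)) w (pre ++ y ∷ []) ≡ s (y , foldl (λ acc y → s (y , acc , γ)) w pre , γ)
      go′ w [] = refl
      go′ w (p ∷ pre) = go′ _ pre
     T₁ = size σ y ; T₂ = size (list σ) ys ; c = ⟪ each ⟫ n
     tm : c + (2 + T₂ * c) ≤ 2 + suc (T₁ + T₂) * c
     tm = ≤-trans (≤-reflexive (trans (sym (+-assoc c 2 _)) (trans (cong (_+ T₂ * c) (+-comm c 2)) (+-assoc 2 c _))))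
      (+-monoʳ-≤ 2 (+-monoʳ-≤ c (*-monoˡ-≤ c (m≤n+m T₂ T₁))))

-- Combinators for lists, numbers, equality and iteration

module PolynomialTime where

 open import Data.List using (downFrom; drop)
 open import Data.List.Properties
 open import Data.Nat using (pred)
 open import Data.Nat.Properties
 open import Relation.Binary.PropositionalEquality using (module ≡-Reasoning)
 open Machines
 open Programs

 open PT

 size-++ : ∀ τ (xs ys : List ⟦ τ ⟧) → suc (size (list τ) (xs ++ ys)) ≡ size (list τ) xs + size (list τ) ys
 size-++ τ [] ys = refl
 size-++ τ (x ∷ xs) ys = cong suc (trans (sym (+-suc (size τ x) _)) (trans (cong (size τ x +_) (size-++ τ xs ys)) (sym (+-assoc (size τ x) _ _))))

 length≤size : ∀ τ xs → length xs ≤ size (list τ) xs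
 length≤size τ [] = z≤n
 length≤size τ (x ∷ xs) = s≤s (≤-trans (length≤size τ xs) (m≤n+m _ _))

 prefix-size : ∀ τ (ys zs : List ⟦ τ ⟧) → size (list τ) ys ≤ size (list τ) (ys ++ zs)
 prefix-size τ [] zs = size>0 (list τ) zs
 prefix-size τ (y ∷ ys) zs = s≤s (+-monoʳ-≤ _ (prefix-size τ ys zs))

 module _ {Γ σ τ : Ty} {e : ⟦ Γ ⟧ → List ⟦ σ ⟧} {z : ⟦ Γ ⟧ → ⟦ τ ⟧} {s : ⟦ σ ⊗ τ ⊗ Γ ⟧ → ⟦ τ ⟧} where

  -- If the growth per step is bounded independently of the accumulator, the total growth is at most
  -- the number of steps times this bound; repeated doubling is thereby excluded.
  foldP⁺ : PT Γ (list σ) e → PT Γ τ z → PT (σ ⊗ τ ⊗ Γ) τ s →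
   (q : Pol) → (∀ γ y acc → size τ (s (y , acc , γ)) ≤ size τ acc + ⟪ q ⟫ (size σ y + size Γ γ)) →
   PT Γ τ (λ γ → foldl (λ acc y → s (y , acc , γ)) (z γ) (e γ))
  foldP⁺ E Z S q inc = foldP E Z S (growth Z ⊞ growth E ⊠ (q ⊙ (growth E ⊞ X))) bounded
   where
   go : ∀ γ c acc ys → (size (list σ) ys ≤ c) →
    size τ (foldl (λ acc y → s (y , acc , γ)) acc ys) ≤ size τ acc + length ys * ⟪ q ⟫ (c + size Γ γ)
   go γ c acc [] le = m≤m+n _ _
   go γ c acc (y ∷ ys) le = ≤-trans (go γ c _ ys (≤-trans (≤-trans (m≤n+m _ _) (n≤1+n _)) le))
    (≤-trans (+-monoˡ-≤ _ (≤-trans (inc γ y acc) (+-monoʳ-≤ _ (⟪⟫-mono q (+-monoˡ-≤ _ (≤-trans (≤-trans (m≤m+n _ _) (n≤1+n _)) le))))))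
     (≤-reflexive (+-assoc (size τ acc) _ _)))
   bounded : ∀ γ ys zs → e γ ≡ ys ++ zs →
    size τ (foldl (λ acc y → s (y , acc , γ)) (z γ) ys) ≤ ⟪ growth Z ⊞ growth E ⊠ (q ⊙ (growth E ⊞ X)) ⟫ (size Γ γ)
   bounded γ ys zs eq = ≤-trans (go γ (⟪ growth E ⟫ n) (z γ) ys le)
    (+-mono-≤ (grow Z γ) (*-mono-≤ (≤-trans (length≤size σ ys) le) (≤-reflexive (sym (⊙-eval q (growth E ⊞ X) n)))))
    where
    n = size Γ γ
    le : size (list σ) ys ≤ ⟪ growth E ⟫ n
    le = ≤-trans (≤-trans (prefix-size σ ys zs) (≤-reflexive (cong (size (list σ)) (sym eq)))) (grow E γ)

 -- de Bruijn variables of an environment x₀ ⊗ x₁ ⊗ … ⊗ Γ; wₖ is the environment without the first k variables.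
 v0 : ∀ {σ Γ} → PT (σ ⊗ Γ) σ proj₁
 v0 = fstP
 w1 : ∀ {σ Γ} → PT (σ ⊗ Γ) Γ proj₂
 w1 = sndP
 v1 : ∀ {σ₀ σ Γ} → PT (σ₀ ⊗ σ ⊗ Γ) σ (λ γ → proj₁ (proj₂ γ))
 v1 = v0 ∘P w1
 w2 : ∀ {σ₀ σ Γ} → PT (σ₀ ⊗ σ ⊗ Γ) Γ (λ γ → proj₂ (proj₂ γ))
 w2 = w1 ∘P w1
 v2 : ∀ {σ₀ σ₁ σ Γ} → PT (σ₀ ⊗ σ₁ ⊗ σ ⊗ Γ) σ (λ γ → proj₁ (proj₂ (proj₂ γ)))
 v2 = v0 ∘P w2
 w3 : ∀ {σ₀ σ₁ σ Γ} → PT (σ₀ ⊗ σ₁ ⊗ σ ⊗ Γ) Γ (λ γ → proj₂ (proj₂ (proj₂ γ)))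
 w3 = w1 ∘P w2
 v3 : ∀ {σ₀ σ₁ σ₂ σ Γ} → PT (σ₀ ⊗ σ₁ ⊗ σ₂ ⊗ σ ⊗ Γ) σ (λ γ → proj₁ (proj₂ (proj₂ (proj₂ γ))))
 v3 = v0 ∘P w3

 letP : ∀ {Γ σ τ e f} → PT Γ σ e → PT (σ ⊗ Γ) τ f → PT Γ τ (λ γ → f (e γ , γ))
 letP E F = F ∘P (E ,P idP)

 sucP : ∀ {Γ e} → PT Γ nat e → PT Γ nat (λ γ → suc (e γ))
 sucP E = sucP′ ∘P E

 infixr 5 _∷P_
 _∷P_ : ∀ {Γ τ e f} → PT Γ τ e → PT Γ (list τ) f → PT Γ (list τ) (λ γ → e γ ∷ f γ)
 E ∷P F = consP′ ∘P (E ,P F)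

 nilP : ∀ {Γ τ} → PT Γ (list τ) (λ _ → [])
 nilP {τ = τ} = constP (list τ) []

 [_]P : ∀ {Γ τ e} → PT Γ τ e → PT Γ (list τ) (λ γ → [ e γ ])
 [ E ]P = E ∷P nilP

 inj₁P : ∀ {Γ σ τ e} → PT Γ σ e → PT Γ (σ ⊕ τ) (λ γ → inj₁ (e γ))
 inj₁P E = inj₁P′ ∘P E

 inj₂P : ∀ {Γ σ τ e} → PT Γ τ e → PT Γ (σ ⊕ τ) (λ γ → inj₂ (e γ))
 inj₂P E = inj₂P′ ∘P E

 notP : ∀ {Γ e} → PT Γ 𝔹 e → PT Γ 𝔹 (λ γ → not (e γ))
 notP {e = e} E = ext (λ γ → lem (e γ)) (ifP E (constP 𝔹 false) (constP 𝔹 true))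
  where
  lem : ∀ b → (if b then false else true) ≡ not b
  lem false = refl
  lem true = refl

 infixr 6 _∧P_
 infixr 5 _∨P_
 _∧P_ : ∀ {Γ e f} → PT Γ 𝔹 e → PT Γ 𝔹 f → PT Γ 𝔹 (λ γ → e γ ∧ f γ)
 _∧P_ {e = e} {f} E F = ext (λ γ → lem (e γ) (f γ)) (ifP E F (constP 𝔹 false))
  where
  lem : ∀ b c → (if b then c else false) ≡ b ∧ c
  lem false c = refl
  lem true c = refl

 _∨P_ : ∀ {Γ e f} → PT Γ 𝔹 e → PT Γ 𝔹 f → PT Γ 𝔹 (λ γ → e γ ∨ f γ)
 _∨P_ {e = e} {f} E F = ext (λ γ → lem (e γ) (f γ)) (ifP E (constP 𝔹 true) F)
  where
  lem : ∀ b c → (if b then true else c) ≡ b ∨ c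
  lem false c = refl
  lem true c = refl

 ʳ++P : ∀ {Γ τ e f} → PT Γ (list τ) e → PT Γ (list τ) f → PT Γ (list τ) (λ γ → e γ ʳ++ f γ)
 ʳ++P {Γ} {τ} E F = foldP⁺ E F (v0 ∷P v1) (K 1 ⊞ X)
  (λ γ y acc → ≤-trans (s≤s (≤-reflexive (+-comm (size τ y) _)))
   (≤-trans (≤-reflexive (sym (+-suc _ _))) (+-monoʳ-≤ _ (s≤s (m≤m+n (size τ y) (size Γ γ))))))

 reverseP : ∀ {Γ τ e} → PT Γ (list τ) e → PT Γ (list τ) (λ γ → reverse (e γ))
 reverseP E = ʳ++P E nilP

 infixr 5 _++P_
 _++P_ : ∀ {Γ τ e f} → PT Γ (list τ) e → PT Γ (list τ) f → PT Γ (list τ) (λ γ → e γ ++ f γ)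
 _++P_ {e = e} {f} E F = ext (λ γ → trans (ʳ++-defn (reverse (e γ))) (cong (_++ f γ) (reverse-involutive (e γ)))) (ʳ++P (reverseP E) F)

 concatMapP : ∀ {Γ σ τ e g} → PT Γ (list σ) e → PT (σ ⊗ Γ) (list τ) g →
  PT Γ (list τ) (λ γ → concatMap (λ x → g (x , γ)) (e γ))
 -- The list is reversed so that each block can be put in front of the accumulator.
 concatMapP {Γ} {σ} {τ} {e} {g} E G = ext (λ γ → lem γ (e γ))
  (foldP⁺ (reverseP E) nilP ((G ∘P (v0 ,P w2)) ++P v1) (growth G)
   (λ γ y acc → ≤-trans (n≤1+n _) (≤-trans (≤-reflexive (size-++ τ (g (y , γ)) acc))
    (≤-trans (≤-reflexive (+-comm _ (size (list τ) acc))) (+-monoʳ-≤ (size (list τ) acc) (grow G (y , γ)))))))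
  where
  lem : ∀ γ xs → foldl (λ acc y → g (y , γ) ++ acc) [] (reverse xs) ≡ concatMap (λ x → g (x , γ)) xs
  lem γ [] = refl
  lem γ (x ∷ xs) = begin
   foldl _ [] (reverse (x ∷ xs)) ≡⟨ cong (foldl (λ acc y → g (y , γ) ++ acc) []) (unfold-reverse x xs) ⟩
   foldl _ [] (reverse xs ++ [ x ]) ≡⟨ foldl-∷ʳ (λ acc y → g (y , γ) ++ acc) [] x (reverse xs) ⟩
   g (x , γ) ++ foldl _ [] (reverse xs) ≡⟨ cong (g (x , γ) ++_) (lem γ xs) ⟩
   concatMap (λ x → g (x , γ)) (x ∷ xs) ∎
   where open ≡-Reasoning

 mapP : ∀ {Γ σ τ e g} → PT Γ (list σ) e → PT (σ ⊗ Γ) τ g → PT Γ (list τ) (λ γ → map (λ x → g (x , γ)) (e γ))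
 mapP {e = e} {g} E G = ext (λ γ → lem γ (e γ)) (concatMapP E [ G ]P)
  where
  lem : ∀ γ xs → concatMap (λ x → [ g (x , γ) ]) xs ≡ map (λ x → g (x , γ)) xs
  lem γ [] = refl
  lem γ (x ∷ xs) = cong (_ ∷_) (lem γ xs)

 filterP : ∀ {Γ σ e g} → PT Γ (list σ) e → PT (σ ⊗ Γ) 𝔹 g → PT Γ (list σ) (λ γ → filterᵇ (λ x → g (x , γ)) (e γ))
 filterP {e = e} {g} E G = ext (λ γ → lem γ (e γ)) (concatMapP E (ifP G [ v0 ]P nilP))
  where
  lem : ∀ γ xs → concatMap (λ x → if g (x , γ) then [ x ] else []) xs ≡ filterᵇ (λ x → g (x , γ)) xs
  lem γ [] = refl
  lem γ (x ∷ xs) with g (x , γ)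
  ... | false = lem γ xs
  ... | true = cong (x ∷_) (lem γ xs)

 productP : ∀ {Γ σ τ e f} → PT Γ (list σ) e → PT Γ (list τ) f → PT Γ (list (σ ⊗ τ)) (λ γ → cartesianProduct (e γ) (f γ))
 productP {e = e} {f} E F = ext (λ γ → lem (e γ) (f γ)) (concatMapP E (mapP (F ∘P w1) (v1 ,P v0)))
  where
  lem : ∀ {A B : Set} (xs : List A) (ys : List B) → concatMap (λ x → map (x ,_) ys) xs ≡ cartesianProduct xs ys
  lem [] ys = refl
  lem (x ∷ xs) ys = cong (map (x ,_) ys ++_) (lem xs ys)

 anyP : ∀ {Γ σ e g} → PT Γ (list σ) e → PT (σ ⊗ Γ) 𝔹 g → PT Γ 𝔹 (λ γ → any (λ x → g (x , γ)) (e γ))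
 anyP {e = e} {g} E G = ext (λ γ → lem γ (e γ)) (foldP⁺ E (constP 𝔹 false) (v1 ∨P (G ∘P (v0 ,P w2))) (K 0) (λ _ _ _ → ≤-refl))
  where
  stuck : ∀ γ xs → foldl (λ acc y → acc ∨ g (y , γ)) true xs ≡ true
  stuck γ [] = refl
  stuck γ (x ∷ xs) = stuck γ xs
  lem : ∀ γ xs → foldl (λ acc y → acc ∨ g (y , γ)) false xs ≡ any (λ x → g (x , γ)) xs
  lem γ [] = refl
  lem γ (x ∷ xs) with g (x , γ)
  ... | false = lem γ xs
  ... | true = stuck γ xs

 allP : ∀ {Γ σ e g} → PT Γ (list σ) e → PT (σ ⊗ Γ) 𝔹 g → PT Γ 𝔹 (λ γ → all (λ x → g (x , γ)) (e γ))
 allP {e = e} {g} E G = ext (λ γ → lem γ (e γ)) (foldP⁺ E (constP 𝔹 true) (v1 ∧P (G ∘P (v0 ,P w2))) (K 0) (λ _ _ _ → ≤-refl))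
  where
  stuck : ∀ γ xs → foldl (λ acc y → acc ∧ g (y , γ)) false xs ≡ false
  stuck γ [] = refl
  stuck γ (x ∷ xs) = stuck γ xs
  lem : ∀ γ xs → foldl (λ acc y → acc ∧ g (y , γ)) true xs ≡ all (λ x → g (x , γ)) xs
  lem γ [] = refl
  lem γ (x ∷ xs) with g (x , γ)
  ... | false = stuck γ xs
  ... | true = lem γ xs

 -- A fold over units, whose list is a unary number up to `unitsP`; loops with a counter thus become
 -- instances of `foldP`.
 iterate : ∀ {A : Set} → (A → A) → A → ℕ → A
 iterate f x n = foldl (λ acc _ → f acc) x (replicate n tt)

 iterate-suc : ∀ {A : Set} (f : A → A) x n → iterate f x (suc n) ≡ f (iterate f x n)
 iterate-suc f x zero = refl
 iterate-suc f x (suc n) = iterate-suc f (f x) n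

 iterateP⁺ : ∀ {Γ τ e z s} → PT Γ nat e → PT Γ τ z → PT (τ ⊗ Γ) τ s →
  (q : Pol) → (∀ γ acc → size τ (s (acc , γ)) ≤ size τ acc + ⟪ q ⟫ (size Γ γ)) →
  PT Γ τ (λ γ → iterate (λ acc → s (acc , γ)) (z γ) (e γ))
 iterateP⁺ E Z S q inc = foldP⁺ (unitsP ∘P E) Z (S ∘P w1) q
  (λ γ y acc → ≤-trans (inc γ acc) (+-monoʳ-≤ _ (⟪⟫-mono q (n≤1+n _))))

 infixl 6 _+P_ _∸P_
 infixl 7 _*P_
 _+P_ : ∀ {Γ e f} → PT Γ nat e → PT Γ nat f → PT Γ nat (λ γ → e γ + f γ)
 _+P_ {e = e} {f} E F = ext (λ γ → lem (e γ) (f γ)) (iterateP⁺ E F (sucP v0) (K 1) (λ _ acc → ≤-reflexive (+-comm 1 (suc acc))))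
  where
  lem : ∀ m n → iterate suc n m ≡ m + n
  lem zero n = refl
  lem (suc m) n = trans (iterate-suc suc n m) (cong suc (lem m n))

 _*P_ : ∀ {Γ e f} → PT Γ nat e → PT Γ nat f → PT Γ nat (λ γ → e γ * f γ)
 _*P_ {Γ} {e} {f} E F = ext (λ γ → lem (e γ) (f γ)) (iterateP⁺ E (constP nat 0) ((F ∘P w1) +P v0) (growth F)
  (λ γ acc → s≤s (≤-trans (≤-reflexive (+-comm (f γ) acc)) (+-monoʳ-≤ acc (≤-trans (n≤1+n _) (grow F γ))))))
  where
  lem : ∀ m n → iterate (n +_) 0 m ≡ m * n
  lem zero n = refl
  lem (suc m) n = trans (iterate-suc (n +_) 0 m) (cong (n +_) (lem m n))

 predP : ∀ {Γ e} → PT Γ nat e → PT Γ nat (λ γ → pred (e γ))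
 predP {e = e} E = ext (λ γ → lem (e γ)) (caseℕP E (constP nat 0) v0)
  where
  lem : ∀ n → caseℕ n 0 (λ n → n) ≡ pred n
  lem zero = refl
  lem (suc n) = refl

 _∸P_ : ∀ {Γ e f} → PT Γ nat e → PT Γ nat f → PT Γ nat (λ γ → e γ ∸ f γ)
 _∸P_ {e = e} {f} E F = ext (λ γ → lem (e γ) (f γ)) (iterateP⁺ F E (predP v0) (K 0) (λ _ acc → ≤-trans (s≤s pred[n]≤n) (m≤m+n _ 0)))
  where
  lem : ∀ m n → iterate pred m n ≡ m ∸ n
  lem m zero = refl
  lem m (suc n) = trans (iterate-suc pred m n) (trans (cong pred (lem m n)) (pred[m∸n]≡m∸[1+n] m n))

 infix 4 _≤ᵇP_ _<ᵇP_
 _≤ᵇP_ : ∀ {Γ e f} → PT Γ nat e → PT Γ nat f → PT Γ 𝔹 (λ γ → e γ ≤ᵇ f γ)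
 _≤ᵇP_ {e = e} {f} E F = ext (λ γ → lem (e γ) (f γ)) (caseℕP (E ∸P F) (constP 𝔹 true) (constP 𝔹 false))
  where
  lem : ∀ m n → caseℕ (m ∸ n) true (λ _ → false) ≡ (m ≤ᵇ n)
  lem zero zero = refl
  lem zero (suc n) = refl
  lem (suc m) zero = refl
  lem (suc zero) (suc n) = lem zero n
  lem (suc (suc m)) (suc n) = lem (suc m) n

 _<ᵇP_ : ∀ {Γ e f} → PT Γ nat e → PT Γ nat f → PT Γ 𝔹 (λ γ → e γ <ᵇ f γ)
 E <ᵇP F = sucP E ≤ᵇP F

 _⊓P_ : ∀ {Γ e f} → PT Γ nat e → PT Γ nat f → PT Γ nat (λ γ → e γ ⊓ f γ)
 _⊓P_ {e = e} {f} E F = ext (λ γ → lem (e γ) (f γ)) (E ∸P (E ∸P F))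
  where
  lem : ∀ m n → m ∸ (m ∸ n) ≡ m ⊓ n
  lem zero n = 0∸n≡0 (0 ∸ n)
  lem (suc m) zero = n∸n≡0 m
  lem (suc m) (suc n) = trans (+-∸-assoc 1 (m∸n≤m m n)) (cong suc (lem m n))

 lengthP : ∀ {Γ σ e} → PT Γ (list σ) e → PT Γ nat (λ γ → length (e γ))
 lengthP {e = e} E = ext (λ γ → trans (lem 0 (e γ)) (+-identityʳ _)) (foldP⁺ E (constP nat 0) (sucP v1) (K 1) (λ _ _ acc → ≤-reflexive (+-comm 1 (suc acc))))
  where
  lem : ∀ {A : Set} n (xs : List A) → foldl (λ acc _ → suc acc) n xs ≡ length xs + n
  lem n [] = refl
  lem n (x ∷ xs) = trans (lem (suc n) xs) (+-suc _ n)

 -- The length of the accumulator serves as the counter. The growth of a step then depends on the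
 -- accumulator, so the size is bounded through the closed form `downFrom` and not by `foldP⁺`.
 downFromP : ∀ {Γ e} → PT Γ nat e → PT Γ (list nat) (λ γ → downFrom (e γ))
 downFromP {Γ} {e} E = ext (λ γ → lem (e γ))
  (foldP (unitsP ∘P E) nilP (lengthP v1 ∷P v1) (growth E ⊠ (K 2 ⊞ growth E) ⊞ K 1) bounded)
  where
  step′ : ∀ n k → foldl (λ acc _ → length acc ∷ acc) (downFrom k) (replicate n tt) ≡ downFrom (n + k)
  step′ zero k = refl
  step′ (suc n) k = trans (cong (λ l → foldl (λ acc _ → length acc ∷ acc) (l ∷ downFrom k) (replicate n tt)) (length-downFrom k))
   (trans (step′ n (suc k)) (cong downFrom (+-suc n k)))
  lem : ∀ n → foldl (λ acc _ → length acc ∷ acc) [] (replicate n tt) ≡ downFrom n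
  lem n = trans (step′ n 0) (cong downFrom (+-identityʳ n))
  units : ∀ ys → ys ≡ replicate (length ys) tt
  units [] = refl
  units (tt ∷ y) = cong (tt ∷_) (units y)
  sz : ∀ k c → k ≤ c → size (list nat) (downFrom k) ≤ k * (2 + c) + 1
  sz zero c le = ≤-refl
  sz (suc k) c le = ≤-trans (s≤s (+-mono-≤ le (sz k c (≤-trans (n≤1+n k) le))))
   (≤-trans (≤-reflexive (sym (+-assoc (suc c) _ 1))) (n≤1+n _))
  bounded : ∀ γ ys zs → replicate (e γ) tt ≡ ys ++ zs →
   size (list nat) (foldl (λ acc _ → length acc ∷ acc) [] ys) ≤ ⟪ growth E ⟫ (size Γ γ) * (2 + ⟪ growth E ⟫ (size Γ γ)) + 1
  bounded γ ys zs eq rewrite trans (cong (foldl (λ acc _ → length acc ∷ acc) []) (units ys)) (lem (length ys)) =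
   ≤-trans (sz (length ys) (e γ) le) (+-monoˡ-≤ 1 (*-mono-≤ (≤-trans le le′) (+-monoʳ-≤ 2 le′)))
   where
   le : length ys ≤ e γ
   le = ≤-trans (m≤m+n _ _) (≤-reflexive (trans (sym (length-++ ys)) (trans (cong length (sym eq)) (length-replicate (e γ)))))
   le′ : e γ ≤ ⟪ growth E ⟫ (size Γ γ)
   le′ = ≤-trans (n≤1+n _) (grow E γ)

 upToP : ∀ {Γ e} → PT Γ nat e → PT Γ (list nat) (λ γ → upTo (e γ))
 upToP {e = e} E = ext (λ γ → reverse-downFrom (e γ)) (reverseP (downFromP E))

 dropP : ∀ {Γ σ e f} → PT Γ nat e → PT Γ (list σ) f → PT Γ (list σ) (λ γ → drop (e γ) (f γ))
 dropP {σ = σ} {e = e} {f} E F = ext (λ γ → lem (e γ) (f γ)) (iterateP⁺ E F (caseListP v0 nilP v1) (K 0) shrink)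
  where
  tl : ∀ {A : Set} → List A → List A
  tl xs = caseList xs [] (λ _ ys → ys)
  shrink : ∀ γ xs → size (list σ) (tl xs) ≤ size (list σ) xs + 0
  shrink γ [] = ≤-refl
  shrink γ (x ∷ xs) = ≤-trans (m≤n+m _ _) (≤-trans (n≤1+n _) (m≤m+n _ 0))
  lem : ∀ {A : Set} n (xs : List A) → iterate tl xs n ≡ drop n xs
  lem zero xs = refl
  lem (suc n) [] = lem n [] |> λ eq → trans eq (drop-[] n)
   where
   infixl 1 _|>_
   _|>_ : ∀ {A B : Set} → A → (A → B) → B
   x |> g = g x
  lem (suc n) (x ∷ xs) = lem n xs

 code : ∀ τ → ⟦ τ ⟧ → List Bool
 code τ x = edoc τ x [] ʳ++ []

 -- Turns a value of any type into a word that programs can inspect; a single comparison of words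
 -- then decides equality at every type.
 codeP : ∀ τ → PT τ (list 𝔹) (code τ)
 codeP τ = record
  { prog = stashA τ ⨾ push M 𝟎 ⨾ loop
  ; time = K 2 ⊞ K 3 ⊠ X ⊞ (K 2 ⊞ (K 2 ⊞ K 5 ⊠ X)) ; growth = K 1 ⊞ K 2 ⊠ X
  ; exec = λ x → stashA-exec τ x ≤-refl ⨾ push ⨾ slack (+-monoʳ-≤ 2 (*-monoʳ-≤ 5 (len x))) (go (edoc τ x []) [])
  ; grow = λ x → ≤-trans (≤-reflexive (sz (edoc τ x []) [])) (≤-trans (≤-reflexive (+-comm _ 1)) (+-monoʳ-≤ 1 (*-monoʳ-≤ 2 (len x)))) }
  where
  len : ∀ x → length (edoc τ x []) ≤ size τ x
  len x = ≤-trans (edoc-length τ x []) (≤-reflexive (+-identityʳ _))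
  loop : Prog
  loop = pop A (onBit (λ b → push M (inj₁ b) ⨾ push M 𝟏)) onBoth
  go : ∀ v acc {m a b} → Exec loop ⟨ put (list 𝔹) acc m ∣ bits v ++ # ∷ a ∣ b ⟩ (2 + 5 * length v) ⟨ put (list 𝔹) (v ʳ++ acc) m ∣ a ∣ b ⟩
  go [] acc = stop refl skip
  go (c ∷ v) acc = slack (≤-reflexive (cong (2 +_) (sym (*-suc 5 (length v))))) (again refl (push ⨾ push) (go v (c ∷ acc)))
  sz : ∀ v acc → size (list 𝔹) (v ʳ++ acc) ≡ 2 * length v + size (list 𝔹) acc
  sz [] acc = refl
  sz (c ∷ v) acc = trans (sz v (c ∷ acc)) (trans (sym (+-assoc (2 * length v) 2 _)) (cong (_+ size (list 𝔹) acc) (trans (+-comm _ 2) (sym (*-suc 2 (length v))))))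

 put-injective : ∀ τ x y {r s} → put τ x r ≡ put τ y s → x ≡ y × r ≡ s
 put-injective 𝟙 x y eq = refl , eq
 put-injective 𝔹 x y refl = refl , refl
 put-injective nat zero zero eq = refl , ∷-injectiveʳ eq
 put-injective nat (suc x) (suc y) eq with refl , eq′ ← put-injective nat x y (∷-injectiveʳ eq) = refl , eq′
 put-injective (list τ) [] [] eq = refl , ∷-injectiveʳ eq
 put-injective (list τ) (x ∷ xs) (y ∷ ys) eq
  with refl , eq′ ← put-injective τ x y (∷-injectiveʳ eq)
  with refl , eq″ ← put-injective (list τ) xs ys eq′ = refl , eq″
 put-injective (σ ⊗ τ) (x , x′) (y , y′) eq
  with refl , eq′ ← put-injective σ x y eq
  with refl , eq″ ← put-injective τ x′ y′ eq′ = refl , eq″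
 put-injective (σ ⊕ τ) (inj₁ x) (inj₁ y) eq with refl , eq′ ← put-injective σ x y (∷-injectiveʳ eq) = refl , eq′
 put-injective (σ ⊕ τ) (inj₂ x) (inj₂ y) eq with refl , eq′ ← put-injective τ x y (∷-injectiveʳ eq) = refl , eq′

 code-injective : ∀ τ x y → code τ x ≡ code τ y → x ≡ y
 code-injective τ x y eq = proj₁ (put-injective τ x y {[]} {[]}
  (trans (sym (edoc-put τ x [] [])) (trans (sym (map-ʳ++ inj₁ (edoc τ x []))) (trans (cong bits eq)
   (trans (map-ʳ++ inj₁ (edoc τ y [])) (edoc-put τ y [] []))))))

 eqBool : Bool → Bool → Bool
 eqBool b c = if b then c else not c

 agree : Bool × List Bool → Bool → Bool × List Bool
 agree (ok , rest) b = caseList rest (false , []) (λ c rest′ → ok ∧ eqBool b c , rest′)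

 eqWord : List Bool → List Bool → Bool
 eqWord v w = let ok , rest = foldl agree (true , w) v in ok ∧ caseList rest true (λ _ _ → false)

 module _ where
  private
   eqBool-sound : ∀ b c → eqBool b c ≡ true → b ≡ c
   eqBool-sound false false _ = refl
   eqBool-sound true true _ = refl

   bad : ∀ v w → proj₁ (foldl agree (false , w) v) ≡ false
   bad [] w = refl
   bad (b ∷ v) [] = bad v []
   bad (b ∷ v) (c ∷ w) = bad v w

  eqWord-sound : ∀ v w → eqWord v w ≡ true → v ≡ w
  eqWord-sound [] [] eq = refl
  eqWord-sound (b ∷ v) [] eq rewrite bad v [] with () ← eq
  eqWord-sound (b ∷ v) (c ∷ w) eq with eqBool b c in bc
  ... | true = cong₂ _∷_ (eqBool-sound b c bc) (eqWord-sound v w eq)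
  ... | false rewrite bad v w with () ← eq

  eqWord-refl : ∀ v → eqWord v v ≡ true
  eqWord-refl [] = refl
  eqWord-refl (false ∷ v) = eqWord-refl v
  eqWord-refl (true ∷ v) = eqWord-refl v

 eqWordP : ∀ {Γ e f} → PT Γ (list 𝔹) e → PT Γ (list 𝔹) f → PT Γ 𝔹 (λ γ → eqWord (e γ) (f γ))
 eqWordP {Γ} {e} {f} E F = ext (λ γ → refl)
  (letP (foldP⁺ E (constP 𝔹 true ,P F) S (K 1) inc) (fstP ∘P v0 ∧P caseListP (sndP ∘P v0) (constP 𝔹 true) (constP 𝔹 false)))
  where
  S : PT (𝔹 ⊗ (𝔹 ⊗ list 𝔹) ⊗ Γ) (𝔹 ⊗ list 𝔹) (λ (b , acc , γ) →
   caseList (proj₂ acc) (false , []) (λ c rest′ → proj₁ acc ∧ eqBool b c , rest′))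
  S = caseListP (sndP ∘P v1) (constP (𝔹 ⊗ list 𝔹) (false , []))
   ((fstP ∘P v3 ∧P ifP v2 v0 (notP v0)) ,P v1)
  inc : ∀ γ b acc → size (𝔹 ⊗ list 𝔹) (caseList (proj₂ acc) (false , []) (λ c rest′ → proj₁ acc ∧ eqBool b c , rest′)) ≤ size (𝔹 ⊗ list 𝔹) acc + 1
  inc γ b (ok , []) = s≤s (s≤s z≤n)
  inc γ b (ok , c ∷ rest) = s≤s (≤-trans (n≤1+n _) (≤-trans (n≤1+n _) (m≤m+n _ 1)))

 abstract
  eqᵇ : ∀ τ → ⟦ τ ⟧ → ⟦ τ ⟧ → Bool
  eqᵇ τ x y = eqWord (code τ x) (code τ y)

  eqᵇ-sound : ∀ τ x y → eqᵇ τ x y ≡ true → x ≡ y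
  eqᵇ-sound τ x y eq = code-injective τ x y (eqWord-sound _ _ eq)

  eqᵇ-refl : ∀ τ x → eqᵇ τ x x ≡ true
  eqᵇ-refl τ x = eqWord-refl (code τ x)

  eqP : ∀ {Γ} τ {e f} → PT Γ τ e → PT Γ τ f → PT Γ 𝔹 (λ γ → eqᵇ τ (e γ) (f γ))
  eqP τ E F = eqWordP (codeP τ ∘P E) (codeP τ ∘P F)

 -- Conversions between a bare word on the tape and the code of a list, in which 𝟏 precedes every
 -- bit and 𝟎 ends the list.
 readInput writeOutput : Prog
 readInput = (push A # ⨾ pop M (onBit (λ b → push A (inj₁ b))) onBoth) ⨾ push M 𝟎 ⨾ pop A (onBit (λ b → push M (inj₁ b) ⨾ push M 𝟏)) onBoth
 writeOutput = push A # ⨾ pop M (onBit (branch skip (pop M (onBit (λ b → push A (inj₁ b))) never))) onTrue ⨾ backA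

 readInput-exec : ∀ w {b} → Exec readInput ⟨ bits w ∣ [] ∣ b ⟩ (⟪ K 2 ⊞ (K 2 ⊞ K 3 ⊠ X) ⊞ (K 2 ⊞ (K 2 ⊞ K 5 ⊠ X)) ⟫ (length w)) ⟨ put (list 𝔹) w [] ∣ [] ∣ b ⟩
 readInput-exec w {b} = (push ⨾ slack (≤-reflexive refl) (retarget (λ v → ⟨ [] ∣ v ∣ b ⟩) (lem w) (in₁ w))) ⨾ push ⨾
  slack (+-monoʳ-≤ 2 (*-monoʳ-≤ 5 (≤-reflexive (length-reverse w))))
   (retarget (λ v → ⟨ put (list 𝔹) v [] ∣ [] ∣ b ⟩) (trans (ʳ++-defn (reverse w)) (trans (++-identityʳ _) (reverse-involutive w))) (in₂ (reverse w) []))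
  where
  lem : ∀ w → bits w ʳ++ # ∷ [] ≡ bits (reverse w) ++ # ∷ []
  lem w = trans (ʳ++-defn (bits w)) (cong (_++ # ∷ []) (sym (reverse-map inj₁ w)))
  in₁ : ∀ w {a b} → Exec (pop M (onBit (λ b → push A (inj₁ b))) onBoth) ⟨ bits w ∣ a ∣ b ⟩ (2 + 3 * length w) ⟨ [] ∣ bits w ʳ++ a ∣ b ⟩
  in₁ [] = stop refl skip
  in₁ (c ∷ w) = slack (≤-reflexive (cong (2 +_) (sym (*-suc 3 (length w))))) (again refl push (in₁ w))
  in₂ : ∀ v acc {m a b} → Exec (pop A (onBit (λ b → push M (inj₁ b) ⨾ push M 𝟏)) onBoth)
   ⟨ put (list 𝔹) acc m ∣ bits v ++ # ∷ a ∣ b ⟩ (2 + 5 * length v) ⟨ put (list 𝔹) (v ʳ++ acc) m ∣ a ∣ b ⟩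
  in₂ [] acc = stop refl skip
  in₂ (c ∷ v) acc = slack (≤-reflexive (cong (2 +_) (sym (*-suc 5 (length v))))) (again refl (push ⨾ push) (in₂ v (c ∷ acc)))

 writeT : Pol
 writeT = K 2 ⊞ (K 2 ⊞ K 4 ⊠ X ⊞ (K 2 ⊞ K 3 ⊠ X))

 writeOutput-exec : ∀ v {m b} → Exec writeOutput ⟨ put (list 𝔹) v m ∣ [] ∣ b ⟩ (⟪ writeT ⟫ (length v)) ⟨ bits v ++ m ∣ [] ∣ b ⟩
 writeOutput-exec v {m} {b} = push ⨾ out v ⨾
  slack (+-monoʳ-≤ 2 (*-monoʳ-≤ 3 (≤-reflexive (length-reverse v))))
   (retarget (λ l → ⟨ l ∣ [] ∣ b ⟩) (lem v) (back (reverse v)))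
  where
  lem : ∀ v → bits (reverse v) ʳ++ m ≡ bits v ++ m
  lem v = trans (ʳ++-defn (bits (reverse v))) (cong (_++ m) (trans (sym (reverse-map inj₁ (reverse v))) (cong bits (reverse-involutive v))))
  back : ∀ v {m a b} → Exec backA ⟨ m ∣ bits v ++ # ∷ a ∣ b ⟩ (2 + 3 * length v) ⟨ bits v ʳ++ m ∣ a ∣ b ⟩
  back [] = stop refl skip
  back (c ∷ v) = slack (≤-reflexive (cong (2 +_) (sym (*-suc 3 (length v))))) (again refl push (back v))
  out : ∀ v → Exec (pop M (onBit (branch skip (pop M (onBit (λ b → push A (inj₁ b))) never))) onTrue)
   ⟨ put (list 𝔹) v m ∣ # ∷ [] ∣ b ⟩ (2 + 4 * length v) ⟨ m ∣ bits (reverse v) ++ # ∷ [] ∣ b ⟩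
  out v = retarget (λ l → ⟨ m ∣ l ∣ b ⟩) (trans (ʳ++-defn (bits v)) (cong (_++ # ∷ []) (sym (reverse-map inj₁ v)))) (go v)
   where
   go : ∀ v {a} → Exec (pop M (onBit (branch skip (pop M (onBit (λ b → push A (inj₁ b))) never))) onTrue)
    ⟨ put (list 𝔹) v m ∣ a ∣ b ⟩ (2 + 4 * length v) ⟨ m ∣ bits v ʳ++ a ∣ b ⟩
   go [] = stop refl skip
   go (c ∷ v) = slack (≤-reflexive (cong (2 +_) (sym (*-suc 4 (length v))))) (again refl (stop refl push) (go v))

 size-word : ∀ w → size (list 𝔹) w ≡ 2 * length w + 1
 size-word [] = refl
 size-word (b ∷ w) = trans (cong (λ n → suc (suc n)) (size-word w)) (cong (_+ 1) (sym (*-suc 2 (length w))))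

 polyTime : ∀ {f} → PT (list 𝔹) (list 𝔹) f → PolyTime f
 polyTime {f} F = machine (readInput ⨾ prog F ⨾ writeOutput) , dominate T , λ w →
  exec-outputs (slack (dominate-≤ T (length w))
   (readInput-exec w ⨾ exec≤ F w S (≤-reflexive (size-word w)) ⨾
    slack (⊙-≤ writeT (growth F ⊙ S) (≤-trans (length≤size 𝔹 (f w)) (≤-trans (grow F w) (⊙-≤ (growth F) S (≤-reflexive (size-word w))))))
     (retarget (λ l → ⟨ l ∣ [] ∣ [] ⟩) (++-identityʳ (bits (f w))) (writeOutput-exec (f w)))))
  where
  S = K 2 ⊠ X ⊞ K 1
  T = K 2 ⊞ (K 2 ⊞ K 3 ⊠ X) ⊞ (K 2 ⊞ (K 2 ⊞ K 5 ⊠ X)) ⊞ ((time F ⊙ S) ⊞ (writeT ⊙ (growth F ⊙ S)))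

-- Regular graphs: a path with connected complement

module RegularGraphs where

 open import Data.Bool using (T)
 open import Data.Fin using (toℕ; _≟_)
 open import Data.Fin.Properties using (any?)
 open import Data.Fin.Subset using (Subset) renaming (_∈_ to _∈ₛ_)
 open import Data.List using (filter)
 open import Data.List.Membership.Propositional.Properties
 import Data.List.Relation.Unary.Any as Any
 import Data.List.Relation.Unary.All as All
 open import Data.Nat.Properties using (n≤1+n; +-suc; <⇒≢; <-asym)
 open import Data.Vec using (tabulate; lookup)
 open import Data.Vec.Properties using ([]=⇒lookup; lookup⇒[]=; lookup∘tabulate)
 open import Data.Vec.Properties.WithK using ([]=-irrelevant)
 open import Function.Bundles using (Inverse; mk↔ₛ′)
 open import Function.Definitions using (Injective)
 open import Relation.Binary.Construct.Closure.ReflexiveTransitive using (Star; ε; _◅_)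
 open import Relation.Nullary using (yes; no; does)
 open import Relation.Nullary.Decidable using (dec-true)

 open Graph

 module _ {A : Set} where

  remove : ∀ {x : A} {xs} → x ∈ xs → List A
  remove {xs = _ ∷ xs} (here _) = xs
  remove {xs = y ∷ xs} (there p) = y ∷ remove p

  length-remove : ∀ {x : A} {xs} (p : x ∈ xs) → suc (length (remove p)) ≡ length xs
  length-remove {xs = _ ∷ xs} (here _) = refl
  length-remove {xs = y ∷ xs} (there p) = cong suc (length-remove p)

  ∈-remove : ∀ {x y : A} {xs} (p : x ∈ xs) → y ∈ xs → x ≢ y → y ∈ remove p
  ∈-remove (here refl) (here refl) ne = ⊥-elim (ne refl)
  ∈-remove (here _) (there q) ne = q
  ∈-remove (there p) (here eq) ne = here eq
  ∈-remove (there p) (there q) ne = there (∈-remove p q ne)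

  unique-⊆-length : ∀ {xs ys : List A} → Unique xs → xs ⊆ ys → length xs ≤ length ys
  unique-⊆-length [] sub = z≤n
  unique-⊆-length (x∉ ∷ u) sub = ≤-trans (s≤s (unique-⊆-length u
   (λ q → ∈-remove (sub (here refl)) (sub (there q)) (All.lookup x∉ q))))
   (≤-reflexive (length-remove (sub (here refl))))

  -- By counting: an element of ys outside xs would give a repetition-free list inside ys that is
  -- longer than ys. In this way r images among r candidates must be all of them.
  unique-⊆-⊇ : DecidableEquality A → ∀ {xs ys : List A} → Unique xs → xs ⊆ ys → length ys ≤ length xs → ys ⊆ xs
  unique-⊆-⊇ _≟ᴬ_ {xs} {ys} u sub le {y} y∈ with Any.any? (y ≟ᴬ_) xs
  ... | yes p = p
  ... | no ¬p = ⊥-elim (1+n≰n (≤-trans (unique-⊆-length (All.tabulate (λ {z} q eq → ¬p (subst (_∈ xs) (sym eq) q)) ∷ u)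
   (λ { (here refl) → y∈ ; (there q) → sub q })) le))

 first-two : ∀ {A : Set} (xs : List A) → 2 ≤ length xs → ∃[ x ] ∃[ y ] ∃[ zs ] xs ≡ x ∷ y ∷ zs
 first-two (x ∷ y ∷ zs) _ = x , y , zs , refl
 first-two (x ∷ []) (s≤s ())

 T-⇔-≡ : ∀ {a b} → (T a → T b) → (T b → T a) → a ≡ b
 T-⇔-≡ {false} {false} f g = refl
 T-⇔-≡ {false} {true} f g = ⊥-elim (g tt)
 T-⇔-≡ {true} {false} f g = ⊥-elim (f tt)
 T-⇔-≡ {true} {true} f g = refl

 ¬T-false : ∀ {b} → ¬ T b → b ≡ false
 ¬T-false {false} _ = refl
 ¬T-false {true} n = ⊥-elim (n tt)

 T-not : ∀ {b} → T (not b) → ¬ T b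
 T-not {false} _ ()

 ¬T-not : ∀ {b} → ¬ T b → T (not b)
 ¬T-not {false} _ = tt
 ¬T-not {true} n = n tt

 ∧-T : ∀ {a b} → T a → T b → T (a ∧ b)
 ∧-T {true} _ q = q

 T-∧₁ : ∀ {a b} → T (a ∧ b) → T a
 T-∧₁ {true} _ = tt

 T-∧₂ : ∀ a {b} → T (a ∧ b) → T b
 T-∧₂ true q = q

 -- Replaces the vertex subset of `ContainsInduced` by an injective map; equality of Booleans says
 -- that adjacency is both preserved and reflected.
 Embedding : Graph → Graph → Set
 Embedding H G = Σ (Vertex H → Vertex G) λ f → Injective _≡_ _≡_ f × ∀ u v → has (edges H) u v ≡ has (edges G) (f u) (f v)

 contains⇒embedding : ∀ H G → ContainsInduced H G → Embedding H G
 contains⇒embedding H G (S , φ , adj) = f , inj , λ u v → T-⇔-≡ (Equivalence.to (adj u v)) (Equivalence.from (adj u v))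
  where
  f = λ u → proj₁ (Inverse.to φ u)
  pair : ∀ {p q : ∃[ v ] v ∈ₛ S} → proj₁ p ≡ proj₁ q → p ≡ q
  pair {v , p} {.v , q} refl = cong (v ,_) ([]=-irrelevant p q)
  inj : Injective _≡_ _≡_ f
  inj {u} {v} eq = trans (sym (Inverse.strictlyInverseʳ φ u)) (trans (cong (Inverse.from φ) (pair eq)) (Inverse.strictlyInverseʳ φ v))

 embedding⇒contains : ∀ H G → Embedding H G → ContainsInduced H G
 embedding⇒contains H G (f , inj , adj) = S , mk↔ₛ′ to from to∘from from∘to ,
  λ u v → mk⇔ (subst T (adj u v)) (subst T (sym (adj u v)))
  where
  hit? : ∀ v → Dec (∃[ u ] f u ≡ v)
  hit? v = any? (λ u → f u ≟ v)
  S : Subset (order G)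
  S = tabulate (λ v → does (hit? v))
  to : Vertex H → ∃[ v ] v ∈ₛ S
  to u = f u , lookup⇒[]= (f u) S (trans (lookup∘tabulate _ (f u)) (dec-true (hit? (f u)) (u , refl)))
  found : ∀ v → v ∈ₛ S → ∃[ u ] f u ≡ v
  found v p with hit? v | trans (sym (lookup∘tabulate (λ v → does (hit? v)) v)) ([]=⇒lookup p)
  ... | yes h | _ = h
  from : (∃[ v ] v ∈ₛ S) → Vertex H
  from (v , p) = proj₁ (found v p)
  to∘from : ∀ q → to (from q) ≡ q
  to∘from (v , p) = pair (proj₂ (found v p))
   where
   pair : ∀ {p q : ∃[ v ] v ∈ₛ S} → proj₁ p ≡ proj₁ q → p ≡ q
   pair {v , p} {.v , q} refl = cong (v ,_) ([]=-irrelevant p q)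
  from∘to : ∀ u → from (to u) ≡ u
  from∘to u = inj (proj₂ (found (f u) (proj₂ (to u))))

 module Neighbours (R : Graph) where

  V : Set
  V = Vertex R

  _~_ : V → V → Set
  _~_ = Adj R

  ~-sym : ∀ {u v} → u ~ v → v ~ u
  ~-sym {u} {v} = subst T (EdgeSet.sym (edges R) u v)

  ~-irrefl : ∀ {u v} → u ~ v → u ≢ v
  ~-irrefl {u} a refl = subst T (EdgeSet.irrefl (edges R) u) a

  N : V → List V
  N u = filterᵇ (has (edges R) u) (allFin (order R))

  N-unique : ∀ u → Unique (N u)
  N-unique u = filter⁺ (T? ∘ has (edges R) u) (allFin⁺ (order R))

  ∈-N⁺ : ∀ {u v} → u ~ v → v ∈ N u
  ∈-N⁺ {u} {v} a = ∈-filter⁺ (T? ∘ has (edges R) u) (∈-allFin v) a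

  ∈-N⁻ : ∀ {u v} → v ∈ N u → u ~ v
  ∈-N⁻ {u} p = proj₂ (∈-filter⁻ (T? ∘ has (edges R) u) {xs = allFin (order R)} p)

  _∈?_ : ∀ (v : V) xs → Dec (v ∈ xs)
  v ∈? xs = Any.any? (v ≟_) xs

 -- In a connected r-regular graph with r ≥ 2 some path a–p–b has a connected complement K. To find it, grow K while the
 -- complement still contains a path on three vertices.
 module Core (R : Graph) (conn : Connected R) (r : ℕ) (reg : ∀ u → degree R u ≡ r) (2≤r : 2 ≤ r) where

  open Neighbours R public

  degree-≤ : ∀ u ys → (∀ {v} → u ~ v → v ∈ ys) → r ≤ length ys
  degree-≤ u ys sub = ≤-trans (≤-reflexive (sym (reg u))) (unique-⊆-length (N-unique u) (sub ∘ ∈-N⁻))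

  degree-≥ : ∀ u ys → Unique ys → (∀ {v} → v ∈ ys → u ~ v) → length ys ≤ r
  degree-≥ u ys uy sub = ≤-trans (unique-⊆-length uy (∈-N⁺ ∘ sub)) (≤-reflexive (reg u))

  three : ∀ {x y z : V} → x ≢ y → x ≢ z → y ≢ z → Unique (x ∷ y ∷ z ∷ [])
  three xy xz yz = (xy ∷ xz ∷ []) ∷ (yz ∷ []) ∷ [] ∷ []

  -- Connectivity is recorded as an order of insertion in which each vertex has an earlier
  -- neighbour; extending the set then requires only one edge.
  data Grown : List V → Set where
   [] : Grown []
   start : ∀ k → Grown [ k ]
   grow : ∀ {z κ K} → z ∉ K → κ ∈ K → z ~ κ → Grown K → Grown (z ∷ K)

  -- The form in which the connectivity of K is used: a property handed on along the edges inside K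
  -- spreads from any vertex to all. The newest vertex z exchanges it with the older ones over the
  -- edge zκ.
  grown-closed : ∀ {K} → Grown K → (Q : V → Set) → (∀ {u v} → u ∈ K → v ∈ K → u ~ v → Q u → Q v) →
   ∀ {v₀} → v₀ ∈ K → Q v₀ → ∀ {v} → v ∈ K → Q v
  grown-closed (start k) Q cl (here refl) q (here refl) = q
  grown-closed (grow {z} {κ} {K} z∉ κ∈ zκ g) Q cl v₀∈ q v∈ = finish v₀∈ q v∈
   where
   cl′ : ∀ {u v} → u ∈ K → v ∈ K → u ~ v → Q u → Q v
   cl′ u∈ v∈ = cl (there u∈) (there v∈)
   finish : ∀ {v₀} → v₀ ∈ z ∷ K → Q v₀ → ∀ {v} → v ∈ z ∷ K → Q v
   finish (here refl) q (here refl) = q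
   finish (here refl) q (there v∈) = grown-closed g Q cl′ κ∈ (cl (here refl) (there κ∈) zκ q) v∈
   finish (there v₀∈) q (there v∈) = grown-closed g Q cl′ v₀∈ q v∈
   finish (there v₀∈) q (here refl) = cl (there κ∈) (here refl) (~-sym zκ) (grown-closed g Q cl′ v₀∈ q κ∈)

  grown-unique : ∀ {K} → Grown K → Unique K
  grown-unique [] = []
  grown-unique (start k) = [] ∷ []
  grown-unique (grow z∉ _ _ g) = All.tabulate (λ p eq → z∉ (subst (_∈ _) (sym eq) p)) ∷ grown-unique g

  record Triple : Set where
   field
    a p b : V
    pa : p ~ a
    pb : p ~ b
    a≢b : a ≢ b

   members : List V
   members = a ∷ p ∷ b ∷ []

   partner : ∀ {z} → z ∈ members → ∃[ t ] t ∈ members × z ~ t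
   partner (here refl) = p , there (here refl) , ~-sym pa
   partner (there (here refl)) = a , here refl , pa
   partner (there (there (here refl))) = p , there (here refl) , ~-sym pb

  open Triple

  record Split (K : List V) : Set where
   field
    triple : Triple
    grown : Grown K
    outside : ∀ {z} → z ∈ members triple → z ∉ K

  open Split

  crossing : ∀ {K : List V} {u v} → Star _~_ u v → u ∈ K → v ∉ K → ∃[ κ ] ∃[ z ] κ ∈ K × z ∉ K × κ ~ z
  crossing ε u∈ v∉ = ⊥-elim (v∉ u∈)
  crossing {K} {u} (_◅_ {j = w} uw s) u∈ v∉ with w ∈? K
  ... | yes w∈ = crossing s w∈ v∉
  ... | no w∉ = u , w , u∈ , w∉ , uw

  cons-∉ : ∀ {z v : V} {K} → v ≢ z → v ∉ K → v ∉ z ∷ K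
  cons-∉ ne v∉ (here eq) = ne eq
  cons-∉ ne v∉ (there p) = v∉ p

  -- Let κz be an edge that leaves K. If z is not on the path, z is added; if u has a neighbour in
  -- K, u is added. In the remaining case z is on the path and u sees nothing of K, so two
  -- neighbours of u other than z form a new path with middle u; the old path is abandoned and z
  -- joins K.
  enlarge : ∀ {K} (S : Split K) u → u ∉ K → u ∉ members (triple S) → ∃[ z ] Split (z ∷ K)
  enlarge {[]} S u u∉K u∉S = u , record { triple = triple S ; grown = start u ; outside = λ z∈ → cons-∉ (λ eq → u∉S (subst (_∈ _) eq z∈)) λ () }
  enlarge {K@(k ∷ _)} S u u∉K u∉S
   with κ , z , κ∈ , z∉ , κz ← crossing (conn k (p (triple S))) (here refl) (outside S (there (here refl)))
   with z ∈? members (triple S)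
  ... | no z∉S = z , record { triple = triple S ; grown = grow z∉ κ∈ (~-sym κz) (grown S)
   ; outside = λ v∈ → cons-∉ (λ eq → z∉S (subst (_∈ _) eq v∈)) (outside S v∈) }
  ... | yes z∈S with Any.any? (λ v → v ∈? N u) K
  ... | yes adj with κ′ , κ′∈ , uκ′ ← find adj =
   u , record { triple = triple S ; grown = grow u∉K κ′∈ (∈-N⁻ uκ′) (grown S)
    ; outside = λ v∈ → cons-∉ (λ eq → u∉S (subst (_∈ _) eq v∈)) (outside S v∈) }
  ... | no ¬adj = z , rest (filter (λ v → nz? v) (N u)) refl
   where
   nz? : ∀ v → Dec (v ≢ z)
   nz? v with v ≟ z
   ... | yes eq = no (λ ne → ne eq)
   ... | no ne = yes ne
   D = filter nz? (N u)
   D-∉ : ∀ {v} → v ∈ D → u ~ v × v ∉ z ∷ K × v ≢ u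
   D-∉ {v} v∈ with v∈N , v≢z ← ∈-filter⁻ nz? {xs = N u} v∈ =
    ∈-N⁻ v∈N , cons-∉ v≢z (λ v∈K → ¬adj (lose v∈K v∈N)) , ≢-sym (~-irrefl (∈-N⁻ v∈N))
   u≢z : u ≢ z
   u≢z refl = u∉S z∈S
   -- With at most one neighbour of u besides z, the degree r is at most 2, and since r ≥ 2 the edge
   -- zu exists. But z also has the neighbours κ in K and t on the path, three in all.
   few : length D ≤ 1 → ⊥
   few le = 1+n≰n (≤-trans (degree-≥ z (u ∷ κ ∷ t ∷ []) (three (λ eq → u∉K (subst (_∈ K) (sym eq) κ∈)) (λ eq → u∉S (subst (_∈ _) (sym eq) t∈))
    (λ eq → outside S t∈ (subst (_∈ K) eq κ∈))) nbr) r≤2)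
    where
    t = proj₁ (partner (triple S) z∈S)
    t∈ = proj₁ (proj₂ (partner (triple S) z∈S))
    zt = proj₂ (proj₂ (partner (triple S) z∈S))
    r≤2 : r ≤ 2
    r≤2 = ≤-trans (degree-≤ u (z ∷ D) cover) (s≤s le)
     where
     cover : ∀ {v} → u ~ v → v ∈ z ∷ D
     cover {v} uv with v ≟ z
     ... | yes eq = here eq
     ... | no ne = there (∈-filter⁺ nz? (∈-N⁺ uv) ne)
    zu : z ~ u
    zu with z ∈? N u
    ... | yes z∈ = ~-sym (∈-N⁻ z∈)
    ... | no z∉ = ⊥-elim (1+n≰n (≤-trans 2≤r (≤-trans (degree-≤ u D (λ uv → ∈-filter⁺ nz? (∈-N⁺ uv) (λ { refl → z∉ (∈-N⁺ uv) }))) le)))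
    nbr : ∀ {v} → v ∈ u ∷ κ ∷ t ∷ [] → z ~ v
    nbr (here refl) = zu
    nbr (there (here refl)) = ~-sym κz
    nbr (there (there (here refl))) = zt
   rest : ∀ L → D ≡ L → Split (z ∷ K)
   rest [] eq = ⊥-elim (few (≤-trans (≤-reflexive (cong length eq)) z≤n))
   rest (_ ∷ []) eq = ⊥-elim (few (≤-reflexive (cong length eq)))
   rest (x ∷ y ∷ L) eq = record
    { triple = record { a = x ; p = u ; b = y ; pa = proj₁ (D-∉ x∈) ; pb = proj₁ (D-∉ y∈)
     ; a≢b = distinct (subst Unique eq (filter⁺ nz? (N-unique u))) }
    ; grown = grow z∉ κ∈ (~-sym κz) (grown S)
    ; outside = λ { (here refl) → proj₁ (proj₂ (D-∉ x∈)) ; (there (here refl)) → cons-∉ u≢z u∉K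
     ; (there (there (here refl))) → proj₁ (proj₂ (D-∉ y∈)) } }
    where
    x∈ : x ∈ D
    x∈ = subst (x ∈_) (sym eq) (here refl)
    y∈ : y ∈ D
    y∈ = subst (y ∈_) (sym eq) (there (here refl))
    distinct : Unique (x ∷ y ∷ L) → x ≢ y
    distinct ((ne ∷ _) ∷ _) = ne

  record Complement : Set where
   field
    K : List V
    split : Split K
    cover : ∀ v → v ∈ members (triple split) ⊎ v ∈ K

  covered? : ∀ {K} (S : Split K) v → Dec (v ∈ members (triple S) ⊎ v ∈ K)
  covered? {K} S v with v ∈? members (triple S) | v ∈? K
  ... | yes p | _ = yes (inj₁ p)
  ... | no _ | yes q = yes (inj₂ q)
  ... | no p | no q = no [ p , q ]′

  -- Each round adds one vertex to K, so the order of R bounds the number of rounds; at fuel zero, K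
  -- together with the vertex a outside it would exceed the order.
  complete : ∀ fuel {K} → Split K → order R ≤ fuel + length K → Complement
  complete zero {K} S le = ⊥-elim (1+n≰n (≤-trans (unique-⊆-length {ys = allFin (order R)}
   (All.tabulate (λ {v} v∈ eq → outside S (here refl) (subst (_∈ K) (sym eq) v∈)) ∷ grown-unique (grown S)) (λ {v} _ → ∈-allFin v))
   (≤-trans (≤-reflexive (length-tabulate {n = order R} id)) le)))
  complete (suc f) {K} S le with Data.Fin.Properties.all? (covered? S)
  ... | yes all = record { K = K ; split = S ; cover = all }
  ... | no ¬all with u , ¬u ← Data.Fin.Properties.¬∀⟶∃¬ (order R) _ (covered? S) ¬all =
   let z , S′ = enlarge S u (λ p → ¬u (inj₂ p)) (λ p → ¬u (inj₁ p)) in complete f S′ (≤-trans le (≤-reflexive (sym (+-suc f (length K)))))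

  complement : V → Complement
  complement u with N u in eq
  ... | [] = ⊥-elim (1+n≰n (≤-trans (≤-trans (n≤1+n 1) 2≤r) (≤-reflexive (trans (sym (reg u)) (cong length eq)))))
  ... | _ ∷ [] = ⊥-elim (1+n≰n (≤-trans 2≤r (≤-reflexive (trans (sym (reg u)) (cong length eq)))))
  ... | x ∷ y ∷ L = complete (order R) S (≤-reflexive (sym (Data.Nat.Properties.+-identityʳ _)))
   where
   distinct : Unique (x ∷ y ∷ L) → x ≢ y
   distinct ((ne ∷ _) ∷ _) = ne
   S : Split []
   S = record
    { triple = record { a = x ; p = u ; b = y ; pa = ∈-N⁻ (subst (x ∈_) (sym eq) (here refl)) ; pb = ∈-N⁻ (subst (y ∈_) (sym eq) (there (here refl)))
     ; a≢b = distinct (subst Unique eq (N-unique u)) }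
    ; grown = [] ; outside = λ _ () }

 module _ (R : Graph) (conn : Connected R) (r : ℕ) (reg : ∀ u → degree R u ≡ r) (2≤e : 2 ≤ ∣ edges R ∣ₑ) where

  open Neighbours R

  private
   isEdge : V × V → Bool
   isEdge (u , v) = (toℕ u <ᵇ toℕ v) ∧ has (edges R) u v

   pairs : List (V × V)
   pairs = filterᵇ isEdge (cartesianProduct (allFin (order R)) (allFin (order R)))

   edge : ∀ {uv} → uv ∈ pairs → T (isEdge uv)
   edge p = proj₂ (∈-filter⁻ (T? ∘ isEdge) {xs = cartesianProduct (allFin (order R)) (allFin (order R))} p)

  some-vertex : V
  some-vertex = proj₁ (proj₁ (first-two pairs 2≤e))

  -- If r ≤ 1, a walk that starts on the edge uv never leaves it, so by connectivity there is no
  -- other edge. The two listed edges would coincide, since both are listed with the smaller end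
  -- first.
  2≤degree : 2 ≤ r
  2≤degree with 2 ≤? r
  ... | yes le = le
  ... | no ¬le with (u , v) , (u′ , v′) , _ , eq ← first-two pairs 2≤e = ⊥-elim (ne (cong₂ _,_ (proj₁ same) (proj₂ same)))
   where
   ne : (u , v) ≢ (u′ , v′)
   ne with (d ∷ _) ∷ _ ← subst Unique eq (filter⁺ (T? ∘ isEdge) (cartesianProduct⁺ (allFin⁺ (order R)) (allFin⁺ (order R)))) = d
   e₁ : T (isEdge (u , v))
   e₁ = edge (subst ((u , v) ∈_) (sym eq) (here refl))
   e₂ : T (isEdge (u′ , v′))
   e₂ = edge (subst ((u′ , v′) ∈_) (sym eq) (there (here refl)))
   only : ∀ {x y z} → x ~ y → x ~ z → y ≡ z
   only {x} {y} {z} xy xz with y ≟ z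
   ... | yes e = e
   ... | no ne = ⊥-elim (¬le (≤-trans (unique-⊆-length {xs = y ∷ z ∷ []} ((ne ∷ []) ∷ [] ∷ [])
    (λ { (here refl) → ∈-N⁺ xy ; (there (here refl)) → ∈-N⁺ xz })) (≤-reflexive (reg x))))
   uv : u ~ v
   uv = T-∧₂ (toℕ u <ᵇ toℕ v) e₁
   stay′ : ∀ {x y} → Star _~_ x y → x ≡ u ⊎ x ≡ v → y ≡ u ⊎ y ≡ v
   stay′ ε h = h
   stay′ (xy ◅ s) (inj₁ refl) = stay′ s (inj₂ (only xy uv))
   stay′ (xy ◅ s) (inj₂ refl) = stay′ s (inj₁ (only xy (~-sym uv)))
   same : u ≡ u′ × v ≡ v′
   same with stay′ (conn u u′) (inj₁ refl) | stay′ (conn u v′) (inj₁ refl)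
   ... | inj₁ refl | inj₂ refl = refl , refl
   ... | inj₁ refl | inj₁ refl = ⊥-elim (<⇒≢ (<ᵇ⇒< (toℕ u′) (toℕ v′) (T-∧₁ e₂)) refl)
   ... | inj₂ refl | inj₂ refl = ⊥-elim (<⇒≢ (<ᵇ⇒< (toℕ u′) (toℕ v′) (T-∧₁ e₂)) refl)
   ... | inj₂ refl | inj₁ refl = ⊥-elim (<-asym (<ᵇ⇒< (toℕ u) (toℕ v) (T-∧₁ e₁)) (<ᵇ⇒< (toℕ v) (toℕ u) (T-∧₁ e₂)))

-- Gluing copies of a regular graph at a centre

module GluedCopies where

 open import Data.Bool using (T)
 open import Data.Bool.Properties using (∨-comm)
 open import Data.Fin using (toℕ)
 open import Data.List using (lookup)
 open import Data.List.Membership.Propositional.Properties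
 open import Data.List.Relation.Unary.Any using (index)
 import Data.List.Relation.Unary.Any as Any
 import Data.List.Relation.Unary.All as All
 open import Data.Nat.Properties using (<⇒<ᵇ; <-cmp)
 open import Relation.Nullary using (yes; no)
 open Programs using (Ty; 𝟙; 𝔹; nat; list; _⊗_; _⊕_; ⟦_⟧; PT; _∘P_)
 open PolynomialTime using (eqᵇ; eqᵇ-sound; eqᵇ-refl; anyP; eqP; v0; w1)
 open RegularGraphs

 open Graph

 T-eq : ∀ {τ} {x y : ⟦ τ ⟧} → T (eqᵇ τ x y) → x ≡ y
 T-eq {τ} {x} {y} t = eqᵇ-sound τ x y (Equivalence.to T-≡ t)

 eq-T : ∀ τ (x : ⟦ τ ⟧) → T (eqᵇ τ x x)
 eq-T τ x = Equivalence.from T-≡ (eqᵇ-refl τ x)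

 dec : ∀ τ → DecidableEquality ⟦ τ ⟧
 dec τ x y with T? (eqᵇ τ x y)
 ... | yes t = yes (T-eq t)
 ... | no ¬t = no λ { refl → ¬t (eq-T τ x) }

 abstract
  mem : ∀ τ → ⟦ τ ⟧ → List ⟦ τ ⟧ → Bool
  mem τ x xs = any (eqᵇ τ x) xs

  mem⁺ : ∀ τ {x xs} → x ∈ xs → T (mem τ x xs)
  mem⁺ τ {x} p = any⁺ (eqᵇ τ x) (Any.map (λ { refl → eq-T τ x }) p)

  mem⁻ : ∀ τ x xs → T (mem τ x xs) → x ∈ xs
  mem⁻ τ x xs t = Any.map T-eq (any⁻ (eqᵇ τ x) xs t)

  memP : ∀ {Γ} τ {e f} → PT Γ τ e → PT Γ (list τ) f → PT Γ 𝔹 (λ γ → mem τ (e γ) (f γ))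
  memP τ E F = anyP F (eqP τ (E ∘P w1) v0)

 T-∨₁ : ∀ {a b} → T a → T (a ∨ b)
 T-∨₁ {true} _ = tt

 T-∨₂ : ∀ a {b} → T b → T (a ∨ b)
 T-∨₂ true _ = tt
 T-∨₂ false t = t

 module _ {A : Set} where

  ∈-remove⁻ : ∀ {x y : A} {xs} (p : x ∈ xs) → y ∈ remove p → y ∈ xs
  ∈-remove⁻ (here _) q = there q
  ∈-remove⁻ (there p) (here eq) = here eq
  ∈-remove⁻ (there p) (there q) = there (∈-remove⁻ p q)

  unique-remove : ∀ {x : A} {xs} (p : x ∈ xs) → Unique xs → Unique (remove p)
  unique-remove (here _) (_ ∷ u) = u
  unique-remove (there p) (d ∷ u) = All.tabulate (λ q → All.lookup d (∈-remove⁻ p q)) ∷ unique-remove p u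

  ∉-remove : ∀ {x : A} {xs} (p : x ∈ xs) → Unique xs → x ∉ remove p
  ∉-remove (here refl) (d ∷ u) q = All.lookup d q refl
  ∉-remove (there p) (d ∷ u) (here refl) = All.lookup d p refl
  ∉-remove (there p) (d ∷ u) (there q) = ∉-remove p u q

  lookup-injective : ∀ {xs : List A} → Unique xs → ∀ i j → lookup xs i ≡ lookup xs j → i ≡ j
  lookup-injective (d ∷ u) zero zero eq = refl
  lookup-injective (d ∷ u) zero (suc j) eq = ⊥-elim (All.lookup d (∈-lookup j) eq)
  lookup-injective (d ∷ u) (suc i) zero eq = ⊥-elim (All.lookup d (∈-lookup i) (sym eq))
  lookup-injective (d ∷ u) (suc i) (suc j) eq = cong suc (lookup-injective u i j eq)

 concatMap-length≤ : ∀ {A B : Set} (g : A → List B) → (∀ x → length (g x) ≤ 1) → ∀ xs → length (concatMap g xs) ≤ length xs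
 concatMap-length≤ g le [] = z≤n
 concatMap-length≤ g le (x ∷ xs) = ≤-trans (≤-reflexive (length-++ (g x))) (+-mono-≤ (le x) (concatMap-length≤ g le xs))

 ∈-concatMap : ∀ {A B : Set} (g : A → List B) {x y xs} → x ∈ xs → y ∈ g x → y ∈ concatMap g xs
 ∈-concatMap g x∈ y∈ = ∈-concatMap⁺ g (lose x∈ y∈)

 isPair : ∀ {n} → EdgeSet n → Fin n × Fin n → Bool
 isPair E (u , v) = (toℕ u <ᵇ toℕ v) ∧ has E u v

 edgePairs : ∀ {n} → EdgeSet n → List (Fin n × Fin n)
 edgePairs {n} E = filterᵇ (isPair E) (cartesianProduct (allFin n) (allFin n))

 edgePairs-unique : ∀ {n} (E : EdgeSet n) → Unique (edgePairs E)
 edgePairs-unique {n} E = filter⁺ (T? ∘ isPair E) (cartesianProduct⁺ (allFin⁺ n) (allFin⁺ n))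

 ∈-edgePairs : ∀ {n} (E : EdgeSet n) {u v} → toℕ u < toℕ v → T (has E u v) → (u , v) ∈ edgePairs E
 ∈-edgePairs E {u} {v} lt e = ∈-filter⁺ (T? ∘ isPair E) (∈-cartesianProduct⁺ (∈-allFin u) (∈-allFin v)) (∧-T (<⇒<ᵇ lt) e)

 edgePairs⁻ : ∀ {n} (E : EdgeSet n) {u v} → (u , v) ∈ edgePairs E → toℕ u < toℕ v × T (has E u v)
 edgePairs⁻ {n} E {u} {v} p with t ← proj₂ (∈-filter⁻ (T? ∘ isPair E) {xs = cartesianProduct (allFin n) (allFin n)} p) =
  <ᵇ⇒< (toℕ u) (toℕ v) (T-∧₁ t) , T-∧₂ (toℕ u <ᵇ toℕ v) t

 module ListGraph (τ : Ty) (adj : ⟦ τ ⟧ → ⟦ τ ⟧ → Bool) (adj-sym : ∀ y z → adj y z ≡ adj z y)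
  (adj-irrefl : ∀ y → adj y y ≡ false) (vs : List ⟦ τ ⟧) where

  listGraph : Graph
  listGraph = record
   { order = length vs
   ; edges = record { has = λ i j → adj (lookup vs i) (lookup vs j)
    ; sym = λ i j → adj-sym _ _ ; irrefl = λ i → adj-irrefl _ } }

 module Tables (R : Graph) where

  open Neighbours R

  private
   nums : V × V → ℕ × ℕ
   nums (u , v) = toℕ u , toℕ v

   adjacent : V × V → Bool
   adjacent (u , v) = has (edges R) u v

   VV : List (V × V)
   VV = cartesianProduct (allFin (order R)) (allFin (order R))

  -- R is fixed, so its adjacency is a finite constant that the reduction can look up.
  table : List (ℕ × ℕ)
  table = map nums (filterᵇ adjacent VV)

  hasN : ℕ → ℕ → Bool
  hasN k l = mem (nat ⊗ nat) (k , l) table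

  hasN⁺ : ∀ {u v} → u ~ v → T (hasN (toℕ u) (toℕ v))
  hasN⁺ {u} {v} e = mem⁺ (nat ⊗ nat) (∈-map⁺ nums (∈-filter⁺ (T? ∘ adjacent) (∈-cartesianProduct⁺ (∈-allFin u) (∈-allFin v)) e))

  hasN⁻ : ∀ {u v} → T (hasN (toℕ u) (toℕ v)) → u ~ v
  hasN⁻ {u} {v} t with (u′ , v′) , p , eq ← ∈-map⁻ nums (mem⁻ (nat ⊗ nat) (toℕ u , toℕ v) table t)
   with refl ← toℕ-injective {i = u} {u′} (cong proj₁ eq) | refl ← toℕ-injective {i = v} {v′} (cong proj₂ eq) =
   proj₂ (∈-filter⁻ (T? ∘ adjacent) {xs = VV} p)

  hasN-sym : ∀ k l → T (hasN k l) → T (hasN l k)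
  hasN-sym k l t with (u , v) , p , refl ← ∈-map⁻ nums (mem⁻ (nat ⊗ nat) (k , l) table t) =
   hasN⁺ (~-sym (proj₂ (∈-filter⁻ (T? ∘ adjacent) {xs = VV} p)))

  hasN-irrefl : ∀ k → ¬ T (hasN k k)
  hasN-irrefl k t with (u , v) , p , eq ← ∈-map⁻ nums (mem⁻ (nat ⊗ nat) (k , k) table t)
   with refl ← toℕ-injective {i = u} {v} (trans (sym (cong proj₁ eq)) (cong proj₂ eq)) =
   ~-irrefl (proj₂ (∈-filter⁻ (T? ∘ adjacent) {xs = VV} p)) refl

 IsCover : ∀ {X : Set} → List X → (X → X → Bool) → List X → Set
 IsCover Us arc C = ∀ {x y} → x ∈ Us → y ∈ Us → T (arc x y) → x ∈ C ⊎ y ∈ C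

 HasCover : ∀ {X : Set} → List X → (X → X → Bool) → ℕ → Set
 HasCover Us arc k = ∃[ C ] length C ≤ k × IsCover Us arc C

 -- A vertex x of Q becomes the edge between the centre and `vertex x`; every arc x → y of Q becomes a copy of R in which
 -- p is the centre, a and b are `vertex x` and `vertex y`, and the vertices in K are new.
 module Gluing (R : Graph) (conn : Connected R) (r : ℕ) (reg : ∀ u → degree R u ≡ r) (2≤r : 2 ≤ r)
  (co : Core.Complement R conn r reg 2≤r)
  (τ : Ty) (arc : ⟦ τ ⟧ → ⟦ τ ⟧ → Bool) (arc-asym : ∀ {x y} → T (arc x y) → ¬ T (arc y x))
  where

  open Core R conn r reg 2≤r
  open Complement co
  open Split split
  open Triple triple
  open Tables R

  X : Set
  X = ⟦ τ ⟧

  υ : Ty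
  υ = 𝟙 ⊕ τ ⊕ τ ⊗ τ ⊗ nat

  pattern centre = inj₁ tt
  pattern vertex x = inj₂ (inj₁ x)
  pattern private′ x y k = inj₂ (inj₂ (x , y , k))

  arc-irrefl : ∀ {x} → ¬ T (arc x x)
  arc-irrefl t = arc-asym t t

  qadj : X → X → Bool
  qadj x y = arc x y ∨ arc y x

  -- Adjacency of a vertex z of Q with the new vertex k of the arc x → y. The tail acts as a and the
  -- head as b; this is why Q has to be oriented.
  link : X → X → X → ℕ → Bool
  link z x y k = arc x y ∧ (eqᵇ τ z x ∧ hasN (toℕ a) k ∨ eqᵇ τ z y ∧ hasN (toℕ b) k)

  -- New vertices exist for all pairs (x , y), which keeps the vertex list a plain product; the
  -- guard `arc x y` isolates them where there is no arc. Vertices of Q are adjacent only along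
  -- arcs, and only if a and b are adjacent in R.
  adj : ⟦ υ ⟧ → ⟦ υ ⟧ → Bool
  adj centre centre = false
  adj centre (vertex x) = true
  adj centre (private′ x y k) = arc x y ∧ hasN (toℕ p) k
  adj (vertex x) centre = true
  adj (vertex x) (vertex y) = qadj x y ∧ hasN (toℕ a) (toℕ b)
  adj (vertex z) (private′ x y k) = link z x y k
  adj (private′ x y k) centre = arc x y ∧ hasN (toℕ p) k
  adj (private′ x y k) (vertex z) = link z x y k
  adj (private′ x y k) (private′ x′ y′ k′) = (eqᵇ τ x x′ ∧ eqᵇ τ y y′) ∧ (arc x y ∧ hasN k k′)

  adj-sym : ∀ y z → adj y z ≡ adj z y
  adj-sym centre centre = refl
  adj-sym centre (vertex x) = refl
  adj-sym centre (private′ x y k) = refl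
  adj-sym (vertex x) centre = refl
  adj-sym (vertex x) (vertex y) = cong (_∧ hasN (toℕ a) (toℕ b)) (∨-comm (arc x y) (arc y x))
  adj-sym (vertex x) (private′ _ _ _) = refl
  adj-sym (private′ _ _ _) centre = refl
  adj-sym (private′ _ _ _) (vertex x) = refl
  adj-sym (private′ x y k) (private′ x′ y′ k′) = T-⇔-≡ (flip′ x y k x′ y′ k′) (flip′ x′ y′ k′ x y k)
   where
   flip′ : ∀ x y k x′ y′ k′ → T (adj (private′ x y k) (private′ x′ y′ k′)) → T (adj (private′ x′ y′ k′) (private′ x y k))
   flip′ x y k x′ y′ k′ t
    with e , h ← Equivalence.to (T-∧ {eqᵇ τ x x′ ∧ eqᵇ τ y y′}) t
    with ex , ey ← Equivalence.to (T-∧ {eqᵇ τ x x′}) e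
    with refl ← T-eq {τ} {x} {x′} ex | refl ← T-eq {τ} {y} {y′} ey =
    ∧-T (∧-T (eq-T τ x) (eq-T τ y)) (∧-T (T-∧₁ h) (hasN-sym k k′ (T-∧₂ (arc x y) h)))

  adj-irrefl : ∀ y → adj y y ≡ false
  adj-irrefl centre = refl
  adj-irrefl (vertex x) = ¬T-false (λ t → [ arc-irrefl , arc-irrefl ]′ (Equivalence.to (T-∨ {arc x x}) (T-∧₁ t)))
  adj-irrefl (private′ x y k) = ¬T-false (λ t → hasN-irrefl k (T-∧₂ (arc x y) (T-∧₂ (eqᵇ τ x x ∧ eqᵇ τ y y) t)))

  place : X → X → V → ⟦ υ ⟧
  place x y u with cover u
  ... | inj₁ (here _) = vertex x
  ... | inj₁ (there (here _)) = centre
  ... | inj₁ (there (there (here _))) = vertex y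
  ... | inj₂ _ = private′ x y (toℕ u)

  p≢a : p ≢ a
  p≢a = ~-irrefl pa
  p≢b : p ≢ b
  p≢b = ~-irrefl pb
  p∉ : p ∉ K
  p∉ = outside (there (here refl))
  a∉ : a ∉ K
  a∉ = outside (here refl)
  b∉ : b ∉ K
  b∉ = outside (there (there (here refl)))

  place-p : ∀ x y → place x y p ≡ centre
  place-p x y with cover p
  ... | inj₁ (here e) = ⊥-elim (p≢a e)
  ... | inj₁ (there (here _)) = refl
  ... | inj₁ (there (there (here e))) = ⊥-elim (p≢b e)
  ... | inj₂ k = ⊥-elim (p∉ k)

  place-a : ∀ x y → place x y a ≡ vertex x
  place-a x y with cover a
  ... | inj₁ (here e) = refl
  ... | inj₁ (there (here e)) = ⊥-elim (p≢a (sym e))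
  ... | inj₁ (there (there (here e))) = ⊥-elim (a≢b e)
  ... | inj₂ k = ⊥-elim (a∉ k)

  place-b : ∀ x y → place x y b ≡ vertex y
  place-b x y with cover b
  ... | inj₁ (here e) = ⊥-elim (a≢b (sym e))
  ... | inj₁ (there (here e)) = ⊥-elim (p≢b (sym e))
  ... | inj₁ (there (there (here e))) = refl
  ... | inj₂ k = ⊥-elim (b∉ k)

  place-K : ∀ x y {κ} → κ ∈ K → place x y κ ≡ private′ x y (toℕ κ)
  place-K x y {κ} κ∈ with cover κ
  ... | inj₁ (here refl) = ⊥-elim (a∉ κ∈)
  ... | inj₁ (there (here refl)) = ⊥-elim (p∉ κ∈)
  ... | inj₁ (there (there (here refl))) = ⊥-elim (b∉ κ∈)
  ... | inj₂ k = refl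

  place-injective : ∀ {x y} → x ≢ y → ∀ {u w} → place x y u ≡ place x y w → u ≡ w
  place-injective x≢y {u} {w} eq with cover u | cover w
  ... | inj₁ (here refl) | inj₁ (here refl) = refl
  ... | inj₁ (here refl) | inj₁ (there (there (here refl))) with refl ← eq = ⊥-elim (x≢y refl)
  ... | inj₁ (there (here refl)) | inj₁ (there (here refl)) = refl
  ... | inj₁ (there (there (here refl))) | inj₁ (here refl) with refl ← eq = ⊥-elim (x≢y refl)
  ... | inj₁ (there (there (here refl))) | inj₁ (there (there (here refl))) = refl
  ... | inj₂ _ | inj₂ _ = toℕ-injective (cong (λ { (private′ _ _ k) → k ; _ → 0 }) eq)
  ... | inj₁ (here refl) | inj₁ (there (here refl)) with () ← eq
  ... | inj₁ (here refl) | inj₂ _ with () ← eq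
  ... | inj₁ (there (here refl)) | inj₁ (here refl) with () ← eq
  ... | inj₁ (there (here refl)) | inj₁ (there (there (here refl))) with () ← eq
  ... | inj₁ (there (here refl)) | inj₂ _ with () ← eq
  ... | inj₁ (there (there (here refl))) | inj₁ (there (here refl)) with () ← eq
  ... | inj₁ (there (there (here refl))) | inj₂ _ with () ← eq
  ... | inj₂ _ | inj₁ (here refl) with () ← eq
  ... | inj₂ _ | inj₁ (there (here refl)) with () ← eq
  ... | inj₂ _ | inj₁ (there (there (here refl))) with () ← eq

  arc⇒≢ : ∀ {x y} → T (arc x y) → x ≢ y
  arc⇒≢ t refl = arc-irrefl t

  module _ {x y : X} (xy : T (arc x y)) where

   private
    x≢y : x ≢ y
    x≢y = arc⇒≢ xy

    link-a⁻ : ∀ {κ} → T (link x x y (toℕ κ)) → a ~ κ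
    link-a⁻ {κ} t with Equivalence.to (T-∨ {eqᵇ τ x x ∧ hasN (toℕ a) (toℕ κ)}) (T-∧₂ (arc x y) t)
    ... | inj₁ h = hasN⁻ (T-∧₂ (eqᵇ τ x x) h)
    ... | inj₂ h = ⊥-elim (x≢y (T-eq (T-∧₁ {eqᵇ τ x y} h)))

    link-b⁻ : ∀ {κ} → T (link y x y (toℕ κ)) → b ~ κ
    link-b⁻ {κ} t with Equivalence.to (T-∨ {eqᵇ τ y x ∧ hasN (toℕ a) (toℕ κ)}) (T-∧₂ (arc x y) t)
    ... | inj₁ h = ⊥-elim (x≢y (sym (T-eq (T-∧₁ {eqᵇ τ y x} h))))
    ... | inj₂ h = hasN⁻ (T-∧₂ (eqᵇ τ y y) h)

    link-a⁺ : ∀ {κ} → a ~ κ → T (link x x y (toℕ κ))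
    link-a⁺ e = ∧-T xy (T-∨₁ (∧-T (eq-T τ x) (hasN⁺ e)))

    link-b⁺ : ∀ {κ} → b ~ κ → T (link y x y (toℕ κ))
    link-b⁺ {κ} e = ∧-T xy (T-∨₂ (eqᵇ τ y x ∧ hasN (toℕ a) (toℕ κ)) (∧-T (eq-T τ y) (hasN⁺ e)))

    qadj-xy : T (qadj x y)
    qadj-xy = T-∨₁ xy

   place-adj : ∀ u w → adj (place x y u) (place x y w) ≡ has (edges R) u w
   place-adj u w with cover u | cover w
   ... | inj₁ (here refl) | inj₁ (here refl) = trans (adj-irrefl (vertex x)) (sym (EdgeSet.irrefl (edges R) a))
   ... | inj₁ (here refl) | inj₁ (there (here refl)) = T-⇔-≡ (λ _ → ~-sym pa) (λ _ → tt)
   ... | inj₁ (here refl) | inj₁ (there (there (here refl))) = T-⇔-≡ (λ t → hasN⁻ (T-∧₂ (qadj x y) t)) (λ e → ∧-T qadj-xy (hasN⁺ e))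
   ... | inj₁ (here refl) | inj₂ _ = T-⇔-≡ link-a⁻ link-a⁺
   ... | inj₁ (there (here refl)) | inj₁ (here refl) = T-⇔-≡ (λ _ → pa) (λ _ → tt)
   ... | inj₁ (there (here refl)) | inj₁ (there (here refl)) = sym (EdgeSet.irrefl (edges R) p)
   ... | inj₁ (there (here refl)) | inj₁ (there (there (here refl))) = T-⇔-≡ (λ _ → pb) (λ _ → tt)
   ... | inj₁ (there (here refl)) | inj₂ _ = T-⇔-≡ (λ t → hasN⁻ (T-∧₂ (arc x y) t)) (λ e → ∧-T xy (hasN⁺ e))
   ... | inj₁ (there (there (here refl))) | inj₁ (here refl) =
    T-⇔-≡ (λ t → ~-sym (hasN⁻ (T-∧₂ (qadj y x) t))) (λ e → ∧-T (T-∨₂ (arc y x) xy) (hasN⁺ (~-sym e)))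
   ... | inj₁ (there (there (here refl))) | inj₁ (there (here refl)) = T-⇔-≡ (λ _ → ~-sym pb) (λ _ → tt)
   ... | inj₁ (there (there (here refl))) | inj₁ (there (there (here refl))) = trans (adj-irrefl (vertex y)) (sym (EdgeSet.irrefl (edges R) b))
   ... | inj₁ (there (there (here refl))) | inj₂ _ = T-⇔-≡ link-b⁻ link-b⁺
   ... | inj₂ _ | inj₁ (here refl) = T-⇔-≡ (λ t → ~-sym (link-a⁻ t)) (λ e → link-a⁺ (~-sym e))
   ... | inj₂ _ | inj₁ (there (here refl)) = T-⇔-≡ (λ t → ~-sym (hasN⁻ (T-∧₂ (arc x y) t))) (λ e → ∧-T xy (hasN⁺ (~-sym e)))
   ... | inj₂ _ | inj₁ (there (there (here refl))) = T-⇔-≡ (λ t → ~-sym (link-b⁻ t)) (λ e → link-b⁺ (~-sym e))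
   ... | inj₂ _ | inj₂ _ = T-⇔-≡ (λ t → hasN⁻ (T-∧₂ (arc x y) (T-∧₂ (eqᵇ τ x x ∧ eqᵇ τ y y) t)))
    (λ e → ∧-T (∧-T (eq-T τ x) (eq-T τ y)) (∧-T xy (hasN⁺ e)))

  module Instance′ (Us : List X) (Us-unique : Unique Us) where

   privates : List (X × X × ℕ)
   privates = cartesianProduct Us (cartesianProduct Us (map toℕ K))

   Ys : List ⟦ υ ⟧
   Ys = centre ∷ map (λ x → vertex x) Us ++ map (λ t → inj₂ (inj₂ t)) privates

   open ListGraph υ adj adj-sym adj-irrefl Ys public

   Ys-unique : Unique Ys
   Ys-unique = All.tabulate (λ p eq → clash p (sym eq)) ∷
    ++⁺ (map⁺ (λ { refl → refl }) Us-unique)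
     (map⁺ (λ { refl → refl }) (cartesianProduct⁺ Us-unique (cartesianProduct⁺ Us-unique (map⁺ toℕ-injective (grown-unique grown)))))
     (λ (p , q) → disjoint p q)
    where
    clash : ∀ {z : ⟦ υ ⟧} → z ∈ map (λ x → vertex x) Us ++ map (λ t → inj₂ (inj₂ t)) privates → z ≢ centre
    clash p refl with ∈-++⁻ (map (λ x → vertex x) Us) p
    ... | inj₁ q with () ← proj₂ (proj₂ (∈-map⁻ _ q))
    ... | inj₂ q with () ← proj₂ (proj₂ (∈-map⁻ _ q))
    disjoint : ∀ {z : ⟦ υ ⟧} → z ∈ map (λ x → vertex x) Us → z ∈ map (λ t → inj₂ (inj₂ t)) privates → ⊥
    disjoint p q with _ , _ , refl ← ∈-map⁻ _ p with () ← proj₂ (proj₂ (∈-map⁻ _ q))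

   vertex∈ : ∀ {x} → x ∈ Us → vertex x ∈ Ys
   vertex∈ x∈ = there (∈-++⁺ˡ (∈-map⁺ _ x∈))

   private∈ : ∀ {x y κ} → x ∈ Us → y ∈ Us → κ ∈ K → private′ x y (toℕ κ) ∈ Ys
   private∈ x∈ y∈ κ∈ = there (∈-++⁺ʳ _ (∈-map⁺ _ (∈-cartesianProduct⁺ x∈ (∈-cartesianProduct⁺ y∈ (∈-map⁺ _ κ∈)))))

   vertex∈⁻ : ∀ {x} → vertex x ∈ Ys → x ∈ Us
   vertex∈⁻ (there m) with ∈-++⁻ (map (λ x → vertex x) Us) m
   ... | inj₁ q with _ , x∈ , refl ← ∈-map⁻ _ q = x∈
   ... | inj₂ q with () ← proj₂ (proj₂ (∈-map⁻ _ q))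

   private∈⁻ : ∀ {x y k} → private′ x y k ∈ Ys → x ∈ Us × y ∈ Us × ∃[ κ ] κ ∈ K × k ≡ toℕ κ
   private∈⁻ (there m) with ∈-++⁻ (map (λ x → vertex x) Us) m
   ... | inj₁ q with () ← proj₂ (proj₂ (∈-map⁻ _ q))
   ... | inj₂ q with _ , t∈ , refl ← ∈-map⁻ _ q
    with x∈ , t∈′ ← ∈-cartesianProduct⁻ Us _ t∈
    with y∈ , k∈ ← ∈-cartesianProduct⁻ Us _ t∈′ = x∈ , y∈ , ∈-map⁻ _ k∈

   place∈ : ∀ {x y} → x ∈ Us → y ∈ Us → ∀ u → place x y u ∈ Ys
   place∈ x∈ y∈ u with cover u
   ... | inj₁ (here _) = vertex∈ x∈
   ... | inj₁ (there (here _)) = here refl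
   ... | inj₁ (there (there (here _))) = vertex∈ y∈
   ... | inj₂ κ∈ = private∈ x∈ y∈ κ∈

   module _ (F : EdgeSet (length Ys)) (F⊆ : F ⊆ₑ edges listGraph) (free : ¬ ContainsInduced R (listGraph − F)) where

    private
     -- Each deleted edge is charged to one vertex of Q: an edge at a new vertex to the tail of its
     -- arc, any other edge to an end in Q.
     pick : ⟦ υ ⟧ → ⟦ υ ⟧ → List X
     pick (private′ x _ _) _ = [ x ]
     pick _ (private′ x _ _) = [ x ]
     pick (vertex x) _ = [ x ]
     pick _ (vertex x) = [ x ]
     pick centre centre = []

     pick-length : ∀ y z → length (pick y z) ≤ 1
     pick-length centre centre = z≤n
     pick-length centre (vertex _) = ≤-refl
     pick-length centre (private′ _ _ _) = ≤-refl
     pick-length (vertex _) centre = ≤-refl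
     pick-length (vertex _) (vertex _) = ≤-refl
     pick-length (vertex _) (private′ _ _ _) = ≤-refl
     pick-length (private′ _ _ _) _ = ≤-refl

     pick-place : ∀ {x y} u w → T (adj (place x y u) (place x y w)) →
      x ∈ pick (place x y u) (place x y w) ⊎ y ∈ pick (place x y u) (place x y w)
     pick-place u w t with cover u | cover w
     ... | inj₁ (here _) | inj₁ (here _) = inj₁ (here refl)
     ... | inj₁ (here _) | inj₁ (there (here _)) = inj₁ (here refl)
     ... | inj₁ (here _) | inj₁ (there (there (here _))) = inj₁ (here refl)
     ... | inj₁ (here _) | inj₂ _ = inj₁ (here refl)
     ... | inj₁ (there (here _)) | inj₁ (here _) = inj₁ (here refl)
     ... | inj₁ (there (here _)) | inj₁ (there (here _)) = ⊥-elim t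
     ... | inj₁ (there (here _)) | inj₁ (there (there (here _))) = inj₂ (here refl)
     ... | inj₁ (there (here _)) | inj₂ _ = inj₁ (here refl)
     ... | inj₁ (there (there (here _))) | inj₁ (here _) = inj₂ (here refl)
     ... | inj₁ (there (there (here _))) | inj₁ (there (here _)) = inj₂ (here refl)
     ... | inj₁ (there (there (here _))) | inj₁ (there (there (here _))) = inj₂ (here refl)
     ... | inj₁ (there (there (here _))) | inj₂ _ = inj₁ (here refl)
     ... | inj₂ _ | _ = inj₁ (here refl)

     pickPair : Fin (length Ys) × Fin (length Ys) → List X
     pickPair (i , j) = pick (lookup Ys i) (lookup Ys j)

    deleted : List X
    deleted = concatMap pickPair (edgePairs F)

    deleted-length : length deleted ≤ ∣ F ∣ₑ
    deleted-length = concatMap-length≤ pickPair (λ (i , j) → pick-length (lookup Ys i) (lookup Ys j)) (edgePairs F)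

    -- If neither end of an arc is charged, no edge of its copy was deleted, and the copy survives
    -- as an induced R.
    deleted-covers : IsCover Us arc deleted
    deleted-covers {x} {y} x∈ y∈ xy with Any.any? (dec τ x) deleted | Any.any? (dec τ y) deleted
    ... | yes p | _ = inj₁ p
    ... | no _ | yes q = inj₂ q
    ... | no ¬p | no ¬q = ⊥-elim (free (embedding⇒contains R (listGraph − F) (f , f-inj , adj-eq)))
     where
     f : V → Fin (length Ys)
     f u = index (place∈ x∈ y∈ u)
     at-f : ∀ u → place x y u ≡ lookup Ys (f u)
     at-f u = lookup-index (place∈ x∈ y∈ u)
     f-inj : ∀ {u w} → f u ≡ f w → u ≡ w
     f-inj {u} {w} eq = place-injective (arc⇒≢ xy) (trans (at-f u) (trans (cong (lookup Ys) eq) (sym (at-f w))))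
     -- `edgePairs` lists an edge only with the smaller index first; the other order follows by
     -- symmetry.
     untouched< : ∀ u w → toℕ (f u) < toℕ (f w) → ¬ T (has F (f u) (f w))
     untouched< u w lt e = [ (λ m → ¬p (in-deleted m)) , (λ m → ¬q (in-deleted m)) ]′
      (pick-place u w (subst₂ (λ s t → T (adj s t)) (sym (at-f u)) (sym (at-f w)) (F⊆ (f u) (f w) e)))
      where
      in-deleted : ∀ {z} → z ∈ pick (place x y u) (place x y w) → z ∈ deleted
      in-deleted m = ∈-concatMap pickPair {x = f u , f w} (∈-edgePairs F lt e) (subst₂ (λ s t → _ ∈ pick s t) (at-f u) (at-f w) m)
     untouched : ∀ u w → ¬ T (has F (f u) (f w))
     untouched u w e with <-cmp (toℕ (f u)) (toℕ (f w))
     ... | tri< lt _ _ = untouched< u w lt e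
     ... | tri≈ _ eq _ with f u | toℕ-injective {i = f u} {f w} eq
     ... | _ | refl = subst T (EdgeSet.irrefl F (f w)) e
     untouched u w e | tri> _ _ gt = untouched< w u gt (subst T (EdgeSet.sym F (f u) (f w)) e)
     adj-eq : ∀ u w → has (edges R) u w ≡ has (edges (listGraph − F)) (f u) (f w)
     adj-eq u w rewrite ¬T-false (untouched u w) | sym (at-f u) | sym (at-f w) =
      trans (sym (place-adj xy u w)) (sym (∧-true (adj (place x y u) (place x y w))))
      where
      ∧-true : ∀ b → b ∧ true ≡ b
      ∧-true false = refl
      ∧-true true = refl

   deletion⇒cover : ∀ {k} → Problem.Yes (R -freeEdgeDeletion) (listGraph , k) → HasCover Us arc k
   deletion⇒cover (F , F⊆ , le , free) = deleted F F⊆ free , ≤-trans (deleted-length F F⊆ free) le , deleted-covers F F⊆ free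

-- Deleting the spokes of a cover leaves no induced copy

module NoInducedCopy where

 open import Data.Bool using (T)
 open import Data.Fin using (toℕ; _≟_)
 open import Data.List using (lookup)
 open import Data.List.Membership.Propositional.Properties
 open import Data.List.Relation.Unary.Any using (index)
 import Data.List.Relation.Unary.Any as Any
 import Data.List.Relation.Unary.All as All
 open import Relation.Nullary using (yes; no)
 open import Relation.Nullary.Decidable using (¬?; decidable-stable)
 open Programs using (Ty; ⟦_⟧)
 open PolynomialTime using (eqᵇ)
 open RegularGraphs
 open GluedCopies

 open Graph

 module Converse (R : Graph) (conn : Connected R) (r : ℕ) (reg : ∀ u → degree R u ≡ r) (2≤r : 2 ≤ r)
  (co : Core.Complement R conn r reg 2≤r)
  (τ : Ty) (arc : ⟦ τ ⟧ → ⟦ τ ⟧ → Bool) (arc-asym : ∀ {x y} → T (arc x y) → ¬ T (arc y x))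
  (Us : List ⟦ τ ⟧) (Us-unique : Unique Us) where

  open Core R conn r reg 2≤r
  open Complement co
  open Split split
  open Triple triple
  open Tables R
  open Gluing R conn r reg 2≤r co τ arc arc-asym
  open Instance′ Us Us-unique

  module _ (no-triangle : ∀ {x y z} → T (qadj x y) → T (qadj x z) → T (qadj y z) → ⊥)
   (C : List X) (covers : IsCover Us arc C) where

   inF : ⟦ υ ⟧ → ⟦ υ ⟧ → Bool
   inF centre (vertex x) = mem τ x C
   inF (vertex x) centre = mem τ x C
   inF _ _ = false

   inF-sym : ∀ y z → inF y z ≡ inF z y
   inF-sym centre centre = refl
   inF-sym centre (vertex x) = refl
   inF-sym centre (private′ x y k) = refl
   inF-sym (vertex x) centre = refl
   inF-sym (vertex x) (vertex y) = refl
   inF-sym (vertex x) (private′ _ _ _) = refl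
   inF-sym (private′ _ _ _) centre = refl
   inF-sym (private′ _ _ _) (vertex x) = refl
   inF-sym (private′ _ _ _) (private′ _ _ _) = refl

   inF-irrefl : ∀ y → inF y y ≡ false
   inF-irrefl centre = refl
   inF-irrefl (vertex x) = refl
   inF-irrefl (private′ _ _ _) = refl

   inF⊆adj : ∀ y z → T (inF y z) → T (adj y z)
   inF⊆adj centre (vertex x) _ = tt
   inF⊆adj (vertex x) centre _ = tt

   F : EdgeSet (length Ys)
   F = record { has = λ i j → inF (lookup Ys i) (lookup Ys j) ; sym = λ i j → inF-sym (lookup Ys i) (lookup Ys j) ; irrefl = λ i → inF-irrefl (lookup Ys i) }

   private
    -- C may contain elements outside `Us`; these contribute no edge. The centre comes first in `Ys`
    -- and therefore has index zero.
    spoke : X → List (Fin (length Ys) × Fin (length Ys))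
    spoke x with Any.any? (dec υ (vertex x)) Ys
    ... | yes p = [ zero , index p ]
    ... | no _ = []

    spoke-length : ∀ x → length (spoke x) ≤ 1
    spoke-length x with Any.any? (dec υ (vertex x)) Ys
    ... | yes _ = ≤-refl
    ... | no _ = z≤n

    spoke∈ : ∀ {j x} → lookup Ys j ≡ vertex x → (zero , j) ∈ spoke x
    spoke∈ {j} {x} eq with Any.any? (dec υ (vertex x)) Ys
    ... | yes p = here (cong (zero ,_) (lookup-injective Ys-unique j (index p) (trans eq (lookup-index p))))
    ... | no ¬p = ⊥-elim (¬p (subst (_∈ Ys) eq (∈-lookup j)))

    first : ∀ {i} → lookup Ys i ≡ centre → i ≡ zero
    first {i} eq = lookup-injective Ys-unique i zero eq

   F-size : ∣ F ∣ₑ ≤ length C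
   F-size = ≤-trans (unique-⊆-length {xs = edgePairs F} (edgePairs-unique F) sub)
    (concatMap-length≤ spoke spoke-length C)
    where
    sub′ : ∀ i j → toℕ i < toℕ j → T (inF (lookup Ys i) (lookup Ys j)) → (i , j) ∈ concatMap spoke C
    sub′ i j lt e with lookup Ys i in eqi | lookup Ys j in eqj
    ... | centre | vertex x with refl ← first {i} eqi = ∈-concatMap spoke (mem⁻ τ x C e) (spoke∈ eqj)
    ... | vertex x | centre with refl ← first {j} eqj with () ← lt
    sub : edgePairs F ⊆ concatMap spoke C
    sub {i , j} m with lt , e ← edgePairs⁻ F m = sub′ i j lt e

   a′ : ⟦ υ ⟧ → ⟦ υ ⟧ → Bool
   a′ y z = adj y z ∧ not (inF y z)

   by-role : (Q : V → Set) → Q a → Q p → Q b → (∀ {κ} → κ ∈ K → Q κ) → ∀ v → Q v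
   by-role Q qa qp qb qK v with cover v
   ... | inj₁ (here refl) = qa
   ... | inj₁ (there (here refl)) = qp
   ... | inj₁ (there (there (here refl))) = qb
   ... | inj₂ κ∈ = qK κ∈

   -- For the case r = 2: there a and b cannot be adjacent, hence Q spans no edges in the graph, and
   -- no vertex of Q can replace the centre.
   a~b⇒3≤r : a ~ b → ∀ {κ} → κ ∈ K → a ~ κ → 3 ≤ r
   a~b⇒3≤r ab {κ} κ∈ aκ = degree-≥ a (p ∷ b ∷ κ ∷ []) (three p≢b (λ { refl → p∉ κ∈ }) (λ { refl → b∉ κ∈ }))
    (λ { (here refl) → ~-sym pa ; (there (here refl)) → ab ; (there (there (here refl))) → aκ })

   private
    -- If an end of the path has no neighbour in K then r = 2 and R is the triangle on a, p, b.
    end : ∀ {a b} → p ~ a → p ~ b → a ≢ b → (∀ v → v ∈ a ∷ p ∷ b ∷ [] ⊎ v ∈ K) →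
     (∀ {z} → z ∈ a ∷ p ∷ b ∷ [] → z ∉ K) → ∀ {κ} → κ ∈ K → ∃[ κ′ ] κ′ ∈ K × a ~ κ′
    end {a} {b} pa pb a≢b cover outside {κ₀} κ₀∈ with Any.any? (λ v → v ∈? N a) K
    ... | yes q with κ , κ∈ , aκ ← find q = κ , κ∈ , ∈-N⁻ aκ
    ... | no ¬q = ⊥-elim (contra (crossing (conn a κ₀) (here refl) (λ m → outside m κ₀∈)))
     where
     r≤2 : r ≤ 2
     r≤2 = degree-≤ a (p ∷ b ∷ []) sub
      where
      sub : ∀ {v} → a ~ v → v ∈ p ∷ b ∷ []
      sub {v} av with cover v
      ... | inj₁ (here refl) = ⊥-elim (~-irrefl av refl)
      ... | inj₁ (there m) = m
      ... | inj₂ v∈K = ⊥-elim (¬q (lose v∈K (∈-N⁺ av)))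
     ab : a ~ b
     ab with b ∈? N a
     ... | yes m = ∈-N⁻ m
     ... | no ¬m = ⊥-elim (1+n≰n (≤-trans 2≤r (degree-≤ a [ p ] sub)))
      where
      sub : ∀ {v} → a ~ v → v ∈ [ p ]
      sub {v} av with cover v
      ... | inj₁ (here refl) = ⊥-elim (~-irrefl av refl)
      ... | inj₁ (there (here e)) = here e
      ... | inj₁ (there (there (here refl))) = ⊥-elim (¬m (∈-N⁺ av))
      ... | inj₂ v∈K = ⊥-elim (¬q (lose v∈K (∈-N⁺ av)))
     full : ∀ {z x y} → z ∈ a ∷ p ∷ b ∷ [] → z ~ x → z ~ y → x ≢ y → x ∉ K → y ∉ K → ∀ {k} → k ∈ K → ¬ z ~ k
     full {z} {x} {y} z∈ zx zy x≢y x∉ y∉ {k} k∈ zk = 1+n≰n (≤-trans (degree-≥ z (x ∷ y ∷ k ∷ [])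
      (three x≢y (λ { refl → x∉ k∈ }) (λ { refl → y∉ k∈ }))
      (λ { (here refl) → zx ; (there (here refl)) → zy ; (there (there (here refl))) → zk })) r≤2)
     a∉′ = outside (here refl)
     p∉′ = outside (there (here refl))
     b∉′ = outside (there (there (here refl)))
     contra : (∃[ κ ] ∃[ z ] κ ∈ a ∷ p ∷ b ∷ [] × z ∉ a ∷ p ∷ b ∷ [] × κ ~ z) → ⊥
     contra (k , z , k∈ , z∉ , kz) with cover z
     ... | inj₁ z∈ = z∉ z∈
     ... | inj₂ z∈K with k∈
     ... | here refl = full k∈ (~-sym pa) ab (~-irrefl pb) p∉′ b∉′ z∈K kz
     ... | there (here refl) = full k∈ pa pb a≢b a∉′ b∉′ z∈K kz
     ... | there (there (here refl)) = full k∈ (~-sym pb) (~-sym ab) (~-irrefl pa) p∉′ a∉′ z∈K kz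

   a-end : ∀ {κ} → κ ∈ K → ∃[ κ′ ] κ′ ∈ K × a ~ κ′
   a-end = end pa pb a≢b cover outside

   b-end : ∀ {κ} → κ ∈ K → ∃[ κ′ ] κ′ ∈ K × b ~ κ′
   b-end = end pb pa (≢-sym a≢b) (λ v → [ (λ m → inj₁ (turn m)) , inj₂ ]′ (cover v)) (λ m → outside (turn′ m))
    where
    turn : ∀ {v} → v ∈ a ∷ p ∷ b ∷ [] → v ∈ b ∷ p ∷ a ∷ []
    turn (here e) = there (there (here e))
    turn (there (here e)) = there (here e)
    turn (there (there (here e))) = here e
    turn′ : ∀ {v} → v ∈ b ∷ p ∷ a ∷ [] → v ∈ a ∷ p ∷ b ∷ []
    turn′ (here e) = there (there (here e))
    turn′ (there (here e)) = there (here e)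
    turn′ (there (there (here e))) = here e

   -- f is a hypothetical induced copy that survives the deletion. Its image contains no new vertex
   -- (`Private`), so it lies in the centre and Q. There a vertex of Q has too small a degree if a
   -- and b are not adjacent, and otherwise the triangle a, p, b has no image.
   module Refute (f : V → ⟦ υ ⟧) (f-inj : ∀ {u w} → f u ≡ f w → u ≡ w) (f∈ : ∀ u → f u ∈ Ys)
    (f-adj : ∀ u w → has (edges R) u w ≡ a′ (f u) (f w)) where

    adj⁺ : ∀ {u w} → u ~ w → T (adj (f u) (f w)) × ¬ T (inF (f u) (f w))
    adj⁺ {u} {w} e with t ← subst T (f-adj u w) e = T-∧₁ t , T-not (T-∧₂ (adj (f u) (f w)) t)

    private
     cover-C : ∀ {x y} → vertex x ∈ Ys → vertex y ∈ Ys → T (qadj x y) → x ∈ C ⊎ y ∈ C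
     cover-C {x} {y} x∈ y∈ q with Equivalence.to (T-∨ {arc x y}) q
     ... | inj₁ xy = covers (vertex∈⁻ x∈) (vertex∈⁻ y∈) xy
     ... | inj₂ yx = [ inj₂ , inj₁ ]′ (covers (vertex∈⁻ y∈) (vertex∈⁻ x∈) yx)

     fN : V → List ⟦ υ ⟧
     fN u = map f (N u)

     fN-unique : ∀ u → Unique (fN u)
     fN-unique u = map⁺ f-inj (N-unique u)

     fN-length : ∀ u → length (fN u) ≡ r
     fN-length u = trans (length-map f (N u)) (reg u)

     allV : List V
     allV = allFin (order R)

     f-image : List ⟦ υ ⟧
     f-image = map f allV

     f-image-length : length f-image ≡ length allV
     f-image-length = length-map f allV

    -- A new vertex of an arc has exactly r neighbours in the whole graph, all within its copy. An
    -- image that contains it must contain these neighbours as well, and this spreads through K to a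
    -- and b.
    module Private {x y κ₀ u₀} (κ₀∈ : κ₀ ∈ K) (eq₀ : f u₀ ≡ private′ x y (toℕ κ₀)) (x∈ : x ∈ Us) (y∈ : y ∈ Us) where

     xy : T (arc x y)
     xy with w , _ , _ , eqN ← first-two (N u₀) (≤-trans 2≤r (≤-reflexive (sym (reg u₀))))
      with uw ← ∈-N⁻ {u₀} {w} (subst (w ∈_) (sym eqN) (here refl))
      with t ← proj₁ (adj⁺ uw) rewrite eq₀ with f w
     ... | centre = T-∧₁ t
     ... | vertex z = T-∧₁ t
     ... | private′ x′ y′ k = T-∧₁ (T-∧₂ (eqᵇ τ x x′ ∧ eqᵇ τ y y′) t)

     P : V → ⟦ υ ⟧
     P = place x y

     P-inj : ∀ {u w} → P u ≡ P w → u ≡ w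
     P-inj = place-injective (arc⇒≢ xy)

     Im : V → Set
     Im w = ∃[ u ] f u ≡ P w

     inner : ∀ {κ} t → κ ∈ K → t ∈ Ys → T (adj (private′ x y (toℕ κ)) t) → ∃[ w ] t ≡ P w × κ ~ w
     inner centre κ∈ _ t = p , sym (place-p x y) , ~-sym (hasN⁻ (T-∧₂ (arc x y) t))
     inner {κ} (vertex z) κ∈ _ t with Equivalence.to (T-∨ {eqᵇ τ z x ∧ hasN (toℕ a) (toℕ κ)}) (T-∧₂ (arc x y) t)
     ... | inj₁ h with refl ← T-eq {τ} {z} {x} (T-∧₁ h) = a , sym (place-a x y) , ~-sym (hasN⁻ (T-∧₂ (eqᵇ τ z x) h))
     ... | inj₂ h with refl ← T-eq {τ} {z} {y} (T-∧₁ h) = b , sym (place-b x y) , ~-sym (hasN⁻ (T-∧₂ (eqᵇ τ z y) h))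
     inner {κ} (private′ x′ y′ k′) κ∈ m t
      with e , h ← Equivalence.to (T-∧ {eqᵇ τ x x′ ∧ eqᵇ τ y y′}) t
      with ex , ey ← Equivalence.to (T-∧ {eqᵇ τ x x′}) e
      with refl ← T-eq {τ} {x} {x′} ex | refl ← T-eq {τ} {y} {y′} ey
      with _ , _ , κ′ , κ′∈ , refl ← private∈⁻ m = κ′ , sym (place-K x y κ′∈) , hasN⁻ (T-∧₂ (arc x y) h)

     copy-nbrs : ∀ {κ u} → κ ∈ K → f u ≡ P κ → fN u ⊆ map P (N κ)
     copy-nbrs {κ} κ∈ eq m with w′ , w′∈ , refl ← ∈-map⁻ f m
      with t ← proj₁ (adj⁺ (∈-N⁻ w′∈)) rewrite trans eq (place-K x y κ∈)
      with w″ , e , κw″ ← inner (f w′) κ∈ (f∈ w′) t = subst (_∈ map P (N κ)) (sym e) (∈-map⁺ P (∈-N⁺ κw″))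

     spread-out : ∀ {κ w} → κ ∈ K → Im κ → κ ~ w → Im w
     spread-out {κ} {w} κ∈ (u , eq) κw
      with u′ , _ , e ← ∈-map⁻ f (unique-⊆-⊇ (dec υ) {fN u} {map P (N κ)} (fN-unique u) (copy-nbrs κ∈ eq)
       (≤-reflexive (trans (length-map P (N κ)) (trans (reg κ) (sym (fN-length u))))) (∈-map⁺ P (∈-N⁺ κw))) = u′ , sym e

     Im-K : ∀ {κ} → κ ∈ K → Im κ
     Im-K = grown-closed grown Im (λ u∈ _ uv im → spread-out u∈ im uv) κ₀∈ (u₀ , trans eq₀ (sym (place-K x y κ₀∈)))

     Im-a : Im a
     Im-a with κ , κ∈ , aκ ← a-end κ₀∈ = spread-out κ∈ (Im-K κ∈) (~-sym aκ)

     Im-b : Im b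
     Im-b with κ , κ∈ , bκ ← b-end κ₀∈ = spread-out κ∈ (Im-K κ∈) (~-sym bκ)

     _∈υ?_ : ∀ (t : ⟦ υ ⟧) L → Dec (t ∈ L)
     t ∈υ? L = Any.any? (dec υ t) L

     -- u has r neighbours, but z has only one fewer besides p, so some neighbour of u is mapped
     -- elsewhere; by `not-in-copy` it goes to the centre or out of the copy.
     escape : ∀ {z u} (zp : z ~ p) → f u ≡ P z → ∃[ w ] u ~ w × f w ∉ map P (remove (∈-N⁺ zp))
     escape {z} {u} zp eq with Any.any? (λ w → ¬? (f w ∈υ? map P (remove (∈-N⁺ zp)))) (N u)
     ... | yes q with w , w∈ , w∉ ← find q = w , ∈-N⁻ w∈ , w∉
     ... | no ¬q = ⊥-elim (1+n≰n (≤-trans (≤-reflexive (trans (length-remove (∈-N⁺ zp)) (trans (reg z) (sym (fN-length u)))))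
      (≤-trans (unique-⊆-length (fN-unique u) sub) (≤-reflexive (length-map P (remove (∈-N⁺ zp)))))))
      where
      sub : fN u ⊆ map P (remove (∈-N⁺ zp))
      sub m with w , w∈ , refl ← ∈-map⁻ f m with f w ∈υ? map P (remove (∈-N⁺ zp))
      ... | yes h = h
      ... | no ¬h = ⊥-elim (¬q (lose w∈ ¬h))

     not-in-copy : ∀ {z u w} (zp : z ~ p) → f u ≡ P z → u ~ w → f w ∉ map P (remove (∈-N⁺ zp)) → ∀ v → v ≢ p → f w ≢ P v
     not-in-copy {z} {u} {w} zp eq uw w∉ v v≢p e =
      w∉ (subst (_∈ _) (sym e) (∈-map⁺ P (∈-remove (∈-N⁺ zp) (∈-N⁺ zv) (≢-sym v≢p))))
      where
      zv : z ~ v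
      zv = subst T (place-adj xy z v) (subst₂ (λ s t → T (adj s t)) eq e (proj₁ (adj⁺ uw)))

     -- The image of f is the whole copy, but a spoke of the copy has been deleted.
     whole : (∀ w → Im w) → ⊥
     whole im = [ short (~-sym pa) (place-a x y) , short (~-sym pb) (place-b x y) ]′ (covers x∈ y∈ xy)
      where
      P⊆f : map P allV ⊆ f-image
      P⊆f m = let v , _ , e = ∈-map⁻ P m ; u′ , e′ = im v in subst (_∈ f-image) (trans e′ (sym e)) (∈-map⁺ f (∈-allFin u′))
      f⊆P : f-image ⊆ map P allV
      f⊆P = unique-⊆-⊇ (dec υ) (map⁺ P-inj (allFin⁺ (order R))) P⊆f (≤-reflexive (trans f-image-length (sym (length-map P allV))))
      short : ∀ {z ξ} → z ~ p → P z ≡ vertex ξ → ξ ∈ C → ⊥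
      short {z} {ξ} zp Pz ξ∈ with u , eq ← im z with w , uw , w∉ ← escape zp eq
       with v , _ , e ← ∈-map⁻ P (f⊆P (∈-map⁺ f (∈-allFin w)))
       with v ≟ p
      ... | no v≢p = not-in-copy zp eq uw w∉ v v≢p e
      ... | yes refl = proj₂ (adj⁺ uw) (subst₂ (λ s t → T (inF s t)) (sym (trans eq Pz)) (sym (trans e (place-p x y))) (mem⁺ τ ξ∈))

     -- R is a cycle: the image of f contains the copy without the centre and one more vertex, adjacent to both ends.
     one-extra : p ∈ allV → ∀ {w w′} → (∀ v → v ≢ p → f w ≢ P v) → (∀ v → v ≢ p → f w′ ≢ P v) → f w ≢ f w′ → ⊥
     one-extra p∈ {w} {w′} hw hw′ ne =
      1+n≰n (≤-trans (≤-trans (≤-reflexive (cong suc (trans (sym (length-remove p∈)) (cong suc (sym (length-map P Vp))))))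
       (unique-⊆-length uniq sub)) (≤-reflexive f-image-length))
      where
      Vp : List V
      Vp = remove p∈
      out : ∀ {z} → (∀ v → v ≢ p → z ≢ P v) → All (z ≢_) (map P Vp)
      out h = All.tabulate λ m e → let v , v∈ , e′ = ∈-map⁻ P m in
       h v (λ e → ∉-remove p∈ (allFin⁺ (order R)) (subst (_∈ Vp) e v∈)) (trans e e′)
      uniq : Unique (f w ∷ f w′ ∷ map P Vp)
      uniq = (ne ∷ out hw) ∷ out hw′ ∷ map⁺ P-inj (unique-remove p∈ (allFin⁺ (order R)))
      hit : ∀ v → v ≢ p → Im v
      hit = by-role (λ v → v ≢ p → Im v) (λ _ → Im-a) (λ ne → ⊥-elim (ne refl)) (λ _ → Im-b) (λ κ∈ _ → Im-K κ∈)
      sub : f w ∷ f w′ ∷ map P Vp ⊆ f-image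
      sub (here refl) = ∈-map⁺ f (∈-allFin w)
      sub (there (here refl)) = ∈-map⁺ f (∈-allFin w′)
      sub (there (there m)) = let v , v∈ , e′ = ∈-map⁻ P m ; u , e = hit v (λ e → ∉-remove p∈ (allFin⁺ (order R)) (subst (_∈ Vp) e v∈))
       in subst (_∈ f-image) (trans e (sym e′)) (∈-map⁺ f (∈-allFin u))

     -- Here r = 2, and one vertex that is not in the copy without its centre is adjacent to both x
     -- and y. It is not the centre, because the spoke to x or y was deleted; not a vertex of Q,
     -- because this would give a the degree 3; and not a new vertex, because that would belong to
     -- this very copy or to the reversed arc.
     partial : (∀ {κ} → κ ∈ K → ¬ p ~ κ) → ∀ {ua ub w w′} → f ua ≡ P a → f ub ≡ P b → ua ~ w → ub ~ w′ →
      (∀ v → v ≢ p → f w ≢ P v) → f w ≡ f w′ → ⊥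
     partial p≁K {ua} {ub} {w} {w′} eqa eqb uw uw′ out same = finish (f w) refl (f∈ w) (proj₁ ta) (proj₂ ta) (proj₁ tb) (proj₂ tb)
      where
      ta : T (adj (vertex x) (f w)) × ¬ T (inF (vertex x) (f w))
      ta with h ← adj⁺ uw rewrite trans eqa (place-a x y) = h
      tb : T (adj (vertex y) (f w)) × ¬ T (inF (vertex y) (f w))
      tb with h ← adj⁺ uw′ rewrite trans eqb (place-b x y) | same = h
      r≤2 : r ≤ 2
      r≤2 = degree-≤ p (a ∷ b ∷ []) sub
       where
       sub : ∀ {v} → p ~ v → v ∈ a ∷ b ∷ []
       sub {v} pv with cover v
       ... | inj₁ (here e) = here e
       ... | inj₁ (there (here refl)) = ⊥-elim (~-irrefl pv refl)
       ... | inj₁ (there (there (here e))) = there (here e)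
       ... | inj₂ κ∈ = ⊥-elim (p≁K κ∈ pv)
      ends : ∀ {z x′ y′ k} → T (link z x′ y′ k) → T (arc x′ y′) × (z ≡ x′ ⊎ z ≡ y′)
      ends {z} {x′} {y′} {k} t with Equivalence.to (T-∨ {eqᵇ τ z x′ ∧ hasN (toℕ a) k}) (T-∧₂ (arc x′ y′) t)
      ... | inj₁ h = T-∧₁ t , inj₁ (T-eq (T-∧₁ h))
      ... | inj₂ h = T-∧₁ t , inj₂ (T-eq (T-∧₁ h))
      finish : ∀ t → f w ≡ t → t ∈ Ys → T (adj (vertex x) t) → ¬ T (inF (vertex x) t) → T (adj (vertex y) t) → ¬ T (inF (vertex y) t) → ⊥
      finish centre _ _ _ nx _ ny = [ (λ h → nx (mem⁺ τ h)) , (λ h → ny (mem⁺ τ h)) ]′ (covers x∈ y∈ xy)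
      finish (vertex z) _ _ tx _ _ _ with κ , κ∈ , aκ ← a-end κ₀∈ =
       1+n≰n (≤-trans (a~b⇒3≤r (hasN⁻ (T-∧₂ (qadj x z) tx)) κ∈ aκ) r≤2)
      finish (private′ x′ y′ k′) e m tx _ ty _
       with x′y′ , ex ← ends {x} {x′} {y′} {k′} tx | _ , ey ← ends {y} {x′} {y′} {k′} ty
       with _ , _ , κ′ , κ′∈ , refl ← private∈⁻ m with ex | ey
      ... | inj₁ refl | inj₁ refl = arc-irrefl xy
      ... | inj₁ refl | inj₂ refl = out κ′ (λ { refl → p∉ κ′∈ }) (trans e (sym (place-K x y κ′∈)))
      ... | inj₂ refl | inj₁ refl = arc-asym xy x′y′
      ... | inj₂ refl | inj₂ refl = arc-irrefl xy

     absurd : ⊥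
     absurd with Any.any? (λ κ → κ ∈? N p) K
     ... | no ¬q =
      let ua , eqa = Im-a ; ub , eqb = Im-b
          w , uw , w∉ = escape (~-sym pa) eqa ; w′ , uw′ , w′∉ = escape (~-sym pb) eqb
          out = not-in-copy (~-sym pa) eqa uw w∉
      in partial (λ κ∈ pκ → ¬q (lose κ∈ (∈-N⁺ pκ))) eqa eqb uw uw′ out
       -- Two different extra vertices would be too many for the order of R, so both ends escape to
       -- the same vertex.
       (decidable-stable (dec υ (f w) (f w′)) (one-extra (∈-allFin p) out (not-in-copy (~-sym pb) eqb uw′ w′∉)))
     ... | yes q with κ , κ∈ , pκ ← find q =
      whole (by-role Im Im-a (spread-out κ∈ (Im-K κ∈) (~-sym (∈-N⁻ pκ))) Im-b Im-K)

    no-private : ∀ {u x y k} → f u ≢ private′ x y k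
    no-private {u} eq with x∈ , y∈ , κ , κ∈ , refl ← private∈⁻ (subst (_∈ Ys) eq (f∈ u)) = Private.absurd κ∈ eq x∈ y∈

    shape : ∀ u → f u ≡ centre ⊎ ∃[ x ] f u ≡ vertex x
    shape u with f u in eq
    ... | centre = inj₁ refl
    ... | vertex x = inj₂ (x , refl)
    ... | private′ _ _ _ = ⊥-elim (no-private eq)

    vertices-adjacent : ∀ {u w x y} → f u ≡ vertex x → f w ≡ vertex y → u ~ w → T (qadj x y) × a ~ b
    vertices-adjacent {u} {w} {x} {y} eu ew uw with t ← proj₁ (adj⁺ uw) rewrite eu | ew = T-∧₁ t , hasN⁻ (T-∧₂ (qadj x y) t)

    centre-adjacent : ∀ {u w y} → f u ≡ centre → f w ≡ vertex y → u ~ w → y ∉ C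
    centre-adjacent eu ew uw y∈ with h ← proj₂ (adj⁺ uw) rewrite eu | ew = h (mem⁺ τ y∈)

    one-centre : ∀ {u w} → f u ≡ centre → f w ≡ centre → u ≢ w → ⊥
    one-centre eu ew u≢w = u≢w (f-inj (trans eu (sym ew)))

    in-Ys : ∀ {u x} → f u ≡ vertex x → vertex x ∈ Ys
    in-Ys {u} eq = subst (_∈ Ys) eq (f∈ u)

    spokes : ∀ {u v w x y} → f u ≡ centre → f v ≡ vertex x → f w ≡ vertex y → u ~ v → u ~ w → v ~ w → ⊥
    spokes eu ev ew uv uw vw = [ centre-adjacent eu ev uv , centre-adjacent eu ew uw ]′
     (cover-C (in-Ys ev) (in-Ys ew) (proj₁ (vertices-adjacent ev ew vw)))

    -- Two corners cannot both be the centre; a triangle through the centre would use the spokes to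
    -- both ends of an arc, one of which was deleted; a triangle inside Q is excluded.
    triangle : ∀ {u v w} → u ~ v → u ~ w → v ~ w → ⊥
    triangle {u} {v} {w} uv uw vw with shape u | shape v | shape w
    ... | inj₁ eu | inj₁ ev | _ = one-centre eu ev (~-irrefl uv)
    ... | inj₁ eu | inj₂ _ | inj₁ ew = one-centre eu ew (~-irrefl uw)
    ... | inj₂ _ | inj₁ ev | inj₁ ew = one-centre ev ew (~-irrefl vw)
    ... | inj₁ eu | inj₂ (_ , ev) | inj₂ (_ , ew) = spokes eu ev ew uv uw vw
    ... | inj₂ (_ , eu) | inj₁ ev | inj₂ (_ , ew) = spokes ev eu ew (~-sym uv) vw uw
    ... | inj₂ (_ , eu) | inj₂ (_ , ev) | inj₁ ew = spokes ew eu ev (~-sym uw) (~-sym vw) uv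
    ... | inj₂ (_ , eu) | inj₂ (_ , ev) | inj₂ (_ , ew) =
     no-triangle (proj₁ (vertices-adjacent eu ev uv)) (proj₁ (vertices-adjacent eu ew uw)) (proj₁ (vertices-adjacent ev ew vw))

    some : ∃[ u ] ∃[ x ] f u ≡ vertex x
    some with shape p | shape a
    ... | inj₂ (x , e) | _ = p , x , e
    ... | inj₁ _ | inj₂ (x , e) = a , x , e
    ... | inj₁ e | inj₁ e′ = ⊥-elim (one-centre e e′ p≢a)

    refute : ⊥
    refute with b ∈? N a
    -- If a and b are not adjacent, the vertices of Q are pairwise non-adjacent, so all of the at
    -- least two neighbours of u would have to be mapped to the centre.
    ... | no a≁b with u , x , eu ← some with w , w′ , _ , eq ← first-two (N u) (≤-trans 2≤r (≤-reflexive (sym (reg u))))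
     with (d ∷ _) ∷ _ ← subst Unique eq (N-unique u)
     with shape w | shape w′
    ... | inj₁ e | inj₁ e′ = one-centre e e′ d
    ... | inj₂ (_ , e) | _ = a≁b (∈-N⁺ (proj₂ (vertices-adjacent eu e (∈-N⁻ (subst (w ∈_) (sym eq) (here refl))))))
    ... | inj₁ _ | inj₂ (_ , e) = a≁b (∈-N⁺ (proj₂ (vertices-adjacent eu e (∈-N⁻ (subst (w′ ∈_) (sym eq) (there (here refl)))))))
    refute | yes ab = triangle pa pb (∈-N⁻ ab)

   free : ¬ ContainsInduced R (listGraph − F)
   free contains with f , f-inj , f-adj ← contains⇒embedding R (listGraph − F) contains =
    Refute.refute (λ u → lookup Ys (f u)) (λ e → f-inj (lookup-injective Ys-unique _ _ e)) (λ u → ∈-lookup (f u)) f-adj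

   cover⇒deletion : ∀ {k} → length C ≤ k → Problem.Yes (R -freeEdgeDeletion) (listGraph , k)
   cover⇒deletion le = F , (λ i j → inF⊆adj (lookup Ys i) (lookup Ys j)) , ≤-trans F-size le , free

-- Vertex cover: from formulas to oriented triangle-free graphs

module VertexCover where

 open import Data.Bool using (T)
 open import Data.List using (lookup)
 open import Data.List.Properties using (filter-++)
 open import Data.List.Membership.Propositional.Properties
 import Data.List.Relation.Unary.Any as Any
 import Data.List.Relation.Unary.All as All
 open import Data.List.Relation.Unary.AllPairs using (AllPairs)
 import Data.List.Relation.Unary.AllPairs as AllPairs
 import Data.List.Relation.Unary.AllPairs.Properties as AllPairsₚ
 open import Data.Nat.ListAction using (sum)
 open import Data.Nat.Properties
 open import Relation.Nullary using (yes; no)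
 open Programs using (Ty; 𝔹; nat; _⊗_; _⊕_; ⟦_⟧)
 open PolynomialTime using (eqᵇ)
 open RegularGraphs
 open GluedCopies

 concatMap-unique : ∀ {A B : Set} (g : A → List B) {xs} → Unique xs → (∀ {x} → x ∈ xs → Unique (g x)) →
  (∀ {x y v} → x ∈ xs → y ∈ xs → v ∈ g x → v ∈ g y → x ≡ y) → Unique (concatMap g xs)
 concatMap-unique g [] ug disj = []
 concatMap-unique g (d ∷ u) ug disj = ++⁺ (ug (here refl)) (concatMap-unique g u (ug ∘ there) (λ p q → disj (there p) (there q)))
  (λ (m , m′) → let y , y∈ , v∈ = find (∈-concatMap⁻ g m′) in All.lookup d y∈ (disj (here refl) (there y∈) m v∈))

 ∈-concatMap⁻′ : ∀ {A B : Set} (g : A → List B) xs {v} → v ∈ concatMap g xs → ∃[ x ] x ∈ xs × v ∈ g x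
 ∈-concatMap⁻′ g xs m = find (∈-concatMap⁻ g m)

 length-concatMap : ∀ {A B : Set} (g : A → List B) xs → length (concatMap g xs) ≡ sum (map (length ∘ g) xs)
 length-concatMap g [] = refl
 length-concatMap g (x ∷ xs) = trans (length-++ (g x)) (cong (length (g x) +_) (length-concatMap g xs))

 filter-concatMap : ∀ {A B : Set} (q : B → Bool) (g : A → List B) xs → filterᵇ q (concatMap g xs) ≡ concatMap (filterᵇ q ∘ g) xs
 filter-concatMap q g [] = refl
 filter-concatMap q g (x ∷ xs) = trans (filter-++ (T? ∘ q) (g x) (concatMap g xs)) (cong (filterᵇ q (g x) ++_) (filter-concatMap q g xs))

 filter-pair : ∀ {A : Set} (q : A → Bool) x y → T (q x) ⊎ T (q y) → length (filterᵇ q (x ∷ y ∷ [])) ≡ (if q x ∧ q y then 2 else 1)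
 filter-pair q x y t with q x
 filter-pair q x y t | true with q y
 ... | true = refl
 ... | false = refl
 filter-pair q x y (inj₂ t) | false with q y
 ... | true = refl

 filter-cons : ∀ {A : Set} (q : A → Bool) x xs → length (filterᵇ q (x ∷ xs)) ≡ (if q x then 1 else 0) + length (filterᵇ q xs)
 filter-cons q x xs with q x
 ... | true = refl
 ... | false = refl

 module _ {A : Set} (b h : A → ℕ) where

  sum-mono : ∀ xs → (∀ {x} → x ∈ xs → b x ≤ h x) → sum (map b xs) ≤ sum (map h xs)
  sum-mono [] le = z≤n
  sum-mono (x ∷ xs) le = +-mono-≤ (le (here refl)) (sum-mono xs (le ∘ there))

  -- Lower bounds whose sum already exhausts the budget are attained in every term; `cover⇒sat`
  -- obtains its exact counts from this.
  sum-tight : ∀ xs → (∀ {x} → x ∈ xs → b x ≤ h x) → sum (map h xs) ≤ sum (map b xs) → ∀ {x} → x ∈ xs → h x ≤ b x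
  sum-tight (x ∷ xs) le tot (here refl) = +-cancelʳ-≤ (sum (map h xs)) _ _ (≤-trans tot (+-monoʳ-≤ (b x) (sum-mono xs (le ∘ there))))
  sum-tight (x ∷ xs) le tot (there m) = sum-tight xs (le ∘ there)
   (+-cancelˡ-≤ (h x) _ _ (≤-trans tot (+-monoˡ-≤ _ (le (here refl))))) m

 -- Any two elements include one that satisfies q, so at most one fails; applied to the corners of a
 -- clause, which are pairwise joined.
 almost-all : ∀ {A : Set} (q : A → Bool) {xs} → AllPairs (λ u v → T (q u) ⊎ T (q v)) xs → length xs ≤ suc (length (filterᵇ q xs))
 almost-all q [] = z≤n
 almost-all q {x ∷ xs} (d ∷ ap) with q x
 ... | true = s≤s (almost-all q ap)
 ... | false = s≤s (≤-reflexive (sym (cong length (all-kept d))))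
  where
  all-kept : ∀ {ys} → All (λ v → T false ⊎ T (q v)) ys → filterᵇ q ys ≡ ys
  all-kept [] = refl
  all-kept {y ∷ _} (inj₂ t ∷ al) with q y
  ... | true = cong (_ ∷_) (all-kept al)

 some-missing : ∀ {A : Set} (q : A → Bool) xs → length (filterᵇ q xs) < length xs → ∃[ x ] x ∈ xs × ¬ T (q x)
 some-missing q (x ∷ xs) lt with T? (q x)
 ... | no ¬t = x , here refl , ¬t
 ... | yes t with q x
 ... | true = let y , y∈ , n = some-missing q xs (≤-pred lt) in y , there y∈ , n

 number : ∀ {A : Set} → ℕ → List A → List (ℕ × A)
 number k [] = []
 number k (x ∷ xs) = (k , x) ∷ number (suc k) xs

 module _ {A : Set} where

  number-≥ : ∀ k (xs : List A) {j x} → (j , x) ∈ number k xs → k ≤ j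
  number-≥ k (x ∷ xs) (here refl) = ≤-refl
  number-≥ k (x ∷ xs) (there m) = ≤-trans (n≤1+n k) (number-≥ (suc k) xs m)

  number-< : ∀ k (xs : List A) → AllPairs (λ p q → proj₁ p < proj₁ q) (number k xs)
  number-< k [] = []
  number-< k (x ∷ xs) = All.tabulate (λ m → number-≥ (suc k) xs m) ∷ number-< (suc k) xs

  number-unique : ∀ k (xs : List A) → Unique (number k xs)
  number-unique k xs = AllPairs.map (λ lt eq → <⇒≢ lt (cong proj₁ eq)) (number-< k xs)

  number-functional : ∀ k (xs : List A) {j x y} → (j , x) ∈ number k xs → (j , y) ∈ number k xs → x ≡ y
  number-functional k (x ∷ xs) (here refl) (here refl) = refl
  number-functional k (x ∷ xs) (here refl) (there m) = ⊥-elim (1+n≰n (number-≥ (suc k) xs m))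
  number-functional k (x ∷ xs) (there m) (here refl) = ⊥-elim (1+n≰n (number-≥ (suc k) xs m))
  number-functional k (x ∷ xs) (there m) (there m′) = number-functional (suc k) xs m m′

  number-∈ : ∀ k (xs : List A) {j x} → (j , x) ∈ number k xs → x ∈ xs
  number-∈ k (x ∷ xs) (here refl) = here refl
  number-∈ k (x ∷ xs) (there m) = there (number-∈ (suc k) xs m)

  ∈-number : ∀ k (xs : List A) {x} → x ∈ xs → ∃[ j ] (j , x) ∈ number k xs
  ∈-number k (x ∷ xs) (here refl) = k , here refl
  ∈-number k (x ∷ xs) (there m) = let j , p = ∈-number (suc k) xs m in j , there p

  length-number : ∀ k (xs : List A) → length (number k xs) ≡ length xs
  length-number k [] = refl
  length-number k (x ∷ xs) = cong suc (length-number (suc k) xs)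

 -- Every arc u → v is replaced by a path u → (u , v , false) → (u , v , true) → v, which removes all triangles.
 module Subdivision (τ₀ : Ty) (arc₀ : ⟦ τ₀ ⟧ → ⟦ τ₀ ⟧ → Bool) (arc₀-irrefl : ∀ {u} → ¬ T (arc₀ u u)) where

  τ₁ : Ty
  τ₁ = τ₀ ⊕ τ₀ ⊗ τ₀ ⊗ 𝔹

  arc₁ : ⟦ τ₁ ⟧ → ⟦ τ₁ ⟧ → Bool
  arc₁ (inj₁ u) (inj₁ v) = false
  arc₁ (inj₁ u) (inj₂ (u′ , v , b)) = not b ∧ eqᵇ τ₀ u u′ ∧ arc₀ u′ v
  arc₁ (inj₂ (u , v , b)) (inj₁ v′) = b ∧ eqᵇ τ₀ v v′ ∧ arc₀ u v
  arc₁ (inj₂ (u , v , b)) (inj₂ (u′ , v′ , b′)) = (not b ∧ b′) ∧ (eqᵇ τ₀ u u′ ∧ eqᵇ τ₀ v v′) ∧ arc₀ u v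

  data Arc : ⟦ τ₁ ⟧ → ⟦ τ₁ ⟧ → Set where
   enter : ∀ {u v} → T (arc₀ u v) → Arc (inj₁ u) (inj₂ (u , v , false))
   middle : ∀ {u v} → T (arc₀ u v) → Arc (inj₂ (u , v , false)) (inj₂ (u , v , true))
   leave : ∀ {u v} → T (arc₀ u v) → Arc (inj₂ (u , v , true)) (inj₁ v)

  arc₁⁻ : ∀ x y → T (arc₁ x y) → Arc x y
  arc₁⁻ (inj₁ u) (inj₂ (u′ , v , false)) t with refl ← T-eq {τ₀} {u} {u′} (T-∧₁ t) = enter (T-∧₂ (eqᵇ τ₀ u u′) t)
  arc₁⁻ (inj₂ (u , v , true)) (inj₁ v′) t with refl ← T-eq {τ₀} {v} {v′} (T-∧₁ t) = leave (T-∧₂ (eqᵇ τ₀ v v′) t)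
  arc₁⁻ (inj₂ (u , v , false)) (inj₂ (u′ , v′ , true)) t
   with e ← T-∧₁ {eqᵇ τ₀ u u′ ∧ eqᵇ τ₀ v v′} t
   with refl ← T-eq {τ₀} {u} {u′} (T-∧₁ e) | refl ← T-eq {τ₀} {v} {v′} (T-∧₂ (eqᵇ τ₀ u u′) e) = middle (T-∧₂ (eqᵇ τ₀ u u′ ∧ eqᵇ τ₀ v v′) t)

  arc₁⁺ : ∀ {x y} → Arc x y → T (arc₁ x y)
  arc₁⁺ (enter {u} t) = ∧-T (eq-T τ₀ u) t
  arc₁⁺ (middle {u} {v} t) = ∧-T (∧-T (eq-T τ₀ u) (eq-T τ₀ v)) t
  arc₁⁺ (leave {u} {v} t) = ∧-T (eq-T τ₀ v) t

  arc₁-asym : ∀ {x y} → T (arc₁ x y) → ¬ T (arc₁ y x)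
  arc₁-asym {x} {y} t s with arc₁⁻ x y t | arc₁⁻ y x s
  ... | enter _ | ()
  ... | middle _ | ()
  ... | leave _ | ()

  -- Inner vertices have only their two neighbours on a path of three arcs, so a triangle would be
  -- such a path closed up to a loop u → u of the original graph.
  no-triangle : ∀ {x y z} → T (arc₁ x y ∨ arc₁ y x) → T (arc₁ x z ∨ arc₁ z x) → T (arc₁ y z ∨ arc₁ z y) → ⊥
  no-triangle {x} {y} {z} xy xz yz = go (edge x y xy) (edge x z xz) (edge y z yz)
   where
   edge : ∀ x y → T (arc₁ x y ∨ arc₁ y x) → Arc x y ⊎ Arc y x
   edge x y t with Equivalence.to (T-∨ {arc₁ x y}) t
   ... | inj₁ s = inj₁ (arc₁⁻ x y s)
   ... | inj₂ s = inj₂ (arc₁⁻ y x s)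
   go : Arc x y ⊎ Arc y x → Arc x z ⊎ Arc z x → Arc y z ⊎ Arc z y → ⊥
   go (inj₁ (enter _)) (inj₁ (enter _)) (inj₁ ())
   go (inj₁ (enter _)) (inj₁ (enter _)) (inj₂ ())
   go (inj₁ (enter t)) (inj₂ (leave _)) (inj₁ (middle _)) = arc₀-irrefl t
   go (inj₁ (enter _)) (inj₂ (leave _)) (inj₂ ())
   go (inj₁ (middle _)) (inj₁ (middle _)) (inj₁ ())
   go (inj₁ (middle _)) (inj₁ (middle _)) (inj₂ ())
   go (inj₁ (middle _)) (inj₂ (enter t)) (inj₁ (leave _)) = arc₀-irrefl t
   go (inj₁ (middle _)) (inj₂ (enter _)) (inj₂ ())
   go (inj₁ (leave t)) (inj₁ (leave _)) (inj₁ ())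
   go (inj₁ (leave t)) (inj₁ (leave _)) (inj₂ ())
   go (inj₁ (leave t)) (inj₂ (middle _)) (inj₁ (enter _)) = arc₀-irrefl t
   go (inj₁ (leave _)) (inj₂ (middle _)) (inj₂ ())
   go (inj₂ (enter _)) (inj₁ (middle _)) (inj₁ ())
   go (inj₂ (enter t)) (inj₁ (middle _)) (inj₂ (leave _)) = arc₀-irrefl t
   go (inj₂ (enter _)) (inj₂ (enter _)) (inj₁ ())
   go (inj₂ (enter _)) (inj₂ (enter _)) (inj₂ ())
   go (inj₂ (middle _)) (inj₁ (leave _)) (inj₁ ())
   go (inj₂ (middle t)) (inj₁ (leave _)) (inj₂ (enter _)) = arc₀-irrefl t
   go (inj₂ (middle _)) (inj₂ (middle _)) (inj₁ ())
   go (inj₂ (middle _)) (inj₂ (middle _)) (inj₂ ())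
   go (inj₂ (leave _)) (inj₁ (enter _)) (inj₁ ())
   go (inj₂ (leave t)) (inj₁ (enter _)) (inj₂ (middle _)) = arc₀-irrefl t
   go (inj₂ (leave _)) (inj₂ (leave _)) (inj₁ ())
   go (inj₂ (leave _)) (inj₂ (leave _)) (inj₂ ())

  module _ (U₀ : List ⟦ τ₀ ⟧) (U₀-unique : Unique U₀) where

   U₁ : List ⟦ τ₁ ⟧
   U₁ = map inj₁ U₀ ++ map inj₂ (cartesianProduct U₀ (cartesianProduct U₀ (false ∷ true ∷ [])))

   isArc : ⟦ τ₀ ⟧ × ⟦ τ₀ ⟧ → Bool
   isArc (u , v) = arc₀ u v

   arcs : List (⟦ τ₀ ⟧ × ⟦ τ₀ ⟧)
   arcs = filterᵇ isArc (cartesianProduct U₀ U₀)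

   arcs-unique : Unique arcs
   arcs-unique = filter⁺ (T? ∘ isArc) (cartesianProduct⁺ U₀-unique U₀-unique)

   arcs⁻ : ∀ {u v} → (u , v) ∈ arcs → (u ∈ U₀ × v ∈ U₀) × T (arc₀ u v)
   arcs⁻ m with m′ , t ← ∈-filter⁻ (T? ∘ isArc) {xs = cartesianProduct U₀ U₀} m = ∈-cartesianProduct⁻ U₀ U₀ m′ , t

   arcs⁺ : ∀ {u v} → u ∈ U₀ → v ∈ U₀ → T (arc₀ u v) → (u , v) ∈ arcs
   arcs⁺ u∈ v∈ t = ∈-filter⁺ (T? ∘ isArc) (∈-cartesianProduct⁺ u∈ v∈) t

   bools : ∀ b → b ∈ false ∷ true ∷ []
   bools false = here refl
   bools true = there (here refl)

   U₁-unique : Unique U₁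
   U₁-unique = ++⁺ (map⁺ (λ { refl → refl }) U₀-unique)
    (map⁺ (λ { refl → refl }) (cartesianProduct⁺ U₀-unique (cartesianProduct⁺ U₀-unique (((λ ()) ∷ []) ∷ [] ∷ []))))
    (λ (m , m′) → case-⊥ (∈-map⁻ inj₁ m) (∈-map⁻ inj₂ m′))
    where
    case-⊥ : ∀ {v : ⟦ τ₁ ⟧} → (∃[ x ] x ∈ U₀ × v ≡ inj₁ x) → (∃[ y ] y ∈ cartesianProduct U₀ (cartesianProduct U₀ (false ∷ true ∷ [])) × v ≡ inj₂ y) → ⊥
    case-⊥ (_ , _ , refl) (_ , _ , ())

   inj₁-U₁ : ∀ {u} → u ∈ U₀ → inj₁ u ∈ U₁
   inj₁-U₁ m = ∈-++⁺ˡ (∈-map⁺ inj₁ m)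

   U₁-inj₂ : ∀ {u v b} → inj₂ (u , v , b) ∈ U₁ → u ∈ U₀ × v ∈ U₀
   U₁-inj₂ m with ∈-++⁻ (map inj₁ U₀) m
   ... | inj₁ m′ with () ← proj₂ (proj₂ (∈-map⁻ inj₁ m′))
   ... | inj₂ m′ with _ , t∈ , refl ← ∈-map⁻ inj₂ m′ with u∈ , t∈′ ← ∈-cartesianProduct⁻ U₀ _ t∈ = u∈ , proj₁ (∈-cartesianProduct⁻ U₀ _ t∈′)

   inj₂-U₁ : ∀ {u v b} → u ∈ U₀ → v ∈ U₀ → inj₂ (u , v , b) ∈ U₁
   inj₂-U₁ u∈ v∈ = ∈-++⁺ʳ (map inj₁ U₀) (∈-map⁺ inj₂ (∈-cartesianProduct⁺ u∈ (∈-cartesianProduct⁺ v∈ (bools _))))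

   -- One inner vertex per path suffices: the second if u ∈ C already covers the first arc,
   -- otherwise the first, since then v ∈ C covers the last arc.
   subdivide : ∀ {k} → HasCover U₀ arc₀ k → HasCover U₁ arc₁ (k + length arcs)
   subdivide {k} (C , le , cov) = C′ , ≤-trans (≤-reflexive (trans (length-++ (map inj₁ C)) (cong₂ _+_ (length-map inj₁ C) (length-map mid arcs)))) (+-monoˡ-≤ _ le) ,
    λ {x} {y} x∈ y∈ t → covers x∈ y∈ (arc₁⁻ x y t)
    where
    mid : ⟦ τ₀ ⟧ × ⟦ τ₀ ⟧ → ⟦ τ₁ ⟧
    mid (u , v) = inj₂ (u , v , mem τ₀ u C)
    C′ : List ⟦ τ₁ ⟧
    C′ = map inj₁ C ++ map mid arcs
    old : ∀ {u} → u ∈ C → inj₁ u ∈ C′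
    old m = ∈-++⁺ˡ (∈-map⁺ inj₁ m)
    new : ∀ {u v b} → u ∈ U₀ → v ∈ U₀ → T (arc₀ u v) → mem τ₀ u C ≡ b → inj₂ (u , v , b) ∈ C′
    new u∈ v∈ t refl = ∈-++⁺ʳ (map inj₁ C) (∈-map⁺ mid (arcs⁺ u∈ v∈ t))
    covers : ∀ {x y} → x ∈ U₁ → y ∈ U₁ → Arc x y → x ∈ C′ ⊎ y ∈ C′
    covers x∈ y∈ (enter {u} {v} t) with mem τ₀ u C in eq | U₁-inj₂ y∈
    ... | true | _ = inj₁ (old (mem⁻ τ₀ u C (subst T (sym eq) tt)))
    ... | false | u∈ , v∈ = inj₂ (new u∈ v∈ t eq)
    covers x∈ y∈ (middle {u} {v} t) with mem τ₀ u C in eq | U₁-inj₂ x∈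
    ... | true | u∈ , v∈ = inj₂ (new u∈ v∈ t eq)
    ... | false | u∈ , v∈ = inj₁ (new u∈ v∈ t eq)
    covers x∈ y∈ (leave {u} {v} t) with mem τ₀ u C in eq | U₁-inj₂ x∈
    ... | true | u∈ , v∈ = inj₁ (new u∈ v∈ t eq)
    ... | false | u∈ , v∈ = [ (λ m → ⊥-elim (subst T eq (mem⁺ τ₀ m))) , (λ m → inj₂ (old m)) ]′ (cov u∈ v∈ t)

   -- The middle arc forces at least one inner vertex of each path into C, which accounts for
   -- `length arcs`. A path with both of its inner vertices in C has one to spare, and that one pays
   -- for taking u.
   contract : ∀ {k} → HasCover U₁ arc₁ (k + length arcs) → HasCover U₀ arc₀ k
   contract {k} (C , le , cov) = C₀ , +-cancelʳ-≤ (length arcs) _ _ (≤-trans count (≤-trans (unique-⊆-length D-unique D⊆) le)) , covers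
    where
    inC : ⟦ τ₁ ⟧ → Bool
    inC x = mem τ₁ x C
    old : ⟦ τ₀ ⟧ → Bool
    old u = inC (inj₁ u)
    both : ⟦ τ₀ ⟧ × ⟦ τ₀ ⟧ → Bool
    both (u , v) = inC (inj₂ (u , v , false)) ∧ inC (inj₂ (u , v , true))
    C₀ : List ⟦ τ₀ ⟧
    C₀ = filterᵇ old U₀ ++ map proj₁ (filterᵇ both arcs)
    mids : ⟦ τ₀ ⟧ × ⟦ τ₀ ⟧ → List ⟦ τ₁ ⟧
    mids (u , v) = inj₂ (u , v , false) ∷ inj₂ (u , v , true) ∷ []
    D₁ D₂ D : List ⟦ τ₁ ⟧
    D₁ = map inj₁ (filterᵇ old U₀)
    D₂ = filterᵇ inC (concatMap mids arcs)
    D = D₁ ++ D₂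
    mids⁻ : ∀ {uv x} → x ∈ mids uv → ∃[ b ] x ≡ inj₂ (proj₁ uv , proj₂ uv , b)
    mids⁻ (here refl) = false , refl
    mids⁻ (there (here refl)) = true , refl
    D-unique : Unique D
    D-unique = ++⁺ (map⁺ (λ { refl → refl }) (filter⁺ (T? ∘ old) U₀-unique))
     (filter⁺ (T? ∘ inC) (concatMap-unique mids arcs-unique (λ _ → ((λ ()) ∷ []) ∷ [] ∷ [])
      (λ _ _ m m′ → same (mids⁻ m) (mids⁻ m′))))
     (λ (m , m′) → apart m m′)
     where
     same : ∀ {uv uv′ : ⟦ τ₀ ⟧ × ⟦ τ₀ ⟧} {x : ⟦ τ₁ ⟧} → (∃[ b ] x ≡ inj₂ (proj₁ uv , proj₂ uv , b)) → (∃[ b ] x ≡ inj₂ (proj₁ uv′ , proj₂ uv′ , b)) → uv ≡ uv′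
     same (_ , refl) (_ , refl) = refl
     apart : ∀ {x} → x ∈ D₁ → x ∈ D₂ → ⊥
     apart m m′ with _ , _ , refl ← ∈-map⁻ inj₁ m
      with _ , _ , q ← ∈-concatMap⁻′ mids arcs (proj₁ (∈-filter⁻ (T? ∘ inC) {xs = concatMap mids arcs} m′))
      with _ , () ← mids⁻ q
    D⊆ : D ⊆ C
    D⊆ m with ∈-++⁻ D₁ m
    ... | inj₁ q with u , u∈ , refl ← ∈-map⁻ inj₁ q = mem⁻ τ₁ (inj₁ u) C (proj₂ (∈-filter⁻ (T? ∘ old) {xs = U₀} u∈))
    ... | inj₂ q = mem⁻ τ₁ _ C (proj₂ (∈-filter⁻ (T? ∘ inC) {xs = concatMap mids arcs} q))
    per-arc : ∀ L → (∀ {uv} → uv ∈ L → uv ∈ arcs) → length (filterᵇ both L) + length L ≤ length (concatMap (filterᵇ inC ∘ mids) L)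
    per-arc [] sub = z≤n
    per-arc ((u , v) ∷ L) sub with ih ← per-arc L (sub ∘ there) with (u∈ , v∈) , t ← arcs⁻ (sub (here refl))
     with c ← cov (inj₂-U₁ {b = false} u∈ v∈) (inj₂-U₁ {b = true} u∈ v∈) (arc₁⁺ (middle t)) =
     ≤-trans (≤-reflexive (cong (_+ suc (length L)) (filter-cons both (u , v) L)))
      (≤-trans (≤-trans (move (both (u , v))) (+-monoʳ-≤ (if both (u , v) then 2 else 1) ih))
       (≤-reflexive (sym (trans (length-++ (filterᵇ inC (mids (u , v))))
        (cong (_+ _) (filter-pair inC _ _ ([ (λ m → inj₁ (mem⁺ τ₁ m)) , (λ m → inj₂ (mem⁺ τ₁ m)) ]′ c)))))))
     where
     move : ∀ b → (if b then 1 else 0) + length (filterᵇ both L) + suc (length L) ≤ (if b then 2 else 1) + (length (filterᵇ both L) + length L)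
     move true = s≤s (≤-reflexive (+-suc _ _))
     move false = ≤-reflexive (+-suc _ _)
    count : length C₀ + length arcs ≤ length D
    count = ≤-trans (≤-reflexive (trans (cong (_+ length arcs) (trans (length-++ (filterᵇ old U₀)) (cong (length (filterᵇ old U₀) +_) (length-map proj₁ (filterᵇ both arcs)))))
     (+-assoc (length (filterᵇ old U₀)) _ _)))
     (≤-trans (+-monoʳ-≤ (length (filterᵇ old U₀)) (≤-trans (per-arc arcs id) (≤-reflexive (cong length (sym (filter-concatMap inC mids arcs))))))
      (≤-reflexive (sym (trans (length-++ D₁) (cong (_+ length D₂) (length-map inj₁ (filterᵇ old U₀)))))))
    covers : IsCover U₀ arc₀ C₀
    covers {u} {v} u∈ v∈ t with cov (inj₁-U₁ u∈) (inj₂-U₁ u∈ v∈) (arc₁⁺ (enter t)) | cov (inj₂-U₁ u∈ v∈) (inj₁-U₁ v∈) (arc₁⁺ (leave t))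
    ... | inj₁ m | _ = inj₁ (∈-++⁺ˡ (∈-filter⁺ (T? ∘ old) u∈ (mem⁺ τ₁ m)))
    ... | inj₂ _ | inj₂ m = inj₂ (∈-++⁺ˡ (∈-filter⁺ (T? ∘ old) v∈ (mem⁺ τ₁ m)))
    ... | inj₂ p | inj₁ q = inj₁ (∈-++⁺ʳ (filterᵇ old U₀) (∈-map⁺ proj₁ (∈-filter⁺ (T? ∘ both) (arcs⁺ u∈ v∈ t) (∧-T (mem⁺ τ₁ p) (mem⁺ τ₁ q)))))

 -- Vertex cover instance of a CNF formula: an arc for every variable, a transitive tournament for every clause.
 module Formula (ν : Ty) where

  ℓit : Ty
  ℓit = ν ⊗ 𝔹

  Lit : Set
  Lit = ⟦ ℓit ⟧

  -- Splitting off a first literal makes clauses non-empty, and the length of the tail becomes the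
  -- cost of the clause in a cover.
  Cl : Set
  Cl = Lit × List Lit

  lits : Cl → List Lit
  lits (l , ls) = l ∷ ls

  record WellFormed (vars : List ⟦ ν ⟧) (cls : List Cl) : Set where
   field
    vars-unique : Unique vars
    vars-all : ∀ {c l} → c ∈ cls → l ∈ lits c → proj₁ l ∈ vars

  Sat : List Cl → Set
  Sat cls = Σ (⟦ ν ⟧ → Bool) λ σ → ∀ {c} → c ∈ cls → ∃[ l ] l ∈ lits c × σ (proj₁ l) ≡ proj₂ l

  τ₀ : Ty
  τ₀ = ℓit ⊕ nat ⊗ nat ⊗ ℓit

  -- Literals in the cover are the true ones. A corner is joined to its own literal and not to the
  -- negation, so a corner left out of the cover certifies that its literal is true.
  arc₀ : ⟦ τ₀ ⟧ → ⟦ τ₀ ⟧ → Bool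
  arc₀ (inj₁ (x , b)) (inj₁ (y , c)) = (b ∧ not c) ∧ eqᵇ ν x y
  arc₀ (inj₁ _) (inj₂ _) = false
  arc₀ (inj₂ (j , i , l)) (inj₁ l′) = eqᵇ ℓit l l′
  arc₀ (inj₂ (j , i , l)) (inj₂ (j′ , i′ , l′)) = eqᵇ nat j j′ ∧ (i <ᵇ i′)

  arc₀-irrefl : ∀ {u} → ¬ T (arc₀ u u)
  arc₀-irrefl {inj₁ (x , true)} ()
  arc₀-irrefl {inj₁ (x , false)} ()
  arc₀-irrefl {inj₂ (j , i , l)} t = <⇒≢ (<ᵇ⇒< i i (T-∧₂ (eqᵇ nat j j) t)) refl

  varV : ⟦ ν ⟧ → List ⟦ τ₀ ⟧
  varV x = inj₁ (x , true) ∷ inj₁ (x , false) ∷ []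

  corner : ℕ → ℕ × Lit → ⟦ τ₀ ⟧
  corner j (i , l) = inj₂ (j , i , l)

  clauseV : ℕ × Cl → List ⟦ τ₀ ⟧
  clauseV (j , c) = map (corner j) (number 0 (lits c))

  module _ (vars : List ⟦ ν ⟧) (cls : List Cl) (wf : WellFormed vars cls) where

   open WellFormed wf

   U₀ : List ⟦ τ₀ ⟧
   U₀ = concatMap varV vars ++ concatMap clauseV (number 0 cls)

   -- The least conceivable size of a cover: one end of every variable arc, and all but one corner
   -- of every clause.
   k₀ : ℕ
   k₀ = length vars + length (concatMap proj₂ cls)

   varV⁻ : ∀ {x v} → v ∈ varV x → ∃[ b ] v ≡ inj₁ (x , b)
   varV⁻ (here refl) = true , refl
   varV⁻ (there (here refl)) = false , refl

   clauseV⁻ : ∀ {jc v} → v ∈ clauseV jc → ∃[ i ] ∃[ l ] (i , l) ∈ number 0 (lits (proj₂ jc)) × v ≡ inj₂ (proj₁ jc , i , l)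
   clauseV⁻ {j , c} m with (i , l) , m′ , refl ← ∈-map⁻ (corner j) m = i , l , m′ , refl

   U₀-unique : Unique U₀
   U₀-unique = ++⁺ (concatMap-unique varV vars-unique (λ _ → ((λ ()) ∷ []) ∷ [] ∷ []) (λ _ _ m m′ → sameV (varV⁻ m) (varV⁻ m′)))
    (concatMap-unique clauseV (number-unique 0 cls) (λ {jc} _ → map⁺ (λ { refl → refl }) (number-unique 0 (lits (proj₂ jc))))
     (λ p q m m′ → sameC p q (clauseV⁻ m) (clauseV⁻ m′)))
    (λ (m , m′) → apart (proj₂ (proj₂ (∈-concatMap⁻′ varV vars m))) (proj₂ (proj₂ (∈-concatMap⁻′ clauseV (number 0 cls) m′))))
    where
    sameV : ∀ {x y : ⟦ ν ⟧} {v : ⟦ τ₀ ⟧} → (∃[ b ] v ≡ inj₁ (x , b)) → (∃[ b ] v ≡ inj₁ (y , b)) → x ≡ y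
    sameV (_ , refl) (_ , refl) = refl
    sameC : ∀ {jc jc′ v} → jc ∈ number 0 cls → jc′ ∈ number 0 cls →
     (∃[ i ] ∃[ l ] (i , l) ∈ number 0 (lits (proj₂ jc)) × v ≡ inj₂ (proj₁ jc , i , l)) →
     (∃[ i ] ∃[ l ] (i , l) ∈ number 0 (lits (proj₂ jc′)) × v ≡ inj₂ (proj₁ jc′ , i , l)) → jc ≡ jc′
    sameC {j , c} {.j , c′} p q (_ , _ , _ , refl) (_ , _ , _ , refl) = cong (j ,_) (number-functional 0 cls p q)
    apart : ∀ {x jc v} → v ∈ varV x → v ∈ clauseV jc → ⊥
    apart m m′ with _ , refl ← varV⁻ m with _ , _ , _ , () ← clauseV⁻ m′

   inj₁-U₀ : ∀ {x} b → x ∈ vars → inj₁ (x , b) ∈ U₀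
   inj₁-U₀ true x∈ = ∈-++⁺ˡ (∈-concatMap varV x∈ (here refl))
   inj₁-U₀ false x∈ = ∈-++⁺ˡ (∈-concatMap varV x∈ (there (here refl)))

   inj₂-U₀ : ∀ {j c i l} → (j , c) ∈ number 0 cls → (i , l) ∈ number 0 (lits c) → inj₂ (j , i , l) ∈ U₀
   inj₂-U₀ {j} p q = ∈-++⁺ʳ (concatMap varV vars) (∈-concatMap clauseV p (∈-map⁺ (corner j) q))

   U₀-inj₁ : ∀ {x b} → inj₁ (x , b) ∈ U₀ → x ∈ vars
   U₀-inj₁ m with ∈-++⁻ (concatMap varV vars) m
   ... | inj₁ q with y , y∈ , q′ ← ∈-concatMap⁻′ varV vars q with _ , refl ← varV⁻ q′ = y∈
   ... | inj₂ q with _ , _ , q′ ← ∈-concatMap⁻′ clauseV (number 0 cls) q with _ , _ , _ , () ← clauseV⁻ q′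

   U₀-inj₂ : ∀ {j i l} → inj₂ (j , i , l) ∈ U₀ → ∃[ c ] (j , c) ∈ number 0 cls × (i , l) ∈ number 0 (lits c)
   U₀-inj₂ m with ∈-++⁻ (concatMap varV vars) m
   ... | inj₁ q with _ , _ , q′ ← ∈-concatMap⁻′ varV vars q with _ , () ← varV⁻ q′
   ... | inj₂ q with (j , c) , p , q′ ← ∈-concatMap⁻′ clauseV (number 0 cls) q with _ , _ , r , refl ← clauseV⁻ q′ = c , p , r

   -- The cover takes the true literals and leaves out the first true corner of each clause: its arc
   -- to the literal is covered by the literal, its other arcs by the remaining corners.
   sat⇒cover : Sat cls → HasCover U₀ arc₀ k₀
   sat⇒cover (σ , sat) = C , ≤-trans (≤-reflexive (trans (length-++ (map lit vars)) (cong (_+ length (concatMap chosen (number 0 cls))) (length-map lit vars)))) (+-monoʳ-≤ (length vars) size≤) , cov _ _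
    where
    holds : ℕ × Lit → Bool
    holds (_ , x , b) = eqᵇ 𝔹 (σ x) b
    skip′ : List (ℕ × Lit) → List (ℕ × Lit)
    skip′ [] = []
    skip′ (l ∷ ls) = if holds l then ls else l ∷ skip′ ls
    lit : ⟦ ν ⟧ → ⟦ τ₀ ⟧
    lit x = inj₁ (x , σ x)
    chosen : ℕ × Cl → List ⟦ τ₀ ⟧
    chosen (j , c) = map (corner j) (skip′ (number 0 (lits c)))
    C : List ⟦ τ₀ ⟧
    C = map lit vars ++ concatMap chosen (number 0 cls)
    skip-length : ∀ ls → Any (T ∘ holds) ls → suc (length (skip′ ls)) ≤ length ls
    skip-length (l ∷ ls) (here t) rewrite Equivalence.to T-≡ t = ≤-refl
    skip-length (l ∷ ls) (there q) with holds l
    ... | true = ≤-refl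
    ... | false = s≤s (skip-length ls q)
    skip-or : ∀ ls {l} → l ∈ ls → l ∈ skip′ ls ⊎ T (holds l)
    skip-or (l ∷ ls) (here refl) with holds l
    ... | true = inj₂ tt
    ... | false = inj₁ (here refl)
    skip-or (l ∷ ls) (there m) with holds l
    ... | true = inj₁ m
    ... | false = [ (λ q → inj₁ (there q)) , inj₂ ]′ (skip-or ls m)
    skip-two : ∀ ls {l l′} → l ∈ ls → l′ ∈ ls → l ≢ l′ → l ∈ skip′ ls ⊎ l′ ∈ skip′ ls
    skip-two (x ∷ ls) m m′ ne with holds x | m | m′
    ... | _ | here refl | here refl = ⊥-elim (ne refl)
    ... | true | here refl | there q = inj₂ q
    ... | true | there q | _ = inj₁ q
    ... | false | here refl | there _ = inj₁ (here refl)
    ... | false | there _ | here refl = inj₂ (here refl)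
    ... | false | there q | there q′ = [ (λ z → inj₁ (there z)) , (λ z → inj₂ (there z)) ]′ (skip-two ls q q′ ne)
    one-true : ∀ {c} → c ∈ cls → Any (T ∘ holds) (number 0 (lits c))
    one-true c∈ with (x , b) , l∈ , eq ← sat c∈ with i , m ← ∈-number 0 _ l∈ = lose m (subst (λ s → T (eqᵇ 𝔹 s b)) (sym eq) (eq-T 𝔹 b))
    size≤ : length (concatMap chosen (number 0 cls)) ≤ length (concatMap proj₂ cls)
    size≤ = go 0 cls id
     where
     go : ∀ k ds → (∀ {c} → c ∈ ds → c ∈ cls) → length (concatMap chosen (number k ds)) ≤ length (concatMap proj₂ ds)
     go k [] sub = z≤n
     go k (c ∷ ds) sub = ≤-trans (≤-reflexive (length-++ (chosen (k , c)))) (≤-trans (+-mono-≤ one (go (suc k) ds (sub ∘ there))) (≤-reflexive (sym (length-++ (proj₂ c)))))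
      where
      one : length (chosen (k , c)) ≤ length (proj₂ c)
      one = ≤-trans (≤-reflexive (length-map (corner k) (skip′ (number 0 (lits c))))) (≤-pred (≤-trans (skip-length (number 0 (lits c)) (one-true (sub (here refl))))
       (≤-reflexive (length-number 0 (lits c)))))
    cov : ∀ x y → x ∈ U₀ → y ∈ U₀ → T (arc₀ x y) → x ∈ C ⊎ y ∈ C
    cov (inj₁ (x , true)) (inj₁ (y , false)) x∈ y∈ t with refl ← T-eq {ν} {x} {y} t with σ x in eq
    ... | true = inj₁ (∈-++⁺ˡ (subst (λ b → inj₁ (x , b) ∈ map lit vars) eq (∈-map⁺ lit (U₀-inj₁ x∈))))
    ... | false = inj₂ (∈-++⁺ˡ (subst (λ b → inj₁ (x , b) ∈ map lit vars) eq (∈-map⁺ lit (U₀-inj₁ x∈))))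
    cov (inj₂ (j , i , l)) (inj₁ l′@(x , b)) x∈ y∈ t with refl ← T-eq {ℓit} {l} {l′} t with c , p , q ← U₀-inj₂ x∈
     with skip-or (number 0 (lits c)) q
    ... | inj₁ s = inj₁ (∈-++⁺ʳ (map lit vars) (∈-concatMap chosen p (∈-map⁺ (corner j) s)))
    ... | inj₂ h with eq ← T-eq {𝔹} {σ x} {b} h = inj₂ (∈-++⁺ˡ (subst (λ b → inj₁ (x , b) ∈ map lit vars) eq (∈-map⁺ lit (U₀-inj₁ y∈))))
    cov (inj₂ (j , i , l)) (inj₂ (j′ , i′ , l′)) x∈ y∈ t with refl ← T-eq {nat} {j} {j′} (T-∧₁ t)
     with c , p , q ← U₀-inj₂ x∈ | c′ , p′ , q′ ← U₀-inj₂ y∈ with refl ← number-functional 0 cls p p′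
     with skip-two (number 0 (lits c)) q q′ (λ e → <⇒≢ (<ᵇ⇒< i i′ (T-∧₂ (eqᵇ nat j j) t)) (cong proj₁ e))
    ... | inj₁ s = inj₁ (∈-++⁺ʳ (map lit vars) (∈-concatMap chosen p (∈-map⁺ (corner j) s)))
    ... | inj₂ s = inj₂ (∈-++⁺ʳ (map lit vars) (∈-concatMap chosen p (∈-map⁺ (corner j) s)))

   -- `k₀` is the sum of the lower bounds for variables and clauses, so all of them are attained:
   -- exactly one literal of each variable is chosen, and each clause misses a corner, whose literal
   -- must then be in the cover.
   cover⇒sat : HasCover U₀ arc₀ k₀ → Sat cls
   cover⇒sat (C , le , cov) = σ , λ c∈ → good (proj₂ (∈-number 0 cls c∈))
    where
    inC : ⟦ τ₀ ⟧ → Bool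
    inC v = mem τ₀ v C
    σ : ⟦ ν ⟧ → Bool
    σ x = inC (inj₁ (x , true))
    hV : ⟦ ν ⟧ → ℕ
    hV x = length (filterᵇ inC (varV x))
    hC : ℕ × Cl → ℕ
    hC jc = length (filterᵇ inC (clauseV jc))
    bV : ⟦ ν ⟧ → ℕ
    bV _ = 1
    bC : ℕ × Cl → ℕ
    bC (j , c) = length (proj₂ c)
    lowV : ∀ {x} → x ∈ vars → 1 ≤ hV x
    lowV {x} x∈ = ≤-trans (one (σ x ∧ inC (inj₁ (x , false)))) (≤-reflexive (sym (filter-pair inC (inj₁ (x , true)) (inj₁ (x , false))
     ([ (λ m → inj₁ (mem⁺ τ₀ m)) , (λ m → inj₂ (mem⁺ τ₀ m)) ]′ (cov (inj₁-U₀ true x∈) (inj₁-U₀ false x∈) (eq-T ν x))))))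
     where
     one : ∀ b → 1 ≤ (if b then 2 else 1)
     one true = s≤s z≤n
     one false = s≤s z≤n
    lowC : ∀ {jc} → jc ∈ number 0 cls → bC jc ≤ hC jc
    lowC {j , c} p = ≤-pred (≤-trans (≤-reflexive (trans (sym (length-number 0 (lits c))) (sym (length-map (corner j) (number 0 (lits c))))))
     (almost-all inC (pairs (number-< 0 (lits c)) id)))
     where
     pairs : ∀ {ls} → AllPairs (λ p q → proj₁ p < proj₁ q) ls → (∀ {l} → l ∈ ls → l ∈ number 0 (lits c)) → AllPairs (λ u v → T (inC u) ⊎ T (inC v)) (map (corner j) ls)
     pairs [] sub = []
     pairs {(i , l) ∷ ls} (d ∷ ap) sub = All.tabulate here-pairs ∷ pairs ap (sub ∘ there)
      where
      here-pairs : ∀ {v} → v ∈ map (corner j) ls → T (inC (corner j (i , l))) ⊎ T (inC v)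
      here-pairs m with (i′ , l′) , m′ , refl ← ∈-map⁻ (corner j) m =
       [ (λ z → inj₁ (mem⁺ τ₀ z)) , (λ z → inj₂ (mem⁺ τ₀ z)) ]′
        (cov (inj₂-U₀ p (sub (here refl))) (inj₂-U₀ p (sub (there m′))) (∧-T (eq-T nat j) (<⇒<ᵇ (All.lookup d m′))))
    SV SC : ℕ
    SV = sum (map hV vars)
    SC = sum (map hC (number 0 cls))
    bV-sum : ∀ xs → sum (map bV xs) ≡ length xs
    bV-sum [] = refl
    bV-sum (x ∷ xs) = cong suc (bV-sum xs)
    bC-sum : ∀ k ds → sum (map bC (number k ds)) ≡ length (concatMap proj₂ ds)
    bC-sum k [] = refl
    bC-sum k (c ∷ ds) = trans (cong (length (proj₂ c) +_) (bC-sum (suc k) ds)) (sym (length-++ (proj₂ c)))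
    total : SV + SC ≤ sum (map bV vars) + sum (map bC (number 0 cls))
    total = ≤-trans (≤-reflexive (sym (trans (cong length (filter-++ (T? ∘ inC) (concatMap varV vars) _))
     (trans (length-++ (filterᵇ inC (concatMap varV vars)))
      (cong₂ _+_ (trans (cong length (filter-concatMap inC varV vars)) (length-concatMap (filterᵇ inC ∘ varV) vars))
       (trans (cong length (filter-concatMap inC clauseV (number 0 cls))) (length-concatMap (filterᵇ inC ∘ clauseV) (number 0 cls))))))))
     (≤-trans (unique-⊆-length (filter⁺ (T? ∘ inC) U₀-unique) (λ {v} m → mem⁻ τ₀ v C (proj₂ (∈-filter⁻ (T? ∘ inC) {xs = U₀} m))))
      (≤-trans le (≤-reflexive (sym (cong₂ _+_ (bV-sum vars) (bC-sum 0 cls))))))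
    tightV : ∀ {x} → x ∈ vars → hV x ≤ 1
    tightV = sum-tight bV hV vars lowV (+-cancelʳ-≤ SC _ _ (≤-trans total (+-monoʳ-≤ _ (sum-mono bC hC (number 0 cls) lowC))))
    tightC : ∀ {jc} → jc ∈ number 0 cls → hC jc ≤ bC jc
    tightC = sum-tight bC hC (number 0 cls) lowC (+-cancelˡ-≤ SV _ _ (≤-trans total (+-monoˡ-≤ _ (sum-mono bV hV vars lowV))))
    chosen : ∀ {x} b → x ∈ vars → inj₁ (x , b) ∈ C → σ x ≡ b
    chosen true x∈ m = Equivalence.to T-≡ (mem⁺ τ₀ m)
    chosen {x} false x∈ m = ¬T-false λ t → 1+n≰n (≤-trans (≤-reflexive (sym (two t))) (tightV x∈))
     where
     two : T (inC (inj₁ (x , true))) → hV x ≡ 2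
     two t = trans (filter-pair inC _ _ (inj₁ t)) (cong₂ (λ b c → if b ∧ c then 2 else 1) (Equivalence.to T-≡ t) (Equivalence.to T-≡ (mem⁺ τ₀ m)))
    good : ∀ {j c} → (j , c) ∈ number 0 cls → ∃[ l ] l ∈ lits c × σ (proj₁ l) ≡ proj₂ l
    good {j} {c} p with v , v∈ , ¬v ← some-missing inC (clauseV (j , c)) (≤-trans (s≤s (tightC p))
     (≤-reflexive (trans (sym (length-number 0 (lits c))) (sym (length-map (corner j) (number 0 (lits c)))))))
     with i , l@(x , b) , m , refl ← clauseV⁻ v∈ =
     l , l∈ , chosen b x∈ ([ (λ q → ⊥-elim (¬v (mem⁺ τ₀ q))) , id ]′ (cov (inj₂-U₀ p m) (inj₁-U₀ b x∈) (eq-T ℓit l)))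
     where
     l∈ = number-∈ 0 (lits c) m
     x∈ = vars-all (number-∈ 0 cls p) l∈

-- The reduction as a program, and its linear budget

module FormulaToGraph where

 open import Data.Bool using (T)
 open import Data.Fin using (toℕ)
 open import Data.List using (lookup)
 open import Data.List.Properties
 open import Data.List.Membership.Propositional.Properties
 open import Data.Nat.Binary using (fromℕ')
 import Data.Nat.Binary as ℕᵇ
 open import Data.Nat.Binary.Properties using (fromℕ≡fromℕ')
 open import Data.Nat.Properties
 open Programs
 open PolynomialTime
 open RegularGraphs
 open GluedCopies
 open NoInducedCopy
 open VertexCover

 open Graph using (degree; order; edges)

 pairP : ∀ {Γ e f} → PT Γ (list 𝔹) e → PT Γ (list 𝔹) f → PT Γ (list 𝔹) (λ γ → ⟨ e γ , f γ ⟩)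
 pairP {e = e} {f} E F = ext (λ γ → lem (e γ) (f γ)) (concatMapP E (constP 𝔹 true ∷P v0 ∷P nilP) ++P (constP 𝔹 false ∷P F))
  where
  lem : ∀ w v → concatMap (λ b → true ∷ b ∷ []) w ++ false ∷ v ≡ ⟨ w , v ⟩
  lem [] v = refl
  lem (b ∷ w) v = cong (λ l → true ∷ b ∷ l) (lem w v)

 unaryP : ∀ {Γ e} → PT Γ nat e → PT Γ (list 𝔹) (λ γ → unary (e γ))
 unaryP {e = e} E = ext (λ γ → map-replicate (λ _ → true) (e γ) tt) (mapP (unitsP ∘P E) (constP 𝔹 true))

 -- Bijective base 2, least digit first, with false for the digit 1 and true for 2: a carry turns 1
 -- into 2 and stops, or 2 into 1 and goes on. In `inc`, a carry that remains at the end becomes a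
 -- new digit 1.
 incStep : Bool × List Bool → Bool → Bool × List Bool
 incStep (carry , out) b = if carry then (b , not b ∷ out) else (false , b ∷ out)

 inc : List Bool → List Bool
 inc w = let carry , out = foldl incStep (true , []) w in out ʳ++ (if carry then [ false ] else [])

 inc-suc : ∀ n → inc (encodeℕᵇ n) ≡ encodeℕᵇ (ℕᵇ.suc n)
 inc-suc n = go n []
  where
  fin : Bool × List Bool → List Bool
  fin (carry , out) = out ʳ++ (if carry then [ false ] else [])
  idle : ∀ w out → fin (foldl incStep (false , out) w) ≡ out ʳ++ w
  idle [] out = refl
  idle (b ∷ w) out = idle w (b ∷ out)
  go : ∀ n out → fin (foldl incStep (true , out) (encodeℕᵇ n)) ≡ out ʳ++ encodeℕᵇ (ℕᵇ.suc n)
  go ℕᵇ.zero out = refl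
  go 2[1+ n ] out = go n (false ∷ out)
  go 1+[2 n ] out = idle (encodeℕᵇ n) (true ∷ out)

 incP : PT (list 𝔹) (list 𝔹) inc
 incP = letP (foldP⁺ idP (constP (𝔹 ⊗ list 𝔹) (true , [])) S (K 2) bound) (ʳ++P (sndP ∘P v0) (ifP (fstP ∘P v0) (constP (list 𝔹) [ false ]) nilP))
  where
  S : PT (𝔹 ⊗ (𝔹 ⊗ list 𝔹) ⊗ list 𝔹) (𝔹 ⊗ list 𝔹) (λ (b , acc , _) → incStep acc b)
  S = ifP (fstP ∘P v1) (v0 ,P (notP v0 ∷P (sndP ∘P v1))) (constP 𝔹 false ,P (v0 ∷P (sndP ∘P v1)))
  bound : ∀ γ b acc → size (𝔹 ⊗ list 𝔹) (incStep acc b) ≤ size (𝔹 ⊗ list 𝔹) acc + 2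
  bound γ b (true , out) = ≤-reflexive (cong suc (+-comm 2 _))
  bound γ b (false , out) = ≤-reflexive (cong suc (+-comm 2 _))

 -- The number is given in unary and counted up in binary, one increment for each unit; so the
 -- number of increments is bounded by the size of the unary input.
 binaryP : ∀ {Γ e} → PT Γ nat e → PT Γ (list 𝔹) (λ γ → encodeℕᵇ (fromℕ (e γ)))
 binaryP {e = e} E = ext (λ γ → trans (lem (e γ)) (cong encodeℕᵇ (sym (fromℕ≡fromℕ' (e γ))))) (iterateP⁺ E nilP (incP ∘P v0) (K 2) (λ _ → bound))
  where
  lem : ∀ n → iterate inc [] n ≡ encodeℕᵇ (fromℕ' n)
  lem zero = refl
  lem (suc n) = trans (iterate-suc inc [] n) (trans (cong inc (lem n)) (inc-suc (fromℕ' n)))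
  len : ∀ w acc → length (proj₂ (foldl incStep acc w)) ≡ length w + length (proj₂ acc)
  len [] acc = refl
  len (b ∷ w) (true , out) = trans (len w _) (+-suc _ _)
  len (b ∷ w) (false , out) = trans (len w _) (+-suc _ _)
  one : ∀ b → length (if b then [ false ] else []) ≤ 1
  one true = ≤-refl
  one false = z≤n
  bound : ∀ w → size (list 𝔹) (inc w) ≤ size (list 𝔹) w + 2
  bound w = ≤-trans (≤-reflexive (size-word (inc w))) (≤-trans (+-monoˡ-≤ 1 (*-monoʳ-≤ 2
   (≤-trans (≤-reflexive (trans (length-ʳ++ (proj₂ (foldl incStep (true , []) w))) (cong (_+ length (if proj₁ (foldl incStep (true , []) w) then [ false ] else [])) (trans (len w (true , [])) (+-identityʳ _)))))
    (≤-trans (+-monoʳ-≤ (length w) (one (proj₁ (foldl incStep (true , []) w)))) (≤-reflexive (+-comm _ 1))))))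
   (≤-reflexive (trans (cong (_+ 1) (*-suc 2 (length w))) (trans (cong suc (cong suc (sym (size-word w)))) (+-comm 2 _)))))

 -- The counter is part of the accumulator and is copied at every step; the size is therefore
 -- bounded through the length of the whole list.
 numberP : ∀ {Γ σ e} → PT Γ (list σ) e → PT Γ (list (nat ⊗ σ)) (λ γ → number 0 (e γ))
 numberP {Γ} {σ} {e} E = ext (λ γ → trans (cong (reverse ∘ proj₂) (lem 0 [] (e γ))) (trans (cong reverse (ʳ++-defn (number 0 (e γ)))) (trans (cong reverse (++-identityʳ (reverse (number 0 (e γ))))) (reverse-involutive (number 0 (e γ))))))
  (reverseP (sndP ∘P foldP E (constP (nat ⊗ list (nat ⊗ σ)) (0 , [])) S (K 2 ⊞ growth′ ⊠ (K 1 ⊞ (growth′ ⊞ growth′) ⊞ K 1)) bounded))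
  where
  growth′ : Pol
  growth′ = PT.growth E
  S : PT (σ ⊗ (nat ⊗ list (nat ⊗ σ)) ⊗ Γ) (nat ⊗ list (nat ⊗ σ)) (λ (x , (n , acc) , _) → suc n , (n , x) ∷ acc)
  S = sucP (fstP ∘P v1) ,P ((fstP ∘P v1 ,P v0) ∷P (sndP ∘P v1))
  lem : ∀ {A : Set} k acc (xs : List A) → foldl (λ (n , acc) x → suc n , (n , x) ∷ acc) (k , acc) xs ≡ (length xs + k , number k xs ʳ++ acc)
  lem k acc [] = refl
  lem k acc (x ∷ xs) = trans (lem (suc k) ((k , x) ∷ acc) xs) (cong (_, number k (x ∷ xs) ʳ++ acc) (+-suc _ k))
  sz : ∀ c ys n acc → (size (list σ) ys ≤ c) → (length ys + n ≤ c) →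
   size (nat ⊗ list (nat ⊗ σ)) (foldl (λ (n , acc) x → suc n , (n , x) ∷ acc) (n , acc) ys) ≤ size (nat ⊗ list (nat ⊗ σ)) (n , acc) + length ys * (1 + (c + c) + 1)
  sz c [] n acc _ _ = m≤m+n _ _
  sz c (y ∷ ys) n acc le le′ = ≤-trans (sz c ys (suc n) ((n , y) ∷ acc) (≤-trans (≤-trans (m≤n+m _ _) (n≤1+n _)) le) (≤-trans (≤-reflexive (+-suc _ n)) le′))
   (≤-trans (+-monoˡ-≤ _ (one (size (list (nat ⊗ σ)) acc))) (≤-reflexive (+-assoc (suc n + size (list (nat ⊗ σ)) acc) _ _)))
   where
   one : ∀ s → suc (suc n) + suc (suc n + size σ y + s) ≤ suc n + s + (1 + (c + c) + 1)
   one s = ≤-trans (≤-reflexive (rearrange n (size σ y) s)) (+-monoʳ-≤ (suc n + s) (≤-trans (+-monoʳ-≤ 1 (s≤s (+-mono-≤ {suc n} {c} (≤-trans (s≤s (m≤n+m n (length ys))) le′) (≤-trans (≤-trans (m≤m+n _ _) (n≤1+n _)) le))))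
    (≤-reflexive (cong suc (sym (+-comm (c + c) 1))))))
    where
    open import Data.Nat.Tactic.RingSolver using (solve-∀)
    rearrange : ∀ n y s → suc (suc n) + suc (suc n + y + s) ≡ suc n + s + (1 + suc (suc n + y))
    rearrange = solve-∀
  bounded : ∀ γ ys zs → e γ ≡ ys ++ zs → size (nat ⊗ list (nat ⊗ σ)) (foldl (λ (n , acc) x → suc n , (n , x) ∷ acc) (0 , []) ys)
   ≤ ⟪ K 2 ⊞ growth′ ⊠ (K 1 ⊞ (growth′ ⊞ growth′) ⊞ K 1) ⟫ (size Γ γ)
  bounded γ ys zs eq = ≤-trans (sz c ys 0 [] le (≤-trans (≤-reflexive (+-identityʳ _)) len)) (+-monoʳ-≤ 2 (*-monoˡ-≤ (1 + (c + c) + 1) len))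
   where
   c = ⟪ growth′ ⟫ (size Γ γ)
   le : size (list σ) ys ≤ c
   le = ≤-trans (≤-trans (prefix-size σ ys zs) (≤-reflexive (cong (size (list σ)) (sym eq)))) (PT.grow E γ)
   len : length ys ≤ c
   len = ≤-trans (length≤size σ ys) le

 length-product : ∀ {A B : Set} (xs : List A) (ys : List B) → length (cartesianProduct xs ys) ≡ length xs * length ys
 length-product [] ys = refl
 length-product (x ∷ xs) ys = trans (length-++ (map (x ,_) ys)) (cong₂ _+_ (length-map (x ,_) ys) (length-product xs ys))

 -- The encoding of a graph runs over pairs of indices; this lets the program run over pairs of
 -- vertices instead.
 matrix : ∀ τ (adj : ⟦ τ ⟧ → ⟦ τ ⟧ → Bool) vs →
  map (λ (i , j) → adj (lookup vs i) (lookup vs j)) (cartesianProduct (allFin (length vs)) (allFin (length vs))) ≡ map (λ (y , z) → adj y z) (cartesianProduct vs vs)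
 matrix τ adj vs = trans (product-map (lookup vs) (allFin (length vs)) (allFin (length vs))) (cong (λ l → map (λ (y , z) → adj y z) (cartesianProduct l l)) (trans (map-tabulate id (lookup vs)) (tabulate-lookup vs)))
  where
  row : ∀ {A : Set} (f : A → ⟦ τ ⟧) x ys → map (λ (i , j) → adj (f i) (f j)) (map (x ,_) ys) ≡ map (λ (y , z) → adj y z) (map (f x ,_) (map f ys))
  row f x [] = refl
  row f x (y ∷ ys) = cong (_ ∷_) (row f x ys)
  product-map : ∀ {A : Set} (f : A → ⟦ τ ⟧) xs ys → map (λ (i , j) → adj (f i) (f j)) (cartesianProduct xs ys) ≡ map (λ (y , z) → adj y z) (cartesianProduct (map f xs) (map f ys))
  product-map f [] ys = refl
  product-map f (x ∷ xs) ys = trans (map-++ _ (map (x ,_) ys) _) (trans (cong₂ _++_ (row f x ys) (product-map f xs ys)) (sym (map-++ _ (map (f x ,_) (map f ys)) _)))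

 module Reduction (R : Graph) (conn : Connected R) (r : ℕ) (reg : ∀ u → degree R u ≡ r) (2≤r : 2 ≤ r)
  (co : Core.Complement R conn r reg 2≤r) (ν : Ty) where

  open Core.Complement co using () renaming (K to Kᴿ; split to splitᴿ)
  open Core.Split splitᴿ using (triple)
  open Core.Triple triple using (a; p; b)
  open Formula ν public
  open Subdivision τ₀ arc₀ (λ {u} → arc₀-irrefl {u})
  open Gluing R conn r reg 2≤r co τ₁ arc₁ (λ {x} {y} → arc₁-asym {x} {y})
  open Tables R

  φτ : Ty
  φτ = list ν ⊗ list (ℓit ⊗ list ℓit)

  arc₀P : ∀ {Γ e f} → PT Γ τ₀ e → PT Γ τ₀ f → PT Γ 𝔹 (λ γ → arc₀ (e γ) (f γ))
  arc₀P E F = G ∘P (E ,P F)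
   where
   G : PT (τ₀ ⊗ τ₀) 𝔹 (λ (u , v) → arc₀ u v)
   G = ext (λ { (inj₁ _ , inj₁ _) → refl ; (inj₁ _ , inj₂ _) → refl ; (inj₂ _ , inj₁ _) → refl ; (inj₂ _ , inj₂ _) → refl })
    (case⊕P fstP
     (case⊕P (sndP ∘P w1) ((sndP ∘P v1 ∧P notP (sndP ∘P v0)) ∧P eqP ν (fstP ∘P v1) (fstP ∘P v0)) (constP 𝔹 false))
     (case⊕P (sndP ∘P w1) (eqP ℓit (sndP ∘P sndP ∘P v1) v0)
      (eqP nat (fstP ∘P v1) (fstP ∘P v0) ∧P ((fstP ∘P sndP ∘P v1) <ᵇP (fstP ∘P sndP ∘P v0)))))

  arc₁P : ∀ {Γ e f} → PT Γ τ₁ e → PT Γ τ₁ f → PT Γ 𝔹 (λ γ → arc₁ (e γ) (f γ))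
  arc₁P E F = G ∘P (E ,P F)
   where
   G : PT (τ₁ ⊗ τ₁) 𝔹 (λ (u , v) → arc₁ u v)
   G = ext (λ { (inj₁ _ , inj₁ _) → refl ; (inj₁ _ , inj₂ _) → refl ; (inj₂ _ , inj₁ _) → refl ; (inj₂ _ , inj₂ _) → refl })
    (case⊕P fstP
     (case⊕P (sndP ∘P w1) (constP 𝔹 false)
      (notP (sndP ∘P sndP ∘P v0) ∧P eqP τ₀ v1 (fstP ∘P v0) ∧P arc₀P (fstP ∘P v0) (fstP ∘P sndP ∘P v0)))
     (case⊕P (sndP ∘P w1)
      (sndP ∘P sndP ∘P v1 ∧P eqP τ₀ (fstP ∘P sndP ∘P v1) v0 ∧P arc₀P (fstP ∘P v1) (fstP ∘P sndP ∘P v1))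
      ((notP (sndP ∘P sndP ∘P v1) ∧P sndP ∘P sndP ∘P v0) ∧P
       (eqP τ₀ (fstP ∘P v1) (fstP ∘P v0) ∧P eqP τ₀ (fstP ∘P sndP ∘P v1) (fstP ∘P sndP ∘P v0)) ∧P
       arc₀P (fstP ∘P v1) (fstP ∘P sndP ∘P v1))))

  hasNP : ∀ {Γ e f} → PT Γ nat e → PT Γ nat f → PT Γ 𝔹 (λ γ → hasN (e γ) (f γ))
  hasNP E F = memP (nat ⊗ nat) (E ,P F) (constP (list (nat ⊗ nat)) table)

  linkP : ∀ {Γ e f} → PT Γ τ₁ e → PT Γ (τ₁ ⊗ τ₁ ⊗ nat) f → PT Γ 𝔹 (λ γ → link (e γ) (proj₁ (f γ)) (proj₁ (proj₂ (f γ))) (proj₂ (proj₂ (f γ))))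
  linkP E F = arc₁P (fstP ∘P F) (fstP ∘P sndP ∘P F) ∧P
   (eqP τ₁ E (fstP ∘P F) ∧P hasNP (constP nat (toℕ a)) (sndP ∘P sndP ∘P F) ∨P eqP τ₁ E (fstP ∘P sndP ∘P F) ∧P hasNP (constP nat (toℕ b)) (sndP ∘P sndP ∘P F))

  adjP : ∀ {Γ e f} → PT Γ υ e → PT Γ υ f → PT Γ 𝔹 (λ γ → adj (e γ) (f γ))
  adjP E F = G ∘P (E ,P F)
   where
   spokeP : ∀ {Γ f} → PT Γ (τ₁ ⊗ τ₁ ⊗ nat) f → PT Γ 𝔹 (λ γ → arc₁ (proj₁ (f γ)) (proj₁ (proj₂ (f γ))) ∧ hasN (toℕ p) (proj₂ (proj₂ (f γ))))
   spokeP F = arc₁P (fstP ∘P F) (fstP ∘P sndP ∘P F) ∧P hasNP (constP nat (toℕ p)) (sndP ∘P sndP ∘P F)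
   G : PT (υ ⊗ υ) 𝔹 (λ (y , z) → adj y z)
   G = ext (λ { (inj₁ _ , inj₁ _) → refl ; (inj₁ _ , inj₂ (inj₁ _)) → refl ; (inj₁ _ , inj₂ (inj₂ _)) → refl
    ; (inj₂ (inj₁ _) , inj₁ _) → refl ; (inj₂ (inj₁ _) , inj₂ (inj₁ _)) → refl ; (inj₂ (inj₁ _) , inj₂ (inj₂ _)) → refl
    ; (inj₂ (inj₂ _) , inj₁ _) → refl ; (inj₂ (inj₂ _) , inj₂ (inj₁ _)) → refl ; (inj₂ (inj₂ _) , inj₂ (inj₂ _)) → refl })
    (case⊕P fstP
     (case⊕P (sndP ∘P w1) (constP 𝔹 false) (case⊕P v0 (constP 𝔹 true) (spokeP v0)))
     (case⊕P v0
      (case⊕P (sndP ∘P w2) (constP 𝔹 true)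
       (case⊕P v0 ((arc₁P v2 v0 ∨P arc₁P v0 v2) ∧P hasNP (constP nat (toℕ a)) (constP nat (toℕ b))) (linkP v2 v0)))
      (case⊕P (sndP ∘P w2) (spokeP v1)
       (case⊕P v0 (linkP v0 v2)
        ((eqP τ₁ (fstP ∘P v2) (fstP ∘P v0) ∧P eqP τ₁ (fstP ∘P sndP ∘P v2) (fstP ∘P sndP ∘P v0)) ∧P
         (arc₁P (fstP ∘P v2) (fstP ∘P sndP ∘P v2) ∧P hasNP (sndP ∘P sndP ∘P v2) (sndP ∘P sndP ∘P v0)))))))

  vertices₀ : ⟦ φτ ⟧ → List ⟦ τ₀ ⟧
  vertices₀ (vars , cls) = concatMap varV vars ++ concatMap clauseV (number 0 cls)

  vertices₀P : PT φτ (list τ₀) vertices₀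
  vertices₀P = concatMapP fstP (inj₁P (v0 ,P constP 𝔹 true) ∷P inj₁P (v0 ,P constP 𝔹 false) ∷P nilP) ++P
   concatMapP (numberP sndP) (mapP (numberP (fstP ∘P sndP ∘P v0 ∷P sndP ∘P sndP ∘P v0)) (inj₂P (fstP ∘P v1 ,P v0)))

  vertices₁P : PT φτ (list τ₁) (λ φ → map inj₁ (vertices₀ φ) ++ map inj₂ (cartesianProduct (vertices₀ φ) (cartesianProduct (vertices₀ φ) (false ∷ true ∷ []))))
  vertices₁P = mapP vertices₀P (inj₁P v0) ++P mapP (productP vertices₀P (productP vertices₀P (constP (list 𝔹) (false ∷ true ∷ [])))) (inj₂P v0)

  vertices₁ : ⟦ φτ ⟧ → List ⟦ τ₁ ⟧
  vertices₁ φ = map inj₁ (vertices₀ φ) ++ map inj₂ (cartesianProduct (vertices₀ φ) (cartesianProduct (vertices₀ φ) (false ∷ true ∷ [])))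

  vertices : ⟦ φτ ⟧ → List ⟦ υ ⟧
  vertices φ = inj₁ tt ∷ map (λ x → inj₂ (inj₁ x)) (vertices₁ φ) ++ map (λ t → inj₂ (inj₂ t)) (cartesianProduct (vertices₁ φ) (cartesianProduct (vertices₁ φ) (map toℕ Kᴿ)))

  verticesP : PT φτ (list υ) vertices
  verticesP = inj₁P (constP 𝟙 tt) ∷P mapP vertices₁P (inj₂P (inj₁P v0)) ++P
   mapP (productP vertices₁P (productP vertices₁P (constP (list nat) (map toℕ Kᴿ)))) (inj₂P (inj₂P v0))

  arcCount : ⟦ φτ ⟧ → ℕ
  arcCount φ = length (filterᵇ (λ (u , v) → arc₀ u v) (cartesianProduct (vertices₀ φ) (vertices₀ φ)))

  budget : ⟦ φτ ⟧ → ℕ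
  budget φ = length (proj₁ φ) + length (concatMap proj₂ (proj₂ φ)) + arcCount φ

  budgetP : PT φτ nat budget
  budgetP = lengthP fstP +P lengthP (concatMapP sndP (sndP ∘P v0)) +P lengthP (filterP (productP vertices₀P vertices₀P) (arc₀P (fstP ∘P v0) (sndP ∘P v0)))

  graph : ⟦ φτ ⟧ → Graph
  graph φ = ListGraph.listGraph υ adj adj-sym adj-irrefl (vertices φ)

  instance′ : ⟦ φτ ⟧ → Graph × ℕ
  instance′ φ = graph φ , budget φ

  word : ⟦ φτ ⟧ → Word
  word φ = Problem.encode (R -freeEdgeDeletion) (instance′ φ)

  wordP : PT φτ (list 𝔹) word
  wordP = ext (λ φ → cong (λ m → ⟨ encodeℕᵇ (fromℕ (budget φ)) , ⟨ unary (length (vertices φ)) , m ⟩ ⟩) (sym (matrix υ adj (vertices φ))))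
   (pairP (binaryP budgetP) (pairP (unaryP (lengthP verticesP)) (mapP (productP verticesP verticesP) (adjP (fstP ∘P v0) (sndP ∘P v0)))))

  correct : ∀ φ → WellFormed (proj₁ φ) (proj₂ φ) → Sat (proj₂ φ) ⇔ Problem.Yes (R -freeEdgeDeletion) (instance′ φ)
  correct φ@(vars , cls) wf = mk⇔ to from
   where
   U₀u = U₀-unique vars cls wf
   U₁u = U₁-unique (U₀ vars cls wf) U₀u
   to : Sat cls → Problem.Yes (R -freeEdgeDeletion) (instance′ φ)
   to sat with C , le , cov ← subdivide (U₀ vars cls wf) U₀u (sat⇒cover vars cls wf sat) =
    Converse.cover⇒deletion R conn r reg 2≤r co τ₁ arc₁ (λ {x} {y} → arc₁-asym {x} {y}) (vertices₁ φ) U₁u (λ {x} {y} {z} → no-triangle {x} {y} {z}) C cov le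
   from : Problem.Yes (R -freeEdgeDeletion) (instance′ φ) → Sat cls
   from yes = cover⇒sat vars cls wf (contract (U₀ vars cls wf) U₀u (Instance′.deletion⇒cover (vertices₁ φ) U₁u yes))

  -- A clause of width w contributes at most w arcs to literals and w² arcs between its corners.
  budget-≤ : ∀ φ → WellFormed (proj₁ φ) (proj₂ φ) → (∀ {c} → c ∈ proj₂ φ → length (lits c) ≤ 3) → budget φ ≤ 2 * length (proj₁ φ) + 15 * length (proj₂ φ)
  budget-≤ φ@(vars , cls) wf narrow = ≤-trans (+-mono-≤ (+-monoʳ-≤ (length vars) heads) arcs≤) (≤-reflexive (arith (length vars) (length cls)))
   where
   open import Data.Nat.Tactic.RingSolver using (solve-∀)
   -- n counts the variables and once more their arcs; for each clause, 3 bounds the corners that it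
   -- costs and 12 = 3 + 3 · 3 its arcs.
   arith : ∀ n m → n + 3 * m + (n + 12 * m) ≡ 2 * n + 15 * m
   arith = solve-∀
   bounded : ∀ {A : Set} k c (g : A → List ⟦ τ₀ ⊗ τ₀ ⟧) xs → (∀ {x} → x ∈ xs → length (g x) ≤ c) → k ≡ length xs → length (concatMap g xs) ≤ c * k
   bounded .0 c g [] le refl = z≤n
   bounded .(suc (length xs)) c g (x ∷ xs) le refl = ≤-trans (≤-reflexive (length-++ (g x))) (≤-trans (+-mono-≤ (le (here refl)) (bounded _ c g xs (le ∘ there) refl)) (≤-reflexive (sym (*-suc c (length xs)))))
   heads : length (concatMap proj₂ cls) ≤ 3 * length cls
   heads = go cls narrow
    where
    go : ∀ ds → (∀ {c} → c ∈ ds → length (lits c) ≤ 3) → length (concatMap proj₂ ds) ≤ 3 * length ds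
    go [] le = z≤n
    go (c ∷ ds) le = ≤-trans (≤-reflexive (length-++ (proj₂ c))) (≤-trans (+-mono-≤ (≤-trans (n≤1+n _) (le (here refl))) (go ds (le ∘ there))) (≤-reflexive (sym (*-suc 3 (length ds)))))
   opposite : ⟦ ν ⟧ → ⟦ τ₀ ⊗ τ₀ ⟧
   opposite x = inj₁ (x , true) , inj₁ (x , false)
   toLit : ℕ → ℕ × Lit → ⟦ τ₀ ⊗ τ₀ ⟧
   toLit j il = corner j il , inj₁ (proj₂ il)
   inner : ℕ × Cl → List ⟦ τ₀ ⊗ τ₀ ⟧
   inner jc = map (toLit (proj₁ jc)) (number 0 (lits (proj₂ jc))) ++ cartesianProduct (clauseV jc) (clauseV jc)
   L : List ⟦ τ₀ ⊗ τ₀ ⟧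
   L = map opposite vars ++ concatMap inner (number 0 cls)
   sub : arcs (U₀ vars cls wf) (U₀-unique vars cls wf) ⊆ L
   sub {u , v} m with (u∈ , v∈) , t ← arcs⁻ (U₀ vars cls wf) (U₀-unique vars cls wf) m = go u v u∈ v∈ t
    where
    go : ∀ u v → u ∈ U₀ vars cls wf → v ∈ U₀ vars cls wf → T (arc₀ u v) → (u , v) ∈ L
    go (inj₁ (x , true)) (inj₁ (y , false)) u∈ v∈ t with refl ← T-eq {ν} {x} {y} t = ∈-++⁺ˡ (∈-map⁺ opposite (U₀-inj₁ vars cls wf u∈))
    go (inj₂ (j , i , l)) (inj₁ l′) u∈ v∈ t with refl ← T-eq {ℓit} {l} {l′} t with c , p , q ← U₀-inj₂ vars cls wf u∈ =
     ∈-++⁺ʳ (map opposite vars) (∈-concatMap inner p (∈-++⁺ˡ (∈-map⁺ (toLit j) q)))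
    go (inj₂ (j , i , l)) (inj₂ (j′ , i′ , l′)) u∈ v∈ t with refl ← T-eq {nat} {j} {j′} (T-∧₁ t)
     with c , p , q ← U₀-inj₂ vars cls wf u∈ | c′ , p′ , q′ ← U₀-inj₂ vars cls wf v∈ with refl ← number-functional 0 cls p p′ =
     ∈-++⁺ʳ (map opposite vars) (∈-concatMap inner p (∈-++⁺ʳ (map (toLit j) (number 0 (lits c))) (∈-cartesianProduct⁺ (∈-map⁺ (corner j) q) (∈-map⁺ (corner j) q′))))
   inner≤ : ∀ {jc} → jc ∈ number 0 cls → length (inner jc) ≤ 12
   inner≤ {j , c} m = ≤-trans (≤-reflexive (trans (length-++ (map (toLit j) (number 0 (lits c)))) (cong₂ _+_ (length-map (toLit j) (number 0 (lits c))) (length-product (clauseV (j , c)) (clauseV (j , c))))))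
    (+-mono-≤ w (*-mono-≤ w′ w′))
    where
    w : length (number 0 (lits c)) ≤ 3
    w = ≤-trans (≤-reflexive (length-number 0 (lits c))) (narrow (number-∈ 0 cls m))
    w′ : length (clauseV (j , c)) ≤ 3
    w′ = ≤-trans (≤-reflexive (length-map (corner j) (number 0 (lits c)))) w
   arcs≤ : arcCount φ ≤ length vars + 12 * length cls
   arcs≤ = ≤-trans (unique-⊆-length (arcs-unique (U₀ vars cls wf) (U₀-unique vars cls wf)) sub)
    (≤-trans (≤-reflexive (length-++ (map opposite vars))) (+-mono-≤ (≤-reflexive (length-map opposite vars)) (bounded (length cls) 12 inner (number 0 cls) inner≤ (sym (length-number 0 cls)))))

-- Membership in NP

module Membership where

 open import Data.Bool using (T)
 open import Data.Fin.Properties using (toℕ-fromℕ<)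
 open import Data.List using (lookup; foldr; applyUpTo; tabulate; drop)
 open import Data.List.Properties
 open import Data.List.Membership.Propositional.Properties
 import Data.List.Relation.Unary.All as All
 open import Data.Nat.Binary using (toℕ)
 import Data.Nat.Binary as ℕᵇ
 open import Data.Nat.Binary.Properties using (fromℕ-toℕ; toℕ-fromℕ)
 open import Data.Nat.Properties
 open import Relation.Nullary using (yes; no)
 open Programs hiding (M; A; B)
 open PolynomialTime
 open RegularGraphs
 open GluedCopies
 open FormulaToGraph using (pairP; unaryP)

 open Graph using (order; edges; Vertex; Adj)

 private
  toN : ∀ {n} → Fin n → ℕ
  toN = Data.Fin.toℕ

 Scan : Set
 Scan = (Bool × Bool) × (List Bool × List Bool)

 -- `pending` means that a data bit has been announced, `done` that the separator has been read. A
 -- word that is no pair still gives some result; `check` later compares with the true encoding.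
 unpairStep : Scan → Bool → Scan
 unpairStep ((done , pending) , (w , v)) b =
  if done then ((done , pending) , (w , b ∷ v))
  else if pending then ((false , false) , (b ∷ w , v))
  else ((not b , b) , (w , v))

 unpair : Word → Word × Word
 unpair x = let _ , (w , v) = foldl unpairStep ((false , false) , ([] , [])) x in reverse w , reverse v

 unpair-pair : ∀ w v → unpair ⟨ w , v ⟩ ≡ (w , v)
 unpair-pair w v = trans (cong fin (go w [])) (cong₂ _,_ (back w) (back v))
  where
  fin : Scan → Word × Word
  fin (_ , (w , v)) = reverse w , reverse v
  rest : ∀ v w acc → foldl unpairStep ((true , false) , (w , acc)) v ≡ ((true , false) , (w , v ʳ++ acc))
  rest [] w acc = refl
  rest (b ∷ v) w acc = rest v w (b ∷ acc)
  go : ∀ w acc → foldl unpairStep ((false , false) , (acc , [])) ⟨ w , v ⟩ ≡ ((true , false) , (w ʳ++ acc , v ʳ++ []))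
  go [] acc = rest v acc []
  go (b ∷ w) acc = go w (b ∷ acc)
  back : ∀ (w : Word) → reverse (w ʳ++ []) ≡ w
  back w = reverse-involutive w

 unpairP : PT (list 𝔹) (list 𝔹 ⊗ list 𝔹) unpair
 unpairP = letP (foldP⁺ idP (constP σ ((false , false) , ([] , []))) S (K 2) bound) (reverseP (fstP ∘P sndP ∘P v0) ,P reverseP (sndP ∘P sndP ∘P v0))
  where
  σ = (𝔹 ⊗ 𝔹) ⊗ (list 𝔹 ⊗ list 𝔹)
  S : PT (𝔹 ⊗ σ ⊗ list 𝔹) σ (λ (b , acc , _) → unpairStep acc b)
  S = ifP (fstP ∘P fstP ∘P v1) (fstP ∘P v1 ,P (fstP ∘P sndP ∘P v1 ,P (v0 ∷P (sndP ∘P sndP ∘P v1))))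
   (ifP (sndP ∘P fstP ∘P v1) (constP (𝔹 ⊗ 𝔹) (false , false) ,P ((v0 ∷P (fstP ∘P sndP ∘P v1)) ,P (sndP ∘P sndP ∘P v1)))
    ((notP v0 ,P v0) ,P (sndP ∘P v1)))
  bound : ∀ γ b acc → size σ (unpairStep acc b) ≤ size σ acc + 2
  bound γ b ((true , p) , (w , v)) = ≤-reflexive (trans (cong (λ s → 2 + s) (trans (+-suc _ _) (cong suc (+-suc _ _)))) (+-comm 2 _))
  bound γ b ((false , true) , (w , v)) = ≤-reflexive (+-comm 2 _)
  bound γ b ((false , false) , (w , v)) = m≤m+n _ 2

 decodeᵇ : Word → ℕᵇ
 decodeᵇ [] = ℕᵇ.zero
 decodeᵇ (false ∷ w) = 1+[2 decodeᵇ w ]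
 decodeᵇ (true ∷ w) = 2[1+ decodeᵇ w ]

 encode-decode : ∀ w → encodeℕᵇ (decodeᵇ w) ≡ w
 encode-decode [] = refl
 encode-decode (false ∷ w) = cong (false ∷_) (encode-decode w)
 encode-decode (true ∷ w) = cong (true ∷_) (encode-decode w)

 decode-encode : ∀ n → decodeᵇ (encodeℕᵇ n) ≡ n
 decode-encode ℕᵇ.zero = refl
 decode-encode 2[1+ n ] = cong 2[1+_] (decode-encode n)
 decode-encode 1+[2 n ] = cong 1+[2_] (decode-encode n)

 valueStep : ℕ → Bool → ℕ → ℕ
 valueStep N b acc = N ⊓ ((if b then 2 else 1) + (acc + acc))

 -- the number written in binary, but at most N
 capped : ℕ → Word → ℕ
 capped N w = foldl (λ acc b → valueStep N b acc) 0 (reverse w)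

 -- The number k is written in binary and may be exponentially large, but it is only compared with
 -- the number of deleted edges. Truncating after each digit is compatible with doubling, so the
 -- outcome is the minimum.
 capped-≡ : ∀ N w → capped N w ≡ N ⊓ toℕ (decodeᵇ w)
 capped-≡ N w = trans (reverse-foldl _ 0 w) (go w)
  where
  cap : ∀ c v → N ⊓ (suc c + (N ⊓ v + N ⊓ v)) ≡ N ⊓ (suc c + (v + v))
  cap c v with ≤-total v N
  ... | inj₁ le rewrite m≥n⇒m⊓n≡n le = refl
  ... | inj₂ ge rewrite m≤n⇒m⊓n≡m ge = trans (m≤n⇒m⊓n≡m (≤-trans (m≤m+n N N) (m≤n+m (N + N) (suc c))))
   (sym (m≤n⇒m⊓n≡m (≤-trans ge (≤-trans (m≤m+n v v) (m≤n+m (v + v) (suc c))))))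
  double : ∀ v → v + v ≡ 2 * v
  double v = cong (v +_) (sym (+-identityʳ v))
  go : ∀ w → foldr (λ b acc → valueStep N b acc) 0 w ≡ N ⊓ toℕ (decodeᵇ w)
  go [] = sym (⊓-zeroʳ N)
  go (false ∷ w) rewrite go w = trans (cap 0 (toℕ (decodeᵇ w))) (cong (λ z → N ⊓ suc z) (double (toℕ (decodeᵇ w))))
  go (true ∷ w) rewrite go w = trans (cap 1 (toℕ (decodeᵇ w))) (cong (N ⊓_) (trans (cong (2 +_) (double (toℕ (decodeᵇ w)))) (sym (*-suc 2 (toℕ (decodeᵇ w))))))

 cappedP : ∀ {Γ e f} → PT Γ nat e → PT Γ (list 𝔹) f → PT Γ nat (λ γ → capped (e γ) (f γ))
 cappedP {Γ} {e} E F = foldP⁺ (reverseP F) (constP nat 0) ((E ∘P w2) ⊓P (ifP v0 (constP nat 2) (constP nat 1) +P (v1 +P v1))) (PT.growth E)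
  (λ γ b acc → ≤-trans (s≤s (m⊓n≤m (e γ) _)) (≤-trans (PT.grow E γ) (≤-trans (⟪⟫-mono (PT.growth E) (n≤1+n (size Γ γ))) (m≤n+m _ (suc acc)))))

 nth : ∀ {A : Set} → A → List A → ℕ → A
 nth d xs i = caseList (drop i xs) d (λ x _ → x)

 nthP : ∀ {Γ τ e f} (d : ⟦ τ ⟧) → PT Γ (list τ) e → PT Γ nat f → PT Γ τ (λ γ → nth d (e γ) (f γ))
 nthP {τ = τ} d E F = caseListP (dropP F E) (constP τ d) v0

 nth-lookup : ∀ {A : Set} (d : A) xs i → nth d xs (toN i) ≡ lookup xs i
 nth-lookup d (x ∷ xs) zero = refl
 nth-lookup d (x ∷ xs) (suc i) = nth-lookup d xs i

 nth-++ : ∀ {A : Set} (d : A) xs {ys} i → i < length xs → nth d (xs ++ ys) i ≡ nth d xs i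
 nth-++ d (x ∷ xs) zero lt = refl
 nth-++ d (x ∷ xs) (suc i) (s≤s lt) = nth-++ d xs i lt

 nth-map-row : ∀ {A B C : Set} (d : C) (h : A × B → C) x ys j → nth d (map h (map (x ,_) ys)) (toN j) ≡ h (x , lookup ys j)
 nth-map-row d h x (y ∷ ys) zero = refl
 nth-map-row d h x (y ∷ ys) (suc j) = nth-map-row d h x ys j

 nth-product : ∀ {A B C : Set} (d : C) (h : A × B → C) xs ys i j →
  nth d (map h (cartesianProduct xs ys)) (toN i * length ys + toN j) ≡ h (lookup xs i , lookup ys j)
 nth-product d h (x ∷ xs) ys zero j = trans (cong (λ l → nth d l (toN j)) (map-++ h (map (x ,_) ys) _))
  (trans (nth-++ d (map h (map (x ,_) ys)) (toN j) (≤-trans (toℕ<n j) (≤-reflexive (sym (trans (length-map h (map (x ,_) ys)) (length-map (x ,_) ys)))))) (nth-map-row d h x ys j))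
 nth-product d h (x ∷ xs) ys (suc i) j = trans (cong (λ l → caseList l d (λ x _ → x)) eq) (nth-product d h xs ys i j)
  where
  eq : drop (length ys + toN i * length ys + toN j) (map h (map (x ,_) ys ++ cartesianProduct xs ys)) ≡ drop (toN i * length ys + toN j) (map h (cartesianProduct xs ys))
  eq = trans (cong₂ drop (+-assoc (length ys) (toN i * length ys) (toN j)) (map-++ h (map (x ,_) ys) _))
   (trans (sym (drop-drop (length ys) _ _)) (cong (drop (toN i * length ys + toN j))
    (trans (cong (λ l → drop l (map h (map (x ,_) ys) ++ map h (cartesianProduct xs ys))) (sym (trans (length-map h (map (x ,_) ys)) (length-map (x ,_) ys)))) (drop-prefix (map h (map (x ,_) ys))))))
   where
   drop-prefix : ∀ {A : Set} (xs : List A) {ys} → drop (length xs) (xs ++ ys) ≡ ys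
   drop-prefix [] = refl
   drop-prefix (x ∷ xs) = drop-prefix xs

 -- entry (i , j) of a symmetric matrix read above the diagonal
 entry : Word → ℕ → ℕ → ℕ → Bool
 entry m n i j = if i <ᵇ j then nth false m (i * n + j) else (if j <ᵇ i then nth false m (j * n + i) else false)

 entryP : ∀ {Γ e f g h} → PT Γ (list 𝔹) e → PT Γ nat f → PT Γ nat g → PT Γ nat h → PT Γ 𝔹 (λ γ → entry (e γ) (f γ) (g γ) (h γ))
 entryP E F G H = ifP (G <ᵇP H) (nthP false E (G *P F +P H)) (ifP (H <ᵇP G) (nthP false E (H *P F +P G)) (constP 𝔹 false))

 <ᵇ-asym : ∀ i j → T (i <ᵇ j) → (j <ᵇ i) ≡ false
 <ᵇ-asym i j t = ¬T-false (λ s → <-asym (<ᵇ⇒< i j t) (<ᵇ⇒< j i s))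

 entry-sym : ∀ m n i j → entry m n i j ≡ entry m n j i
 entry-sym m n i j with i <ᵇ j in eq | j <ᵇ i in eq′
 ... | false | false = refl
 ... | false | true = refl
 ... | true | false = refl
 ... | true | true with () ← trans (sym eq′) (<ᵇ-asym i j (subst T (sym eq) tt))

 entry-irrefl : ∀ m n i → entry m n i i ≡ false
 entry-irrefl m n i rewrite ¬T-false {i <ᵇ i} (λ t → <-irrefl refl (<ᵇ⇒< i i t)) = refl

 module _ {n : ℕ} where

  pairsFin : List (Fin n × Fin n)
  pairsFin = cartesianProduct (allFin n) (allFin n)

  fullMatrix : (Fin n → Fin n → Bool) → Word
  fullMatrix h = map (λ (u , v) → h u v) pairsFin

  decoded : Word → EdgeSet n
  decoded m = record { has = λ u v → entry m n (toN u) (toN v) ; sym = λ u v → entry-sym m n (toN u) (toN v) ; irrefl = λ u → entry-irrefl m n (toN u) }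

  private
   cast′ : Fin n → Fin (length (allFin n))
   cast′ = Data.Fin.cast (sym (length-tabulate id))

   index-toℕ : ∀ u → toN (cast′ u) ≡ toN u
   index-toℕ u = Data.Fin.Properties.toℕ-cast _ u

   look : ∀ u → lookup (allFin n) (cast′ u) ≡ u
   look u = lookup-tabulate id u

  nth-matrix : ∀ (h : Fin n → Fin n → Bool) u v → nth false (fullMatrix h) (toN u * n + toN v) ≡ h u v
  nth-matrix h u v = trans (cong (λ l → nth false (fullMatrix h) (toN u * l + toN v)) (sym (length-tabulate {n = n} id)))
   (trans (cong₂ (λ i j → nth false (fullMatrix h) (i * length (allFin n) + j)) (sym (index-toℕ u)) (sym (index-toℕ v)))
    (trans (nth-product false (λ (u , v) → h u v) (allFin n) (allFin n) (cast′ u) (cast′ v)) (cong₂ h (look u) (look v))))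

  entry-matrix : ∀ (E : EdgeSet n) u v → entry (fullMatrix (has E)) n (toN u) (toN v) ≡ has E u v
  entry-matrix E u v with toN u <ᵇ toN v in eq | toN v <ᵇ toN u in eq′
  ... | true | _ = nth-matrix (has E) u v
  ... | false | true = trans (nth-matrix (has E) v u) (EdgeSet.sym E v u)
  ... | false | false = trans (sym (EdgeSet.irrefl E u)) (cong (has E u) (toℕ-injective {i = u} {v} same))
   where
   same : toN u ≡ toN v
   same with <-cmp (toN u) (toN v)
   ... | tri< lt _ _ with () ← trans (sym eq) (Equivalence.to T-≡ (<⇒<ᵇ lt))
   ... | tri≈ _ e _ = e
   ... | tri> _ _ gt with () ← trans (sym eq′) (Equivalence.to T-≡ (<⇒<ᵇ gt))

 upTo-allFin : ∀ n → map toN (allFin n) ≡ upTo n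
 upTo-allFin n = trans (map-tabulate id toN) (go id n)
  where
  go : ∀ {A : Set} (f : ℕ → A) n → tabulate (λ (i : Fin n) → f (toN i)) ≡ applyUpTo f n
  go f zero = refl
  go f (suc n) = cong (f 0 ∷_) (go (f ∘ suc) n)

 pairs-upTo : ∀ n → map (λ (u , v) → toN u , toN v) (cartesianProduct (allFin n) (allFin n)) ≡ cartesianProduct (upTo n) (upTo n)
 pairs-upTo n = trans (go (allFin n) (allFin n)) (cong (λ l → cartesianProduct l l) (upTo-allFin n))
  where
  row : ∀ (u : Fin n) (ys : List (Fin n)) → map (λ (u , v) → toN u , toN v) (map (u ,_) ys) ≡ map (toN u ,_) (map toN ys)
  row u [] = refl
  row u (y ∷ ys) = cong (_ ∷_) (row u ys)
  go : ∀ (xs ys : List (Fin n)) → map (λ (u , v) → toN u , toN v) (cartesianProduct xs ys) ≡ cartesianProduct (map toN xs) (map toN ys)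
  go [] ys = refl
  go (x ∷ xs) ys = trans (map-++ _ (map (x ,_) ys) _) (cong₂ _++_ (row x ys) (go xs ys))

 filter-map-length : ∀ {A B : Set} (g : A → B) (q : B → Bool) xs → length (filterᵇ (q ∘ g) xs) ≡ length (filterᵇ q (map g xs))
 filter-map-length g q [] = refl
 filter-map-length g q (x ∷ xs) with q (g x)
 ... | true = cong suc (filter-map-length g q xs)
 ... | false = filter-map-length g q xs

 -- s will be the order of R, a constant, so the number n^s of tuples is polynomial and all of them
 -- can be tried.
 tuples : ℕ → ℕ → List (List ℕ)
 tuples zero n = [ [] ]
 tuples (suc s) n = concatMap (λ t → map (λ i → i ∷ t) (upTo n)) (tuples s n)

 tuplesP : ∀ {Γ e} s → PT Γ nat e → PT Γ (list (list nat)) (λ γ → tuples s (e γ))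
 tuplesP zero E = constP (list (list nat)) [ [] ]
 tuplesP (suc s) E = concatMapP (tuplesP s E) (mapP (upToP (E ∘P w1)) (v0 ∷P v1))

 tuples⁺ : ∀ {n} t → (∀ {i} → i ∈ t → i < n) → t ∈ tuples (length t) n
 tuples⁺ [] lt = here refl
 tuples⁺ {n} (i ∷ t) lt = ∈-concatMap _ (tuples⁺ t (lt ∘ there)) (∈-map⁺ (_∷ t) (∈-upTo⁺ (lt (here refl))))

 tuples⁻ : ∀ s {n t} → t ∈ tuples s n → (∀ {i} → i ∈ t → i < n) × length t ≡ s
 tuples⁻ zero (here refl) = (λ ()) , refl
 tuples⁻ (suc s) {n} m with t , t∈ , q ← find (∈-concatMap⁻ (λ t → map (λ i → i ∷ t) (upTo n)) {xs = tuples s n} m)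
  with i , i∈ , refl ← ∈-map⁻ (_∷ t) q with lt , len ← tuples⁻ s t∈ = (λ { (here refl) → ∈-upTo⁻ i∈ ; (there p) → lt p }) , cong suc len

 module Verifier (R : Graph) where

  table′ : List (ℕ × ℕ × Bool)
  table′ = map (λ (u , v) → toN u , toN v , has (edges R) u v) (cartesianProduct (allFin (order R)) (allFin (order R)))

  at-tuple : List ℕ → ℕ → ℕ
  at-tuple = nth 0

  rowOK : (ℕ → ℕ → Bool) → List ℕ → ℕ × ℕ × Bool → Bool
  rowOK A t (a , b , h) = eqᵇ 𝔹 h (A (at-tuple t a) (at-tuple t b)) ∧ (eqᵇ nat a b ∨ not (eqᵇ nat (at-tuple t a) (at-tuple t b)))

  copyIn : (ℕ → ℕ → Bool) → ℕ → Bool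
  copyIn A n = any (λ t → all (rowOK A t) table′) (tuples (order R) n)

  module _ (G : Graph) (A : ℕ → ℕ → Bool) (A-has : ∀ u v → A (toN u) (toN v) ≡ has (edges G) u v) where

   private
    VR = Vertex R

   copy⇒embedding : T (copyIn A (order G)) → Embedding R G
   copy⇒embedding c with t , t∈ , ok ← find (any⁻ (λ t → all (rowOK A t) table′) (tuples (order R) (order G)) c) = f , f-inj , f-adj
    where
    inside = tuples⁻ (order R) t∈
    cast″ : VR → Fin (length t)
    cast″ = Data.Fin.cast (sym (proj₂ inside))
    at-eq : ∀ u → at-tuple t (toN u) ≡ lookup t (cast″ u)
    at-eq u = trans (cong (at-tuple t) (sym (Data.Fin.Properties.toℕ-cast _ u))) (nth-lookup 0 t (cast″ u))
    lt : ∀ u → at-tuple t (toN u) < order G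
    lt u = subst (_< order G) (sym (at-eq u)) (proj₁ inside (∈-lookup (cast″ u)))
    f : VR → Vertex G
    f u = fromℕ< (lt u)
    f-at : ∀ u → toN (f u) ≡ at-tuple t (toN u)
    f-at u = toℕ-fromℕ< (lt u)
    row : ∀ u v → T (rowOK A t (toN u , toN v , has (edges R) u v))
    row u v = All.lookup (all⁺ (rowOK A t) table′ ok) (∈-map⁺ (λ (u , v) → toN u , toN v , has (edges R) u v) (∈-cartesianProduct⁺ (∈-allFin u) (∈-allFin v)))
    f-adj : ∀ u v → has (edges R) u v ≡ has (edges G) (f u) (f v)
    f-adj u v = trans (T-eq {𝔹} (T-∧₁ (row u v))) (trans (cong₂ A (sym (f-at u)) (sym (f-at v))) (A-has (f u) (f v)))
    f-inj : ∀ {u v} → f u ≡ f v → u ≡ v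
    f-inj {u} {v} eq with Equivalence.to (T-∨ {eqᵇ nat (toN u) (toN v)}) (T-∧₂ (eqᵇ 𝔹 (has (edges R) u v) (A (at-tuple t (toN u)) (at-tuple t (toN v)))) (row u v))
    ... | inj₁ e = toℕ-injective (T-eq {nat} e)
    ... | inj₂ n = ⊥-elim (T-not n (subst (λ z → T (eqᵇ nat (at-tuple t (toN u)) z)) (trans (sym (f-at u)) (trans (cong toN eq) (f-at v))) (eq-T nat _)))

   embedding⇒copy : Embedding R G → T (copyIn A (order G))
   embedding⇒copy (f , f-inj , f-adj) = any⁺ (λ t → all (rowOK A t) table′) (lose t∈ (all⁻ (rowOK A t) (All.tabulate λ m → ok _ m)))
    where
    t : List ℕ
    t = map (toN ∘ f) (allFin (order R))
    len : length t ≡ order R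
    len = trans (length-map (toN ∘ f) (allFin (order R))) (length-tabulate {n = order R} id)
    t∈ : t ∈ tuples (order R) (order G)
    t∈ = subst (λ s → t ∈ tuples s (order G)) len (tuples⁺ t (λ m → let u , _ , e = ∈-map⁻ (toN ∘ f) m in subst (_< order G) (sym e) (toℕ<n (f u))))
    at-eq : ∀ u → at-tuple t (toN u) ≡ toN (f u)
    at-eq u = trans (cong (λ l → at-tuple l (toN u)) (map-tabulate id (toN ∘ f))) (go (order R) (toN ∘ f) u)
     where
     go : ∀ n (g : Fin n → ℕ) u → at-tuple (tabulate g) (toN u) ≡ g u
     go (suc n) g zero = refl
     go (suc n) g (suc u) = go n (g ∘ suc) u
    ok : ∀ x → x ∈ table′ → T (rowOK A t x)
    ok x m with (u , v) , _ , refl ← ∈-map⁻ (λ (u , v) → toN u , toN v , has (edges R) u v) m =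
     ∧-T (subst (λ z → T (eqᵇ 𝔹 (has (edges R) u v) z)) (trans (f-adj u v) (sym (trans (cong₂ A (at-eq u) (at-eq v)) (A-has (f u) (f v))))) (eq-T 𝔹 _)) distinct
     where
     distinct : T (eqᵇ nat (toN u) (toN v) ∨ not (eqᵇ nat (at-tuple t (toN u)) (at-tuple t (toN v))))
     distinct with dec nat (toN u) (toN v)
     ... | yes e = T-∨₁ (subst (λ z → T (eqᵇ nat (toN u) z)) e (eq-T nat (toN u)))
     ... | no ne = T-∨₂ (eqᵇ nat (toN u) (toN v)) (¬T-not (λ h → ne (cong toN (f-inj (toℕ-injective (trans (sym (at-eq u)) (trans (T-eq {nat} h) (at-eq v))))))))

  E-of F-of rest-of : Word → Word → ℕ → ℕ → ℕ → Bool
  E-of m v n i j = entry m n i j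
  F-of m v n i j = entry m n i j ∧ entry v n i j
  rest-of m v n i j = E-of m v n i j ∧ not (F-of m v n i j)

  count : Word → Word → ℕ → ℕ
  count m v n = length (filterᵇ (λ (i , j) → (i <ᵇ j) ∧ F-of m v n i j) (cartesianProduct (upTo n) (upTo n)))

  -- Well-formedness is tested by encoding again: w is compared with the encoding of what was
  -- decoded from it. The certificate is any word, read as a matrix and intersected with the edges,
  -- so it always names a legal set of deletions.
  check : Word → Word → Word → Word → Word → Bool
  check w kw uw m v =
   let n = length uw ; c = count m v n in
   eqWord w ⟨ kw , ⟨ unary n , map (λ (i , j) → entry m n i j) (cartesianProduct (upTo n) (upTo n)) ⟩ ⟩
   ∧ ((c ≤ᵇ capped c kw) ∧ not (copyIn (rest-of m v n) n))

  check₂ : Word → Word → Word → Word × Word → Bool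
  check₂ w v kw (uw , m) = check w kw uw m v

  check₁ : Word → Word → Word × Word → Bool
  check₁ w v (kw , gw) = check₂ w v kw (unpair gw)

  check₀ : Word × Word → Bool
  check₀ (w , v) = check₁ w v (unpair w)

  verify : Word → Bool
  verify x = check₀ (unpair x)

  verifyP : PT (list 𝔹) 𝔹 verify
  verifyP = checkP ∘P ((wP ,P kwP ,P (fstP ∘P gP ,P sndP ∘P gP ,P sndP ∘P unpairP)))
   where
   wP = fstP ∘P unpairP
   kwP = fstP ∘P (unpairP ∘P wP)
   gP = unpairP ∘P (sndP ∘P (unpairP ∘P wP))
   Γ = list 𝔹 ⊗ list 𝔹 ⊗ list 𝔹 ⊗ list 𝔹 ⊗ list 𝔹
   F-ofP : ∀ {Δ m v n i j} → PT Δ (list 𝔹) m → PT Δ (list 𝔹) v → PT Δ nat n → PT Δ nat i → PT Δ nat j → PT Δ 𝔹 (λ δ → F-of (m δ) (v δ) (n δ) (i δ) (j δ))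
   F-ofP M V N I J = entryP M N I J ∧P entryP V N I J
   countP : ∀ {Δ m v n} → PT Δ (list 𝔹) m → PT Δ (list 𝔹) v → PT Δ nat n → PT Δ nat (λ δ → count (m δ) (v δ) (n δ))
   countP M V N = lengthP (filterP (productP (upToP N) (upToP N)) (((fstP ∘P v0) <ᵇP (sndP ∘P v0)) ∧P F-ofP (M ∘P w1) (V ∘P w1) (N ∘P w1) (fstP ∘P v0) (sndP ∘P v0)))
   copyP : ∀ {Δ m v n} → PT Δ (list 𝔹) m → PT Δ (list 𝔹) v → PT Δ nat n → PT Δ 𝔹 (λ δ → copyIn (rest-of (m δ) (v δ) (n δ)) (n δ))
   copyP M V N = anyP (tuplesP (order R) N) (allP (constP (list (nat ⊗ nat ⊗ 𝔹)) table′)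
    (eqP 𝔹 (sndP ∘P sndP ∘P v0) (entryP (M ∘P w2) (N ∘P w2) x y ∧P notP (F-ofP (M ∘P w2) (V ∘P w2) (N ∘P w2) x y)) ∧P (eqP nat (fstP ∘P v0) (fstP ∘P sndP ∘P v0) ∨P notP (eqP nat x y))))
    where
    x : ∀ {Δ} → PT ((nat ⊗ nat ⊗ 𝔹) ⊗ list nat ⊗ Δ) nat (λ ((a , _) , t , _) → at-tuple t a)
    x = nthP 0 v1 (fstP ∘P v0)
    y : ∀ {Δ} → PT ((nat ⊗ nat ⊗ 𝔹) ⊗ list nat ⊗ Δ) nat (λ ((_ , b , _) , t , _) → at-tuple t b)
    y = nthP 0 v1 (fstP ∘P sndP ∘P v0)
   nP : PT Γ nat (λ (_ , _ , uw , _) → length uw)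
   nP = lengthP v2
   mP : PT Γ (list 𝔹) (λ (_ , _ , _ , m , _) → m)
   mP = v0 ∘P w3
   vP : PT Γ (list 𝔹) (λ (_ , _ , _ , _ , v) → v)
   vP = w1 ∘P w3
   checkP : PT Γ 𝔹 (λ (w , kw , uw , m , v) → check w kw uw m v)
   checkP = eqWordP v0 (pairP v1 (pairP (unaryP nP) (mapP (productP (upToP nP) (upToP nP)) (entryP (mP ∘P w1) (nP ∘P w1) (fstP ∘P v0) (sndP ∘P v0)))))
    ∧P ((countP mP vP nP ≤ᵇP cappedP (countP mP vP nP) v1) ∧P notP (copyP mP vP nP))

  private
   enc = Problem.encode (R -freeEdgeDeletion)

  pointwise-matrix : ∀ n m → map (λ (i , j) → entry m n i j) (cartesianProduct (upTo n) (upTo n)) ≡ fullMatrix (has (decoded {n} m))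
  pointwise-matrix n m = trans (cong (map (λ (i , j) → entry m n i j)) (sym (pairs-upTo n))) (sym (map-∘ (cartesianProduct (allFin n) (allFin n))))

  meet : ∀ {n} → EdgeSet n → EdgeSet n → EdgeSet n
  meet E F = record { has = λ u v → has E u v ∧ has F u v ; sym = λ u v → cong₂ _∧_ (EdgeSet.sym E u v) (EdgeSet.sym F u v)
   ; irrefl = λ u → cong (_∧ has F u u) (EdgeSet.irrefl E u) }

  count-size : ∀ n m v → count m v n ≡ ∣ meet (decoded {n} m) (decoded v) ∣ₑ
  count-size n m v = trans (cong (λ l → length (filterᵇ (λ (i , j) → (i <ᵇ j) ∧ F-of m v n i j) l)) (sym (pairs-upTo n)))
   (sym (filter-map-length (λ (u , v) → toN u , toN v) (λ (i , j) → (i <ᵇ j) ∧ F-of m v n i j) (cartesianProduct (allFin n) (allFin n))))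

  check-sound : ∀ w kw uw m v → check w kw uw m v ≡ true → Problem.language (R -freeEdgeDeletion) w
  check-sound w kw uw m v eq = (G , k) , encoded , F , (λ _ _ → T-∧₁) , small , free
   where
   n = length uw
   c = count m v n
   G : Graph
   G = record { order = n ; edges = decoded m }
   k : ℕ
   k = toℕ (decodeᵇ kw)
   F : EdgeSet n
   F = meet (decoded m) (decoded v)
   t : T (check w kw uw m v)
   t = Equivalence.from T-≡ eq
   word′ = ⟨ kw , ⟨ unary n , map (λ (i , j) → entry m n i j) (cartesianProduct (upTo n) (upTo n)) ⟩ ⟩
   t₂ = T-∧₂ (eqWord w word′) t
   encoded : enc (G , k) ≡ w
   encoded = trans (cong₂ (λ a b → ⟨ a , ⟨ unary n , b ⟩ ⟩) (trans (cong encodeℕᵇ (fromℕ-toℕ (decodeᵇ kw))) (encode-decode kw)) (sym (pointwise-matrix n m)))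
    (sym (eqWord-sound w word′ (Equivalence.to T-≡ (T-∧₁ t))))
   small : ∣ F ∣ₑ ≤ k
   small = ≤-trans (≤-reflexive (sym (count-size n m v))) (≤-trans (≤ᵇ⇒≤ c _ (T-∧₁ t₂)) (≤-trans (≤-reflexive (capped-≡ c kw)) (m⊓n≤n c k)))
   free : ¬ ContainsInduced R (G − F)
   free ci = T-not (T-∧₂ (c ≤ᵇ capped c kw) t₂) (embedding⇒copy (G − F) (rest-of m v n) (λ _ _ → refl) (contains⇒embedding R (G − F) ci))

  sound : ∀ w v → verify ⟨ w , v ⟩ ≡ true → Problem.language (R -freeEdgeDeletion) w
  sound w v eq = check-sound w (proj₁ (unpair w)) (proj₁ (unpair (proj₂ (unpair w)))) (proj₂ (unpair (proj₂ (unpair w)))) v (trans (sym (cong check₀ (unpair-pair w v))) eq)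

  -- The certificate is the adjacency matrix of F with its n² entries, and n is at most the length
  -- of w because w contains n in unary.
  complete : ∀ w → Problem.language (R -freeEdgeDeletion) w → ∃[ v ] length v ≤ 1 * length w ^ 2 + 1 × verify ⟨ w , v ⟩ ≡ true
  complete w ((G , k) , refl , F , F⊆ , le , free) = v , short , Equivalence.to T-≡ accepted
   where
   n = order G
   kw = encodeℕᵇ (fromℕ k)
   m = fullMatrix (has (edges G))
   v = fullMatrix (has F)
   pair-length : ∀ a b → length b ≤ length ⟨ a , b ⟩
   pair-length [] b = n≤1+n _
   pair-length (_ ∷ a) b = ≤-trans (pair-length a b) (≤-trans (n≤1+n _) (n≤1+n _))
   pair-length₁ : ∀ a b → length a ≤ length ⟨ a , b ⟩
   pair-length₁ [] b = z≤n
   pair-length₁ (_ ∷ a) b = s≤s (≤-trans (pair-length₁ a b) (n≤1+n _))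
   n≤w : n ≤ length w
   n≤w = ≤-trans (≤-reflexive (sym (length-replicate n))) (≤-trans (pair-length₁ (unary n) m) (pair-length kw ⟨ unary n , m ⟩))
   short : length v ≤ 1 * length w ^ 2 + 1
   short = ≤-trans (≤-reflexive (trans (length-map _ (pairsFin {n})) (trans (len (allFin n) (allFin n)) (cong (λ l → l * l) (length-tabulate {n = n} id)))))
    (≤-trans (*-mono-≤ n≤w n≤w) (≤-trans (≤-reflexive (sym (trans (*-identityˡ (length w ^ 2)) (cong (length w *_) (*-identityʳ (length w)))))) (m≤m+n _ 1)))
    where
    len : ∀ {A B : Set} (xs : List A) (ys : List B) → length (cartesianProduct xs ys) ≡ length xs * length ys
    len [] ys = refl
    len (x ∷ xs) ys = trans (length-++ (map (x ,_) ys)) (cong₂ _+_ (length-map (x ,_) ys) (len xs ys))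
   E-has : ∀ u u′ → entry m n (toN u) (toN u′) ≡ has (edges G) u u′
   E-has = entry-matrix (edges G)
   F-has : ∀ u u′ → F-of m v n (toN u) (toN u′) ≡ has F u u′
   F-has u u′ rewrite E-has u u′ | entry-matrix F u u′ = T-⇔-≡ (λ t → T-∧₂ (has (edges G) u u′) t) (λ t → ∧-T (F⊆ u u′ t) t)
   c = count m v n
   c≡ : c ≡ ∣ F ∣ₑ
   c≡ = trans (count-size n m v) (cong length (filter-≐ (λ uv → T? _) (λ uv → T? _)
    ( (λ {uv} t → subst (λ b → T ((toN (proj₁ uv) <ᵇ toN (proj₂ uv)) ∧ b)) (F-has (proj₁ uv) (proj₂ uv)) t)
    , (λ {uv} t → subst (λ b → T ((toN (proj₁ uv) <ᵇ toN (proj₂ uv)) ∧ b)) (sym (F-has (proj₁ uv) (proj₂ uv))) t)) (cartesianProduct (allFin n) (allFin n))))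
   val : toℕ (decodeᵇ kw) ≡ k
   val = trans (cong toℕ (decode-encode (fromℕ k))) (toℕ-fromℕ k)
   checked : ∀ uw → length uw ≡ n → T (check w kw uw m v)
   checked uw refl = ∧-T (Equivalence.from T-≡ (subst (λ z → eqWord w ⟨ kw , ⟨ unary n , z ⟩ ⟩ ≡ true) (sym mat) (eqWord-refl w)))
    (∧-T (≤⇒≤ᵇ (≤-trans (⊓-glb ≤-refl (≤-trans (≤-reflexive c≡) le)) (≤-reflexive (sym (trans (capped-≡ c kw) (cong (c ⊓_) val))))))
     (¬T-not (λ t → free (embedding⇒contains R (G − F) (copy⇒embedding (G − F) (rest-of m v n)
      (λ u u′ → cong₂ (λ a b → a ∧ not b) (E-has u u′) (F-has u u′)) t)))))
    where
    mat : map (λ (i , j) → entry m n i j) (cartesianProduct (upTo n) (upTo n)) ≡ m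
    mat = trans (pointwise-matrix n m) (map-cong (λ (u , u′) → E-has u u′) (pairsFin {n}))
   accepted : T (verify ⟨ w , v ⟩)
   accepted = subst T (sym (trans (cong check₀ (unpair-pair w v)) (trans (cong (check₁ w v) (unpair-pair kw ⟨ unary n , m ⟩)) (cong (check₂ w v kw) (unpair-pair (unary n) m)))))
    (checked (unary n) (length-replicate n))

  inNP : InNP (Problem.language (R -freeEdgeDeletion))
  inNP = verify , record { coefficient = 1 ; exponent = 2 } , polyTime ([ verifyP ]P) , λ w → mk⇔ (complete w) (λ (v , _ , eq) → sound w v eq)

-- Tilings with local constraints as CNF formulas

module Tilings where

 open import Data.Bool using (T)
 open import Data.Fin using (toℕ)
 open import Data.List.Membership.Propositional.Properties
 open import Data.Nat.Properties
 open import Relation.Nullary using (yes; no)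
 open Programs hiding (M; A; B)
 open PolynomialTime
 open RegularGraphs using (¬T-false; T-not; ¬T-not)
 open GluedCopies using (T-eq; dec; ∈-concatMap)
 open VertexCover using (module Formula; ∈-concatMap⁻′)

 bools : ℕ → Ty
 bools zero = 𝟙
 bools (suc k) = 𝔹 ⊗ bools k

 -- A function of k bits is a decision tree with constants at its leaves.
 tableP : ∀ k {τ} (F : ⟦ bools k ⟧ → ⟦ τ ⟧) → PT (bools k) τ F
 tableP zero {τ} F = constP τ (F tt)
 tableP (suc k) F = ext lem (ifP fstP (tableP k (λ r → F (true , r)) ∘P sndP) (tableP k (λ r → F (false , r)) ∘P sndP))
  where
  lem : ∀ x → (if proj₁ x then F (true , proj₂ x) else F (false , proj₂ x)) ≡ F x
  lem (true , _) = refl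
  lem (false , _) = refl

 isZero : ℕ → Bool
 isZero i = caseℕ i true (λ _ → false)

 module Tiling (ι : Ty) (N : ℕ) (d₀ : Fin N) (k : ℕ)
  (rows cols : ⟦ ι ⟧ → ℕ) (flags : ⟦ ι ⟧ → ℕ → ℕ → ⟦ bools k ⟧)
  (allowed : ⟦ bools k ⟧ → Fin N → Bool) (hrel : Fin N → Fin N → Bool) (vrel : Bool → Fin N → Fin N → Bool) where

  -- Rows will be points of time and columns distances from the head. The vertical relation is told
  -- whether it applies to column 0, the column next to the head.
  record IsTiling (w : ⟦ ι ⟧) (g : ℕ → ℕ → Fin N) : Set where
   field
    unary-ok : ∀ {t i} → t ≤ rows w → i < cols w → T (allowed (flags w t i) (g t i))
    h-ok : ∀ {t i} → t ≤ rows w → suc i < cols w → T (hrel (g t i) (g t (suc i)))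
    v-ok : ∀ {t i} → t < rows w → i < cols w → T (vrel (isZero i) (g t i) (g (suc t) i))

  ν : Ty
  ν = nat ⊗ nat ⊗ nat

  open Formula ν using (Lit; Cl; lits; Sat; WellFormed)

  φτ : Ty
  φτ = list ν ⊗ list ((ν ⊗ 𝔹) ⊗ list (ν ⊗ 𝔹))

  allowedCodes : ⟦ bools k ⟧ → List ℕ
  allowedCodes f = map toℕ (filterᵇ (allowed f) (allFin N))

  codes : Fin N × Fin N → ℕ × ℕ
  codes (d , e) = toℕ d , toℕ e

  bad : (Fin N → Fin N → Bool) → List (ℕ × ℕ)
  bad rel = map codes (filterᵇ (λ (d , e) → not (rel d e)) (cartesianProduct (allFin N) (allFin N)))

  -- Nothing forces a cell to carry only one tile: the clauses for neighbouring cells restrict all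
  -- marked tiles, so any marked tile that is allowed in its cell may be chosen.
  cellClauses : ⟦ ι ⟧ → ℕ × ℕ → List Cl
  cellClauses w (t , i) = (((t , i , N) , true) , map (λ d → (t , i , d) , true) (allowedCodes (flags w t i))) ∷ (((t , i , N) , false) , []) ∷ []

  hClauses vClauses : ℕ × ℕ → List Cl
  hClauses (t , i) = map (λ (d , e) → ((t , i , d) , false) , [ (t , suc i , e) , false ]) (bad hrel)
  vClauses (t , i) = map (λ (d , e) → ((t , i , d) , false) , [ (suc t , i , e) , false ]) (if isZero i then bad (vrel true) else bad (vrel false))

  -- code N never names a tile; it makes the clause of a cell without allowed tiles well-formed
  vars : ⟦ ι ⟧ → List ⟦ ν ⟧
  vars w = cartesianProduct (upTo (suc (rows w))) (cartesianProduct (upTo (cols w)) (upTo (suc N)))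

  clauses : ⟦ ι ⟧ → List Cl
  clauses w = concatMap (cellClauses w) (cartesianProduct (upTo (suc (rows w))) (upTo (cols w)))
   ++ concatMap hClauses (cartesianProduct (upTo (suc (rows w))) (upTo (cols w ∸ 1)))
   ++ concatMap vClauses (cartesianProduct (upTo (rows w)) (upTo (cols w)))

  formulaP : PT ι nat rows → PT ι nat cols → PT (ι ⊗ nat ⊗ nat) (bools k) (λ (w , t , i) → flags w t i) → PT ι φτ (λ w → vars w , clauses w)
  formulaP RP CP FP = productP (upToP (sucP RP)) (productP (upToP CP) (constP (list nat) (upTo (suc N)))) ,P
   (concatMapP (productP (upToP (sucP RP)) (upToP CP))
    (((cell (constP nat N) ,P constP 𝔹 true) ,P mapP (tableP k allowedCodes ∘P (FP ∘P (w1 ,P (fstP ∘P v0 ,P sndP ∘P v0))))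
     ((fstP ∘P v1 ,P (sndP ∘P v1 ,P v0)) ,P constP 𝔹 true))
     ∷P ((cell (constP nat N) ,P constP 𝔹 false) ,P nilP) ∷P nilP)
    ++P concatMapP (productP (upToP (sucP RP)) (upToP (CP ∸P constP nat 1)))
     (mapP (constP (list (nat ⊗ nat)) (bad hrel)) (((fstP ∘P v1 ,P (sndP ∘P v1 ,P fstP ∘P v0)) ,P constP 𝔹 false) ,P [ (fstP ∘P v1 ,P (sucP (sndP ∘P v1) ,P sndP ∘P v0)) ,P constP 𝔹 false ]P))
    ++P concatMapP (productP (upToP RP) (upToP CP))
     (mapP (ifP (caseℕP (sndP ∘P v0) (constP 𝔹 true) (constP 𝔹 false)) (constP (list (nat ⊗ nat)) (bad (vrel true))) (constP (list (nat ⊗ nat)) (bad (vrel false))))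
      (((fstP ∘P v1 ,P (sndP ∘P v1 ,P fstP ∘P v0)) ,P constP 𝔹 false) ,P [ (sucP (fstP ∘P v1) ,P (sndP ∘P v1 ,P sndP ∘P v0)) ,P constP 𝔹 false ]P)))
   where
   cell : ∀ {Γ e} → PT ((nat ⊗ nat) ⊗ Γ) nat e → PT ((nat ⊗ nat) ⊗ Γ) ν (λ γ → proj₁ (proj₁ γ) , proj₂ (proj₁ γ) , e γ)
   cell E = fstP ∘P v0 ,P (sndP ∘P v0 ,P E)

  bad⁺ : ∀ rel {d e} → ¬ T (rel d e) → (toℕ d , toℕ e) ∈ bad rel
  bad⁺ rel {d} {e} n = ∈-map⁺ codes (∈-filter⁺ (T? ∘ (λ (d , e) → not (rel d e))) (∈-cartesianProduct⁺ (∈-allFin d) (∈-allFin e)) (¬T-not n))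

  bad⁻ : ∀ rel {p} → p ∈ bad rel → ∃[ d ] ∃[ e ] p ≡ (toℕ d , toℕ e) × ¬ T (rel d e)
  bad⁻ rel m with (d , e) , q , refl ← ∈-map⁻ codes m = d , e , refl , T-not (proj₂ (∈-filter⁻ (T? ∘ (λ (d , e) → not (rel d e))) {xs = cartesianProduct (allFin N) (allFin N)} q))

  vlist : Bool → List (ℕ × ℕ)
  vlist b = if b then bad (vrel true) else bad (vrel false)

  vlist⁺ : ∀ b {d e} → ¬ T (vrel b d e) → (toℕ d , toℕ e) ∈ vlist b
  vlist⁺ true = bad⁺ (vrel true)
  vlist⁺ false = bad⁺ (vrel false)

  vlist⁻ : ∀ b {p} → p ∈ vlist b → ∃[ d ] ∃[ e ] p ≡ (toℕ d , toℕ e) × ¬ T (vrel b d e)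
  vlist⁻ true = bad⁻ (vrel true)
  vlist⁻ false = bad⁻ (vrel false)

  module _ (w : ⟦ ι ⟧) where

   private
    R₁ = upTo (suc (rows w))
    C₁ = upTo (cols w)
    S₁ = cartesianProduct R₁ C₁
    S₂ = cartesianProduct R₁ (upTo (cols w ∸ 1))
    S₃ = cartesianProduct (upTo (rows w)) C₁

    pred-< : ∀ {i n} → i < n ∸ 1 → suc i < n
    pred-< {i} {suc n} lt = s≤s lt

    <-pred′ : ∀ {i n} → suc i < n → i < n ∸ 1
    <-pred′ {i} {suc n} (s≤s lt) = lt

   in-cells : ∀ {c t i} → t ≤ rows w → i < cols w → c ∈ cellClauses w (t , i) → c ∈ clauses w
   in-cells t≤ i< m = ∈-++⁺ˡ (∈-concatMap (cellClauses w) {xs = S₁} (∈-cartesianProduct⁺ (∈-upTo⁺ (s≤s t≤)) (∈-upTo⁺ i<)) m)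

   in-h : ∀ {c t i} → t ≤ rows w → suc i < cols w → c ∈ hClauses (t , i) → c ∈ clauses w
   in-h t≤ i< m = ∈-++⁺ʳ (concatMap (cellClauses w) S₁) (∈-++⁺ˡ (∈-concatMap hClauses {xs = S₂} (∈-cartesianProduct⁺ (∈-upTo⁺ (s≤s t≤)) (∈-upTo⁺ (<-pred′ i<))) m))

   in-v : ∀ {c t i} → t < rows w → i < cols w → c ∈ vClauses (t , i) → c ∈ clauses w
   in-v t< i< m = ∈-++⁺ʳ (concatMap (cellClauses w) S₁) (∈-++⁺ʳ (concatMap hClauses S₂) (∈-concatMap vClauses {xs = S₃} (∈-cartesianProduct⁺ (∈-upTo⁺ t<) (∈-upTo⁺ i<)) m))

   data Origin (c : Cl) : Set where
    cell : ∀ {t i} → t ≤ rows w → i < cols w → c ∈ cellClauses w (t , i) → Origin c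
    horiz : ∀ {t i} → t ≤ rows w → suc i < cols w → c ∈ hClauses (t , i) → Origin c
    vert : ∀ {t i} → t < rows w → i < cols w → c ∈ vClauses (t , i) → Origin c

   origin : ∀ {c} → c ∈ clauses w → Origin c
   origin m with ∈-++⁻ (concatMap (cellClauses w) S₁) m
   ... | inj₁ q with (t , i) , ti∈ , r ← ∈-concatMap⁻′ (cellClauses w) S₁ q with t∈ , i∈ ← ∈-cartesianProduct⁻ R₁ C₁ ti∈ =
    cell (≤-pred (∈-upTo⁻ t∈)) (∈-upTo⁻ i∈) r
   ... | inj₂ q with ∈-++⁻ (concatMap hClauses S₂) q
   ... | inj₁ q′ with (t , i) , ti∈ , r ← ∈-concatMap⁻′ hClauses S₂ q′ with t∈ , i∈ ← ∈-cartesianProduct⁻ R₁ _ ti∈ =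
    horiz (≤-pred (∈-upTo⁻ t∈)) (pred-< (∈-upTo⁻ i∈)) r
   ... | inj₂ q′ with (t , i) , ti∈ , r ← ∈-concatMap⁻′ vClauses S₃ q′ with t∈ , i∈ ← ∈-cartesianProduct⁻ (upTo (rows w)) C₁ ti∈ =
    vert (∈-upTo⁻ t∈) (∈-upTo⁻ i∈) r

   wellFormed : WellFormed (vars w) (clauses w)
   wellFormed = record { vars-unique = cartesianProduct⁺ (upTo⁺ (suc (rows w))) (cartesianProduct⁺ (upTo⁺ (cols w)) (upTo⁺ (suc N))) ; vars-all = λ m → all-vars (origin m) }
    where
    var∈ : ∀ {t i d} → t ≤ rows w → i < cols w → d ≤ N → (t , i , d) ∈ vars w
    var∈ t≤ i< d≤ = ∈-cartesianProduct⁺ (∈-upTo⁺ (s≤s t≤)) (∈-cartesianProduct⁺ (∈-upTo⁺ i<) (∈-upTo⁺ (s≤s d≤)))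
    small : ∀ (d : Fin N) → toℕ d ≤ N
    small d = <⇒≤ (toℕ<n d)
    all-vars : ∀ {c l} → Origin c → l ∈ lits c → proj₁ l ∈ vars w
    all-vars (cell t≤ i< (here refl)) (here refl) = var∈ t≤ i< ≤-refl
    all-vars (cell t≤ i< (here refl)) (there m) with d , d∈ , refl ← ∈-map⁻ _ m with e , _ , refl ← ∈-map⁻ toℕ d∈ = var∈ t≤ i< (small e)
    all-vars (cell t≤ i< (there (here refl))) (here refl) = var∈ t≤ i< ≤-refl
    all-vars (horiz {t} {i} t≤ i< m) l∈ with (d , e) , q , refl ← ∈-map⁻ _ m with d′ , e′ , refl , _ ← bad⁻ hrel q with l∈
    ... | here refl = var∈ t≤ (≤-trans (n≤1+n _) i<) (small d′)
    ... | there (here refl) = var∈ t≤ i< (small e′)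
    all-vars (vert {t} {i} t< i< m) l∈ with (d , e) , q , refl ← ∈-map⁻ _ m with d′ , e′ , refl , _ ← vlist⁻ (isZero i) q with l∈
    ... | here refl = var∈ (<⇒≤ t<) i< (small d′)
    ... | there (here refl) = var∈ t< i< (small e′)

   tiling⇒sat : ∀ {g} → IsTiling w g → Sat (clauses w)
   tiling⇒sat {g} tl = σ , λ m → satisfied (origin m)
    where
    open IsTiling tl
    σ : ⟦ ν ⟧ → Bool
    σ (t , i , d) = eqᵇ nat d (toℕ (g t i))
    σ-true : ∀ t i → σ (t , i , toℕ (g t i)) ≡ true
    σ-true t i = eqᵇ-refl nat _
    pair : ∀ t i t′ i′ (d e : Fin N) → ¬ (toℕ d ≡ toℕ (g t i) × toℕ e ≡ toℕ (g t′ i′)) →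
     ∃[ l ] l ∈ ((t , i , toℕ d) , false) ∷ ((t′ , i′ , toℕ e) , false) ∷ [] × σ (proj₁ l) ≡ proj₂ l
    pair t i t′ i′ d e n with dec nat (toℕ d) (toℕ (g t i)) | dec nat (toℕ e) (toℕ (g t′ i′))
    ... | yes p | yes q = ⊥-elim (n (p , q))
    ... | no p | _ = _ , here refl , ¬T-false (λ h → p (T-eq {nat} h))
    ... | yes _ | no q = _ , there (here refl) , ¬T-false (λ h → q (T-eq {nat} h))
    satisfied : ∀ {c} → Origin c → ∃[ l ] l ∈ lits c × σ (proj₁ l) ≡ proj₂ l
    satisfied (cell {t} {i} t≤ i< (here refl)) = ((t , i , toℕ (g t i)) , true) ,
     there (∈-map⁺ _ (∈-map⁺ toℕ (∈-filter⁺ (T? ∘ allowed (flags w t i)) (∈-allFin (g t i)) (unary-ok t≤ i<)))) , σ-true t i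
    satisfied (cell {t} {i} t≤ i< (there (here refl))) = _ , here refl , ¬T-false (λ h → <⇒≢ (toℕ<n (g t i)) (sym (T-eq {nat} h)))
    satisfied (horiz {t} {i} t≤ i< m) with (d , e) , q , refl ← ∈-map⁻ _ m with d′ , e′ , refl , n ← bad⁻ hrel q =
     pair t i t (suc i) d′ e′ (λ (p , q) → n (subst T (cong₂ hrel (sym (toℕ-injective p)) (sym (toℕ-injective q))) (h-ok t≤ i<)))
    satisfied (vert {t} {i} t< i< m) with (d , e) , q , refl ← ∈-map⁻ _ m with d′ , e′ , refl , n ← vlist⁻ (isZero i) q =
     pair t i (suc t) i d′ e′ (λ (p , q) → n (subst T (cong₂ (vrel (isZero i)) (sym (toℕ-injective p)) (sym (toℕ-injective q))) (v-ok t< i<)))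

   sat⇒tiling : Sat (clauses w) → ∃[ g ] IsTiling w g
   sat⇒tiling (σ , sat) = g , record { unary-ok = λ t≤ i< → proj₁ (found t≤ i<) ; h-ok = h-ok ; v-ok = v-ok }
    where
    pick : ℕ → ℕ → List (Fin N) → Fin N
    pick t i [] = d₀
    pick t i (d ∷ ds) = if σ (t , i , toℕ d) then d else pick t i ds
    pick-ok : ∀ t i ds {d} → d ∈ ds → σ (t , i , toℕ d) ≡ true → pick t i ds ∈ ds × σ (t , i , toℕ (pick t i ds)) ≡ true
    pick-ok t i (d ∷ ds) m eq with σ (t , i , toℕ d) in e
    ... | true = here refl , e
    pick-ok t i (d ∷ ds) (here refl) eq | false with () ← trans (sym e) eq
    pick-ok t i (d ∷ ds) (there m) eq | false with p , q ← pick-ok t i ds m eq = there p , q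
    options : ℕ → ℕ → List (Fin N)
    options t i = filterᵇ (allowed (flags w t i)) (allFin N)
    g : ℕ → ℕ → Fin N
    g t i = pick t i (options t i)
    some : ∀ {t i} → t ≤ rows w → i < cols w → ∃[ d ] d ∈ options t i × σ (t , i , toℕ d) ≡ true
    some {t} {i} t≤ i< with sat (in-cells {t = t} {i} t≤ i< (here refl)) | sat (in-cells {t = t} {i} t≤ i< (there (here refl)))
    ... | _ , here refl , eq | _ , here refl , eq′ with () ← trans (sym eq) eq′
    ... | _ , there m , eq | _ with _ , q , refl ← ∈-map⁻ _ m with d , d∈ , refl ← ∈-map⁻ toℕ q = d , d∈ , eq
    found : ∀ {t i} → t ≤ rows w → i < cols w → T (allowed (flags w t i) (g t i)) × σ (t , i , toℕ (g t i)) ≡ true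
    found {t} {i} t≤ i< with d , d∈ , eq ← some {t} {i} t≤ i< with p , q ← pick-ok t i (options t i) d∈ eq =
     proj₂ (∈-filter⁻ (T? ∘ allowed (flags w t i)) {xs = allFin N} p) , q
    conflict : ∀ {t i t′ i′} → σ (t , i , toℕ (g t i)) ≡ true → σ (t′ , i′ , toℕ (g t′ i′)) ≡ true →
     (∃[ l ] l ∈ ((t , i , toℕ (g t i)) , false) ∷ ((t′ , i′ , toℕ (g t′ i′)) , false) ∷ [] × σ (proj₁ l) ≡ proj₂ l) → ⊥
    conflict e e′ (_ , here refl , q) with () ← trans (sym e) q
    conflict e e′ (_ , there (here refl) , q) with () ← trans (sym e′) q
    h-ok : ∀ {t i} → t ≤ rows w → suc i < cols w → T (hrel (g t i) (g t (suc i)))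
    h-ok {t} {i} t≤ i< with T? (hrel (g t i) (g t (suc i)))
    ... | yes h = h
    ... | no n = ⊥-elim (conflict (proj₂ (found t≤ (≤-trans (n≤1+n _) i<))) (proj₂ (found t≤ i<)) (sat (in-h t≤ i< (∈-map⁺ _ (bad⁺ hrel n)))))
    v-ok : ∀ {t i} → t < rows w → i < cols w → T (vrel (isZero i) (g t i) (g (suc t) i))
    v-ok {t} {i} t< i< with T? (vrel (isZero i) (g t i) (g (suc t) i))
    ... | yes h = h
    ... | no n = ⊥-elim (conflict (proj₂ (found (<⇒≤ t<) i<)) (proj₂ (found t< i<)) (sat (in-v t< i< (∈-map⁺ _ (vlist⁺ (isZero i) n)))))

-- Computations as tableaux

module Tableaux where

 open import Data.Bool using (T)
 open import Data.Fin using (combine; remQuot)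
 open import Data.Fin.Properties using (remQuot-combine) renaming (_≟_ to _≟ᶠ_)
 open import Data.Maybe using (maybe′)
 open import Data.Nat.Properties
 open import Data.Vec as Vec using ()
 open import Relation.Nullary using (yes; no)
 open import Relation.Nullary.Decidable using (⌊_⌋; toWitness; fromWitness)
 open Machines using (Finite; retract; finite-⊤; finite-⊎)
 open Programs hiding (M; A; B)
 open PolynomialTime
 open RegularGraphs using (¬T-false; ∧-T; T-∧₁; T-∧₂)
 open GluedCopies using (T-eq; eq-T; T-∨₁; T-∨₂)
 open FormulaToGraph using (pairP)
 open Membership using (nth; nthP)
 open Tilings using (bools; isZero; module Tiling)

 open Finite

 finite-Bool : Finite Bool
 finite-Bool = retract (λ b → if b then inj₂ tt else inj₁ tt) [ (λ _ → false) , (λ _ → true) ]′ (λ { false → refl ; true → refl }) (finite-⊎ finite-⊤ finite-⊤)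

 finite-Fin : ∀ n → Finite (Fin n)
 finite-Fin n = record { card = n ; to = id ; from = id ; from-to = λ _ → refl }

 finite-Maybe : ∀ {A} → Finite A → Finite (Maybe A)
 finite-Maybe {A} F = retract (maybe inj₂ (inj₁ tt)) [ (λ _ → nothing) , just ]′ (λ { nothing → refl ; (just _) → refl }) (finite-⊎ finite-⊤ F)

 finite-× : ∀ {A B} → Finite A → Finite B → Finite (A × B)
 finite-× {A} {B} F G = record
  { card = card F * card G ; to = λ (a , b) → combine (to F a) (to G b)
  ; from = λ i → let j , k = remQuot (card G) i in from F j , from G k
  ; from-to = λ (a , b) → trans (cong (λ (j , k) → from F j , from G k) (remQuot-combine (to F a) (to G b))) (cong₂ _,_ (from-to F a) (from-to G b)) }

 finite-Vec : ∀ {A} → Finite A → ∀ n → Finite (Vec A n)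
 finite-Vec F zero = retract (λ _ → tt) (λ _ → []) (λ { [] → refl }) finite-⊤
 finite-Vec F (suc n) = retract (λ { (x ∷ xs) → x , xs }) (λ (x , xs) → x ∷ xs) (λ { (_ ∷ _) → refl }) (finite-× F (finite-Vec F n))

 abstract
  eqF : ∀ {A} → Finite A → A → A → Bool
  eqF F a b = ⌊ to F a ≟ᶠ to F b ⌋

  eqF⁻ : ∀ {A} (F : Finite A) {a b} → T (eqF F a b) → a ≡ b
  eqF⁻ F {a} {b} t = trans (sym (from-to F a)) (trans (cong (from F) (toWitness t)) (from-to F b))

  eqF⁺ : ∀ {A} (F : Finite A) {a b} → a ≡ b → T (eqF F a b)
  eqF⁺ F refl = fromWitness refl

 polP : ∀ {Γ e} p → PT Γ nat e → PT Γ nat (λ γ → ⟪ p ⟫ (e γ))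
 polP (K c) E = constP nat c
 polP X E = E
 polP (p ⊞ q) E = polP p E +P polP q E
 polP (p ⊠ q) E = polP p E *P polP q E

 nth-beyond : ∀ {A : Set} (d : A) xs i → length xs ≤ i → nth d xs i ≡ d
 nth-beyond d [] zero le = refl
 nth-beyond d [] (suc i) le = refl
 nth-beyond d (x ∷ xs) (suc i) (s≤s le) = nth-beyond d xs i le

 pair-++ : ∀ w v → ⟨ w , v ⟩ ≡ ⟨ w , [] ⟩ ++ v
 pair-++ [] v = refl
 pair-++ (b ∷ w) v = cong (λ l → true ∷ b ∷ l) (pair-++ w v)

 header-cons : ∀ w → ∃[ x ] ∃[ xs ] ⟨ w , [] ⟩ ≡ x ∷ xs
 header-cons [] = false , [] , refl
 header-cons (b ∷ _) = true , _ , refl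

 imp : Bool → Bool → Bool
 imp a b = not a ∨ b

 imp⁺ : ∀ a {b} → (T a → T b) → T (imp a b)
 imp⁺ true f = f tt
 imp⁺ false f = tt

 imp⁻ : ∀ {a b} → T a → T (imp a b) → T b
 imp⁻ {true} _ t = t

 nth-[] : ∀ {A : Set} (d : A) i → nth d [] i ≡ d
 nth-[] d zero = refl
 nth-[] d (suc i) = refl

 module _ {a : ℕ} where

  isBit : Symbol a → Bool
  isBit (bit _) = true
  isBit _ = false

  symAt : Word → ℕ → Symbol a
  symAt y j = nth nothing (map (λ b → bit b) y) j

  symAt-bit : ∀ y j → j < length y → symAt y j ≡ bit (nth false y j)
  symAt-bit (b ∷ y) zero lt = refl
  symAt-bit (b ∷ y) (suc j) (s≤s lt) = symAt-bit y j lt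

  symAt-blank : ∀ y j → length y ≤ j → symAt y j ≡ nothing
  symAt-blank y j le = nth-beyond nothing (map (λ b → bit b) y) j (≤-trans (≤-reflexive (length-map _ y)) le)

  symAt-++ˡ : ∀ y z j → j < length y → symAt (y ++ z) j ≡ bit (nth false y j)
  symAt-++ˡ (b ∷ y) z zero lt = refl
  symAt-++ˡ (b ∷ y) z (suc j) (s≤s lt) = symAt-++ˡ y z j lt

  symAt-++ʳ : ∀ y z j → symAt (y ++ z) (length y + j) ≡ symAt z j
  symAt-++ʳ [] z j = refl
  symAt-++ʳ (b ∷ y) z j = symAt-++ʳ y z j

 -- The certificate is read off the first row: bits up to the first blank.
 module ReadOff {a : ℕ} (s : ℕ → Symbol a) (L : ℕ) where

  collect : ℕ → ℕ → Word
  collect i zero = []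
  collect i (suc f) with s i
  ... | bit b = b ∷ collect (suc i) f
  ... | _ = []

  collect-length : ∀ f i → length (collect i f) ≤ f
  collect-length zero i = z≤n
  collect-length (suc f) i with s i
  ... | bit b = s≤s (collect-length f (suc i))
  ... | nothing = z≤n
  ... | just (inj₂ _) = z≤n

  -- The local form of a word followed by blanks: a blank is followed by a blank, and work symbols
  -- are excluded.
  Free : ℕ → Set
  Free j = T (isBit (s j)) ⊎ (s j ≡ nothing × (suc j < L → s (suc j) ≡ nothing))

  rest-blank : ∀ f i → (∀ e → e + i < L → e < f → Free (e + i)) → (∀ e → e + i < L → f ≤ e → s (e + i) ≡ nothing) →
   s i ≡ nothing → ∀ e → e + i < L → s (e + i) ≡ nothing
  rest-blank f i fr bl z zero lt = z
  rest-blank f i fr bl z (suc e) lt with e <? f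
  ... | no ge = bl (suc e) lt (m≤n⇒m≤1+n (≮⇒≥ ge))
  ... | yes e<f with fr e (≤-trans (n≤1+n _) lt) e<f
  ... | inj₂ (_ , n) = n lt
  ... | inj₁ b with () ← subst (T ∘ isBit) (rest-blank f i fr bl z e (≤-trans (n≤1+n _) lt)) b

  collect-ok : ∀ f i → (∀ e → e + i < L → e < f → Free (e + i)) → (∀ e → e + i < L → f ≤ e → s (e + i) ≡ nothing) →
   ∀ e → e + i < L → s (e + i) ≡ symAt (collect i f) e
  collect-ok zero i fr bl e lt = trans (bl e lt z≤n) (sym (nth-[] nothing e))
  collect-ok (suc f) i fr bl e lt with s i in eq
  collect-ok (suc f) i fr bl zero lt | bit b = eq
  collect-ok (suc f) i fr bl (suc e) lt | bit b = subst (λ j → s j ≡ symAt (collect (suc i) f) e) (+-suc e i)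
   (collect-ok f (suc i) (λ e′ l h → subst Free (sym (+-suc e′ i)) (fr (suc e′) (subst (_< L) (+-suc e′ i) l) (s≤s h)))
    (λ e′ l h → subst (λ j → s j ≡ nothing) (sym (+-suc e′ i)) (bl (suc e′) (subst (_< L) (+-suc e′ i) l) (s≤s h))) e (subst (_< L) (sym (+-suc e i)) lt))
  collect-ok (suc f) i fr bl e lt | nothing = trans (rest-blank (suc f) i fr bl eq e lt) (sym (nth-[] nothing e))
  collect-ok (suc f) i fr bl e lt | just (inj₂ x) with fr 0 (≤-trans (s≤s (m≤n+m i e)) lt) (s≤s z≤n)
  ... | inj₁ b with () ← subst (T ∘ isBit) eq b
  ... | inj₂ (z , _) with () ← trans (sym eq) z

 -- The tape is folded at the head: column i holds the i-th cells to the left and to the right of the head.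
 module Tableau (M : TM) where

  open TM M

  Col : Set
  Col = Vec (Γ × Γ) tapes

  -- A tile repeats the state and all head symbols and shows three consecutive columns, so the next
  -- content of its own column depends on this one tile. The relation `H` makes the overlapping
  -- information agree along a row.
  D : Set
  D = Fin states × Vec Γ tapes × Col × Col × Col

  finΓ : Finite Γ
  finΓ = finite-Maybe (finite-⊎ finite-Bool (finite-Fin workSymbols))

  finCol : Finite Col
  finCol = finite-Vec (finite-× finΓ finΓ) tapes

  finHd : Finite (Vec Γ tapes)
  finHd = finite-Vec finΓ tapes

  abstract
   finD : Finite D
   finD = finite-× (finite-Fin states) (finite-× finHd (finite-× finCol (finite-× finCol finCol)))

  N : ℕ
  N = card finD

  blankCol : ∀ {n} → Vec (Γ × Γ) n
  blankCol = Vec.replicate _ (nothing , nothing)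

  -- Made total by idling in halting configurations, so that every row up to the time bound can be
  -- filled.
  δ̂ : Fin states → Vec Γ tapes → Fin states × Vec (Γ × Move) tapes
  δ̂ q hd = maybe′ (λ x → x) (q , Vec.map (_, stay) hd) (δ q hd)

  tick : Config M → Config M
  tick (config q ts) = config (proj₁ (δ̂ q (Vec.map Tape.head ts))) (zipWith writeMove ts (proj₂ (δ̂ q (Vec.map Tape.head ts))))

  keep-tapes : ∀ {n} (ts : Vec (Tape Γ) n) → zipWith writeMove ts (Vec.map (_, stay) (Vec.map Tape.head ts)) ≡ ts
  keep-tapes [] = refl
  keep-tapes (tape _ _ _ ∷ ts) = cong (_ ∷_) (keep-tapes ts)

  tick-step : ∀ {c c′} → step M c ≡ just c′ → tick c ≡ c′
  tick-step {config q ts} eq with δ q (Vec.map Tape.head ts)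
  tick-step {config q ts} refl | just _ = refl

  tick-halt : ∀ {c} → step M c ≡ nothing → tick c ≡ c
  tick-halt {config q ts} eq with δ q (Vec.map Tape.head ts)
  ... | nothing = cong (config q) (keep-tapes ts)

  run : Config M → ℕ → Config M
  run c zero = c
  run c (suc t) = tick (run c t)

  run-tick : ∀ c t → run (tick c) t ≡ tick (run c t)
  run-tick c zero = refl
  run-tick c (suc t) = cong tick (run-tick c t)

  run-halts : ∀ {s c d} → HaltsIn M s c d → ∀ {t} → s ≤ t → run c t ≡ d
  run-halts (halt eq) {zero} _ = refl
  run-halts (halt eq) {suc t} _ = trans (cong tick (run-halts (halt eq) {t} z≤n)) (tick-halt eq)
  run-halts (next {c = c} eq h) {suc t} (s≤s le) = trans (sym (run-tick c t)) (trans (cong (λ c → run c t) (tick-step eq)) (run-halts h le))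

  col : ℕ → Tape Γ → Γ × Γ
  col i tp = nth nothing (Tape.before tp) i , nth nothing (Tape.after tp) i

  prev : ℕ → Tape Γ → Γ × Γ
  prev zero tp = nothing , nothing
  prev (suc i) tp = col i tp

  -- The head stays and the tape moves. On `left` the left half approaches the head and the right
  -- half recedes, the written symbol entering it at column 0; `right` is the mirror image.
  shift : Bool → Γ × Move → Γ × Γ → Γ × Γ → Γ × Γ → Γ × Γ
  shift first (s , stay) p c n = c
  shift first (s , left) p c n = proj₁ n , (if first then s else proj₂ p)
  shift first (s , right) p c n = (if first then s else proj₁ p) , proj₂ n

  newHead : Γ × Move → Γ × Γ → Γ
  newHead (s , stay) c = s
  newHead (s , left) c = proj₁ c
  newHead (s , right) c = proj₂ c

  col-move : ∀ tp act i → col i (writeMove tp act) ≡ shift (isZero i) act (prev i tp) (col i tp) (col (suc i) tp)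
  col-move (tape ls h rs) (s , stay) i = refl
  col-move (tape [] h rs) (s , left) zero = refl
  col-move (tape [] h rs) (s , left) (suc i) = refl
  col-move (tape (l ∷ ls) h rs) (s , left) zero = refl
  col-move (tape (l ∷ ls) h rs) (s , left) (suc i) = refl
  col-move (tape ls h []) (s , right) zero = refl
  col-move (tape ls h []) (s , right) (suc i) = refl
  col-move (tape ls h (r ∷ rs)) (s , right) zero = refl
  col-move (tape ls h (r ∷ rs)) (s , right) (suc i) = refl

  head-move : ∀ tp act → Tape.head (writeMove tp act) ≡ newHead act (col 0 tp)
  head-move (tape ls h rs) (s , stay) = refl
  head-move (tape [] h rs) (s , left) = refl
  head-move (tape (l ∷ ls) h rs) (s , left) = refl
  head-move (tape ls h []) (s , right) = refl
  head-move (tape ls h (r ∷ rs)) (s , right) = refl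

  shifts : ∀ {n} → Bool → Vec (Γ × Move) n → Vec (Γ × Γ) n → Vec (Γ × Γ) n → Vec (Γ × Γ) n → Vec (Γ × Γ) n
  shifts first [] [] [] [] = []
  shifts first (a ∷ as) (p ∷ ps) (c ∷ cs) (n ∷ ns) = shift first a p c n ∷ shifts first as ps cs ns

  newHeads : ∀ {n} → Vec (Γ × Move) n → Vec (Γ × Γ) n → Vec Γ n
  newHeads = zipWith newHead

  column prevColumn : ∀ {n} → ℕ → Vec (Tape Γ) n → Vec (Γ × Γ) n
  column i = Vec.map (col i)
  prevColumn i = Vec.map (prev i)

  column-move : ∀ {n} (ts : Vec (Tape Γ) n) acts i →
   column i (zipWith writeMove ts acts) ≡ shifts (isZero i) acts (prevColumn i ts) (column i ts) (column (suc i) ts)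
  column-move [] [] i = refl
  column-move (t ∷ ts) (a ∷ acts) i = cong₂ _∷_ (col-move t a i) (column-move ts acts i)

  heads-move : ∀ {n} (ts : Vec (Tape Γ) n) acts → Vec.map Tape.head (zipWith writeMove ts acts) ≡ newHeads acts (column 0 ts)
  heads-move [] [] = refl
  heads-move (t ∷ ts) (a ∷ acts) = cong₂ _∷_ (head-move t a) (heads-move ts acts)

  real : Config M → ℕ → D
  real (config q ts) i = q , Vec.map Tape.head ts , prevColumn i ts , column i ts , column (suc i) ts

  H : D → D → Bool
  H (q , hd , p , c , n) (q′ , hd′ , p′ , c′ , n′) = (eqF (finite-Fin states) q q′ ∧ eqF finHd hd hd′) ∧ (eqF finCol n c′ ∧ eqF finCol c p′)

  -- The new head symbols come from column 0 and are checked only there; `H` spreads them over the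
  -- row.
  V : Bool → D → D → Bool
  V first (q , hd , p , c , n) (q′ , hd′ , p′ , c′ , n′) =
   eqF (finite-Fin states) q′ (proj₁ (δ̂ q hd)) ∧ (eqF finCol c′ (shifts first (proj₂ (δ̂ q hd)) p c n) ∧ imp first (eqF finHd hd′ (newHeads (proj₂ (δ̂ q hd)) c)))

  H-real : ∀ c i → T (H (real c i) (real c (suc i)))
  H-real (config q ts) i = ∧-T (∧-T (eqF⁺ (finite-Fin states) refl) (eqF⁺ finHd refl)) (∧-T (eqF⁺ finCol refl) (eqF⁺ finCol refl))

  V-real : ∀ c i → T (V (isZero i) (real c i) (real (tick c) i))
  V-real (config q ts) i = ∧-T (eqF⁺ (finite-Fin states) refl) (∧-T (eqF⁺ finCol (column-move ts _ i)) (imp⁺ (isZero i) (hd i)))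
   where
   hd : ∀ i → T (isZero i) → T (eqF finHd (Vec.map Tape.head (zipWith writeMove ts (proj₂ (δ̂ q (Vec.map Tape.head ts))))) (newHeads (proj₂ (δ̂ q (Vec.map Tape.head ts))) (column i ts)))
   hd zero _ = eqF⁺ finHd (heads-move ts _)

  -- In the known part b is the prescribed bit; elsewhere b says whether the cell may belong to the
  -- certificate or must be blank.
  symOK : Bool → Bool → Γ → Γ → Bool
  symOK true b s s′ = eqF finΓ s (bit b)
  symOK false true s s′ = isBit s ∨ (eqF finΓ s nothing ∧ eqF finΓ s′ nothing)
  symOK false false s s′ = eqF finΓ s nothing

  symOK-known : ∀ {k b s s′} → k ≡ true → T (symOK k b s s′) → s ≡ bit b
  symOK-known refl t = eqF⁻ finΓ t

  symOK-free : ∀ {k b s s′} → k ≡ false → b ≡ true → T (symOK k b s s′) → T (isBit s) ⊎ (s ≡ nothing × s′ ≡ nothing)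
  symOK-free {s = s} refl refl t = [ inj₁ , (λ q → inj₂ (eqF⁻ finΓ (T-∧₁ q) , eqF⁻ finΓ (T-∧₂ (eqF finΓ s nothing) q))) ]′ (Equivalence.to (T-∨ {isBit s}) t)

  symOK-blank : ∀ {k b s s′} → k ≡ false → b ≡ false → T (symOK k b s s′) → s ≡ nothing
  symOK-blank refl refl t = eqF⁻ finΓ t

  startHeads : Bool → Vec Γ tapes
  startHeads b = bit b ∷ Vec.replicate workTapes nothing

  startCol : Γ → Col
  startCol s = (nothing , s) ∷ blankCol

  sym₀ : Col → Γ
  sym₀ c = proj₂ (Vec.head c)

  -- In the last row the first tape must show `true` under the head: the verifier outputs a single
  -- bit, so this symbol is its answer.
  allowedD : ⟦ bools 7 ⟧ → D → Bool
  allowedD (row0 , final , first , last , h , known , b , tt) (q , hd , p , c , n) =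
   (imp final (eqF finΓ (Vec.head hd) (bit true)) ∧ (imp first (eqF finCol p blankCol) ∧ imp last (eqF finCol n blankCol)))
   ∧ imp row0 ((eqF (finite-Fin states) q start ∧ eqF finHd hd (startHeads h)) ∧ (eqF finCol c (startCol (sym₀ c)) ∧ symOK known b (sym₀ c) (sym₀ n)))

  record Allowed (f : ⟦ bools 7 ⟧) (d : D) : Set where
   private
    row0 = proj₁ f
    final = proj₁ (proj₂ f)
    first = proj₁ (proj₂ (proj₂ f))
    last = proj₁ (proj₂ (proj₂ (proj₂ f)))
    h = proj₁ (proj₂ (proj₂ (proj₂ (proj₂ f))))
    known = proj₁ (proj₂ (proj₂ (proj₂ (proj₂ (proj₂ f)))))
    b = proj₁ (proj₂ (proj₂ (proj₂ (proj₂ (proj₂ (proj₂ f))))))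
    hd = proj₁ (proj₂ d)
    p = proj₁ (proj₂ (proj₂ d))
    c = proj₁ (proj₂ (proj₂ (proj₂ d)))
    n = proj₂ (proj₂ (proj₂ (proj₂ d)))
   field
    final-ok : T final → Vec.head hd ≡ bit true
    first-ok : T first → p ≡ blankCol
    last-ok : T last → n ≡ blankCol
    start-ok : T row0 → (proj₁ d ≡ start × hd ≡ startHeads h) × (c ≡ startCol (sym₀ c) × T (symOK known b (sym₀ c) (sym₀ n)))

  allowedD⁻ : ∀ f d → T (allowedD f d) → Allowed f d
  allowedD⁻ (row0 , final , first , last , h , known , b , tt) (q , hd , p , c , n) t = record
   { final-ok = λ z → eqF⁻ finΓ (imp⁻ z (T-∧₁ edge)) ; first-ok = λ z → eqF⁻ finCol (imp⁻ z (T-∧₁ side))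
   ; last-ok = λ z → eqF⁻ finCol (imp⁻ z (T-∧₂ (imp first (eqF finCol p blankCol)) side))
   ; start-ok = λ z → let both = imp⁻ {row0} z row
                          ab = T-∧₁ both
                          cd = T-∧₂ (eqF (finite-Fin states) q start ∧ eqF finHd hd (startHeads h)) both
    in (eqF⁻ (finite-Fin states) (T-∧₁ ab) , eqF⁻ finHd (T-∧₂ (eqF (finite-Fin states) q start) ab)) ,
     (eqF⁻ finCol (T-∧₁ cd) , T-∧₂ (eqF finCol c (startCol (sym₀ c))) cd) }
   where
   edges₀ : Bool
   edges₀ = imp final (eqF finΓ (Vec.head hd) (bit true)) ∧ (imp first (eqF finCol p blankCol) ∧ imp last (eqF finCol n blankCol))
   edge : T edges₀
   edge = T-∧₁ t
   side : T (imp first (eqF finCol p blankCol) ∧ imp last (eqF finCol n blankCol))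
   side = T-∧₂ (imp final (eqF finΓ (Vec.head hd) (bit true))) edge
   row : T (imp row0 ((eqF (finite-Fin states) q start ∧ eqF finHd hd (startHeads h)) ∧ (eqF finCol c (startCol (sym₀ c)) ∧ symOK known b (sym₀ c) (sym₀ n))))
   row = T-∧₂ edges₀ t

  H⁻ : ∀ d d′ → T (H d d′) → (proj₁ d ≡ proj₁ d′ × proj₁ (proj₂ d) ≡ proj₁ (proj₂ d′)) ×
   (proj₂ (proj₂ (proj₂ (proj₂ d))) ≡ proj₁ (proj₂ (proj₂ (proj₂ d′))) × proj₁ (proj₂ (proj₂ (proj₂ d))) ≡ proj₁ (proj₂ (proj₂ d′)))
  H⁻ (q , hd , p , c , n) (q′ , hd′ , p′ , c′ , n′) h =
   (eqF⁻ (finite-Fin states) (T-∧₁ a) , eqF⁻ finHd (T-∧₂ (eqF (finite-Fin states) q q′) a)) , (eqF⁻ finCol (T-∧₁ b) , eqF⁻ finCol (T-∧₂ (eqF finCol n c′) b))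
   where
   a : T (eqF (finite-Fin states) q q′ ∧ eqF finHd hd hd′)
   a = T-∧₁ h
   b : T (eqF finCol n c′ ∧ eqF finCol c p′)
   b = T-∧₂ (eqF (finite-Fin states) q q′ ∧ eqF finHd hd hd′) h

  V⁻ : ∀ first q hd p c n d′ → T (V first (q , hd , p , c , n) d′) →
   proj₁ d′ ≡ proj₁ (δ̂ q hd) × proj₁ (proj₂ (proj₂ (proj₂ d′))) ≡ shifts first (proj₂ (δ̂ q hd)) p c n × (T first → proj₁ (proj₂ d′) ≡ newHeads (proj₂ (δ̂ q hd)) c)
  V⁻ first q hd p c n (q′ , hd′ , p′ , c′ , n′) h =
   eqF⁻ (finite-Fin states) (T-∧₁ h) , eqF⁻ finCol (T-∧₁ rest) , λ z → eqF⁻ finHd (imp⁻ z (T-∧₂ (eqF finCol c′ (shifts first (proj₂ (δ̂ q hd)) p c n)) rest))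
   where
   rest : T (eqF finCol c′ (shifts first (proj₂ (δ̂ q hd)) p c n) ∧ imp first (eqF finHd hd′ (newHeads (proj₂ (δ̂ q hd)) c)))
   rest = T-∧₂ (eqF (finite-Fin states) q′ (proj₁ (δ̂ q hd))) h

  module _ (p q : PolyBound) where

   -- The common prefix of the codes ⟨ w , v ⟩ for all v; the certificate follows it directly.
   header : Word → Word
   header w = ⟨ w , [] ⟩

   guess : Word → ℕ
   guess w = ⟪ polOf p ⟫ (length w)

   -- The time bound is taken at the greatest possible input length. Each half of a tape gains at
   -- most one cell per step, so beyond input length plus time all columns are blank.
   rows cols : Word → ℕ
   rows w = ⟪ polOf q ⟫ (length (header w) + guess w)
   cols w = suc (length (header w) + guess w + rows w)

   -- Column i holds the input cell i + 1, because cell 0 is under the head.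
   known? : Word → ℕ → Bool
   known? w i = suc i <ᵇ length (header w)

   flags : Word → ℕ → ℕ → ⟦ bools 7 ⟧
   flags w t i = isZero t , eqᵇ nat t (rows w) , isZero i , eqᵇ nat (suc i) (cols w) , nth false (header w) 0 ,
    known? w i , (if known? w i then nth false (header w) (suc i) else suc i <ᵇ length (header w) + guess w) , tt

   headerP : ∀ {Γ e} → PT Γ (list 𝔹) e → PT Γ (list 𝔹) (λ γ → header (e γ))
   headerP E = pairP E nilP

   guessP : ∀ {Γ e} → PT Γ (list 𝔹) e → PT Γ nat (λ γ → guess (e γ))
   guessP E = polP (polOf p) (lengthP E)

   rowsP : ∀ {Γ e} → PT Γ (list 𝔹) e → PT Γ nat (λ γ → rows (e γ))
   rowsP E = polP (polOf q) (lengthP (headerP E) +P guessP E)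

   colsP : ∀ {Γ e} → PT Γ (list 𝔹) e → PT Γ nat (λ γ → cols (e γ))
   colsP E = sucP (lengthP (headerP E) +P guessP E +P rowsP E)

   flagsP : PT (list 𝔹 ⊗ nat ⊗ nat) (bools 7) (λ (w , t , i) → flags w t i)
   flagsP = zeroP tP ,P (eqP nat tP (rowsP wP) ,P (zeroP iP ,P (eqP nat (sucP iP) (colsP wP) ,P (nthP false (headerP wP) (constP nat 0) ,P
    (knownP ,P (ifP knownP (nthP false (headerP wP) (sucP iP)) (sucP iP <ᵇP (lengthP (headerP wP) +P guessP wP)) ,P constP 𝟙 tt))))))
    where
    wP = fstP {list 𝔹} {nat ⊗ nat}
    tP = v1 {list 𝔹} {nat} {nat}
    iP = w2 {list 𝔹} {nat} {nat}
    zeroP : ∀ {Γ e} → PT Γ nat e → PT Γ 𝔹 (λ γ → isZero (e γ))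
    zeroP E = caseℕP E (constP 𝔹 true) (constP 𝔹 false)
    knownP = sucP iP <ᵇP lengthP (headerP wP)

   open Tiling (list 𝔹) N (to finD (start , Vec.replicate _ nothing , blankCol , blankCol , blankCol)) 7 rows cols flags
    (λ f d → allowedD f (from finD d)) (λ d e → H (from finD d) (from finD e)) (λ b d e → V b (from finD d) (from finD e)) public

   tableauP : PT (list 𝔹) φτ (λ w → vars w , clauses w)
   tableauP = formulaP (rowsP idP) (colsP idP) flagsP

   module _ (w : Word) where

    private
     u = header w
     L = cols w
     TT = rows w

    first-bit : ∀ v → Vec.map Tape.head (Config.contents (initial M ⟨ w , v ⟩)) ≡ startHeads (nth false u 0)
    first-bit v rewrite pair-++ w v with _ , _ , eq ← header-cons w rewrite eq = cong (_ ∷_) (blanks workTapes)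
     where
     blanks : ∀ n → Vec.map Tape.head (Vec.replicate n (blankTape {workSymbols})) ≡ Vec.replicate n nothing
     blanks zero = refl
     blanks (suc n) = cong (nothing ∷_) (blanks n)

    first-column : ∀ v i → column i (Config.contents (initial M ⟨ w , v ⟩)) ≡ startCol (symAt (u ++ v) (suc i))
    first-column v i rewrite pair-++ w v with _ , _ , eq ← header-cons w rewrite eq = cong₂ _∷_ (cong₂ _,_ (nth-[] nothing i) refl) (blanks workTapes)
     where
     blanks : ∀ n → column i (Vec.replicate n (blankTape {workSymbols})) ≡ blankCol
     blanks zero = refl
     blanks (suc n) = cong₂ _∷_ (cong₂ _,_ (nth-[] nothing i) (nth-[] nothing i)) (blanks n)

    prev-zero : ∀ i → T (isZero i) → ∀ {n} (ts : Vec (Tape Γ) n) → prevColumn i ts ≡ blankCol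
    prev-zero zero _ [] = refl
    prev-zero zero _ (t ∷ ts) = cong (_ ∷_) (prev-zero zero tt ts)

    Short : ℕ → Tape Γ → Set
    Short m tp = length (Tape.before tp) ≤ m × length (Tape.after tp) ≤ m

    data AllShort (m : ℕ) : ∀ {n} → Vec (Tape Γ) n → Set where
     [] : AllShort m []
     _∷_ : ∀ {n tp} {ts : Vec (Tape Γ) n} → Short m tp → AllShort m ts → AllShort m (tp ∷ ts)

    short-move : ∀ {m} tp act → Short m tp → Short (suc m) (writeMove tp act)
    short-move (tape ls h rs) (s , stay) (a , b) = m≤n⇒m≤1+n a , m≤n⇒m≤1+n b
    short-move (tape [] h rs) (s , left) (a , b) = z≤n , s≤s b
    short-move (tape (l ∷ ls) h rs) (s , left) (a , b) = ≤-trans (n≤1+n _) (m≤n⇒m≤1+n a) , s≤s b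
    short-move (tape ls h []) (s , right) (a , b) = s≤s a , z≤n
    short-move (tape ls h (r ∷ rs)) (s , right) (a , b) = s≤s a , ≤-trans (n≤1+n _) (m≤n⇒m≤1+n b)

    short-moves : ∀ {m n} (ts : Vec (Tape Γ) n) acts → AllShort m ts → AllShort (suc m) (zipWith writeMove ts acts)
    short-moves [] [] [] = []
    short-moves (t ∷ ts) (a ∷ acts) (s ∷ ss) = short-move t a s ∷ short-moves ts acts ss

    short-run : ∀ {m} c t → AllShort m (Config.contents c) → AllShort (t + m) (Config.contents (run c t))
    short-run c zero s = s
    short-run c (suc t) s with config q ts ← run c t | ih ← short-run c t s = short-moves ts _ ih

    short-column : ∀ {m n} {ts : Vec (Tape Γ) n} i → m ≤ i → AllShort m ts → column i ts ≡ blankCol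
    short-column i le [] = refl
    short-column i le ((a , b) ∷ ss) = cong₂ _∷_ (cong₂ _,_ (nth-beyond nothing _ i (≤-trans a le)) (nth-beyond nothing _ i (≤-trans b le))) (short-column i le ss)

    short-initial : ∀ y → AllShort (length y) (Config.contents (initial M y))
    short-initial y = input y ∷ blanks workTapes
     where
     blanks : ∀ n {m} → AllShort m (Vec.replicate n (blankTape {workSymbols}))
     blanks zero = []
     blanks (suc n) = (z≤n , z≤n) ∷ blanks n
     input : ∀ y → Short (length y) (inputTape y)
     input [] = z≤n , z≤n
     input (b ∷ y) = z≤n , ≤-trans (≤-reflexive (length-map _ y)) (n≤1+n _)

    input-length : ∀ v → length v ≤ guess w → length ⟨ w , v ⟩ ≤ length u + guess w
    input-length v le = ≤-trans (≤-reflexive (trans (cong length (pair-++ w v)) (length-++ u))) (+-monoʳ-≤ (length u) le)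

    outside : ∀ v t → length v ≤ guess w → t ≤ TT → column L (Config.contents (run (initial M ⟨ w , v ⟩) t)) ≡ blankCol
    outside v t le t≤ = short-column L (≤-trans (+-mono-≤ t≤ (input-length v le)) (≤-trans (≤-reflexive (+-comm TT (length u + guess w))) (n≤1+n _)))
     (short-run (initial M ⟨ w , v ⟩) t (short-initial ⟨ w , v ⟩))

    final : ∀ v {b} → length v ≤ guess w → Outputs M ⟨ w , v ⟩ (at q (length ⟨ w , v ⟩)) [ b ] → Vec.head (Vec.map Tape.head (Config.contents (run (initial M ⟨ w , v ⟩) TT))) ≡ bit b
    final v {b} le (s , d , s≤ , h , out) rewrite run-halts h (≤-trans s≤ (≤-trans (≤-reflexive (sym (polOf-at q (length ⟨ w , v ⟩)))) (⟪⟫-mono (polOf q) (input-length v le)))) = heads d out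
     where
     single : ∀ s rs → leadingBits {workSymbols} (s ∷ rs) ≡ [ b ] → s ≡ bit b
     single (bit c) rs eq = cong (λ b → bit b) (∷-injectiveˡ eq)
     single nothing rs ()
     single (just (inj₂ _)) rs ()
     heads : ∀ d → output M d ≡ [ b ] → Vec.head (Vec.map Tape.head (Config.contents d)) ≡ bit b
     heads (config q (tape _ s rs ∷ ts)) out = single s rs out

    run⇒tiling : ∀ v → length v ≤ guess w → Outputs M ⟨ w , v ⟩ (at q (length ⟨ w , v ⟩)) [ true ] → ∃[ g ] IsTiling w g
    run⇒tiling v le out = g , record
     { unary-ok = λ {t} {i} t≤ i< → subst (λ d → T (allowedD (flags w t i) d)) (sym (from-to finD (real (conf t) i))) (ok t i t≤ i<)
     ; h-ok = λ {t} {i} _ _ → subst₂ (λ d e → T (H d e)) (sym (from-to finD (real (conf t) i))) (sym (from-to finD (real (conf t) (suc i)))) (H-real (conf t) i)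
     ; v-ok = λ {t} {i} _ _ → subst₂ (λ d e → T (V (isZero i) d e)) (sym (from-to finD (real (conf t) i))) (sym (from-to finD (real (conf (suc t)) i))) (V-real (conf t) i) }
     where
     conf : ℕ → Config M
     conf t = run (initial M ⟨ w , v ⟩) t
     g : ℕ → ℕ → Fin N
     g t i = to finD (real (conf t) i)
     edges-ok : ∀ t i → t ≤ TT → T (imp (eqᵇ nat t TT) (eqF finΓ (Vec.head (proj₁ (proj₂ (real (conf t) i)))) (bit true)) ∧
      (imp (isZero i) (eqF finCol (proj₁ (proj₂ (proj₂ (real (conf t) i)))) blankCol) ∧ imp (eqᵇ nat (suc i) L) (eqF finCol (proj₂ (proj₂ (proj₂ (proj₂ (real (conf t) i))))) blankCol)))
     edges-ok t i t≤ = ∧-T (imp⁺ (eqᵇ nat t TT) (λ e → eqF⁺ finΓ (subst (λ t → Vec.head (Vec.map Tape.head (Config.contents (conf t))) ≡ bit true) (sym (T-eq {nat} e)) (final v le out))))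
      (∧-T (imp⁺ (isZero i) (λ z → eqF⁺ finCol (prev-zero i z (Config.contents (conf t)))))
       (imp⁺ (eqᵇ nat (suc i) L) (λ e → eqF⁺ finCol (trans (cong (λ j → column j (Config.contents (conf t))) (T-eq {nat} e)) (outside v t le t≤)))))
     start-ok : ∀ t i → i < L → T (imp (isZero t) ((eqF (finite-Fin states) (proj₁ (real (conf t) i)) start ∧ eqF finHd (proj₁ (proj₂ (real (conf t) i))) (startHeads (nth false u 0))) ∧
      (eqF finCol (proj₁ (proj₂ (proj₂ (proj₂ (real (conf t) i))))) (startCol (sym₀ (proj₁ (proj₂ (proj₂ (proj₂ (real (conf t) i))))))) ∧
       symOK (known? w i) (if known? w i then nth false u (suc i) else suc i <ᵇ length u + guess w) (sym₀ (proj₁ (proj₂ (proj₂ (proj₂ (real (conf t) i)))))) (sym₀ (proj₂ (proj₂ (proj₂ (proj₂ (real (conf t) i)))))))))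
     start-ok (suc t) i i< = tt
     start-ok zero i i< = ∧-T (∧-T (eqF⁺ (finite-Fin states) refl) (eqF⁺ finHd (first-bit v)))
      (∧-T (eqF⁺ finCol (subst (λ c → c ≡ startCol (sym₀ c)) (sym (first-column v i)) refl))
       (subst₂ (λ c n → T (symOK (known? w i) (if known? w i then nth false u (suc i) else suc i <ᵇ length u + guess w) (sym₀ c) (sym₀ n))) (sym (first-column v i)) (sym (first-column v (suc i))) sym-ok))
      where
      y = u ++ v
      sym-ok : T (symOK (known? w i) (if known? w i then nth false u (suc i) else suc i <ᵇ length u + guess w) (symAt y (suc i)) (symAt y (suc (suc i))))
      sym-ok with T? (known? w i)
      ... | yes k rewrite Equivalence.to T-≡ k = eqF⁺ finΓ (symAt-++ˡ u v (suc i) (<ᵇ⇒< (suc i) (length u) k))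
      ... | no k rewrite ¬T-false k with T? (suc i <ᵇ length u + guess w)
      ... | no f rewrite ¬T-false f = eqF⁺ finΓ (symAt-blank y (suc i) (≤-trans (≤-reflexive (length-++ u)) (≤-trans (+-monoʳ-≤ (length u) le) (≮⇒≥ (λ lt → f (<⇒<ᵇ lt))))))
      ... | yes f rewrite Equivalence.to T-≡ f with suc i <? length y
      ... | yes lt = T-∨₁ (subst (T ∘ isBit) (sym (symAt-bit y (suc i) lt)) tt)
      ... | no ge = T-∨₂ (isBit (symAt y (suc i))) (∧-T (eqF⁺ finΓ (symAt-blank y (suc i) (≮⇒≥ ge))) (eqF⁺ finΓ (symAt-blank y (suc (suc i)) (m≤n⇒m≤1+n (≮⇒≥ ge)))))
     ok : ∀ t i → t ≤ TT → i < L → T (allowedD (flags w t i) (real (conf t) i))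
     ok t i t≤ i< = ∧-T (edges-ok t i t≤) (start-ok t i i<)

    module FromTiling {g : ℕ → ℕ → Fin N} (tl : IsTiling w g) where

     open IsTiling tl

     G : ℕ → ℕ → D
     G t i = from finD (g t i)

     St : ℕ → ℕ → Fin states
     St t i = proj₁ (G t i)
     Hd : ℕ → ℕ → Vec Γ tapes
     Hd t i = proj₁ (proj₂ (G t i))
     Pc Cc Nc : ℕ → ℕ → Col
     Pc t i = proj₁ (proj₂ (proj₂ (G t i)))
     Cc t i = proj₁ (proj₂ (proj₂ (proj₂ (G t i))))
     Nc t i = proj₂ (proj₂ (proj₂ (proj₂ (G t i))))

     kind : ℕ → Bool
     kind i = if known? w i then nth false u (suc i) else suc i <ᵇ length u + guess w

     tile : ∀ {t i} → t ≤ TT → i < L → Allowed (flags w t i) (G t i)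
     tile {t} {i} t≤ i< = allowedD⁻ (flags w t i) (G t i) (unary-ok {t} {i} t≤ i<)

     first-tile : ∀ {t} → t ≤ TT → 0 < L → Pc t 0 ≡ blankCol
     first-tile t≤ lt = Allowed.first-ok (tile t≤ lt) tt

     last-tile : ∀ {t i} → t ≤ TT → i < L → suc i ≡ L → Nc t i ≡ blankCol
     last-tile {t} {i} t≤ lt e = Allowed.last-ok (tile t≤ lt) (subst (λ z → T (eqᵇ nat (suc i) z)) e (eq-T nat (suc i)))

     side : ∀ {t i} → t ≤ TT → suc i < L → (St t i ≡ St t (suc i) × Hd t i ≡ Hd t (suc i)) × (Nc t i ≡ Cc t (suc i) × Cc t i ≡ Pc t (suc i))
     side {t} {i} t≤ i< = H⁻ (G t i) (G t (suc i)) (h-ok {t} {i} t≤ i<)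

     s : ℕ → Γ
     s i = sym₀ (Cc 0 i)

     open ReadOff s L

     -- Column m holds the first cell behind the header, which is the cell with number m + 1 =
     -- `length u`.
     m : ℕ
     m = length (proj₁ (proj₂ (header-cons w)))

     u-length : length u ≡ suc m
     u-length = cong length (proj₂ (proj₂ (header-cons w)))

     v : Word
     v = collect m (guess w)

     v-length : length v ≤ guess w
     v-length = collect-length (guess w) m

     sym-fact : ∀ {i} → i < L → T (symOK (known? w i) (kind i) (s i) (sym₀ (Nc 0 i)))
     sym-fact i< = proj₂ (proj₂ (Allowed.start-ok (tile z≤n i<) tt))

     unknown : ∀ e → known? w (e + m) ≡ false
     unknown e = ¬T-false (λ t → <⇒≱ (<ᵇ⇒< (suc (e + m)) (length u) t) (≤-trans (≤-reflexive u-length) (s≤s (m≤n+m m e))))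

     kind-unknown : ∀ i → known? w i ≡ false → kind i ≡ (suc i <ᵇ length u + guess w)
     kind-unknown i eq = cong (λ k → if k then nth false u (suc i) else suc i <ᵇ length u + guess w) eq

     free-fact : ∀ e → e + m < L → e < guess w → Free (e + m)
     free-fact e lt h = [ inj₁ , (λ (z , n) → inj₂ (z , λ lt′ → trans (cong sym₀ (sym (proj₁ (proj₂ (side z≤n lt′))))) n)) ]′
      (symOK-free {known? w (e + m)} {kind (e + m)} {s (e + m)} (unknown e) (trans (kind-unknown (e + m) (unknown e)) (Equivalence.to T-≡ (<⇒<ᵇ inside))) (sym-fact lt))
      where
      inside : suc (e + m) < length u + guess w
      inside = subst (λ l → suc (e + m) < l + guess w) (sym u-length) (s≤s (≤-trans (s≤s (≤-reflexive (+-comm e m))) (≤-trans (≤-reflexive (sym (+-suc m e))) (+-monoʳ-≤ m h))))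

     blank-fact : ∀ e → e + m < L → guess w ≤ e → s (e + m) ≡ nothing
     blank-fact e lt h = symOK-blank {known? w (e + m)} {kind (e + m)} {s (e + m)} {sym₀ (Nc 0 (e + m))} (unknown e)
      (trans (kind-unknown (e + m) (unknown e)) (¬T-false (λ t → <⇒≱ (<ᵇ⇒< (suc (e + m)) (length u + guess w) t) beyond))) (sym-fact lt)
      where
      beyond : length u + guess w ≤ suc (e + m)
      beyond = subst (λ l → l + guess w ≤ suc (e + m)) (sym u-length) (s≤s (≤-trans (+-monoʳ-≤ m h) (≤-reflexive (+-comm m e))))

     symbols : ∀ i → i < L → s i ≡ symAt (u ++ v) (suc i)
     symbols i i< = [ inside , beyond ]′ (<-≤-connex (suc i) (length u))
      where
      inside : suc i < length u → s i ≡ symAt (u ++ v) (suc i)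
      inside k = trans (symOK-known {known? w i} {kind i} {s i} {sym₀ (Nc 0 i)} kn (sym-fact i<)) (trans (cong (λ k → bit (if k then nth false u (suc i) else suc i <ᵇ length u + guess w)) kn) (sym (symAt-++ˡ u v (suc i) k)))
       where
       kn : known? w i ≡ true
       kn = Equivalence.to T-≡ (<⇒<ᵇ k)
      beyond : length u ≤ suc i → s i ≡ symAt (u ++ v) (suc i)
      beyond k = subst (λ j → s j ≡ symAt (u ++ v) (suc j)) (m∸n+n≡m m≤i)
       (trans (collect-ok (guess w) m free-fact blank-fact e (subst (_< L) (sym (m∸n+n≡m m≤i)) i<))
        (sym (trans (cong (symAt (u ++ v)) (trans (cong suc (+-comm e m)) (cong (_+ e) (sym u-length)))) (symAt-++ʳ u v e))))
       where
       m≤i : m ≤ i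
       m≤i = ≤-pred (≤-trans (≤-reflexive (sym u-length)) k)
       e = i ∸ m

     conf : ℕ → Config M
     conf t = run (initial M ⟨ w , v ⟩) t

     -- The outer two columns of a tile are left to `full-row`: they follow from the middle columns
     -- of the neighbouring tiles and, at the margins, from blankness.
     Core : ℕ → Set
     Core t = ∀ i → i < L → St t i ≡ Config.state (conf t) × Hd t i ≡ Vec.map Tape.head (Config.contents (conf t)) × Cc t i ≡ column i (Config.contents (conf t))

     full-row : ∀ t → t ≤ TT → Core t → ∀ i → i < L → G t i ≡ real (conf t) i
     full-row t t≤ core i i< = cong₂ _,_ (proj₁ (core i i<)) (cong₂ _,_ (proj₁ (proj₂ (core i i<))) (cong₂ _,_ (left-col i i<) (cong₂ _,_ (proj₂ (proj₂ (core i i<))) (right-col i i<))))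
      where
      left-col : ∀ i → i < L → Pc t i ≡ prevColumn i (Config.contents (conf t))
      left-col zero lt = trans (first-tile t≤ lt) (sym (prev-zero 0 tt (Config.contents (conf t))))
      left-col (suc i) lt = trans (sym (proj₂ (proj₂ (side t≤ lt)))) (proj₂ (proj₂ (core i (≤-trans (n≤1+n _) lt))))
      right-col : ∀ i → i < L → Nc t i ≡ column (suc i) (Config.contents (conf t))
      right-col i lt = [ (λ lt′ → trans (proj₁ (proj₂ (side t≤ lt′))) (proj₂ (proj₂ (core (suc i) lt′))))
       , (λ eq → trans (last-tile t≤ lt eq) (sym (trans (cong (λ j → column j (Config.contents (conf t))) eq) (outside v t v-length t≤)))) ]′ (m≤n⇒m<n∨m≡n lt)

     -- Induction over the rows: `V` yields the state and the middle column everywhere, but the head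
     -- symbols only in column 0, from where they travel along the row.
     core : ∀ t → t ≤ TT → Core t
     core zero t≤ i i< = proj₁ (proj₁ st) , trans (proj₂ (proj₁ st)) (sym (first-bit v)) , trans (proj₁ (proj₂ st)) (trans (cong startCol (symbols i i<)) (sym (first-column v i)))
      where st = Allowed.start-ok (tile {0} {i} z≤n i<) tt
     core (suc t) t≤ i i< = proj₁ (local i i<) , hd i i< , proj₁ (proj₂ (local i i<))
      where
      c = conf t
      q₀ = Config.state c
      ts = Config.contents c
      acts = proj₂ (δ̂ q₀ (Vec.map Tape.head ts))
      row = full-row t (<⇒≤ t≤) (core t (<⇒≤ t≤))
      local : ∀ i → i < L → St (suc t) i ≡ Config.state (tick c) × Cc (suc t) i ≡ column i (Config.contents (tick c)) × (T (isZero i) → Hd (suc t) i ≡ newHeads acts (column i ts))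
      local i i< = let a , b , h = V⁻ (isZero i) q₀ (Vec.map Tape.head ts) (prevColumn i ts) (column i ts) (column (suc i) ts) (G (suc t) i)
                        (subst (λ d → T (V (isZero i) d (G (suc t) i))) (row i i<) (v-ok {t} {i} t≤ i<))
       in a , trans b (sym (column-move ts acts i)) , h
      hd : ∀ i → i < L → Hd (suc t) i ≡ Vec.map Tape.head (Config.contents (tick c))
      hd zero lt = trans (proj₂ (proj₂ (local 0 lt)) tt) (sym (heads-move ts acts))
      hd (suc i) lt = trans (sym (proj₂ (proj₁ (side t≤ lt)))) (hd i (≤-trans (n≤1+n _) lt))

     accepts : ∀ {b} → Outputs M ⟨ w , v ⟩ (at q (length ⟨ w , v ⟩)) [ b ] → b ≡ true
     accepts {b} out = bit-inj (trans (sym (final v v-length out)) (trans (cong Vec.head (sym (proj₁ (proj₂ (core TT ≤-refl 0 (s≤s z≤n)))))) (Allowed.final-ok (tile {TT} {0} ≤-refl (s≤s z≤n)) (eq-T nat TT))))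
      where
      bit-inj : ∀ {b c} → _≡_ {A = Γ} (bit b) (bit c) → b ≡ c
      bit-inj refl = refl

-- NP-hardness

module CookLevin where

 open import Data.Bool using (T)
 open import Data.Nat.Binary.Properties using (fromℕ-injective)
 open Programs using (polOf-at; nat; _⊗_; _∘P_)
 open PolynomialTime using (polyTime)
 open RegularGraphs
 open FormulaToGraph using (module Reduction)
 open Membership
 open Tableaux using (module Tableau)

 open Graph using (order; edges; degree)

 pair-injective : ∀ {a b c d} → ⟨ a , b ⟩ ≡ ⟨ c , d ⟩ → a ≡ c × b ≡ d
 pair-injective {a} {b} {c} {d} eq with e ← trans (sym (unpair-pair a b)) (trans (cong unpair eq) (unpair-pair c d)) = cong proj₁ e , cong proj₂ e

 encodeℕᵇ-injective : ∀ {m n} → encodeℕᵇ m ≡ encodeℕᵇ n → m ≡ n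
 encodeℕᵇ-injective {m} {n} eq = trans (sym (decode-encode m)) (trans (cong decodeᵇ eq) (decode-encode n))

 -- Graphs with the same code need not be equal, but they have pointwise equal adjacency.
 yes-resp : ∀ R {x y} → Problem.encode (R -freeEdgeDeletion) x ≡ Problem.encode (R -freeEdgeDeletion) y →
  Problem.Yes (R -freeEdgeDeletion) x → Problem.Yes (R -freeEdgeDeletion) y
 yes-resp R {G , k} {G′ , k′} eq yes
  with ek , eg ← pair-injective {encodeℕᵇ (fromℕ k)} {encodeGraph G} {encodeℕᵇ (fromℕ k′)} {encodeGraph G′} eq
  with eu , em ← pair-injective {unary (order G)} {fullMatrix (has (edges G))} {unary (order G′)} {fullMatrix (has (edges G′))} eg =
  go (order G) (edges G) (order G′) (edges G′) (trans (sym (length-replicate (order G))) (trans (cong length eu) (length-replicate (order G′)))) em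
   (fromℕ-injective (encodeℕᵇ-injective ek)) yes
  where
  go : ∀ n (E : EdgeSet n) n′ (E′ : EdgeSet n′) → n ≡ n′ → fullMatrix (has E) ≡ fullMatrix (has E′) → k ≡ k′ →
   Problem.Yes (R -freeEdgeDeletion) (record { order = n ; edges = E } , k) → Problem.Yes (R -freeEdgeDeletion) (record { order = n′ ; edges = E′ } , k′)
  go n E .n E′ refl em refl (F , F⊆ , le , free) =
   F , (λ u v t → subst T (same u v) (F⊆ u v t)) , le ,
   λ c → free (embedding⇒contains R (G₁ − F) (let f , f-inj , f-adj = contains⇒embedding R (G₂ − F) c in
    f , f-inj , λ u v → trans (f-adj u v) (cong (_∧ not (has F (f u) (f v))) (sym (same (f u) (f v))))))
   where
   G₁ G₂ : Graph
   G₁ = record { order = n ; edges = E }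
   G₂ = record { order = n ; edges = E′ }
   same : ∀ u v → has E u v ≡ has E′ u v
   same u v = trans (sym (nth-matrix (has E) u v)) (trans (cong (λ m → nth false m (Data.Fin.toℕ u Data.Nat.* n Data.Nat.+ Data.Fin.toℕ v)) em) (nth-matrix (has E′) u v))

 module Hardness (R : Graph) (conn : Connected R) (r : ℕ) (reg : ∀ u → degree R u ≡ r) (2≤r : 2 ≤ r)
  (co : Core.Complement R conn r reg 2≤r) where

  -- A word belongs to the language if some instance with this code is a yes-instance; on the way
  -- back `yes-resp` exchanges that instance for the one constructed.
  npHard : NPHard (Problem.language (R -freeEdgeDeletion))
  npHard L (verify , p , (M , q , computes) , spec) = word ∘ formula , polyTime (wordP ∘P tableauP p q) , λ w → mk⇔ (to w) (from w)
   where
   open Tableau M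
   open Reduction R conn r reg 2≤r co (nat ⊗ nat ⊗ nat) using (word; wordP; instance′; correct)
   formula = λ w → vars p q w , clauses p q w
   to : ∀ w → L w → Problem.language (R -freeEdgeDeletion) (word (formula w))
   to w l =
    let v , le , ok = Equivalence.to (spec w) l
        g , tl = run⇒tiling p q w v (≤-trans le (≤-reflexive (sym (polOf-at p (length w))))) (subst (λ b → Outputs M ⟨ w , v ⟩ (at q (length ⟨ w , v ⟩)) [ b ]) ok (computes ⟨ w , v ⟩))
    in instance′ (formula w) , refl , Equivalence.to (correct (formula w) (wellFormed p q w)) (tiling⇒sat p q w tl)
   from : ∀ w → Problem.language (R -freeEdgeDeletion) (word (formula w)) → L w
   from w (x , eq , yes) =
    let g , tl = sat⇒tiling p q w (Equivalence.from (correct (formula w) (wellFormed p q w)) (yes-resp R {x} {instance′ (formula w)} eq yes))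
    in Equivalence.from (spec w) (FromTiling.v p q w tl , ≤-trans (FromTiling.v-length p q w tl) (≤-reflexive (polOf-at p (length w))) ,
     FromTiling.accepts p q w tl (computes _))

-- Sparsification

module Sparsification where

 open import Data.Bool using (T)
 open import Data.Bool.Properties using () renaming (_≟_ to _≟ᵇ_)
 open import Data.List.Membership.Propositional.Properties
 import Data.List.Relation.Unary.All as All
 open import Data.Nat.ListAction using (sum)
 open import Data.Nat.Properties
 open import Relation.Nullary using (yes; no)
 open Programs using (Ty; nat; 𝔹; _⊗_; ⟦_⟧; caseList)
 open PolynomialTime using (eqᵇ)
 open RegularGraphs using (T-⇔-≡; ¬T-false; T-not; ¬T-not; ∧-T; T-∧₁; T-∧₂)
 open GluedCopies using (T-eq; eq-T; mem; mem⁺; mem⁻; T-∨₁; T-∨₂)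

 ind : Bool → ℕ
 ind b = if b then 1 else 0

 ind≤1 : ∀ b → ind b ≤ 1
 ind≤1 true = ≤-refl
 ind≤1 false = z≤n

 ind-T : ∀ {b} → T b → ind b ≡ 1
 ind-T {true} _ = refl

 ind-mono : ∀ {a b} → (T a → T b) → ind a ≤ ind b
 ind-mono {false} h = z≤n
 ind-mono {true} {true} h = ≤-refl
 ind-mono {true} {false} h = ⊥-elim (h tt)

 module _ {A : Set} where

  ∑ : List A → (A → ℕ) → ℕ
  ∑ xs f = sum (map f xs)

  count : (A → Bool) → List A → ℕ
  count q xs = length (filterᵇ q xs)

  count-∑ : ∀ q xs → count q xs ≡ ∑ xs (ind ∘ q)
  count-∑ q [] = refl
  count-∑ q (x ∷ xs) with q x
  ... | true = cong suc (count-∑ q xs)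
  ... | false = count-∑ q xs

  ∑-mono : ∀ xs {f g : A → ℕ} → (∀ {x} → x ∈ xs → f x ≤ g x) → ∑ xs f ≤ ∑ xs g
  ∑-mono [] h = z≤n
  ∑-mono (x ∷ xs) h = +-mono-≤ (h (here refl)) (∑-mono xs (h ∘ there))

  ∑-cong : ∀ xs {f g : A → ℕ} → (∀ {x} → x ∈ xs → f x ≡ g x) → ∑ xs f ≡ ∑ xs g
  ∑-cong xs h = ≤-antisym (∑-mono xs (≤-reflexive ∘ h)) (∑-mono xs (≤-reflexive ∘ sym ∘ h))

  ∑-+ : ∀ xs (f g : A → ℕ) → ∑ xs (λ x → f x + g x) ≡ ∑ xs f + ∑ xs g
  ∑-+ [] f g = refl
  ∑-+ (x ∷ xs) f g = trans (cong (f x + g x +_) (∑-+ xs f g)) (mix (f x) (g x) _ _)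
   where
   mix : ∀ a b c d → a + b + (c + d) ≡ a + c + (b + d)
   mix = solve-∀

  ∑-*ʳ : ∀ xs (f : A → ℕ) c → ∑ xs (λ x → f x * c) ≡ ∑ xs f * c
  ∑-*ʳ [] f c = refl
  ∑-*ʳ (x ∷ xs) f c = trans (cong (f x * c +_) (∑-*ʳ xs f c)) (sym (*-distribʳ-+ c (f x) _))

  ∑-const : ∀ xs {f : A → ℕ} {c} → (∀ {x} → x ∈ xs → f x ≤ c) → ∑ xs f ≤ length xs * c
  ∑-const [] h = z≤n
  ∑-const (x ∷ xs) h = +-mono-≤ (h (here refl)) (∑-const xs (h ∘ there))

  ∑-∈ : ∀ {xs x} {f : A → ℕ} → x ∈ xs → f x ≤ ∑ xs f
  ∑-∈ (here refl) = m≤m+n _ _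
  ∑-∈ {f = f} (there {x = y} m) = ≤-trans (∑-∈ m) (m≤n+m _ (f y))

  ∑-zero : ∀ xs {f : A → ℕ} → (∀ {x} → x ∈ xs → f x ≡ 0) → ∑ xs f ≡ 0
  ∑-zero xs h = ≤-antisym (≤-trans (∑-const xs (≤-reflexive ∘ h)) (≤-reflexive (*-zeroʳ (length xs)))) z≤n

  ∑-single : ∀ {xs} → Unique xs → ∀ {q : A → Bool} {y} → (∀ {x} → T (q x) → x ≡ y) → ∑ xs (ind ∘ q) ≤ 1
  ∑-single [] h = z≤n
  ∑-single {x ∷ xs} (d ∷ u) {q} {y} h with T? (q x)
  ... | no n rewrite ¬T-false n = ∑-single u h
  ... | yes t rewrite ∑-zero xs {ind ∘ q} (λ m → cong ind (¬T-false (λ t′ → All.lookup d m (trans (h t) (sym (h t′)))))) | ind-T t = ≤-refl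

 ∑-swap : ∀ {A B : Set} (xs : List A) (ys : List B) (f : A → B → ℕ) → ∑ xs (λ x → ∑ ys (f x)) ≡ ∑ ys (λ y → ∑ xs (λ x → f x y))
 ∑-swap [] ys f = sym (∑-zero ys (λ _ → refl))
 ∑-swap (x ∷ xs) ys f = trans (cong (∑ ys (f x) +_) (∑-swap xs ys f)) (sym (∑-+ ys (f x) _))

 ∑-product : ∀ {A B : Set} (xs : List A) (ys : List B) (f : A × B → ℕ) → ∑ (cartesianProduct xs ys) f ≡ ∑ xs (λ x → ∑ ys (λ y → f (x , y)))
 ∑-product [] ys f = refl
 ∑-product (x ∷ xs) ys f = trans (∑-++ (map (x ,_) ys)) (cong₂ _+_ (row ys) (∑-product xs ys f))
  where
  ∑-++ : ∀ zs {ws} → ∑ (zs ++ ws) f ≡ ∑ zs f + ∑ ws f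
  ∑-++ [] = refl
  ∑-++ (z ∷ zs) = trans (cong (f z +_) (∑-++ zs)) (sym (+-assoc (f z) _ _))
  row : ∀ ys → ∑ (map (x ,_) ys) f ≡ ∑ ys (λ y → f (x , y))
  row [] = refl
  row (y ∷ ys) = cong (f (x , y) +_) (row ys)

 ℓ : Ty
 ℓ = nat ⊗ 𝔹

 Lit : Set
 Lit = ⟦ ℓ ⟧

 -- Sets of literals collected along a branch: the units and the ordered pairs.
 State : Set
 State = List Lit × List (Lit × Lit)

 module Sparse (Ls : List Lit) (Tr : List (Lit × Lit × Lit)) (θ : ℕ) where

  Ls² : List (Lit × Lit)
  Ls² = cartesianProduct Ls Ls

  -- Triples are ordered, and a clause is counted at its first literal; this is enough to bound the
  -- clauses at a leaf. Symmetry in the last two places keeps the set of pairs symmetric when the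
  -- remainders at a literal are added.
  trip : Lit → Lit → Lit → Bool
  trip a b c = mem (ℓ ⊗ ℓ ⊗ ℓ) (a , b , c) Tr

  u : State → Lit → Bool
  u S a = mem ℓ a (proj₁ S)

  pr : State → Lit → Lit → Bool
  pr S a b = mem (ℓ ⊗ ℓ) (a , b) (proj₂ S)

  -- sets that do not contain a smaller set of the family
  lp : State → Lit → Lit → Bool
  lp S a b = pr S a b ∧ (not (u S a) ∧ not (u S b))

  lt : State → Lit → Lit → Lit → Bool
  lt S a b c = trip a b c ∧ ((not (u S a) ∧ (not (u S b) ∧ not (u S c))) ∧ (not (pr S a b) ∧ (not (pr S a c) ∧ not (pr S b c))))

  addU : State → (Lit → Bool) → State
  addU S q = filterᵇ (λ x → u S x ∨ q x) Ls , proj₂ S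

  addP : State → (Lit → Lit → Bool) → State
  addP S q = proj₁ S , filterᵇ (λ (x , y) → pr S x y ∨ q x y) Ls²

  same : Lit → Lit → Lit → Lit → Bool
  same a b x y = eqᵇ (ℓ ⊗ ℓ) (a , b) (x , y) ∨ eqᵇ (ℓ ⊗ ℓ) (b , a) (x , y)

  -- The thresholds let the second branch gain θ² in every case: either θ new units with a net gain
  -- of θ each, or θ² new ordered pairs that count 1 each.
  heavy₁ heavy₃ : State → Lit → Bool
  heavy₁ S a = θ ≤ᵇ count (lp S a) Ls
  heavy₃ S a = θ * θ ≤ᵇ count (λ (x , y) → lt S a x y) Ls²

  heavy₂ : State → Lit × Lit → Bool
  heavy₂ S (a , b) = θ ≤ᵇ count (lt S a b) Ls

  -- The order of the tests matters. Pairs are added only when every literal is in fewer than θ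
  -- pairs, and the remainders at a literal only when no pair is in θ triples; this keeps all
  -- degrees at most 2θ.
  expand : State → ⊤ ⊎ (State × State)
  expand S =
   caseList (filterᵇ (heavy₁ S) Ls)
    (caseList (filterᵇ (heavy₂ S) Ls²)
     (caseList (filterᵇ (heavy₃ S) Ls) (inj₁ tt) (λ a _ → inj₂ (addU S (eqᵇ ℓ a) , addP S (lt S a))))
     (λ ab _ → inj₂ (addP S (same (proj₁ ab) (proj₂ ab)) , addU S (lt S (proj₁ ab) (proj₂ ab)))))
    (λ a _ → inj₂ (addU S (eqᵇ ℓ a) , addU S (lp S a)))

  Light₁ Light₂ : State → Set
  Light₁ S = ∀ {a} → a ∈ Ls → count (lp S a) Ls < θ
  Light₂ S = ∀ {a b} → a ∈ Ls → b ∈ Ls → count (lt S a b) Ls < θ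

  data View (S : State) : ⊤ ⊎ (State × State) → Set where
   split₁ : ∀ {a} → a ∈ Ls → θ ≤ count (lp S a) Ls → View S (inj₂ (addU S (eqᵇ ℓ a) , addU S (lp S a)))
   split₂ : ∀ {a b} → a ∈ Ls → b ∈ Ls → Light₁ S → θ ≤ count (lt S a b) Ls → View S (inj₂ (addP S (same a b) , addU S (lt S a b)))
   split₃ : ∀ {a} → a ∈ Ls → Light₁ S → Light₂ S → θ * θ ≤ count (λ (x , y) → lt S a x y) Ls² → View S (inj₂ (addU S (eqᵇ ℓ a) , addP S (lt S a)))
   leaf : Light₁ S → (∀ {a} → a ∈ Ls → count (λ (x , y) → lt S a x y) Ls² < θ * θ) → View S (inj₁ tt)

  private
   none : ∀ {A : Set} {q : A → Bool} {xs} → filterᵇ q xs ≡ [] → ∀ {x} → x ∈ xs → ¬ T (q x)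
   none {q = q} eq m t with () ← subst (_ ∈_) eq (∈-filter⁺ (T? ∘ q) m t)

   one : ∀ {A : Set} {q : A → Bool} {xs x ys} → filterᵇ q xs ≡ x ∷ ys → x ∈ xs × T (q x)
   one {q = q} {xs} {x} eq = ∈-filter⁻ (T? ∘ q) {xs = xs} (subst (x ∈_) (sym eq) (here refl))

  expandView : ∀ S → View S (expand S)
  expandView S with filterᵇ (heavy₁ S) Ls in eq₁
  ... | a ∷ _ = let m , t = one {q = heavy₁ S} {Ls} eq₁ in split₁ m (≤ᵇ⇒≤ θ _ t)
  ... | [] with filterᵇ (heavy₂ S) Ls² in eq₂
  ... | (a , b) ∷ _ = let m , t = one {q = heavy₂ S} {Ls²} eq₂ ; p , q = ∈-cartesianProduct⁻ Ls Ls m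
   in split₂ p q (λ x∈ → ≰⇒> (λ le → none {q = heavy₁ S} eq₁ x∈ (≤⇒≤ᵇ le))) (≤ᵇ⇒≤ θ _ t)
  ... | [] with filterᵇ (heavy₃ S) Ls in eq₃
  ... | a ∷ _ = let m , t = one {q = heavy₃ S} {Ls} eq₃ in
   split₃ m (λ x∈ → ≰⇒> (λ le → none {q = heavy₁ S} eq₁ x∈ (≤⇒≤ᵇ le))) (λ x∈ y∈ → ≰⇒> (λ le → none {q = heavy₂ S} eq₂ (∈-cartesianProduct⁺ x∈ y∈) (≤⇒≤ᵇ le))) (≤ᵇ⇒≤ (θ * θ) _ t)
  ... | [] = leaf (λ x∈ → ≰⇒> (λ le → none {q = heavy₁ S} eq₁ x∈ (≤⇒≤ᵇ le))) (λ x∈ → ≰⇒> (λ le → none {q = heavy₃ S} eq₃ x∈ (≤⇒≤ᵇ le)))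

  u-addU : ∀ {S q x} → x ∈ Ls → T (u S x ∨ q x) → T (u (addU S q) x)
  u-addU {S} {q} m t = mem⁺ ℓ (∈-filter⁺ (T? ∘ (λ x → u S x ∨ q x)) m t)

  u-addU⁻ : ∀ {S q x} → T (u (addU S q) x) → T (u S x ∨ q x)
  u-addU⁻ {S} {q} {x} t = proj₂ (∈-filter⁻ (T? ∘ (λ x → u S x ∨ q x)) {xs = Ls} (mem⁻ ℓ x _ t))

  pr-addP : ∀ {S q x y} → x ∈ Ls → y ∈ Ls → T (pr S x y ∨ q x y) → T (pr (addP S q) x y)
  pr-addP {S} {q} m m′ t = mem⁺ (ℓ ⊗ ℓ) (∈-filter⁺ (T? ∘ (λ (x , y) → pr S x y ∨ q x y)) (∈-cartesianProduct⁺ m m′) t)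

  pr-addP⁻ : ∀ {S q x y} → T (pr (addP S q) x y) → T (pr S x y ∨ q x y)
  pr-addP⁻ {S} {q} {x} {y} t = proj₂ (∈-filter⁻ (T? ∘ (λ (x , y) → pr S x y ∨ q x y)) {xs = Ls²} (mem⁻ (ℓ ⊗ ℓ) (x , y) _ t))

  lp⁺ : ∀ S x y → T (pr S x y) → ¬ T (u S x) → ¬ T (u S y) → T (lp S x y)
  lp⁺ S x y t nx ny = ∧-T {pr S x y} t (∧-T {not (u S x)} (¬T-not nx) (¬T-not ny))

  lp⁻ : ∀ S x y → T (lp S x y) → T (pr S x y) × ¬ T (u S x) × ¬ T (u S y)
  lp⁻ S x y t = T-∧₁ {pr S x y} t , T-not (T-∧₁ {not (u S x)} r) , T-not (T-∧₂ (not (u S x)) r)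
   where r = T-∧₂ (pr S x y) t

  lt⁺ : ∀ S a x y → T (trip a x y) → ¬ T (u S a) × ¬ T (u S x) × ¬ T (u S y) → ¬ T (pr S a x) × ¬ T (pr S a y) × ¬ T (pr S x y) → T (lt S a x y)
  lt⁺ S a x y t (na , nx , ny) (p , q , r) = ∧-T {trip a x y} t (∧-T {not (u S a) ∧ (not (u S x) ∧ not (u S y))} (∧-T {not (u S a)} (¬T-not na) (∧-T {not (u S x)} (¬T-not nx) (¬T-not ny)))
   (∧-T {not (pr S a x)} (¬T-not p) (∧-T {not (pr S a y)} (¬T-not q) (¬T-not r))))

  lt⁻ : ∀ S a x y → T (lt S a x y) → T (trip a x y) × (¬ T (u S a) × ¬ T (u S x) × ¬ T (u S y)) × (¬ T (pr S a x) × ¬ T (pr S a y) × ¬ T (pr S x y))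
  lt⁻ S a x y t = T-∧₁ {trip a x y} t , (T-not (T-∧₁ {not (u S a)} us) , T-not (T-∧₁ {not (u S x)} us′) , T-not (T-∧₂ (not (u S x)) us′)) ,
   (T-not (T-∧₁ {not (pr S a x)} ps) , T-not (T-∧₁ {not (pr S a y)} ps′) , T-not (T-∧₂ (not (pr S a y)) ps′))
   where
   r = T-∧₂ (trip a x y) t
   us : T (not (u S a) ∧ (not (u S x) ∧ not (u S y)))
   us = T-∧₁ r
   us′ = T-∧₂ (not (u S a)) us
   ps = T-∧₂ (not (u S a) ∧ (not (u S x) ∧ not (u S y))) r
   ps′ = T-∧₂ (not (pr S a x)) ps

  module _ (σ : ℕ → Bool) where

   Holds : Lit → Set
   Holds (x , b) = σ x ≡ b

   record Models (S : State) : Set where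
    field
     units : ∀ {a} → a ∈ Ls → T (u S a) → Holds a
     pairs : ∀ {a b} → a ∈ Ls → b ∈ Ls → T (pr S a b) → Holds a ⊎ Holds b
     triples : ∀ {a b c} → a ∈ Ls → b ∈ Ls → c ∈ Ls → T (trip a b c) → Holds a ⊎ Holds b ⊎ Holds c

   open Models

   addU-models : ∀ {S q} → Models S → (∀ {x} → x ∈ Ls → T (q x) → Holds x) → Models (addU S q)
   addU-models {S} {q} M h = record { units = λ m t → [ units M m , h m ]′ (Equivalence.to (T-∨ {u S _}) (u-addU⁻ {S} {q} t)) ; pairs = pairs M ; triples = triples M }

   addP-models : ∀ {S q} → Models S → (∀ {x y} → x ∈ Ls → y ∈ Ls → T (q x y) → Holds x ⊎ Holds y) → Models (addP S q)
   addP-models {S} {q} M h = record { units = units M ; triples = triples M ; pairs = λ {a} {b} m m′ t → [ pairs M m m′ , h m m′ ]′ (Equivalence.to (T-∨ {pr S a b}) (pr-addP⁻ {S} {q} t)) }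

   addU-models⁻ : ∀ {S q} → Models (addU S q) → Models S
   addU-models⁻ {S} {q} M = record { units = λ m t → units M m (u-addU {S} {q} m (T-∨₁ t)) ; pairs = pairs M ; triples = triples M }

   addP-models⁻ : ∀ {S q} → Models (addP S q) → Models S
   addP-models⁻ {S} {q} M = record { units = units M ; triples = triples M ; pairs = λ m m′ t → pairs M m m′ (pr-addP {S} {q} m m′ (T-∨₁ t)) }

   holds? : ∀ a → Holds a ⊎ ¬ Holds a
   holds? (x , b) with σ x ≟ᵇ b
   ... | yes e = inj₁ e
   ... | no n = inj₂ n

   -- If the common part fails, every set that contains it is satisfied through its remainder.
   branch⁺ : ∀ {S S₁ S₂} → View S (inj₂ (S₁ , S₂)) → Models S → Models S₁ ⊎ Models S₂
   branch⁺ {S} (split₁ {a} a∈ _) M with holds? a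
   ... | inj₁ h = inj₁ (addU-models M (λ {x} _ t → subst Holds (T-eq {ℓ} {a} {x} t) h))
   ... | inj₂ n = inj₂ (addU-models M (λ {x} m t → [ (λ h → ⊥-elim (n h)) , (λ h → h) ]′ (pairs M a∈ m (proj₁ (lp⁻ S a x t)))))
   branch⁺ {S} (split₂ {a} {b} a∈ b∈ _ _) M with holds? a | holds? b
   ... | inj₁ h | _ = inj₁ (addP-models M (λ {x} {y} _ _ t → [ (λ e → inj₁ (subst Holds (cong proj₁ (T-eq {ℓ ⊗ ℓ} {a , b} {x , y} e)) h)) , (λ e → inj₂ (subst Holds (cong proj₂ (T-eq {ℓ ⊗ ℓ} {b , a} {x , y} e)) h)) ]′ (Equivalence.to (T-∨ {eqᵇ (ℓ ⊗ ℓ) (a , b) (x , y)}) t)))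
   ... | inj₂ _ | inj₁ h = inj₁ (addP-models M (λ {x} {y} _ _ t → [ (λ e → inj₂ (subst Holds (cong proj₂ (T-eq {ℓ ⊗ ℓ} {a , b} {x , y} e)) h)) , (λ e → inj₁ (subst Holds (cong proj₁ (T-eq {ℓ ⊗ ℓ} {b , a} {x , y} e)) h)) ]′ (Equivalence.to (T-∨ {eqᵇ (ℓ ⊗ ℓ) (a , b) (x , y)}) t)))
   ... | inj₂ n | inj₂ n′ = inj₂ (addU-models M (λ {x} m t → [ (λ h → ⊥-elim (n h)) , [ (λ h → ⊥-elim (n′ h)) , (λ h → h) ]′ ]′ (triples M a∈ b∈ m (proj₁ (lt⁻ S a b x t)))))
   branch⁺ {S} (split₃ {a} a∈ _ _ _) M with holds? a
   ... | inj₁ h = inj₁ (addU-models M (λ {x} _ t → subst Holds (T-eq {ℓ} {a} {x} t) h))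
   ... | inj₂ n = inj₂ (addP-models M (λ {x} {y} m m′ t → [ (λ h → ⊥-elim (n h)) , (λ h → h) ]′ (triples M a∈ m m′ (proj₁ (lt⁻ S a x y t)))))

   branch⁻ : ∀ {S S₁ S₂} → View S (inj₂ (S₁ , S₂)) → Models S₁ ⊎ Models S₂ → Models S
   branch⁻ {S} (split₁ {a} _ _) = [ addU-models⁻ {S} {eqᵇ ℓ a} , addU-models⁻ {S} {lp S a} ]′
   branch⁻ {S} (split₂ {a} {b} _ _ _ _) = [ addP-models⁻ {S} {same a b} , addU-models⁻ {S} {lt S a b} ]′
   branch⁻ {S} (split₃ {a} _ _ _ _) = [ addU-models⁻ {S} {eqᵇ ℓ a} , addP-models⁻ {S} {lt S a} ]′

  data Explored : State → ℕ → Set where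
   leaf : ∀ {S} → expand S ≡ inj₁ tt → Explored S 1
   node : ∀ {S S₁ S₂ k₁ k₂} → expand S ≡ inj₂ (S₁ , S₂) → Explored S₁ k₁ → Explored S₂ k₂ → Explored S (suc (k₁ + k₂))

  module Progress (Ls-unique : Unique Ls) (trip-sym : ∀ {a b c} → T (trip a b c) → T (trip a c b)) (1≤θ : 1 ≤ θ) where

   deg : State → Lit → ℕ
   deg S a = ∑ Ls (λ x → ind (lp S a x))

   -- The degree bound limits how many pairs a new unit can make redundant; without it the potential
   -- could fall.
   record Inv (S : State) : Set where
    field
     symmetric : ∀ {x y} → x ∈ Ls → y ∈ Ls → T (pr S x y) → T (pr S y x)
     sparse : ∀ {x} → x ∈ Ls → deg S x ≤ 2 * θ

   open Inv

   n : ℕ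
   n = length Ls

   -- A new unit makes up to 4θ ordered pairs redundant, so the weight 5θ leaves a net gain of θ.
   -- With degrees at most 2θ the potential is at most 5θn + 2θn, whence the 7 in `Φmax`.
   units# pairs# Φ : State → ℕ
   units# S = ∑ Ls (λ x → ind (u S x))
   pairs# S = ∑ Ls (deg S)
   Φ S = 5 * θ * units# S + pairs# S

   Φmax : ℕ
   Φmax = 7 * θ * n

   Φ-≤ : ∀ {S} → Inv S → Φ S ≤ Φmax
   Φ-≤ {S} I = ≤-trans (+-mono-≤ (*-monoʳ-≤ (5 * θ) (≤-trans (∑-const Ls {c = 1} (λ {x} _ → ind≤1 (u S x))) (≤-reflexive (*-identityʳ n)))) (∑-const Ls (sparse I))) (≤-reflexive (eq θ n))
    where
    eq : ∀ θ n → 5 * θ * n + n * (2 * θ) ≡ 7 * θ * n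
    eq = solve-∀

   lp-sym : ∀ {S} → Inv S → ∀ {x y} → x ∈ Ls → y ∈ Ls → lp S x y ≡ lp S y x
   lp-sym {S} I m m′ = T-⇔-≡ (go m m′) (go m′ m)
    where
    go : ∀ {x y} → x ∈ Ls → y ∈ Ls → T (lp S x y) → T (lp S y x)
    go {x} {y} m m′ t = let p , nx , ny = lp⁻ S x y t in lp⁺ S y x (symmetric I m m′ p) ny nx

   lt-sym : ∀ {S a} → Inv S → ∀ {x y} → x ∈ Ls → y ∈ Ls → T (lt S a x y) → T (lt S a y x)
   lt-sym {S} {a} I {x} {y} m m′ t = let t′ , (na , nx , ny) , (p , q , r) = lt⁻ S a x y t in lt⁺ S a y x (trip-sym {a} {x} {y} t′) (na , ny , nx) (q , p , λ z → r (symmetric I m′ m z))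

   -- a new unit kills at most 2·2θ ordered pairs
   addU-Φ : ∀ {S q} → Inv S → (∀ {x} → x ∈ Ls → T (q x) → ¬ T (u S x)) → Φ S + θ * count q Ls ≤ Φ (addU S q)
   addU-Φ {S} {q} I new = ≤-trans (≤-reflexive (cong (λ t → Φ S + θ * t) (count-∑ q Ls)))
    (arith (units# S) (∑ Ls (ind ∘ q)) (units# S′) (pairs# S) (pairs# S′) more lost)
    where
    S′ = addU S q
    t = ∑ Ls (ind ∘ q)
    more : units# S + t ≤ units# S′
    more = ≤-trans (≤-reflexive (sym (∑-+ Ls _ _))) (∑-mono Ls (λ {x} m → step′ m))
     where
     step′ : ∀ {x} → x ∈ Ls → ind (u S x) + ind (q x) ≤ ind (u S′ x)
     step′ {x} m with T? (q x)
     ... | yes h rewrite ¬T-false (new m h) | ind-T h | ind-T (u-addU {S} {q} m (T-∨₂ (u S x) h)) = ≤-refl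
     ... | no h rewrite ¬T-false h = ≤-trans (≤-reflexive (+-identityʳ _)) (ind-mono (λ h′ → u-addU {S} {q} m (T-∨₁ h′)))
    hit : Lit → Lit → ℕ
    hit x y = ind (q x) * ind (lp S x y)
    rows : ∑ Ls (λ x → ∑ Ls (hit x)) ≤ t * (2 * θ)
    rows = ≤-trans (∑-mono Ls (λ {x} m → ≤-trans (≤-reflexive (trans (∑-cong Ls (λ {y} _ → *-comm (ind (q x)) (ind (lp S x y)))) (trans (∑-*ʳ Ls (λ y → ind (lp S x y)) (ind (q x))) (*-comm _ (ind (q x)))))) (*-monoʳ-≤ (ind (q x)) (sparse I m))))
     (≤-reflexive (∑-*ʳ Ls (ind ∘ q) (2 * θ)))
    pointwise : ∀ {x y} → x ∈ Ls → y ∈ Ls → ind (lp S x y) ≤ ind (lp S′ x y) + (hit x y + hit y x)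
    pointwise {x} {y} m m′ with T? (lp S x y)
    ... | no h rewrite ¬T-false h = z≤n
    ... | yes h rewrite sym (lp-sym I m m′) | ind-T h with T? (q x) | T? (q y)
    ... | yes a | _ rewrite ind-T a = ≤-trans (m≤m+n 1 _) (m≤n+m _ (ind (lp S′ x y)))
    ... | no a | yes b rewrite ind-T b = ≤-trans (m≤n+m 1 _) (m≤n+m _ (ind (lp S′ x y)))
    ... | no a | no b = ≤-trans (≤-reflexive (sym (ind-T keeps))) (m≤m+n _ _)
     where
     still : ∀ {z} → ¬ T (q z) → ¬ T (u S z) → ¬ T (u S′ z)
     still {z} nq nu w = [ nu , nq ]′ (Equivalence.to (T-∨ {u S z}) (u-addU⁻ {S} {q} w))
     keeps : T (lp S′ x y)
     keeps = let p , nx , ny = lp⁻ S x y h in lp⁺ S′ x y p (still a nx) (still b ny)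
    lost : pairs# S ≤ pairs# S′ + (t * (2 * θ) + t * (2 * θ))
    lost = ≤-trans (∑-mono Ls (λ {x} m → ≤-trans (∑-mono Ls (λ m′ → pointwise m m′)) (≤-reflexive (trans (∑-+ Ls _ _) (cong (deg S′ x +_) (∑-+ Ls _ _))))))
     (≤-trans (≤-reflexive (trans (∑-+ Ls _ _) (cong (pairs# S′ +_) (∑-+ Ls _ _))))
      (+-monoʳ-≤ (pairs# S′) (+-mono-≤ rows (≤-trans (≤-reflexive (∑-swap Ls Ls (λ x y → hit y x))) rows))))
    arith : ∀ a t a′ p p′ → a + t ≤ a′ → p ≤ p′ + (t * (2 * θ) + t * (2 * θ)) → 5 * θ * a + p + θ * t ≤ 5 * θ * a′ + p′
    arith a t a′ p p′ h₁ h₂ = ≤-trans (+-monoˡ-≤ (θ * t) (+-monoʳ-≤ (5 * θ * a) h₂)) (≤-trans (≤-reflexive (eq θ a t p′)) (+-monoˡ-≤ p′ (*-monoʳ-≤ (5 * θ) h₁)))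
     where
     eq : ∀ θ a t p′ → 5 * θ * a + (p′ + (t * (2 * θ) + t * (2 * θ))) + θ * t ≡ 5 * θ * (a + t) + p′
     eq = solve-∀

   addU-Inv : ∀ {S q} → Inv S → Inv (addU S q)
   addU-Inv {S} {q} I = record { symmetric = symmetric I ; sparse = λ {x} m → ≤-trans (∑-mono Ls (λ {y} m′ → ind-mono (fewer m m′))) (sparse I m) }
    where
    fewer : ∀ {x y} → x ∈ Ls → y ∈ Ls → T (lp (addU S q) x y) → T (lp S x y)
    fewer {x} {y} m m′ t = let p , nx , ny = lp⁻ (addU S q) x y t in lp⁺ S x y p (λ w → nx (u-addU {S} {q} m (T-∨₁ w))) (λ w → ny (u-addU {S} {q} m′ (T-∨₁ w)))

   module _ {S : State} {q : Lit → Lit → Bool} (I : Inv S) (fresh : ∀ {x y} → x ∈ Ls → y ∈ Ls → T (q x y) → ¬ T (pr S x y) × ¬ T (u S x) × ¬ T (u S y)) where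

    addP-Φ : Φ S + ∑ Ls (λ x → ∑ Ls (λ y → ind (q x y))) ≤ Φ (addP S q)
    addP-Φ = ≤-trans (≤-reflexive (+-assoc (5 * θ * units# S) _ _)) (+-monoʳ-≤ (5 * θ * units# S)
     (≤-trans (≤-reflexive (sym (∑-+ Ls _ _))) (∑-mono Ls (λ m → ≤-trans (≤-reflexive (sym (∑-+ Ls _ _))) (∑-mono Ls (λ m′ → gain m m′))))))
     where
     gain : ∀ {x y} → x ∈ Ls → y ∈ Ls → ind (lp S x y) + ind (q x y) ≤ ind (lp (addP S q) x y)
     gain {x} {y} m m′ with T? (q x y)
     ... | no h rewrite ¬T-false h = ≤-trans (≤-reflexive (+-identityʳ _)) (ind-mono (λ t → let p , nx , ny = lp⁻ S x y t in lp⁺ (addP S q) x y (pr-addP {S} {q} m m′ (T-∨₁ p)) nx ny))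
     ... | yes h with np , nx , ny ← fresh m m′ h rewrite ind-T h | ¬T-false {lp S x y} (λ t → np (proj₁ (lp⁻ S x y t)))
      | ind-T {lp (addP S q) x y} (lp⁺ (addP S q) x y (pr-addP {S} {q} m m′ (T-∨₂ (pr S x y) h)) nx ny) = ≤-refl

    -- `Light₁` leaves degrees strictly below θ, so θ + 1 new pairs at a literal fit under 2θ. When
    -- a single pair is added, the bound 2 on a row is at most θ + 1 even for θ = 1.
    addP-Inv : Light₁ S → (∀ {x y} → x ∈ Ls → y ∈ Ls → T (q x y) → T (q y x)) → (∀ {x} → x ∈ Ls → ∑ Ls (λ y → ind (q x y)) ≤ suc θ) → Inv (addP S q)
    addP-Inv light q-sym few = record
     { symmetric = λ {x} {y} m m′ t → pr-addP {S} {q} m′ m ([ (λ h → T-∨₁ (symmetric I m m′ h)) , (λ h → T-∨₂ (pr S y x) (q-sym m m′ h)) ]′ (Equivalence.to (T-∨ {pr S x y}) (pr-addP⁻ {S} {q} t)))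
     ; sparse = λ {x} m → ≤-trans (≤-trans (∑-mono Ls (λ {y} m′ → grows m m′)) (≤-reflexive (∑-+ Ls _ _))) (bound (deg S x) (subst (_< θ) (count-∑ (lp S x) Ls) (light m)) (few m)) }
     where
     grows : ∀ {x y} → x ∈ Ls → y ∈ Ls → ind (lp (addP S q) x y) ≤ ind (lp S x y) + ind (q x y)
     grows {x} {y} m m′ with T? (lp (addP S q) x y)
     ... | no h rewrite ¬T-false h = z≤n
     ... | yes h rewrite ind-T h with Equivalence.to (T-∨ {pr S x y}) (pr-addP⁻ {S} {q} (proj₁ (lp⁻ (addP S q) x y h)))
     ... | inj₁ old rewrite ind-T {lp S x y} (let _ , nx , ny = lp⁻ (addP S q) x y h in lp⁺ S x y old nx ny) = s≤s z≤n
     ... | inj₂ new rewrite ind-T new = m≤n+m 1 _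
     bound : ∀ d {c} → d < θ → c ≤ suc θ → d + c ≤ 2 * θ
     bound d {c} lt le = ≤-trans (+-monoʳ-≤ d le) (≤-trans (≤-reflexive (+-suc d θ)) (≤-trans (+-monoˡ-≤ θ lt) (≤-reflexive (cong (θ +_) (sym (+-identityʳ θ))))))

   private
    some : ∀ {A : Set} (q : A → Bool) xs {c} → suc c ≤ count q xs → ∃[ x ] x ∈ xs × T (q x)
    some q xs le with filterᵇ q xs in eq
    ... | x ∷ _ = x , ∈-filter⁻ (T? ∘ q) {xs = xs} (subst (x ∈_) (sym eq) (here refl))

    positive : ∀ {m} → θ ≤ m → suc zero ≤ m
    positive = ≤-trans 1≤θ

    θ≤θ² : 1 ≤ θ * θ
    θ≤θ² = *-mono-≤ 1≤θ 1≤θ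

   unit-count : ∀ {a} → a ∈ Ls → 1 ≤ count (eqᵇ ℓ a) Ls
   unit-count {a} m = ≤-trans (≤-trans (≤-reflexive (sym (ind-T (eq-T ℓ a)))) (∑-∈ {f = ind ∘ eqᵇ ℓ a} m)) (≤-reflexive (sym (count-∑ (eqᵇ ℓ a) Ls)))

   Child : State → ℕ → State → Set
   Child S d S′ = Inv S′ × Φ S + d ≤ Φ S′

   one-unit : ∀ {S a} → Inv S → a ∈ Ls → ¬ T (u S a) → Child S 1 (addU S (eqᵇ ℓ a))
   one-unit {S} {a} I a∈ nu = addU-Inv I , ≤-trans (+-monoʳ-≤ (Φ S) (*-mono-≤ 1≤θ (unit-count a∈))) (addU-Φ {S} {eqᵇ ℓ a} I (λ {x} _ t → subst (λ z → ¬ T (u S z)) (T-eq {ℓ} {a} {x} t) nu))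

   many-units : ∀ {S q} → Inv S → (∀ {x} → x ∈ Ls → T (q x) → ¬ T (u S x)) → θ ≤ count q Ls → Child S (θ * θ) (addU S q)
   many-units {S} {q} I new le = addU-Inv I , ≤-trans (+-monoʳ-≤ (Φ S) (*-monoʳ-≤ θ le)) (addU-Φ {S} {q} I new)

   children : ∀ {S S₁ S₂} → Inv S → View S (inj₂ (S₁ , S₂)) → Child S 1 S₁ × Child S (θ * θ) S₂
   children {S} I (split₁ {a} a∈ le) with x , x∈ , t ← some (lp S a) Ls (positive le) =
    one-unit I a∈ (proj₁ (proj₂ (lp⁻ S a x t))) , many-units I (λ {y} _ h → proj₂ (proj₂ (lp⁻ S a y h))) le
   children {S} I (split₂ {a} {b} a∈ b∈ light le) with x , x∈ , t ← some (lt S a b) Ls (positive le)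
    with _ , (na , nb , _) , (np , _) ← lt⁻ S a b x t =
    (addP-Inv I fresh light swap (λ {x} m → ≤-trans (row m) (s≤s 1≤θ)) , ≤-trans (+-monoʳ-≤ (Φ S) hits) (addP-Φ I fresh)) ,
    many-units I (λ {y} _ h → proj₂ (proj₂ (proj₁ (proj₂ (lt⁻ S a b y h))))) le
    where
    cases : ∀ {x y} → T (same a b x y) → (a ≡ x × b ≡ y) ⊎ (b ≡ x × a ≡ y)
    cases {x} {y} t with Equivalence.to (T-∨ {eqᵇ (ℓ ⊗ ℓ) (a , b) (x , y)}) t
    ... | inj₁ e with eq ← T-eq {ℓ ⊗ ℓ} {a , b} {x , y} e = inj₁ (cong proj₁ eq , cong proj₂ eq)
    ... | inj₂ e with eq ← T-eq {ℓ ⊗ ℓ} {b , a} {x , y} e = inj₂ (cong proj₁ eq , cong proj₂ eq)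
    first : T (same a b a b)
    first = T-∨₁ (eq-T (ℓ ⊗ ℓ) (a , b))
    second : T (same a b b a)
    second = T-∨₂ (eqᵇ (ℓ ⊗ ℓ) (a , b) (b , a)) (eq-T (ℓ ⊗ ℓ) (b , a))
    fresh : ∀ {x y} → x ∈ Ls → y ∈ Ls → T (same a b x y) → ¬ T (pr S x y) × ¬ T (u S x) × ¬ T (u S y)
    fresh m m′ t with cases t
    ... | inj₁ (refl , refl) = np , na , nb
    ... | inj₂ (refl , refl) = (λ z → np (symmetric I b∈ a∈ z)) , nb , na
    swap : ∀ {x y} → x ∈ Ls → y ∈ Ls → T (same a b x y) → T (same a b y x)
    swap _ _ t with cases t
    ... | inj₁ (refl , refl) = second
    ... | inj₂ (refl , refl) = first
    hits : 1 ≤ ∑ Ls (λ x → ∑ Ls (λ y → ind (same a b x y)))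
    hits = ≤-trans (≤-reflexive (sym (ind-T first))) (≤-trans (∑-∈ {f = λ y → ind (same a b a y)} b∈) (∑-∈ {f = λ x → ∑ Ls (λ y → ind (same a b x y))} a∈))
    ind-∨ : ∀ p q → ind (p ∨ q) ≤ ind p + ind q
    ind-∨ true q = s≤s z≤n
    ind-∨ false q = ≤-refl
    row : ∀ {x} → x ∈ Ls → ∑ Ls (λ y → ind (same a b x y)) ≤ 2
    row {x} _ = ≤-trans (∑-mono Ls (λ {y} _ → ind-∨ (eqᵇ (ℓ ⊗ ℓ) (a , b) (x , y)) _)) (≤-trans (≤-reflexive (∑-+ Ls _ _))
     (+-mono-≤ (∑-single Ls-unique (λ {y} t → sym (cong proj₂ (T-eq {ℓ ⊗ ℓ} {a , b} {x , y} t)))) (∑-single Ls-unique (λ {y} t → sym (cong proj₂ (T-eq {ℓ ⊗ ℓ} {b , a} {x , y} t))))))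
   children {S} I (split₃ {a} a∈ light light₂ le) with (x , y) , _ , t ← some (λ (x , y) → lt S a x y) Ls² (≤-trans θ≤θ² le) =
    one-unit I a∈ (proj₁ (proj₁ (proj₂ (lt⁻ S a x y t)))) ,
    (addP-Inv I fresh light (λ m m′ → lt-sym I m m′) (λ {x} m → ≤-trans (≤-reflexive (sym (count-∑ (lt S a x) Ls))) (≤-trans (<⇒≤ (light₂ a∈ m)) (n≤1+n θ))) ,
     ≤-trans (+-monoʳ-≤ (Φ S) (≤-trans le (≤-reflexive (trans (count-∑ _ Ls²) (∑-product Ls Ls _))))) (addP-Φ I fresh))
    where
    fresh : ∀ {x y} → x ∈ Ls → y ∈ Ls → T (lt S a x y) → ¬ T (pr S x y) × ¬ T (u S x) × ¬ T (u S y)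
    fresh {x} {y} _ _ t with _ , (_ , nx , ny) , (_ , _ , np) ← lt⁻ S a x y t = np , nx , ny

   B : ℕ
   B = θ * θ

   private
    move : ∀ p b i → p + (b + suc i) ≡ p + 1 + (b + i)
    move = solve-∀
    shift : ∀ p b c → p + (b + c) ≡ p + c + (b + 0)
    shift = solve-∀
    combine : ∀ i X → 2 * (suc i * X) + 2 * (1 * X) ≡ 2 * (suc (suc i) * X)
    combine = solve-∀

   -- unrolling the small branch B times shows that B units of Φ multiply the number of leaves by at most B + 1
   explore : ∀ e i S → i ≤ B → Inv S → Φmax < Φ S + (e * B + i) → ∃[ k ] Explored S k × suc k ≤ 2 * (suc i * suc B ^ e)
   explore zero zero S _ I lt = ⊥-elim (<⇒≱ lt (≤-trans (≤-reflexive (+-identityʳ _)) (Φ-≤ I)))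
   -- When i is used up, a factor B + 1 is spent: (e + 1)B + 0 is read as eB + B.
   explore (suc e) zero S _ I lt with k , ex , le ← explore e B S ≤-refl I (subst (λ z → Φmax < Φ S + z) (trans (+-identityʳ (B + e * B)) (+-comm B (e * B))) lt) =
    k , ex , ≤-trans le (≤-reflexive (cong (2 *_) (sym (*-identityˡ (suc B ^ suc e)))))
   explore e (suc i) S i≤ I lt with expand S in eq | expandView S
   ... | inj₁ tt | leaf _ _ = 1 , leaf eq , *-monoʳ-≤ 2 (*-mono-≤ {1} {suc (suc i)} (s≤s z≤n) (m^n>0 (suc B) e))
   ... | inj₂ (S₁ , S₂) | v with (I₁ , g₁) , (I₂ , g₂) ← children I v
    with k₁ , ex₁ , le₁ ← explore e i S₁ (≤-trans (n≤1+n i) i≤) I₁ (≤-trans lt (≤-trans (≤-reflexive (move (Φ S) (e * B) i)) (+-monoˡ-≤ (e * B + i) g₁)))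
    with k₂ , ex₂ , le₂ ← explore e 0 S₂ z≤n I₂ (≤-trans lt (≤-trans (+-monoʳ-≤ (Φ S) (+-monoʳ-≤ (e * B) i≤)) (≤-trans (≤-reflexive (shift (Φ S) (e * B) B)) (+-monoˡ-≤ (e * B + 0) g₂)))) =
    -- Bounding k + 1 instead of k makes the bounds of the two subtrees add up, the root included.
    suc (k₁ + k₂) , node eq ex₁ ex₂ , ≤-trans (≤-reflexive (cong suc (sym (+-suc k₁ k₂)))) (≤-trans (+-mono-≤ le₁ le₂) (≤-reflexive (combine i (suc B ^ e))))

-- Step-by-step simulation of a fixed machine

module Simulation where

 open import Data.Bool using (T)
 open import Data.Fin using (toℕ)
 open import Data.List.Membership.Propositional.Properties
 open import Data.Nat.Properties
 open import Data.Vec as Vec using ()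
 open Machines using (Finite)
 open Programs hiding (M; A; B)
 open PolynomialTime
 open RegularGraphs using (¬T-false)
 open GluedCopies using (T-eq; eq-T; ∈-concatMap)
 open VertexCover using (∈-concatMap⁻′)
 open Tableaux using (module Tableau)

 open Finite

 power : Ty → ℕ → Ty
 power τ zero = 𝟙
 power τ (suc n) = τ ⊗ power τ n

 module Simulate (M : TM) where

  open TM M
  open Tableau M using (finΓ; finHd; tick; run; run-halts; tick-halt; tick-step)

  abstract
   code′ : Γ → ℕ
   code′ s = toℕ (to finΓ s)

   code′-injective : ∀ {s t} → code′ s ≡ code′ t → s ≡ t
   code′-injective {s} {t} eq = trans (sym (from-to finΓ s)) (trans (cong (from finΓ) (toℕ-injective eq)) (from-to finΓ t))

  cb : ℕ
  cb = code′ nothing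

  tapeτ actτ configτ : Ty
  tapeτ = list nat ⊗ nat ⊗ list nat
  actτ = nat ⊗ nat
  configτ = nat ⊗ power tapeτ tapes

  encTape : Tape Γ → ⟦ tapeτ ⟧
  encTape (tape ls h rs) = map code′ ls , code′ h , map code′ rs

  encMove : Move → ℕ
  encMove stay = 0
  encMove left = 1
  encMove right = 2

  encVec : ∀ {A : Set} {τ n} → (A → ⟦ τ ⟧) → Vec A n → ⟦ power τ n ⟧
  encVec f [] = tt
  encVec f (x ∷ xs) = f x , encVec f xs

  encAct : Γ × Move → ⟦ actτ ⟧
  encAct (s , m) = code′ s , encMove m

  encTapes : ∀ {n} → Vec (Tape Γ) n → ⟦ power tapeτ n ⟧
  encTapes = encVec {τ = tapeτ} encTape

  encActs : ∀ {n} → Vec (Γ × Move) n → ⟦ power actτ n ⟧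
  encActs = encVec {τ = actτ} encAct

  encHeads : ∀ {n} → Vec Γ n → ⟦ power nat n ⟧
  encHeads = encVec {τ = nat} code′

  encConfig : Config M → ⟦ configτ ⟧
  encConfig (config q ts) = toℕ q , encTapes ts

  write : ⟦ tapeτ ⊗ actτ ⟧ → ⟦ tapeτ ⟧
  write ((ls , h , rs) , (s , m)) =
   caseℕ m (ls , s , rs) (λ m′ → caseℕ m′
    (caseList ls ([] , cb , s ∷ rs) (λ l ls′ → ls′ , l , s ∷ rs))
    (λ _ → caseList rs (s ∷ ls , cb , []) (λ r rs′ → s ∷ ls , r , rs′)))

  write-enc : ∀ tp a → write (encTape tp , encAct a) ≡ encTape (writeMove tp a)
  write-enc (tape ls h rs) (s , stay) = refl
  write-enc (tape [] h rs) (s , left) = refl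
  write-enc (tape (l ∷ ls) h rs) (s , left) = refl
  write-enc (tape ls h []) (s , right) = refl
  write-enc (tape ls h (r ∷ rs)) (s , right) = refl

  writeP : PT (tapeτ ⊗ actτ) tapeτ write
  writeP = caseℕP (sndP ∘P sndP) (fstP ∘P fstP ,P (fstP ∘P sndP ,P sndP ∘P sndP ∘P fstP))
   (caseℕP v0
    (caseListP (fstP ∘P fstP ∘P w1) (nilP ,P (constP nat cb ,P (fstP ∘P sndP ∘P w1 ∷P sndP ∘P sndP ∘P fstP ∘P w1)))
     (v1 ,P (v0 ,P (fstP ∘P sndP ∘P w3 ∷P sndP ∘P sndP ∘P fstP ∘P w3))))
    (caseListP (sndP ∘P sndP ∘P fstP ∘P w2) ((fstP ∘P sndP ∘P w2 ∷P fstP ∘P fstP ∘P w2) ,P (constP nat cb ,P nilP))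
     ((fstP ∘P sndP ∘P w2 ∘P w2 ∷P fstP ∘P fstP ∘P w2 ∘P w2) ,P (v0 ,P v1))))

  write-size : ∀ tp a → size tapeτ (write (tp , a)) ≤ size tapeτ tp + (size actτ a + (2 + cb))
  write-size (ls , h , rs) (s , zero) = ≤-trans (m≤m+n _ (h + 4 + cb)) (≤-reflexive (eq (size (list nat) ls) s (size (list nat) rs) h cb))
   where
   eq : ∀ l s r h c → l + (suc s + r) + (h + 4 + c) ≡ l + (suc h + r) + (suc s + 1 + (2 + c))
   eq = solve-∀
  write-size ([] , h , rs) (s , suc zero) = ≤-trans (m≤m+n _ (h + 3)) (≤-reflexive (eq s (size (list nat) rs) h cb))
   where
   eq : ∀ s r h c → 1 + (suc c + suc (suc s + r)) + (h + 3) ≡ 1 + (suc h + r) + (suc s + 2 + (2 + c))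
   eq = solve-∀
  write-size (l ∷ ls , h , rs) (s , suc zero) = ≤-trans (m≤m+n _ (h + 5 + cb)) (≤-reflexive (eq (size (list nat) ls) l s (size (list nat) rs) h cb))
   where
   eq : ∀ L l s r h c → L + (suc l + suc (suc s + r)) + (h + 5 + c) ≡ suc (suc l + L) + (suc h + r) + (suc s + 2 + (2 + c))
   eq = solve-∀
  write-size (ls , h , []) (s , suc (suc m)) = ≤-trans (m≤m+n _ (h + 4 + m)) (≤-reflexive (eq (size (list nat) ls) s h m cb))
   where
   eq : ∀ l s h m c → suc (suc s + l) + (suc c + 1) + (h + 4 + m) ≡ l + (suc h + 1) + (suc s + suc (suc (suc m)) + (2 + c))
   eq = solve-∀
  write-size (ls , h , r ∷ rs) (s , suc (suc m)) = ≤-trans (m≤m+n _ (h + 6 + m + cb)) (≤-reflexive (eq (size (list nat) ls) s h m cb r (size (list nat) rs)))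
   where
   eq : ∀ l s h m c r R → suc (suc s + l) + (suc r + R) + (h + 6 + m + c) ≡ l + (suc h + suc (suc r + R)) + (suc s + suc (suc (suc m)) + (2 + c))
   eq = solve-∀

  writes : ∀ n → ⟦ power tapeτ n ⊗ power actτ n ⟧ → ⟦ power tapeτ n ⟧
  writes zero _ = tt
  writes (suc n) ((t , ts) , (a , as)) = write (t , a) , writes n (ts , as)

  writesP : ∀ n → PT (power tapeτ n ⊗ power actτ n) (power tapeτ n) (writes n)
  writesP zero = constP 𝟙 tt
  writesP (suc n) = writeP ∘P (fstP ∘P fstP ,P fstP ∘P sndP) ,P writesP n ∘P (sndP ∘P fstP ,P sndP ∘P sndP)

  writes-enc : ∀ {n} (ts : Vec (Tape Γ) n) as → writes n (encTapes ts , encActs as) ≡ encTapes (zipWith writeMove ts as)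
  writes-enc [] [] = refl
  writes-enc (t ∷ ts) (a ∷ as) = cong₂ _,_ (write-enc t a) (writes-enc ts as)

  writes-size : ∀ n ts as → size (power tapeτ n) (writes n (ts , as)) ≤ size (power tapeτ n) ts + (size (power actτ n) as + n * (2 + cb))
  writes-size zero _ _ = s≤s z≤n
  writes-size (suc n) (t , ts) (a , as) = ≤-trans (+-mono-≤ (write-size t a) (writes-size n ts as)) (≤-reflexive (eq (size tapeτ t) (size actτ a) (2 + cb) (size (power tapeτ n) ts) (size (power actτ n) as) (n * (2 + cb))))
   where
   eq : ∀ t a c T A N → t + (a + c) + (T + (A + N)) ≡ t + T + (a + A + (c + N))
   eq = solve-∀

  heads : ∀ n → ⟦ power tapeτ n ⟧ → ⟦ power nat n ⟧
  heads zero _ = tt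
  heads (suc n) (t , ts) = proj₁ (proj₂ t) , heads n ts

  headsP : ∀ n → PT (power tapeτ n) (power nat n) (heads n)
  headsP zero = constP 𝟙 tt
  headsP (suc n) = fstP ∘P sndP ∘P fstP ,P headsP n ∘P sndP

  heads-enc : ∀ {n} (ts : Vec (Tape Γ) n) → heads n (encTapes ts) ≡ encHeads (Vec.map Tape.head ts)
  heads-enc [] = refl
  heads-enc (tape _ _ _ ∷ ts) = cong (_ ,_) (heads-enc ts)

  encHeads-injective : ∀ {n} (hs hs′ : Vec Γ n) → encHeads hs ≡ encHeads hs′ → hs ≡ hs′
  encHeads-injective [] [] eq = refl
  encHeads-injective (h ∷ hs) (h′ ∷ hs′) eq = cong₂ _∷_ (code′-injective (cong proj₁ eq)) (encHeads-injective hs hs′ (cong proj₂ eq))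

  keyτ valτ : Ty
  keyτ = nat ⊗ power nat tapes
  valτ = nat ⊗ power actτ tapes

  key : Fin states × Vec Γ tapes → ⟦ keyτ ⟧
  key (q , hs) = toℕ q , encHeads hs

  key-injective : ∀ x y → key x ≡ key y → x ≡ y
  key-injective (q , hs) (q′ , hs′) eq = cong₂ _,_ (toℕ-injective (cong proj₁ eq)) (encHeads-injective hs hs′ (cong proj₂ eq))

  entries : Fin states × Vec Γ tapes → Maybe (Fin states × Vec (Γ × Move) tapes) → List ⟦ keyτ ⊗ valτ ⟧
  entries x nothing = []
  entries x (just (q′ , as)) = [ key x , toℕ q′ , encActs as ]

  abstract
   allKeys : List (Fin states × Vec Γ tapes)
   allKeys = cartesianProduct (allFin states) (map (from finHd) (allFin (card finHd)))

   ∈-allKeys : ∀ x → x ∈ allKeys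
   ∈-allKeys (q , hs) = ∈-cartesianProduct⁺ (∈-allFin q) (subst (_∈ map (from finHd) (allFin (card finHd))) (from-to finHd hs) (∈-map⁺ (from finHd) (∈-allFin (to finHd hs))))

  entry′ : Fin states × Vec Γ tapes → List ⟦ keyτ ⊗ valτ ⟧
  entry′ x = entries x (δ (proj₁ x) (proj₂ x))

  -- M is fixed, so its transition function is a finite table inside the program, searched by state
  -- and head symbols.
  δ-table : List ⟦ keyτ ⊗ valτ ⟧
  δ-table = concatMap entry′ allKeys

  matching : ⟦ keyτ ⟧ → List ⟦ keyτ ⊗ valτ ⟧
  matching k = filterᵇ (λ e → eqᵇ keyτ k (proj₁ e)) δ-table

  matching⁻ : ∀ x {e} → e ∈ matching (key x) → e ∈ entry′ x
  matching⁻ x {e} m =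
   let m′ , t = ∈-filter⁻ (T? ∘ (λ e → eqᵇ keyτ (key x) (proj₁ e))) {xs = δ-table} m
       y , _ , r = ∈-concatMap⁻′ entry′ allKeys m′
   in subst (λ z → e ∈ entry′ z) (sym (key-injective x y (trans (T-eq {keyτ} {key x} {proj₁ e} t) (keyOf y (δ (proj₁ y) (proj₂ y)) r)))) r
   where
   keyOf : ∀ y o {e} → e ∈ entries y o → proj₁ e ≡ key y
   keyOf y (just _) (here refl) = refl

  matching⁺ : ∀ x {q as} → δ (proj₁ x) (proj₂ x) ≡ just (q , as) → (key x , toℕ q , encActs as) ∈ matching (key x)
  matching⁺ x {q} {as} eq = ∈-filter⁺ (T? ∘ (λ e → eqᵇ keyτ (key x) (proj₁ e))) {x = e} (∈-concatMap entry′ {xs = allKeys} (∈-allKeys x) (subst (λ o → e ∈ entries x o) (sym eq) (here refl))) (eq-T keyτ (key x))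
   where
   e : ⟦ keyτ ⊗ valτ ⟧
   e = key x , toℕ q , encActs as

  current : ⟦ configτ ⟧ → ⟦ keyτ ⟧
  current (q , ts) = q , heads tapes ts

  simStep : ⟦ configτ ⟧ → ⟦ configτ ⟧
  simStep c = caseList (matching (current c)) c (λ e _ → proj₁ (proj₂ e) , writes tapes (proj₂ c , proj₂ (proj₂ e)))

  halted : ⟦ configτ ⟧ → Bool
  halted c = caseList (matching (current c)) true (λ _ _ → false)

  currentP : ∀ {Δ e} → PT Δ configτ e → PT Δ keyτ (λ δ → current (e δ))
  currentP E = fstP ∘P E ,P headsP tapes ∘P sndP ∘P E

  matchingP : ∀ {Δ e} → PT Δ keyτ e → PT Δ (list (keyτ ⊗ valτ)) (λ δ → matching (e δ))
  matchingP E = filterP (constP (list (keyτ ⊗ valτ)) δ-table) (eqP keyτ (E ∘P w1) (fstP ∘P v0))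

  simStepP : PT configτ configτ simStep
  simStepP = caseListP (matchingP (currentP idP)) idP (fstP ∘P sndP ∘P v0 ,P writesP tapes ∘P (sndP ∘P w2 ,P sndP ∘P sndP ∘P v0))

  haltedP : ∀ {Δ e} → PT Δ configτ e → PT Δ 𝔹 (λ δ → halted (e δ))
  haltedP E = caseListP (matchingP (currentP E)) (constP 𝔹 true) (constP 𝔹 false)

  simStep-enc : ∀ c → simStep (encConfig c) ≡ encConfig (tick c) × (step M c ≡ nothing → halted (encConfig c) ≡ true) × (halted (encConfig c) ≡ true → step M c ≡ nothing)
  simStep-enc c@(config q ts) rewrite heads-enc ts = go (δ q (Vec.map Tape.head ts)) refl (matching (key (q , Vec.map Tape.head ts))) refl
   where
   x = q , Vec.map Tape.head ts
   go : ∀ o → δ q (Vec.map Tape.head ts) ≡ o → ∀ l → matching (key x) ≡ l →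
    caseList l (encConfig c) (λ e _ → proj₁ (proj₂ e) , writes tapes (encTapes ts , proj₂ (proj₂ e))) ≡ encConfig (tick c) ×
    (step M c ≡ nothing → caseList l true (λ _ _ → false) ≡ true) × (caseList l true (λ _ _ → false) ≡ true → step M c ≡ nothing)
   go nothing eq [] el = sym (cong encConfig (tick-halt halts)) , (λ _ → refl) , λ _ → halts
    where
    halts : step M c ≡ nothing
    halts rewrite eq = refl
   go nothing eq (e ∷ l) el with () ← subst (λ o → e ∈ entries x o) eq (matching⁻ x (subst (e ∈_) (sym el) (here refl)))
   go (just (q′ , as)) eq [] el with () ← subst ((key x , toℕ q′ , encActs as) ∈_) el (matching⁺ x {q′} {as} eq)
   go (just (q′ , as)) eq (e ∷ l) el with here refl ← subst (λ o → e ∈ entries x o) eq (matching⁻ x (subst (e ∈_) (sym el) (here refl))) =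
    trans (cong (toℕ q′ ,_) (writes-enc ts as)) (sym (cong encConfig (tick-step steps))) , (λ h → ⊥-elim (absurd (trans (sym steps) h))) , λ ()
    where
    steps : step M c ≡ just (config q′ (zipWith writeMove ts as))
    steps rewrite eq = refl
    absurd : ∀ {A : Set} {x : A} → ¬ (just x ≡ nothing)
    absurd ()

  growthC : ℕ
  growthC = size (list (keyτ ⊗ valτ)) δ-table + tapes * (2 + cb)

  -- A step changes one cell on each tape and extends it by at most one, so the configuration grows
  -- by at most a constant and `iterateP⁺` applies.
  simStep-size : ∀ c → size configτ (simStep c) ≤ size configτ c + growthC
  simStep-size c with matching (current c) in eq
  ... | [] = m≤m+n _ _
  ... | (k , q′ , as) ∷ l = ≤-trans (+-monoʳ-≤ (suc q′) (writes-size tapes (proj₂ c) as))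
   (≤-trans (≤-reflexive (mix (suc q′) (size (power tapeτ tapes) (proj₂ c)) (size (power actτ tapes) as) (tapes * (2 + cb))))
    (+-mono-≤ (m≤n+m (size (power tapeτ tapes) (proj₂ c)) (size nat (proj₁ c))) (+-monoˡ-≤ (tapes * (2 + cb)) small)))
   where
   mix : ∀ q t a n → q + (t + (a + n)) ≡ t + (q + a + n)
   mix = solve-∀
   element : ∀ {xs : List ⟦ keyτ ⊗ valτ ⟧} {e} → e ∈ xs → size (keyτ ⊗ valτ) e ≤ size (list (keyτ ⊗ valτ)) xs
   element (here refl) = ≤-trans (m≤m+n _ _) (n≤1+n _)
   element {x ∷ _} (there m) = ≤-trans (element m) (≤-trans (m≤n+m _ (size (keyτ ⊗ valτ) x)) (n≤1+n _))
   small : suc q′ + size (power actτ tapes) as ≤ size (list (keyτ ⊗ valτ)) δ-table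
   small = ≤-trans (m≤n+m _ (size keyτ k)) (element {xs = δ-table} (proj₁ (∈-filter⁻ (T? ∘ (λ e → eqᵇ keyτ (current c) (proj₁ e))) {xs = δ-table} (subst ((k , q′ , as) ∈_) (sym eq) (here refl)))))

  bitCode : Bool → ℕ
  bitCode b = code′ (bit b)

  firstTape : Word → ⟦ tapeτ ⟧
  firstTape w = caseList w ([] , cb , []) (λ b bs → [] , (if b then bitCode true else bitCode false) , map (λ c → if c then bitCode true else bitCode false) bs)

  initT : Word → ⟦ configτ ⟧
  initT w = toℕ start , firstTape w , encTapes (Vec.replicate workTapes blankTape)

  initP : PT (list 𝔹) configτ initT
  initP = constP nat (toℕ start) ,P (caseListP idP (constP tapeτ ([] , cb , [])) (nilP ,P (bitP v0 ,P mapP v1 (bitP v0))) ,P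
   constP (power tapeτ workTapes) (encTapes (Vec.replicate workTapes blankTape)))
   where
   bitP : ∀ {Δ e} → PT Δ 𝔹 e → PT Δ nat (λ δ → if e δ then bitCode true else bitCode false)
   bitP E = ifP E (constP nat (bitCode true)) (constP nat (bitCode false))

  init-enc : ∀ w → initT w ≡ encConfig (initial M w)
  init-enc [] = refl
  init-enc (b ∷ w) = cong (toℕ start ,_) (cong (_, encTapes (Vec.replicate workTapes blankTape)) (cong₂ (λ h r → [] , h , r) (bits′ b) (rest w)))
   where
   bits′ : ∀ b → (if b then bitCode true else bitCode false) ≡ code′ (bit b)
   bits′ true = refl
   bits′ false = refl
   rest : ∀ w → map (λ c → if c then bitCode true else bitCode false) w ≡ map code′ (map (λ c → bit c) w)
   rest [] = refl
   rest (b ∷ w) = cong₂ _∷_ (bits′ b) (rest w)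

  simRun : Word × ℕ → ⟦ configτ ⟧
  simRun (w , J) = iterate simStep (initT w) J

  simRun-enc : ∀ w J → simRun (w , J) ≡ encConfig (run (initial M w) J)
  simRun-enc w zero = init-enc w
  simRun-enc w (suc J) = trans (iterate-suc simStep (initT w) J) (trans (cong simStep (simRun-enc w J)) (proj₁ (simStep-enc (run (initial M w) J))))

  outBit : ⟦ configτ ⟧ → Bool
  outBit c = eqᵇ nat (proj₁ (proj₂ (proj₁ (proj₂ c)))) (bitCode true)

  simulate′ : Word × ℕ → ⊤ ⊎ Bool
  simulate′ wJ = if halted (simRun wJ) then inj₂ (outBit (simRun wJ)) else inj₁ tt

  simulateP : PT (list 𝔹 ⊗ nat) (𝟙 ⊕ 𝔹) simulate′
  simulateP = ifP (haltedP runP) (inj₂P (eqP nat (fstP ∘P sndP ∘P fstP ∘P sndP ∘P runP) (constP nat (bitCode true)))) (constP (𝟙 ⊕ 𝔹) (inj₁ tt))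
   where
   runP : PT (list 𝔹 ⊗ nat) configτ simRun
   runP = iterateP⁺ sndP (initP ∘P fstP) (simStepP ∘P v0) (K growthC) (λ _ c → simStep-size c)

  halts-last : ∀ {s c d} → HaltsIn M s c d → step M d ≡ nothing
  halts-last (halt eq) = eq
  halts-last (next _ h) = halts-last h

  stays : ∀ c k → step M c ≡ nothing → run c k ≡ c
  stays c zero eq = refl
  stays c (suc k) eq = trans (cong tick (stays c k eq)) (tick-halt eq)

  run-+ : ∀ c k J → run c (k + J) ≡ run (run c J) k
  run-+ c zero J = refl
  run-+ c (suc k) J = cong tick (run-+ c k J)

  out-head : ∀ d {a} → output M d ≡ [ a ] → outBit (encConfig d) ≡ a
  out-head (config q (tape _ s rs ∷ ts)) {a} out = trans (cong (λ s → eqᵇ nat (code′ s) (bitCode true)) (single s rs out)) (isTrue a)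
   where
   single : ∀ s rs → leadingBits {workSymbols} (s ∷ rs) ≡ [ a ] → s ≡ bit a
   single (bit c) rs eq = cong (λ b → bit b) (∷-injectiveˡ eq)
   single nothing rs ()
   single (just (inj₂ _)) rs ()
   isTrue : ∀ a → eqᵇ nat (bitCode a) (bitCode true) ≡ a
   isTrue true = eqᵇ-refl nat (bitCode true)
   isTrue false = ¬T-false λ t → false≢true (code′-injective (T-eq {nat} t))
    where
    false≢true : ¬ (_≡_ {A = Γ} (bit false) (bit true))
    false≢true ()

  simulate-complete : ∀ w {t a} J → Outputs M w t [ a ] → t ≤ J → simulate′ (w , J) ≡ inj₂ a
  simulate-complete w {t} {a} J (s , d , s≤ , h , out) t≤ rewrite simRun-enc w J | run-halts h (≤-trans s≤ t≤) | proj₁ (proj₂ (simStep-enc d)) (halts-last h) = cong inj₂ (out-head d out)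

  -- No relation between t and J is assumed: a configuration that has halted by time J persists, and
  -- comparison at time s + J identifies it with the one in which the run ends.
  simulate-sound : ∀ w {t a b} J → Outputs M w t [ a ] → simulate′ (w , J) ≡ inj₂ b → b ≡ a
  simulate-sound w {t} {a} {b} J (s , d , s≤ , h , out) eq rewrite simRun-enc w J with halted (encConfig (run (initial M w) J)) in hl
  simulate-sound w {t} {a} {b} J (s , d , s≤ , h , out) refl | true =
   trans (cong (outBit ∘ encConfig) (trans (sym (stays c s (proj₂ (proj₂ (simStep-enc c)) hl))) (trans (sym (run-+ (initial M w) s J)) (run-halts h (m≤m+n s J))))) (out-head d out)
   where c = run (initial M w) J

-- Parsing 3-CNF encodings and writing leaves as formulas

module Parsing where

 open import Data.Bool using (T)
 open import Data.Fin using (toℕ)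
 open import Data.Fin.Properties using (fromℕ<-toℕ)
 open import Data.List.Membership.Propositional.Properties
 open import Data.List.Relation.Unary.All as All using ()
 open import Data.Nat.Properties
 open import Data.Vec as Vec using ()
 open import Data.Vec.Relation.Unary.Any as VecAny using ()
 open import Relation.Nullary using (yes; no)
 open Programs hiding (M; A; B)
 open PolynomialTime
 open GluedCopies using (mem⁺; mem⁻; memP; ∈-concatMap)
 open VertexCover using (module Formula; ∈-concatMap⁻′)
 open FormulaToGraph using (length-product)
 open Membership using (unpair; unpair-pair; unpairP)
 open Sparsification

 Triple : Set
 Triple = Lit × Lit × Lit

 ℓ³ stateτ scanτ : Ty
 ℓ³ = ℓ ⊗ ℓ ⊗ ℓ
 stateτ = list ℓ ⊗ list (ℓ ⊗ ℓ)
 scanτ = (𝟙 ⊕ ℓ) ⊗ list ℓ ⊗ list ℓ³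

 -- The literal being read, the earlier literals of its clause (last first), and the triples of the complete clauses.
 finish : Lit → List Lit → List Triple → ⟦ scanτ ⟧
 finish c pending out = caseList pending (inj₁ tt , [ c ] , out) (λ b r → caseList r (inj₁ tt , c ∷ b ∷ [] , out)
  (λ a _ → inj₁ tt , [] , (a , b , c) ∷ out))

 -- Between literals the next bit is a sign; inside a literal a true bit extends the unary index and
 -- a false bit ends it.
 parseStep : ⟦ scanτ ⟧ → Bool → ⟦ scanτ ⟧
 parseStep (cur , pending , out) b = case⊕ cur (λ _ → inj₂ (0 , b) , pending , out)
  (λ l → if b then (inj₂ (suc (proj₁ l) , proj₂ l) , pending , out) else finish l pending out)

 clausesOf : Word → List Triple
 clausesOf v = proj₂ (proj₂ (foldl parseStep (inj₁ tt , [] , []) v))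

 clausesOfP : PT (list 𝔹) (list ℓ³) clausesOf
 clausesOfP = sndP ∘P sndP ∘P foldP⁺ idP (constP scanτ (inj₁ tt , [] , []))
  (case⊕P (fstP ∘P v1) ((inj₂P (constP nat 0 ,P v0 ∘P w1)) ,P sndP ∘P v1 ∘P w1)
   (ifP v1 (inj₂P (sucP (fstP ∘P v0) ,P sndP ∘P v0) ,P sndP ∘P v1 ∘P w1)
    (caseListP (fstP ∘P sndP ∘P v1 ∘P w1) (constP (𝟙 ⊕ ℓ) (inj₁ tt) ,P ([ v0 ]P ,P sndP ∘P sndP ∘P v1 ∘P w1))
     (caseListP v1 (constP (𝟙 ⊕ ℓ) (inj₁ tt) ,P ((v2 ∷P v0 ∷P nilP) ,P sndP ∘P sndP ∘P v1 ∘P w3))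
      (constP (𝟙 ⊕ ℓ) (inj₁ tt) ,P (nilP ,P ((v0 ,P (v2 ,P v2 ∘P w2)) ∷P sndP ∘P sndP ∘P v1 ∘P w3 ∘P w2)))))))
  (K 4) bound
  where
  bound : ∀ (γ : Word) b acc → size scanτ (parseStep acc b) ≤ size scanτ acc + 4
  bound γ b (inj₁ tt , p , o) = ≤-trans (≤-reflexive (eq (size (list ℓ) p + size (list ℓ³) o))) (+-monoʳ-≤ (2 + (size (list ℓ) p + size (list ℓ³) o)) (s≤s z≤n))
   where
   eq : ∀ z → 3 + z ≡ 2 + z + 1
   eq = solve-∀
  bound γ true (inj₂ (k , s) , p , o) = ≤-trans (≤-reflexive (+-comm 1 _)) (+-monoʳ-≤ (size scanτ (inj₂ (k , s) , p , o)) (s≤s z≤n))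
  bound γ false (inj₂ l , [] , o) = ≤-trans (m≤m+n _ 2) (≤-reflexive (eq (size ℓ l) (size (list ℓ³) o)))
   where
   eq : ∀ l z → 2 + (suc (l + 1) + z) + 2 ≡ suc l + (1 + z) + 4
   eq = solve-∀
  bound γ false (inj₂ l , b ∷ [] , o) = ≤-trans (m≤m+n _ 2) (≤-reflexive (eq (size ℓ l) (size ℓ b) (size (list ℓ³) o)))
   where
   eq : ∀ l b z → 2 + (suc (l + suc (b + 1)) + z) + 2 ≡ suc l + (suc (b + 1) + z) + 4
   eq = solve-∀
  bound γ false (inj₂ l , b ∷ a ∷ r , o) = ≤-trans (m≤m+n _ (size (list ℓ) r + 3)) (≤-reflexive (eq (size ℓ l) (size ℓ a) (size ℓ b) (size (list ℓ) r) (size (list ℓ³) o)))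
   where
   eq : ∀ l a b r z → 2 + (1 + suc (a + (b + l) + z)) + (r + 3) ≡ suc l + (suc (b + suc (a + r)) + z) + 4
   eq = solve-∀

 numVars : Word → ℕ
 numVars w = length (proj₁ (unpair w))

 literals : Word → List Lit
 literals w = cartesianProduct (upTo (numVars w)) (true ∷ false ∷ [])

 -- Each clause in both orders of its last two literals, which yields `trip-sym`.
 triples : Word → List Triple
 triples w = concatMap (λ t → t ∷ (proj₁ t , proj₂ (proj₂ t) , proj₁ (proj₂ t)) ∷ []) (clausesOf (proj₂ (unpair w)))

 numVarsP : PT (list 𝔹) nat numVars
 numVarsP = lengthP (fstP ∘P unpairP)

 literalsP : PT (list 𝔹) (list ℓ) literals
 literalsP = productP (upToP numVarsP) (constP (list 𝔹) (true ∷ false ∷ []))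

 triplesP : PT (list 𝔹) (list ℓ³) triples
 triplesP = concatMapP (clausesOfP ∘P (sndP ∘P unpairP)) (v0 ∷P (fstP ∘P v0 ,P (sndP ∘P sndP ∘P v0 ,P fstP ∘P sndP ∘P v0)) ∷P nilP)

 literalOf : ∀ {n} → Literal n → Lit
 literalOf (s , i) = toℕ i , s

 tripleOf : ∀ {n} → Clause n → Triple
 tripleOf (a ∷ b ∷ c ∷ []) = literalOf a , literalOf b , literalOf c

 private
  read-unary : ∀ n k s p o v → foldl parseStep (inj₂ (k , s) , p , o) (unary n ++ false ∷ v) ≡ foldl parseStep (finish (n + k , s) p o) v
  read-unary zero k s p o v = refl
  read-unary (suc n) k s p o v = trans (read-unary n (suc k) s p o v) (cong (λ m → foldl parseStep (finish (m , s) p o) v) (+-suc n k))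

  read-literal : ∀ {n} (l : Literal n) p o v → foldl parseStep (inj₁ tt , p , o) (encodeLiteral l ++ v) ≡ foldl parseStep (finish (literalOf l) p o) v
  read-literal (s , i) p o v = trans (cong (foldl parseStep (inj₂ (0 , s) , p , o)) (++-assoc (unary (toℕ i)) [ false ] v))
   (trans (read-unary (toℕ i) 0 s p o v) (cong (λ m → foldl parseStep (finish (m , s) p o) v) (+-identityʳ (toℕ i))))

  read-clause : ∀ {n} (c : Clause n) o v → foldl parseStep (inj₁ tt , [] , o) (concatMap encodeLiteral (Vec.toList c) ++ v) ≡ foldl parseStep (inj₁ tt , [] , tripleOf c ∷ o) v
  read-clause (a ∷ b ∷ c ∷ []) o v =
   trans (cong (foldl parseStep (inj₁ tt , [] , o)) (trans (++-assoc A′ _ v) (cong (A′ ++_) (trans (++-assoc B′ _ v) (cong (B′ ++_) (++-assoc C′ [] v))))))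
    (trans (read-literal a [] o _) (trans (read-literal b _ o _) (read-literal c _ o v)))
   where A′ = encodeLiteral a ; B′ = encodeLiteral b ; C′ = encodeLiteral c

  read-clauses : ∀ {n} (cs : List (Clause n)) {t} o → t ∈ proj₂ (proj₂ (foldl parseStep (inj₁ tt , [] , o) (concatMap (concatMap encodeLiteral ∘ Vec.toList) cs))) →
   (∃[ c ] c ∈ cs × t ≡ tripleOf c) ⊎ t ∈ o
  read-clauses [] o m = inj₂ m
  read-clauses (c ∷ cs) {t} o m with read-clauses cs (tripleOf c ∷ o) (subst (λ z → t ∈ proj₂ (proj₂ z)) (read-clause c o _) m)
  ... | inj₁ (d , d∈ , eq) = inj₁ (d , there d∈ , eq)
  ... | inj₂ (here refl) = inj₁ (c , here refl , refl)
  ... | inj₂ (there m′) = inj₂ m′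

  read-clauses⁺ : ∀ {n} (cs : List (Clause n)) {t} o → t ∈ o ⊎ (∃[ c ] c ∈ cs × t ≡ tripleOf c) →
   t ∈ proj₂ (proj₂ (foldl parseStep (inj₁ tt , [] , o) (concatMap (concatMap encodeLiteral ∘ Vec.toList) cs)))
  read-clauses⁺ [] o (inj₁ m) = m
  read-clauses⁺ (c ∷ cs) {t} o h = subst (λ z → t ∈ proj₂ (proj₂ z)) (sym (read-clause c o _)) (read-clauses⁺ cs (tripleOf c ∷ o) (later h))
   where
   later : t ∈ o ⊎ (∃[ d ] d ∈ (c ∷ cs) × t ≡ tripleOf d) → t ∈ (tripleOf c ∷ o) ⊎ (∃[ d ] d ∈ cs × t ≡ tripleOf d)
   later (inj₁ m) = inj₁ (there m)
   later (inj₂ (d , here refl , refl)) = inj₁ (here refl)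
   later (inj₂ (d , there m , eq)) = inj₂ (d , m , eq)

 module Encoded (φ : 3CNF) where

  open 3CNF φ

  w : Word
  w = encode3CNF φ

  private
   body : Word
   body = concatMap (concatMap encodeLiteral ∘ Vec.toList) clauses

   unpaired : unpair w ≡ (unary variables , body)
   unpaired = unpair-pair (unary variables) body

  numVars-encode : numVars w ≡ variables
  numVars-encode = trans (cong (length ∘ proj₁) unpaired) (length-replicate variables)

  length-literals : length (literals w) ≡ 2 * variables
  length-literals = trans (length-product (upTo (numVars w)) (true ∷ false ∷ [])) (trans (cong (_* 2) (trans (length-upTo (numVars w)) numVars-encode)) (*-comm variables 2))

  triples⁺ : ∀ {c} → c ∈ clauses → tripleOf c ∈ triples w
  triples⁺ {c} m = ∈-concatMap _ {xs = clausesOf (proj₂ (unpair w))} (subst (λ z → tripleOf c ∈ clausesOf (proj₂ z)) (sym unpaired) (read-clauses⁺ clauses [] (inj₂ (c , m , refl)))) (here refl)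

  private
   fromClause : ∀ {t} → t ∈ clausesOf (proj₂ (unpair w)) → ∃[ c ] c ∈ clauses × t ≡ tripleOf c
   fromClause {t} m = [ (λ h → h) , (λ ()) ]′ (read-clauses clauses [] (subst (λ z → t ∈ clausesOf (proj₂ z)) unpaired m))

  triples⁻ : ∀ {a b c} → (a , b , c) ∈ triples w → ∃[ d ] d ∈ clauses × ((a , b , c) ≡ tripleOf d ⊎ (a , c , b) ≡ tripleOf d)
  triples⁻ m with ∈-concatMap⁻′ (λ t → t ∷ (proj₁ t , proj₂ (proj₂ t) , proj₁ (proj₂ t)) ∷ []) (clausesOf (proj₂ (unpair w))) m
  ... | _ , t∈ , here refl = let d , d∈ , eq = fromClause t∈ in d , d∈ , inj₁ eq
  ... | _ , t∈ , there (here refl) = let d , d∈ , eq = fromClause t∈ in d , d∈ , inj₂ eq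

  ∈-literals : (l : Literal variables) → literalOf l ∈ literals w
  ∈-literals (s , i) = ∈-cartesianProduct⁺ (∈-upTo⁺ (subst (toℕ i <_) (sym numVars-encode) (toℕ<n i))) (both s)
   where
   both : ∀ s → s ∈ true ∷ false ∷ []
   both true = here refl
   both false = there (here refl)

  module _ (θ : ℕ) where
   open Sparse (literals w) (triples w) θ

   trip-sym : ∀ {a b c} → T (trip a b c) → T (trip a c b)
   trip-sym {a} {b} {c} t = mem⁺ ℓ³ (swap (mem⁻ ℓ³ (a , b , c) (triples w) t))
    where
    swap : (a , b , c) ∈ triples w → (a , c , b) ∈ triples w
    swap m with ∈-concatMap⁻′ (λ t → t ∷ (proj₁ t , proj₂ (proj₂ t) , proj₁ (proj₂ t)) ∷ []) (clausesOf (proj₂ (unpair w))) m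
    ... | _ , t∈ , here refl = ∈-concatMap _ {xs = clausesOf (proj₂ (unpair w))} t∈ (there (here refl))
    ... | _ , t∈ , there (here refl) = ∈-concatMap _ {xs = clausesOf (proj₂ (unpair w))} t∈ (here refl)

   models⇔satisfiable : (∃[ σ ] Models σ ([] , [])) ⇔ Satisfiable φ
   models⇔satisfiable = mk⇔ (λ (σ , M) → σ ∘ toℕ , All.tabulate (λ {c} → clause σ M c)) from
    where
    clause : ∀ σ → Models σ ([] , []) → ∀ c → c ∈ clauses → VecAny.Any (λ (s , i) → σ (toℕ i) ≡ s) c
    clause σ M (a ∷ b ∷ c ∷ []) m = [ (λ h → here h) , [ (λ h → there (here h)) , (λ h → there (there (here h))) ]′ ]′
     (Models.triples M (∈-literals a) (∈-literals b) (∈-literals c) (mem⁺ ℓ³ (triples⁺ m)))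
    from : Satisfiable φ → ∃[ σ ] Models σ ([] , [])
    from (σ , sat) = σ′ , record
     { units = λ {a} _ t → empty (mem⁻ ℓ a [] t) ; pairs = λ {a} {b} _ _ t → empty (mem⁻ (ℓ ⊗ ℓ) (a , b) [] t)
     ; triples = λ {a} {b} {c} _ _ _ t → let d , d∈ , eq = triples⁻ (mem⁻ ℓ³ (a , b , c) (triples w) t) in
      [ (λ e → holds d (All.lookup sat d∈) e) , (λ e → perm (holds d (All.lookup sat d∈) e)) ]′ eq }
     where
     empty : ∀ {A C : Set} {x : A} → x ∈ [] → C
     empty ()
     σ′ : ℕ → Bool
     σ′ k with k <? variables
     ... | yes lt = σ (fromℕ< lt)
     ... | no _ = false
     σ′-toℕ : ∀ i → σ′ (toℕ i) ≡ σ i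
     σ′-toℕ i with toℕ i <? variables
     ... | yes lt = cong σ (fromℕ<-toℕ i lt)
     ... | no n = ⊥-elim (n (toℕ<n i))
     holds : ∀ {a b c} d → VecAny.Any (λ (s , i) → σ i ≡ s) d → (a , b , c) ≡ tripleOf d → Holds σ′ a ⊎ Holds σ′ b ⊎ Holds σ′ c
     holds ((_ , i) ∷ _ ∷ _ ∷ []) (here p) refl = inj₁ (trans (σ′-toℕ i) p)
     holds (_ ∷ (_ , i) ∷ _ ∷ []) (there (here p)) refl = inj₂ (inj₁ (trans (σ′-toℕ i) p))
     holds (_ ∷ _ ∷ (_ , i) ∷ []) (there (there (here p))) refl = inj₂ (inj₂ (trans (σ′-toℕ i) p))
     perm : ∀ {P Q R : Set} → P ⊎ Q ⊎ R → P ⊎ R ⊎ Q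
     perm (inj₁ p) = inj₁ p
     perm (inj₂ (inj₁ q)) = inj₂ (inj₂ q)
     perm (inj₂ (inj₂ r)) = inj₂ (inj₁ r)

 open Formula nat using (Cl; lits; Sat; WellFormed)

 -- Only pairs and triples without a smaller member of the family become clauses: the others follow
 -- from what is written, and `leaf-count` can bound only the former.
 leafClauses : List Lit × List Triple × State → List Cl
 leafClauses (Ls , Tr , S) =
  map (λ a → a , []) (filterᵇ (u S) Ls) ++
  map (λ p → proj₁ p , [ proj₂ p ]) (filterᵇ (λ p → lp S (proj₁ p) (proj₂ p)) (cartesianProduct Ls Ls)) ++
  map (λ t → proj₁ t , proj₁ (proj₂ t) ∷ proj₂ (proj₂ t) ∷ []) (filterᵇ (λ t → lt S (proj₁ t) (proj₁ (proj₂ t)) (proj₂ (proj₂ t))) (cartesianProduct Ls (cartesianProduct Ls Ls)))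
  where open Sparse Ls Tr 0

 module _ {Δ : Ty} {st : ⟦ Δ ⟧ → State} (S : PT Δ stateτ st) where

  uP : ∀ {a} → PT Δ ℓ a → PT Δ 𝔹 (λ δ → Sparse.u [] [] 0 (st δ) (a δ))
  uP A = memP ℓ A (fstP ∘P S)

  prP : ∀ {a b} → PT Δ ℓ a → PT Δ ℓ b → PT Δ 𝔹 (λ δ → Sparse.pr [] [] 0 (st δ) (a δ) (b δ))
  prP A B = memP (ℓ ⊗ ℓ) (A ,P B) (sndP ∘P S)

  lpP : ∀ {a b} → PT Δ ℓ a → PT Δ ℓ b → PT Δ 𝔹 (λ δ → Sparse.lp [] [] 0 (st δ) (a δ) (b δ))
  lpP A B = prP A B ∧P (notP (uP A) ∧P notP (uP B))

  ltP : ∀ {tr} → PT Δ (list ℓ³) tr → ∀ {a b c} → PT Δ ℓ a → PT Δ ℓ b → PT Δ ℓ c → PT Δ 𝔹 (λ δ → Sparse.lt [] (tr δ) 0 (st δ) (a δ) (b δ) (c δ))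
  ltP Tr A B C = memP ℓ³ (A ,P (B ,P C)) Tr ∧P ((notP (uP A) ∧P (notP (uP B) ∧P notP (uP C))) ∧P (notP (prP A B) ∧P (notP (prP A C) ∧P notP (prP B C))))

 leafτ : Ty
 leafτ = list ℓ ⊗ list ℓ³ ⊗ stateτ

 leafClausesP : PT leafτ (list (ℓ ⊗ list ℓ)) leafClauses
 leafClausesP = mapP (filterP fstP (uP (w2 ∘P w1) v0)) (v0 ,P nilP) ++P
  (mapP (filterP (productP fstP fstP) (lpP (w2 ∘P w1) (fstP ∘P v0) (sndP ∘P v0))) (fstP ∘P v0 ,P [ sndP ∘P v0 ]P) ++P
   mapP (filterP (productP fstP (productP fstP fstP)) (ltP (w2 ∘P w1) (v1 ∘P w1) (fstP ∘P v0) (fstP ∘P sndP ∘P v0) (sndP ∘P sndP ∘P v0)))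
    (fstP ∘P v0 ,P (fstP ∘P sndP ∘P v0 ∷P sndP ∘P sndP ∘P v0 ∷P nilP)))

-- Searching the branching tree

module Branching where

 open import Data.Bool using (T)
 open import Data.List.Membership.Propositional.Properties
 open import Data.List.Relation.Unary.All as All using ()
 open import Data.Nat.Properties
 open import Relation.Nullary using (yes; no)
 open Programs hiding (M; A; B)
 open PolynomialTime
 open VertexCover using (module Formula)
 open Sparsification
 open Parsing

 open PT
 open Formula nat using (Cl; lits; Sat; WellFormed)

 module Leaves (Ls : List Lit) (Tr : List Triple) (θ : ℕ) where

  open Sparse Ls Tr θ

  leafOf : State → List Cl
  leafOf S = leafClauses (Ls , Tr , S)

  data Origin (S : State) : Cl → Set where
   unit : ∀ {a} → a ∈ Ls → T (u S a) → Origin S (a , [])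
   pair : ∀ {a b} → a ∈ Ls → b ∈ Ls → T (lp S a b) → Origin S (a , [ b ])
   triple : ∀ {a b c} → a ∈ Ls → b ∈ Ls → c ∈ Ls → T (lt S a b c) → Origin S (a , b ∷ c ∷ [])

  private
   lp₂ : State → Lit × Lit → Bool
   lp₂ S p = lp S (proj₁ p) (proj₂ p)
   lt₃ : State → Triple → Bool
   lt₃ S t = lt S (proj₁ t) (proj₁ (proj₂ t)) (proj₂ (proj₂ t))
   Ls³ : List Triple
   Ls³ = cartesianProduct Ls Ls²
   units₁ pairs₁ triples₁ : State → List Cl
   units₁ S = map (λ a → a , []) (filterᵇ (u S) Ls)
   pairs₁ S = map (λ p → proj₁ p , [ proj₂ p ]) (filterᵇ (lp₂ S) Ls²)
   triples₁ S = map (λ t → proj₁ t , proj₁ (proj₂ t) ∷ proj₂ (proj₂ t) ∷ []) (filterᵇ (lt₃ S) Ls³)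

  origin : ∀ S {c} → c ∈ leafOf S → Origin S c
  origin S {c} m = [ fromUnits , (λ m′ → [ fromPairs , fromTriples ]′ (∈-++⁻ (pairs₁ S) m′)) ]′ (∈-++⁻ (units₁ S) m)
   where
   fromUnits : c ∈ units₁ S → Origin S c
   fromUnits m with ∈-map⁻ _ m
   ... | a , m′ , refl = let p , t = ∈-filter⁻ (T? ∘ u S) {xs = Ls} m′ in unit p t
   fromPairs : c ∈ pairs₁ S → Origin S c
   fromPairs m with ∈-map⁻ _ m
   ... | (a , b) , m′ , refl = let p , t = ∈-filter⁻ (T? ∘ lp₂ S) {xs = Ls²} m′ ; a∈ , b∈ = ∈-cartesianProduct⁻ Ls Ls p in pair a∈ b∈ t
   fromTriples : c ∈ triples₁ S → Origin S c
   fromTriples m with ∈-map⁻ _ m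
   ... | (a , b , d) , m′ , refl = let p , t = ∈-filter⁻ (T? ∘ lt₃ S) {xs = Ls³} m′ ; a∈ , q = ∈-cartesianProduct⁻ Ls Ls² p ; b∈ , d∈ = ∈-cartesianProduct⁻ Ls Ls q in triple a∈ b∈ d∈ t

  origin⁻ : ∀ S {c} → Origin S c → c ∈ leafOf S
  origin⁻ S (unit p t) = ∈-++⁺ˡ (∈-map⁺ (λ a → a , []) (∈-filter⁺ (T? ∘ u S) p t))
  origin⁻ S (pair p q t) = ∈-++⁺ʳ (units₁ S) (∈-++⁺ˡ (∈-map⁺ (λ p → proj₁ p , [ proj₂ p ]) (∈-filter⁺ (T? ∘ lp₂ S) (∈-cartesianProduct⁺ p q) t)))
  origin⁻ S (triple p q r t) = ∈-++⁺ʳ (units₁ S) (∈-++⁺ʳ (pairs₁ S) (∈-map⁺ (λ t → proj₁ t , proj₁ (proj₂ t) ∷ proj₂ (proj₂ t) ∷ []) (∈-filter⁺ (T? ∘ lt₃ S) (∈-cartesianProduct⁺ p (∈-cartesianProduct⁺ q r)) t)))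

  leaf-width : ∀ S {c} → c ∈ leafOf S → length (lits c) ≤ 3
  leaf-width S m with origin S m
  ... | unit _ _ = s≤s z≤n
  ... | pair _ _ _ = s≤s (s≤s z≤n)
  ... | triple _ _ _ _ = ≤-refl

  leaf-lits : ∀ S {c l} → c ∈ leafOf S → l ∈ lits c → l ∈ Ls
  leaf-lits S m l∈ with origin S m
  leaf-lits S m (here refl) | unit p _ = p
  leaf-lits S m (here refl) | pair p q _ = p
  leaf-lits S m (there (here refl)) | pair p q _ = q
  leaf-lits S m (here refl) | triple p q r _ = p
  leaf-lits S m (there (here refl)) | triple p q r _ = q
  leaf-lits S m (there (there (here refl))) | triple p q r _ = r

  -- A set is satisfied as soon as a smaller member inside it is, so the omitted sets are recovered
  -- from the clauses.
  leaf-sat : ∀ S → (∃[ σ ] Models σ S) ⇔ Sat (leafOf S)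
  leaf-sat S = mk⇔ (λ (σ , M) → σ , λ m → to σ M (origin S m)) (λ (σ , sat) → σ , from σ (λ o → sat (origin⁻ S o)))
   where
   to : ∀ σ → Models σ S → ∀ {c} → Origin S c → ∃[ l ] l ∈ lits c × Holds σ l
   to σ M (unit {a} p t) = a , here refl , Models.units M p t
   to σ M (pair {a} {b} p q t) = [ (λ h → a , here refl , h) , (λ h → b , there (here refl) , h) ]′ (Models.pairs M p q (proj₁ (lp⁻ S a b t)))
   to σ M (triple {a} {b} {c} p q r t) = [ (λ h → a , here refl , h) , [ (λ h → b , there (here refl) , h) , (λ h → c , there (there (here refl)) , h) ]′ ]′ (Models.triples M p q r (proj₁ (lt⁻ S a b c t)))
   from : ∀ σ → (∀ {c} → Origin S c → ∃[ l ] l ∈ lits c × Holds σ l) → Models σ S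
   from σ sat = record { units = unitHolds ; pairs = pairHolds ; triples = tripleHolds }
    where
    unitHolds : ∀ {a} → a ∈ Ls → T (u S a) → Holds σ a
    unitHolds p t with _ , here refl , h ← sat (unit p t) = h
    pairHolds : ∀ {a b} → a ∈ Ls → b ∈ Ls → T (pr S a b) → Holds σ a ⊎ Holds σ b
    pairHolds {a} {b} p q t with T? (u S a) | T? (u S b)
    ... | yes h | _ = inj₁ (unitHolds p h)
    ... | no _ | yes h = inj₂ (unitHolds q h)
    ... | no x | no y with sat (pair p q (lp⁺ S a b t x y))
    ... | _ , here refl , h = inj₁ h
    ... | _ , there (here refl) , h = inj₂ h
    tripleHolds : ∀ {a b c} → a ∈ Ls → b ∈ Ls → c ∈ Ls → T (trip a b c) → Holds σ a ⊎ Holds σ b ⊎ Holds σ c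
    tripleHolds {a} {b} {c} p q r t with T? (u S a) | T? (u S b) | T? (u S c) | T? (pr S a b) | T? (pr S a c) | T? (pr S b c)
    ... | yes h | _ | _ | _ | _ | _ = inj₁ (unitHolds p h)
    ... | no _ | yes h | _ | _ | _ | _ = inj₂ (inj₁ (unitHolds q h))
    ... | no _ | no _ | yes h | _ | _ | _ = inj₂ (inj₂ (unitHolds r h))
    ... | no _ | no _ | no _ | yes h | _ | _ = [ inj₁ , inj₂ ∘ inj₁ ]′ (pairHolds p q h)
    ... | no _ | no _ | no _ | no _ | yes h | _ = [ inj₁ , inj₂ ∘ inj₂ ]′ (pairHolds p r h)
    ... | no _ | no _ | no _ | no _ | no _ | yes h = inj₂ (pairHolds q r h)
    ... | no x | no y | no z | no x′ | no y′ | no z′ with sat (triple p q r (lt⁺ S a b c t (x , y , z) (x′ , y′ , z′)))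
    ... | _ , here refl , h = inj₁ h
    ... | _ , there (here refl) , h = inj₂ (inj₁ h)
    ... | _ , there (there (here refl)) , h = inj₂ (inj₂ h)

  -- At a leaf each literal is the first one in fewer than θ pairs and in fewer than θ² triples, and
  -- it gives at most one unit.
  leaf-count : ∀ {S} → View S (inj₁ tt) → length (leafOf S) ≤ length Ls * (1 + (θ + θ * θ))
  leaf-count {S} (leaf light₁ light₃) = ≤-trans (≤-reflexive (trans (length-++ (units₁ S)) (cong₂ _+_ (length-map _ (filterᵇ (u S) Ls))
   (trans (length-++ (pairs₁ S)) (cong₂ _+_ (length-map _ (filterᵇ (lp₂ S) Ls²)) (length-map _ (filterᵇ (lt₃ S) Ls³)))))))
   (≤-trans (+-mono-≤ (≤-trans (≤-reflexive (count-∑ (u S) Ls)) (∑-const Ls (λ {x} _ → ind≤1 (u S x))))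
    (+-mono-≤ (rows (lp₂ S) Ls light₁) (rows (lt₃ S) Ls² light₃)))
    (≤-reflexive (eq (length Ls) θ (θ * θ))))
   where
   eq : ∀ n a b → n * 1 + (n * a + n * b) ≡ n * (1 + (a + b))
   eq = solve-∀
   rows : ∀ {A : Set} (q : Lit × A → Bool) (ys : List A) {m} → (∀ {a} → a ∈ Ls → count (λ y → q (a , y)) ys < m) → count q (cartesianProduct Ls ys) ≤ length Ls * m
   rows q ys h = ≤-trans (≤-reflexive (trans (count-∑ q (cartesianProduct Ls ys)) (∑-product Ls ys (ind ∘ q)))) (∑-const Ls (λ {x} m → ≤-trans (≤-reflexive (sym (count-∑ (λ y → q (x , y)) ys))) (<⇒≤ (h m))))

 expτ : Ty
 expτ = stateτ ⊗ list ℓ ⊗ list ℓ³ ⊗ nat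

 expand′ : ⟦ expτ ⟧ → ⊤ ⊎ (State × State)
 expand′ (S , Ls , Tr , θ) = Sparse.expand Ls Tr θ S

 module _ {Δ : Ty} {e : ⟦ Δ ⟧ → ⟦ expτ ⟧} (E : PT Δ expτ e) where

  private
   LsP = fstP ∘P sndP ∘P E
   θP = sndP ∘P sndP ∘P sndP ∘P E

  addUP : ∀ {q} → PT (ℓ ⊗ Δ) 𝔹 q → PT Δ stateτ (λ δ → Sparse.addU (proj₁ (proj₂ (e δ))) [] 0 (proj₁ (e δ)) (λ x → q (x , δ)))
  addUP Q = filterP LsP (uP (fstP ∘P E ∘P w1) v0 ∨P Q) ,P sndP ∘P fstP ∘P E

  addPP : ∀ {q} → PT ((ℓ ⊗ ℓ) ⊗ Δ) 𝔹 q → PT Δ stateτ (λ δ → Sparse.addP (proj₁ (proj₂ (e δ))) [] 0 (proj₁ (e δ)) (λ x y → q ((x , y) , δ)))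
  addPP Q = fstP ∘P fstP ∘P E ,P filterP (productP LsP LsP) (prP (fstP ∘P E ∘P w1) (fstP ∘P v0) (sndP ∘P v0) ∨P Q)

 expandP : PT expτ (𝟙 ⊕ (stateτ ⊗ stateτ)) expand′
 expandP = caseListP (filterP LsP (θP ∘P w1 ≤ᵇP lengthP (filterP (LsP ∘P w1) (lpP (fstP ∘P w2) v1 v0))))
  (caseListP (filterP (productP LsP LsP) (θP ∘P w1 ≤ᵇP lengthP (filterP (LsP ∘P w1) (ltP (fstP ∘P w2) (TrP ∘P w2) (fstP ∘P v1) (sndP ∘P v1) v0))))
   (caseListP (filterP LsP ((θP *P θP) ∘P w1 ≤ᵇP lengthP (filterP (productP LsP LsP ∘P w1) (ltP (fstP ∘P w2) (TrP ∘P w2) v1 (fstP ∘P v0) (sndP ∘P v0)))))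
    (constP (𝟙 ⊕ (stateτ ⊗ stateτ)) (inj₁ tt))
    (inj₂P (addUP w2 (eqP ℓ v1 v0) ,P addPP w2 (ltP (fstP ∘P w3) (TrP ∘P w3) v1 (fstP ∘P v0) (sndP ∘P v0)))))
   (inj₂P (addPP w2 (eqP (ℓ ⊗ ℓ) (fstP ∘P v1 ,P sndP ∘P v1) (fstP ∘P v0 ,P sndP ∘P v0) ∨P eqP (ℓ ⊗ ℓ) (sndP ∘P v1 ,P fstP ∘P v1) (fstP ∘P v0 ,P sndP ∘P v0))
    ,P addUP w2 (ltP (fstP ∘P w3) (TrP ∘P w3) (fstP ∘P v1) (sndP ∘P v1) v0))))
  (inj₂P (addUP w2 (eqP ℓ v1 v0) ,P addUP w2 (lpP (fstP ∘P w3) v1 v0)))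
  where
  LsP : PT expτ (list ℓ) (λ δ → proj₁ (proj₂ δ))
  LsP = fstP ∘P sndP
  TrP : PT expτ (list ℓ³) (λ δ → proj₁ (proj₂ (proj₂ δ)))
  TrP = fstP ∘P sndP ∘P sndP
  θP : PT expτ nat (λ δ → proj₂ (proj₂ (proj₂ δ)))
  θP = sndP ∘P sndP ∘P sndP

 envτ searchτ : Ty
 envτ = list ℓ ⊗ list ℓ³ ⊗ nat
 searchτ = list stateτ ⊗ list stateτ

 -- The program language has folds but no recursion: the tree is searched depth first with an
 -- explicit stack, one node per call, and the leaves are collected on the way.
 visit : ⟦ envτ ⟧ → ⟦ searchτ ⟧ → ⟦ searchτ ⟧
 visit γ acc = caseList (proj₁ acc) acc (λ S rest → case⊕ (expand′ (S , γ)) (λ _ → rest , S ∷ proj₂ acc) (λ p → proj₁ p ∷ proj₂ p ∷ rest , proj₂ acc))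

 search : ⟦ nat ⊗ envτ ⟧ → ⟦ searchτ ⟧
 search (J , γ) = iterate (visit γ) ([ [] , [] ] , []) J

 filter-size : ∀ τ (q : ⟦ τ ⟧ → Bool) xs → size (list τ) (filterᵇ q xs) ≤ size (list τ) xs
 filter-size τ q [] = ≤-refl
 filter-size τ q (x ∷ xs) with q x
 ... | true = s≤s (+-monoʳ-≤ (size τ x) (filter-size τ q xs))
 ... | false = ≤-trans (filter-size τ q xs) (≤-trans (m≤n+m _ (size τ x)) (n≤1+n _))

 module Search (γ : ⟦ envτ ⟧) where

  Ls = proj₁ γ
  open Sparse Ls (proj₁ (proj₂ γ)) (proj₂ (proj₂ γ))

  -- States are filtered anew from `Ls` and its square, so their size is bounded independently of
  -- the depth of the search.
  Small Leaf : State → Set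
  Small S = size (list ℓ) (proj₁ S) ≤ size (list ℓ) Ls × size (list (ℓ ⊗ ℓ)) (proj₂ S) ≤ size (list (ℓ ⊗ ℓ)) Ls²
  Leaf S = View S (inj₁ tt)

  Alive : (ℕ → Bool) → ⟦ searchτ ⟧ → Set
  Alive σ (stack , leaves) = Any (Models σ) stack ⊎ Any (Models σ) leaves

  -- `few` persists because a visit adds at most one state; `alive` and `alive⁻` say that no model
  -- is lost or gained, even if the search is not complete.
  record Sound (k : ℕ) (acc : ⟦ searchτ ⟧) : Set where
   field
    few : length (proj₁ acc) + length (proj₂ acc) ≤ suc k
    small : All Small (proj₁ acc)
    smallLeaf : All Small (proj₂ acc)
    atLeaf : All Leaf (proj₂ acc)
    alive : ∀ σ → Models σ ([] , []) → Alive σ acc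
    alive⁻ : ∀ σ → Alive σ acc → Models σ ([] , [])

  open Sound

  addU-small : ∀ {S q} → Small S → Small (addU S q)
  addU-small {S} {q} (a , b) = filter-size ℓ (λ x → u S x ∨ q x) Ls , b

  addP-small : ∀ {S q} → Small S → Small (addP S q)
  addP-small {S} {q} (a , b) = a , filter-size (ℓ ⊗ ℓ) (λ (x , y) → pr S x y ∨ q x y) Ls²

  children-small : ∀ {S S₁ S₂} → View S (inj₂ (S₁ , S₂)) → Small S → Small S₁ × Small S₂
  children-small {S} (split₁ {a} _ _) s = addU-small {S} {eqᵇ ℓ a} s , addU-small {S} {lp S a} s
  children-small {S} (split₂ {a} {b} _ _ _ _) s = addP-small {S} {same a b} s , addU-small {S} {lt S a b} s
  children-small {S} (split₃ {a} _ _ _ _) s = addU-small {S} {eqᵇ ℓ a} s , addP-small {S} {lt S a} s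

  visit-sound : ∀ {k} acc → Sound k acc → Sound (suc k) (visit γ acc)
  visit-sound ([] , leaves) I = record { few = m≤n⇒m≤1+n (few I) ; small = small I ; smallLeaf = smallLeaf I ; atLeaf = atLeaf I ; alive = alive I ; alive⁻ = alive⁻ I }
  visit-sound {k} (S ∷ rest , leaves) I = go (expand S) (expandView S) (small I)
   where
   go : ∀ o → View S o → All Small (S ∷ rest) → Sound (suc k) (case⊕ o (λ _ → rest , S ∷ leaves) (λ p → proj₁ p ∷ proj₂ p ∷ rest , leaves))
   go (inj₁ tt) v (s ∷ ss) = record
    { few = ≤-trans (≤-reflexive (+-suc (length rest) (length leaves))) (m≤n⇒m≤1+n (few I))
    ; small = ss ; smallLeaf = s ∷ smallLeaf I ; atLeaf = v ∷ atLeaf I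
    ; alive = λ σ M → move σ (alive I σ M) ; alive⁻ = λ σ M → alive⁻ I σ (move⁻ σ M) }
    where
    move : ∀ σ → Alive σ (S ∷ rest , leaves) → Alive σ (rest , S ∷ leaves)
    move σ (inj₁ (here m)) = inj₂ (here m)
    move σ (inj₁ (there m)) = inj₁ m
    move σ (inj₂ m) = inj₂ (there m)
    move⁻ : ∀ σ → Alive σ (rest , S ∷ leaves) → Alive σ (S ∷ rest , leaves)
    move⁻ σ (inj₂ (here m)) = inj₁ (here m)
    move⁻ σ (inj₁ m) = inj₁ (there m)
    move⁻ σ (inj₂ (there m)) = inj₂ m
   go (inj₂ (S₁ , S₂)) v (s ∷ ss) = record
    { few = s≤s (few I)
    ; small = proj₁ (children-small v s) ∷ proj₂ (children-small v s) ∷ ss ; smallLeaf = smallLeaf I ; atLeaf = atLeaf I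
    ; alive = λ σ M → move σ (alive I σ M) ; alive⁻ = λ σ M → alive⁻ I σ (move⁻ σ M) }
    where
    move : ∀ σ → Alive σ (S ∷ rest , leaves) → Alive σ (S₁ ∷ S₂ ∷ rest , leaves)
    move σ (inj₁ (here m)) = inj₁ ([ here , (λ m → there (here m)) ]′ (branch⁺ σ v m))
    move σ (inj₁ (there m)) = inj₁ (there (there m))
    move σ (inj₂ m) = inj₂ m
    move⁻ : ∀ σ → Alive σ (S₁ ∷ S₂ ∷ rest , leaves) → Alive σ (S ∷ rest , leaves)
    move⁻ σ (inj₁ (here m)) = inj₁ (here (branch⁻ σ v (inj₁ m)))
    move⁻ σ (inj₁ (there (here m))) = inj₁ (here (branch⁻ σ v (inj₂ m)))
    move⁻ σ (inj₁ (there (there m))) = inj₁ (there m)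
    move⁻ σ (inj₂ m) = inj₂ m

  search-sound : ∀ J → Sound J (search (J , γ))
  search-sound zero = record { few = ≤-refl ; small = (size>0 (list ℓ) Ls , size>0 (list (ℓ ⊗ ℓ)) Ls²) ∷ [] ; smallLeaf = [] ; atLeaf = []
   ; alive = λ σ M → inj₁ (here M) ; alive⁻ = λ { σ (inj₁ (here M)) → M } }
  search-sound (suc J) = subst (Sound (suc J)) (sym (iterate-suc (visit γ) ([ [] , [] ] , []) J)) (visit-sound (search (J , γ)) (search-sound J))

  b : ℕ
  b = size (list ℓ) Ls + size (list (ℓ ⊗ ℓ)) Ls²

  search-size : ∀ {k acc} → Sound k acc → size searchτ acc ≤ 2 + suc k * suc b
  search-size {k} {st , lv} I = ≤-trans (+-mono-≤ (states st (small I)) (states lv (smallLeaf I)))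
   (≤-trans (≤-reflexive (eq (length st) (length lv) (suc b))) (+-monoʳ-≤ 2 (*-monoˡ-≤ (suc b) (few I))))
   where
   eq : ∀ x y c → 1 + x * c + (1 + y * c) ≡ 2 + (x + y) * c
   eq = solve-∀
   states : ∀ xs → All Small xs → size (list stateτ) xs ≤ 1 + length xs * suc b
   states [] [] = ≤-refl
   states (x ∷ xs) ((p , q) ∷ ss) = s≤s (≤-trans (+-mono-≤ (+-mono-≤ p q) (states xs ss)) (≤-reflexive (+-suc b _)))

  finished : ∀ lv m → iterate (visit γ) ([] , lv) m ≡ ([] , lv)
  finished lv zero = refl
  finished lv (suc m) = finished lv m

  explored : ∀ {S k} → Explored S k → ∀ rest lv m → ∃[ lv′ ] iterate (visit γ) (S ∷ rest , lv) (k + m) ≡ iterate (visit γ) (rest , lv′) m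
  explored {S} (leaf eq) rest lv m = S ∷ lv , cong (λ o → iterate (visit γ) (case⊕ o (λ _ → rest , S ∷ lv) (λ p → proj₁ p ∷ proj₂ p ∷ rest , lv)) m) eq
  explored {S} (node {S₁ = S₁} {S₂} {k₁} {k₂} eq e₁ e₂) rest lv m =
   let lv₁ , eq₁ = explored e₁ (S₂ ∷ rest) lv (k₂ + m) ; lv₂ , eq₂ = explored e₂ rest lv₁ m in
   lv₂ , trans (cong (λ o → iterate (visit γ) (case⊕ o (λ _ → rest , S ∷ lv) (λ p → proj₁ p ∷ proj₂ p ∷ rest , lv)) (k₁ + k₂ + m)) eq)
    (trans (cong (iterate (visit γ) (S₁ ∷ S₂ ∷ rest , lv)) (+-assoc k₁ k₂ m)) (trans eq₁ eq₂))

  search-complete : ∀ {k J} → Explored ([] , []) k → k ≤ J → proj₁ (search (J , γ)) ≡ []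
  search-complete {k} {J} ex le = let lv , eq = explored ex [] [] (J ∸ k) in
   trans (cong (λ n → proj₁ (search (n , γ))) (sym (m+[n∸m]≡n le))) (cong proj₁ (trans eq (finished lv (J ∸ k))))

 -- The size bound comes from the invariant of the search; an arbitrary accumulator need not satisfy
 -- `Small`, so `foldP` is applied with the states that really occur.
 searchP : PT (nat ⊗ envτ) searchτ search
 searchP = foldP (unitsP ∘P fstP) (constP searchτ ([ [] , [] ] , []))
  (caseListP (fstP ∘P v1) v1 (case⊕P (expandP ∘P (v0 ,P sndP ∘P w2 ∘P w2)) (v2 ,P (v1 ∷P sndP ∘P v2 ∘P w2)) ((fstP ∘P v0 ∷P sndP ∘P v0 ∷P v2) ,P sndP ∘P v2 ∘P w2)))
  (K 2 ⊞ X ⊠ (K 1 ⊞ (X ⊞ growth pairsP))) bounded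
  where
  pairsP : PT (nat ⊗ envτ) (list (ℓ ⊗ ℓ)) (λ δ → cartesianProduct (proj₁ (proj₂ δ)) (proj₁ (proj₂ δ)))
  pairsP = productP (fstP ∘P sndP) (fstP ∘P sndP)
  units : ∀ ys → ys ≡ replicate (length ys) tt
  units [] = refl
  units (tt ∷ y) = cong (tt ∷_) (units y)
  bounded : ∀ δ ys zs → replicate (proj₁ δ) tt ≡ ys ++ zs →
   size searchτ (foldl (λ acc _ → visit (proj₂ δ) acc) ([ [] , [] ] , []) ys) ≤ ⟪ K 2 ⊞ X ⊠ (K 1 ⊞ (X ⊞ growth pairsP)) ⟫ (size (nat ⊗ envτ) δ)
  bounded δ@(J , γ) ys zs eq = ≤-trans (subst (λ l → size searchτ (foldl (λ acc _ → visit γ acc) ([ [] , [] ] , []) l) ≤ 2 + suc (length ys) * suc b) (sym (units ys)) (search-size (search-sound (length ys))))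
   (+-monoʳ-≤ 2 (*-mono-≤ (≤-trans (s≤s le) (m≤m+n (suc J) _)) (s≤s (+-mono-≤ (≤-trans (m≤m+n _ _) (m≤n+m (size envτ γ) (suc J))) (grow pairsP δ)))))
   where
   open Search γ
   le : length ys ≤ J
   le = ≤-trans (m≤m+n _ _) (≤-reflexive (trans (sym (length-++ ys)) (trans (cong length (sym eq)) (length-replicate J))))

-- Deciding satisfiability from the answers at the leaves

module LeafAnswers where

 open import Data.Bool using (T)
 open import Data.List.Membership.Propositional.Properties
 open import Data.List.Relation.Unary.All as All using ()
 open import Data.Nat.Properties
 open import Relation.Nullary.Reflects using (ofʸ; ofⁿ; fromEquivalence)
 open Programs hiding (M; A; B)
 open PolynomialTime
 open RegularGraphs using (module Core)
 open GluedCopies using (∈-concatMap)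
 open VertexCover using (module Formula; ∈-concatMap⁻′)
 open FormulaToGraph using (module Reduction)
 open Sparsification
 open Simulation using (module Simulate)
 open Parsing
 open Branching

 open Graph using (degree)
 open PT
 open Formula nat using (Cl; lits; Sat; WellFormed)

 reflects⇔ : ∀ {P : Set} {b} → Reflects P b → T b ⇔ P
 reflects⇔ (ofʸ p) = mk⇔ (λ _ → p) (λ _ → tt)
 reflects⇔ (ofⁿ ¬p) = mk⇔ (λ ()) ¬p

 guarded⁻ : ∀ {A : Set} a {x y : A} → x ∈ (if a then [ y ] else []) → T a × x ≡ y
 guarded⁻ true (here eq) = tt , eq

 guarded⁺ : ∀ {A : Set} a {y : A} → T a → y ∈ (if a then [ y ] else [])
 guarded⁺ true _ = here refl

 module Solver (R : Graph) (conn : Connected R) (r : ℕ) (reg : ∀ u → degree R u ≡ r) (2≤r : 2 ≤ r) (co : Core.Complement R conn r reg 2≤r)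
  (M : TM) (cost : Graph × ℕ → ℕ)
  (solves : ∀ x → ∃[ answer ] Outputs M (Problem.encode (R -freeEdgeDeletion) x) (cost x) [ answer ] × Reflects (Problem.Yes (R -freeEdgeDeletion) x) answer) where

  open Reduction R conn r reg 2≤r co nat using (instance′; word; wordP; correct; φτ)
  open Simulate M using (simulate′; simulateP; simulate-complete; simulate-sound)

  leafFormula : Word × State → ⟦ φτ ⟧
  leafFormula (w , S) = upTo (numVars w) , leafClauses (literals w , triples w , S)

  leafFormulaP : PT (list 𝔹 ⊗ stateτ) φτ leafFormula
  leafFormulaP = upToP (numVarsP ∘P fstP) ,P leafClausesP ∘P (literalsP ∘P fstP ,P (triplesP ∘P fstP ,P sndP))

  abstract
   leafWordP : PT (list 𝔹 ⊗ stateτ) (list 𝔹) (λ wS → Problem.encode (R -freeEdgeDeletion) (instance′ (leafFormula wS)))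
   leafWordP = wordP ∘P leafFormulaP

   leafAnswer : (Word × State) × ℕ → ⊤ ⊎ Bool
   leafAnswer (wS , J) = simulate′ (word (leafFormula wS) , J)

   leafAnswer-simulates : ∀ wS J → leafAnswer (wS , J) ≡ simulate′ (word (leafFormula wS) , J)
   leafAnswer-simulates wS J = refl

   leafAnswerP : PT ((list 𝔹 ⊗ stateτ) ⊗ nat) (𝟙 ⊕ 𝔹) leafAnswer
   leafAnswerP = simulateP ∘P (leafWordP ∘P fstP ,P sndP)

  answered accepted : ⊤ ⊎ Bool → Bool
  answered o = case⊕ o (λ _ → false) (λ _ → true)
  accepted o = case⊕ o (λ _ → false) (λ b → b)

  found : ℕ × Word × ℕ → ⟦ searchτ ⟧
  found (θ , w , J) = search (J , literals w , triples w , θ)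

  -- The empty list means no verdict: the stack is not exhausted, or some leaf was not answered
  -- within J steps. A verdict that is given is correct for every θ and J, so the first one can be
  -- trusted.
  conclude : Word × ℕ → ⟦ searchτ ⟧ → List Bool
  conclude (w , J) s = caseList (proj₁ s) (if all (λ S → answered (leafAnswer ((w , S) , J))) (proj₂ s) then [ any (λ S → accepted (leafAnswer ((w , S) , J))) (proj₂ s) ] else []) (λ _ _ → [])

  attempt : ℕ × Word × ℕ → List Bool
  attempt x = conclude (proj₂ x) (found x)

  answers : Word × ℕ → List Bool
  answers wJ = concatMap (λ θ → attempt (θ , wJ)) (upTo (proj₂ wJ))

  attemptP : PT (nat ⊗ list 𝔹 ⊗ nat) (list 𝔹) attempt
  attemptP = letP foundP (caseListP (fstP ∘P v0)
   (ifP (allP (sndP ∘P v0) (case⊕P (ansP v0 (w2 ∘P w1)) (constP 𝔹 false) (constP 𝔹 true)))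
    [ anyP (sndP ∘P v0) (case⊕P (ansP v0 (w2 ∘P w1)) (constP 𝔹 false) v0) ]P nilP)
   nilP)
   where
   foundP : PT (nat ⊗ list 𝔹 ⊗ nat) searchτ found
   foundP = searchP ∘P (w2 ,P (literalsP ∘P v1 ,P (triplesP ∘P v1 ,P v0)))
   ansP : ∀ {Δ e f} → PT Δ stateτ e → PT Δ (list 𝔹 ⊗ nat) f → PT Δ (𝟙 ⊕ 𝔹) (λ δ → leafAnswer ((proj₁ (f δ) , e δ) , proj₂ (f δ)))
   ansP E F = leafAnswerP ∘P ((fstP ∘P F ,P E) ,P sndP ∘P F)

  answersP : PT (list 𝔹 ⊗ nat) (list 𝔹) answers
  answersP = concatMapP (upToP sndP) attemptP

  module _ (φ : 3CNF) where

   open 3CNF φ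
   open Encoded φ

   inst : State → Graph × ℕ
   inst S = instance′ (leafFormula (w , S))

   module _ (θ : ℕ) where
    open Sparse (literals w) (triples w) θ
    open Leaves (literals w) (triples w) θ
    open Search (literals w , triples w , θ)

    wellFormed : ∀ S → WellFormed (upTo (numVars w)) (leafOf S)
    wellFormed S = record { vars-unique = upTo⁺ (numVars w) ; vars-all = λ m l∈ → proj₁ (∈-cartesianProduct⁻ (upTo (numVars w)) (true ∷ false ∷ []) (leaf-lits S m l∈)) }

    yes⇔ : ∀ S → Problem.Yes (R -freeEdgeDeletion) (inst S) ⇔ (∃[ σ ] Models σ S)
    yes⇔ S = mk⇔ (Equivalence.from (leaf-sat S) ∘ Equivalence.from c) (Equivalence.to c ∘ Equivalence.to (leaf-sat S))
     where c = correct (leafFormula (w , S)) (wellFormed S)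

    leaf-sound : ∀ S J {b} → leafAnswer ((w , S) , J) ≡ inj₂ b → T b ⇔ (∃[ σ ] Models σ S)
    leaf-sound S J {b} eq = let a , out , refl′ = solves (inst S) ; e = simulate-sound (word (leafFormula (w , S))) J out (trans (sym (leafAnswer-simulates (w , S) J)) eq) in
     mk⇔ (λ t → Equivalence.to (yes⇔ S) (Equivalence.to (reflects⇔ refl′) (subst T e t))) (λ m → subst T (sym e) (Equivalence.from (reflects⇔ refl′) (Equivalence.from (yes⇔ S) m)))

    leaf-complete : ∀ S J → cost (inst S) ≤ J → T (answered (leafAnswer ((w , S) , J)))
    leaf-complete S J le = let a , out , _ = solves (inst S) in
     subst (T ∘ answered) (sym (trans (leafAnswer-simulates (w , S) J) (simulate-complete (word (leafFormula (w , S))) J out le))) tt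

    attempt-sound : ∀ J {b} → b ∈ attempt (θ , w , J) → T b ⇔ Satisfiable φ
    attempt-sound J {b} m = go (found (θ , w , J)) (search-sound J) m
     where
     ans : State → ⊤ ⊎ Bool
     ans S = leafAnswer ((w , S) , J)
     value : ∀ S o → ans S ≡ o → T (answered o) → T (accepted o) ⇔ (∃[ σ ] Models σ S)
     value S (inj₂ b) eq _ = leaf-sound S J eq
     go : ∀ s → Sound J s → b ∈ conclude (w , J) s → T b ⇔ Satisfiable φ
     go ([] , leaves) I m = let t , eq = guarded⁻ (all (λ S → answered (ans S)) leaves) m in
      subst (λ b → T b ⇔ Satisfiable φ) (sym eq) (mk⇔ (to t) (from t))
      where
      ok : T (all (λ S → answered (ans S)) leaves) → ∀ {S} → S ∈ leaves → T (accepted (ans S)) ⇔ (∃[ σ ] Models σ S)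
      ok t {S} S∈ = value S (ans S) refl (All.lookup (all⁺ (λ S → answered (ans S)) leaves t) S∈)
      to : T (all (λ S → answered (ans S)) leaves) → T (any (λ S → accepted (ans S)) leaves) → Satisfiable φ
      to d t = let S , S∈ , t′ = find (any⁻ (λ S → accepted (ans S)) leaves t) ; σ , mod = Equivalence.to (ok d S∈) t′ in
       Equivalence.to (models⇔satisfiable θ) (σ , Sound.alive⁻ I σ (inj₂ (lose S∈ mod)))
      from : T (all (λ S → answered (ans S)) leaves) → Satisfiable φ → T (any (λ S → accepted (ans S)) leaves)
      from d sat = let σ , mod = Equivalence.from (models⇔satisfiable θ) sat in
       [ (λ ()) , (λ h → let S , S∈ , mod′ = find h in any⁺ (λ S → accepted (ans S)) (lose S∈ (Equivalence.from (ok d S∈) (σ , mod′)))) ]′ (Sound.alive I σ mod)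

    attempt-complete : ∀ {k J} → Explored ([] , []) k → k ≤ J → (∀ {S} → Leaf S → Small S → cost (inst S) ≤ J) → ∃[ b ] b ∈ attempt (θ , w , J)
    attempt-complete {k} {J} ex k≤ cheap = go (found (θ , w , J)) (search-complete ex k≤) (search-sound J)
     where
     go : ∀ s → proj₁ s ≡ [] → Sound J s → ∃[ b ] b ∈ conclude (w , J) s
     go ([] , leaves) refl I = _ , guarded⁺ (all (λ S → answered (leafAnswer ((w , S) , J))) leaves) (all⁻ (λ S → answered (leafAnswer ((w , S) , J))) (All.tabulate (λ {S} S∈ → leaf-complete S J (cheap (All.lookup (Sound.atLeaf I) S∈) (All.lookup (Sound.smallLeaf I) S∈)))))

   answers-sound : ∀ J {b} → b ∈ answers (w , J) → Reflects (Satisfiable φ) b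
   answers-sound J {b} m = let θ , _ , m′ = ∈-concatMap⁻′ (λ θ → attempt (θ , w , J)) (upTo J) m ; e = attempt-sound θ J m′ in
    fromEquivalence (Equivalence.to e) (Equivalence.from e)

   answers-complete : ∀ θ {k J} → θ < J → Sparse.Explored (literals w) (triples w) θ ([] , []) k → k ≤ J →
    (∀ {S} → Search.Leaf (literals w , triples w , θ) S → Search.Small (literals w , triples w , θ) S → cost (inst S) ≤ J) → answers (w , J) ≢ []
   answers-complete θ {J = J} θ< ex k≤ cheap = let b , m = attempt-complete θ ex k≤ cheap in
    nonempty (∈-concatMap (λ θ → attempt (θ , w , J)) {xs = upTo J} (∈-upTo⁺ θ<) m)
    where
    nonempty : ∀ {A : Set} {x : A} {xs} → x ∈ xs → xs ≢ []
    nonempty (here _) ()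
    nonempty (there _) ()

-- Unbounded search and the choice of the exponent

module Growth where

 open import Data.Nat using (_⊔_; >-nonZero)
 open import Data.Nat.DivMod using (m/n*n≤m)
 open import Data.Nat.Properties
 open import Relation.Nullary using (yes; no)
 open Machines
 open Programs
 open PolynomialTime

 open PT

 -- The code of a list starts with 𝟎 exactly if the list is empty, so repetition on 𝟎 goes on until
 -- there is an answer.
 onFalse : Maybe Sym → Bool
 onFalse (just 𝟎) = true
 onFalse _ = false

 resτ : Ty
 resτ = list 𝔹 ⊗ list 𝔹 ⊗ nat

 -- Tries J = 0, 1, 2, … until `answers (w , J)` is not empty.
 searchLoop : {answers : Word × ℕ → List Bool} → PT (list 𝔹 ⊗ nat) resτ (λ x → answers x , proj₁ x , suc (proj₂ x)) → PT (list 𝔹) resτ (λ w → [] , w , 0) → PT (𝔹 ⊗ resτ) 𝔹 proj₁ →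
  Σ TM λ N → Σ Pol λ q → ∀ w J → answers (w , J) ≢ [] → ∃[ b ] (∃[ J₁ ] b ∈ answers (w , J₁)) × Outputs N w (⟪ q ⟫ (length w + J)) [ b ]
 searchLoop {answers} G init out = machine (readInput ⨾ prog init ⨾ loop ⨾ prog out) , readT ⊞ ((time init ⊙ S) ⊞ (loopT ⊞ (time out ⊙ (growth G ⊙ S)))) , λ w J ne → total w J (go w J J 0 refl ne)
  where
  loop : Prog
  -- When the loop ends, the popped 𝟏 was the first bit of a non-empty list, and its first answer b
  -- now lies on top, where `out` expects it.
  loop = pop M (onBit (branch (prog G) skip)) onFalse
  S readT loopT : Pol
  S = K 2 ⊠ X ⊞ K 2
  readT = K 2 ⊞ (K 2 ⊞ K 3 ⊠ X) ⊞ (K 2 ⊞ (K 2 ⊞ K 5 ⊠ X))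
  loopT = K 2 ⊞ (K 1 ⊞ X) ⊠ (K 1 ⊞ (time G ⊙ S))

  sized : ∀ w {J J′} → J′ ≤ J → size (list 𝔹 ⊗ nat) (w , J′) ≤ ⟪ S ⟫ (length w + J)
  sized w {J} le = ≤-trans (+-mono-≤ (≤-reflexive (size-word w)) (s≤s le)) (≤-trans (m≤m+n _ J) (≤-reflexive (eq (length w) J)))
   where
   eq : ∀ l J → 2 * l + 1 + suc J + J ≡ 2 * (l + J) + 2
   eq = solve-∀

  record Run (w : Word) (J J₀ d : ℕ) : Set where
   field
    {b} : Bool
    {bs} : List Bool
    {J₁} : ℕ
    J₁≤ : J₁ ≤ J
    eq : answers (w , J₁) ≡ b ∷ bs
    run : Exec loop ⟨ 𝟎 ∷ put (list 𝔹 ⊗ nat) (w , J₀) [] ∣ [] ∣ [] ⟩ (2 + suc d * (1 + ⟪ time G ⊙ S ⟫ (length w + J)))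
     ⟨ put (𝔹 ⊗ resτ) (b , bs , w , suc J₁) [] ∣ [] ∣ [] ⟩

  go : ∀ w J d J₀ → J₀ + d ≡ J → answers (w , J) ≢ [] → Run w J J₀ d
  go w J d J₀ eq ne = cases (answers (w , J₀)) refl d eq
   where
   t : ℕ
   t = ⟪ time G ⊙ S ⟫ (length w + J)
   tried : J₀ ≤ J → ∀ {l} → answers (w , J₀) ≡ l → Exec (prog G) ⟨ put (list 𝔹 ⊗ nat) (w , J₀) [] ∣ [] ∣ [] ⟩ t ⟨ put (list 𝔹) l (put (list 𝔹 ⊗ nat) (w , suc J₀) []) ∣ [] ∣ [] ⟩
   tried le e = retarget (λ l → ⟨ put (list 𝔹) l (put (list 𝔹 ⊗ nat) (w , suc J₀) []) ∣ [] ∣ [] ⟩) e (exec≤ G (w , J₀) S {n = length w + J} (sized w le))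
   cases : ∀ l → answers (w , J₀) ≡ l → ∀ d → J₀ + d ≡ J → Run w J J₀ d
   cases (b ∷ bs) e d eq = record { J₁≤ = le ; eq = e ; run = slack (≤-trans (≤-reflexive (tm t)) (+-monoʳ-≤ 2 (m≤m+n (suc t) (d * suc t)))) (again refl (tried le e) (stop refl skip)) }
    where
    le : J₀ ≤ J
    le = ≤-trans (m≤m+n J₀ d) (≤-reflexive eq)
    tm : ∀ t → suc (t + 2) ≡ 2 + suc t
    tm = solve-∀
   cases [] e zero eq = ⊥-elim (ne (trans (cong (λ z → answers (w , z)) (trans (sym eq) (+-identityʳ J₀))) e))
   cases [] e (suc d) eq = record { J₁≤ = Run.J₁≤ rest ; eq = Run.eq rest ; run = slack (≤-reflexive (tm t (suc d * suc t))) (again refl (tried le e) (Run.run rest)) }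
    where
    le : J₀ ≤ J
    le = ≤-trans (m≤m+n J₀ (suc d)) (≤-reflexive eq)
    rest : Run w J (suc J₀) d
    rest = go w J d (suc J₀) (trans (sym (+-suc J₀ d)) eq) ne
    tm : ∀ t x → suc (t + (2 + x)) ≡ 2 + (suc t + x)
    tm = solve-∀

  total : ∀ w J → Run w J 0 J → ∃[ b ] (∃[ J₁ ] b ∈ answers (w , J₁)) × Outputs _ w _ [ b ]
  total w J r = Run.b r , (Run.J₁ r , subst (Run.b r ∈_) (sym (Run.eq r)) (here refl)) ,
   exec-outputs (slack (⟪⟫-mono readT (m≤m+n (length w) J)) (readInput-exec w) ⨾
    exec≤ init w S {n = length w + J} (≤-trans (m≤m+n _ 1) (sized w (z≤n {J}))) ⨾
    slack (+-monoʳ-≤ 2 (*-monoˡ-≤ (1 + ⟪ time G ⊙ S ⟫ (length w + J)) (s≤s (m≤n+m J (length w))))) (Run.run r) ⨾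
    exec≤ out (Run.b r , Run.bs r , w , suc (Run.J₁ r)) (growth G ⊙ S) {n = length w + J} big)
   where
   big : size (𝔹 ⊗ resτ) (Run.b r , Run.bs r , w , suc (Run.J₁ r)) ≤ ⟪ growth G ⊙ S ⟫ (length w + J)
   big = ≤-trans (≤-trans (n≤1+n _) (subst (λ l → size resτ (l , w , suc (Run.J₁ r)) ≤ _) (Run.eq r) (grow G (w , Run.J₁ r)))) (⊙-≤ (growth G) S (sized w (Run.J₁≤ r)))

 unboundedSearch : ∀ {answers} → PT (list 𝔹 ⊗ nat) (list 𝔹) answers →
  Σ TM λ N → Σ Pol λ q → ∀ w J → answers (w , J) ≢ [] → ∃[ b ] (∃[ J₁ ] b ∈ answers (w , J₁)) × Outputs N w (⟪ q ⟫ (length w + J)) [ b ]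
 unboundedSearch A′ = searchLoop (A′ ,P (fstP ,P sucP sndP)) (nilP ,P (idP ,P constP nat 0)) fstP

 -- The least monotone function above f; the budgets of the leaf instances are known only from
 -- above, so the bound on f has to be monotone.
 runMax : (ℕ → ℕ) → ℕ → ℕ
 runMax f zero = f 0
 runMax f (suc n) = f (suc n) ⊔ runMax f n

 runMax-≤ : ∀ f {k n} → k ≤ n → f k ≤ runMax f n
 runMax-≤ f {n = zero} z≤n = ≤-refl
 runMax-≤ f {k} {suc n} le with m≤n⇒m<n∨m≡n le
 ... | inj₁ (s≤s le′) = ≤-trans (runMax-≤ f le′) (m≤n⊔m (f (suc n)) _)
 ... | inj₂ refl = m≤m⊔n (f (suc n)) _

 runMax-attained : ∀ f n → ∃[ k ] k ≤ n × runMax f n ≡ f k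
 runMax-attained f zero = 0 , ≤-refl , refl
 runMax-attained f (suc n) with ⊔-sel (f (suc n)) (runMax f n)
 ... | inj₁ eq = suc n , ≤-refl , eq
 ... | inj₂ eq = let k , le , eq′ = runMax-attained f n in k , m≤n⇒m≤1+n le , trans eq eq′

 -- The maximum up to n is attained at some k ≤ n. A large k is handled by the sublinearity of f,
 -- the finitely many small ones by a constant that n exceeds eventually.
 runMax-sublinear : ∀ {f} → Sublinear f → Sublinear (runMax f)
 runMax-sublinear {f} sub c with N , small ← sub c = N + c * runMax f N , λ n le →
  let k , k≤ , eq = runMax-attained f n in ≤-trans (≤-reflexive (cong (c *_) eq)) (bound n le k k≤)
  where
  bound : ∀ n → N + c * runMax f N ≤ n → ∀ k → k ≤ n → c * f k ≤ n
  bound n le k k≤ with k ≤? N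
  ... | yes k≤N = ≤-trans (*-monoʳ-≤ c (runMax-≤ f k≤N)) (≤-trans (m≤n+m _ N) le)
  ... | no k≰N = ≤-trans (small k (<⇒≤ (≰⇒> k≰N))) k≤

 minUpTo : (ℕ → ℕ) → ℕ → ℕ
 minUpTo h zero = h 0
 minUpTo h (suc m) = h (suc m) ⊓ minUpTo h m

 minUpTo-≤ : ∀ h {j m} → j ≤ m → minUpTo h m ≤ h j
 minUpTo-≤ h {m = zero} z≤n = ≤-refl
 minUpTo-≤ h {j} {suc m} le with m≤n⇒m<n∨m≡n le
 ... | inj₁ (s≤s le′) = ≤-trans (m⊓n≤n (h (suc m)) _) (minUpTo-≤ h le′)
 ... | inj₂ refl = m⊓n≤m (h (suc m)) _

 minUpTo-attained : ∀ h m → ∃[ j ] minUpTo h m ≡ h j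
 minUpTo-attained h zero = 0 , refl
 minUpTo-attained h (suc m) with ⊓-sel (h (suc m)) (minUpTo h m)
 ... | inj₁ eq = suc m , eq
 ... | inj₂ eq = let j , eq′ = minUpTo-attained h m in j , trans eq eq′

 -- With m = 5 + D and j = 2m, the factors D and 4m + 1 are both at most 2^m, the second one for all
 -- m ≥ 5.
 exponential-wins : ∀ D → ∃[ j ] D * suc (j + j) ≤ 2 ^ j
 exponential-wins D = m + m , ≤-trans (*-mono-≤ (≤-trans (n≤2^n D) (^-monoʳ-≤ 2 (m≤n+m D 5))) (linear D)) (≤-reflexive (sym (^-distribˡ-+-* 2 m m)))
  where
  m = 5 + D
  n≤2^n : ∀ n → n ≤ 2 ^ n
  n≤2^n zero = z≤n
  n≤2^n (suc n) = ≤-trans (+-mono-≤ (m^n>0 2 n) (n≤2^n n)) (≤-reflexive (cong (2 ^ n +_) (sym (+-identityʳ (2 ^ n)))))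
  linear : ∀ D → suc (5 + D + (5 + D) + (5 + D + (5 + D))) ≤ 2 ^ (5 + D)
  linear zero = m≤m+n 21 11
  linear (suc D) = ≤-trans (≤-reflexive (eq D)) (≤-trans (+-mono-≤ (linear D) (≤-trans (four D) (linear D))) (≤-reflexive (cong (2 ^ (5 + D) +_) (sym (+-identityʳ (2 ^ (5 + D)))))))
   where
   eq : ∀ D → suc (5 + suc D + (5 + suc D) + (5 + suc D + (5 + suc D))) ≡ suc (5 + D + (5 + D) + (5 + D + (5 + D))) + 4
   eq = solve-∀
   four : ∀ D → 4 ≤ suc (5 + D + (5 + D) + (5 + D + (5 + D)))
   four D = s≤s (s≤s (s≤s (s≤s z≤n)))

 -- The least e with e · 2^j > C · n; for C = 14 this e exhausts the potential of the
 -- sparsification.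
 depth : ℕ → ℕ → ℕ → ℕ
 depth C j n = suc (_/_ (C * n) (2 ^ j) {{m^n≢0 2 j}})

 module Exponent (C : ℕ) {{_ : NonZero C}} (width : ℕ → ℕ) (width>0 : ∀ j → 0 < width j) (F : ℕ → ℕ) where

  -- The three summands account for the threshold θ = 2^j itself, for the number of nodes, and for
  -- the time at a leaf whose budget is at most `width j * n`.
  exponent : ℕ → ℕ → ℕ
  exponent j n = suc j + (suc (suc (j + j) * depth C j n) + F (width j * n))

  -- This minimum occurs only in the time bound and is never computed by the machine. The range j ≤
  -- n is wide enough because j stays fixed while n grows.
  best : ℕ → ℕ
  best n = minUpTo (λ j → exponent j n) n

  -- From here on j lies in the range of the minimum, `width j * n` lies where F is small, and 3c
  -- times the additive constants is at most n.
  threshold : ℕ → ℕ → ℕ → ℕ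
  threshold c j N = j + (N + 3 * c * (suc j + suc (suc (j + j))))

  -- The exponent is split into a constant part, a part proportional to n / 2^j, and the part with
  -- F; each of them times 3c is at most n. The middle part requires j to be large compared with c,
  -- so j is fixed before n.
  best-small : ∀ c j → 3 * c * C * suc (j + j) ≤ 2 ^ j → ∀ N → (∀ m → N ≤ m → width j * (3 * c) * F m ≤ m) → ∀ n → threshold c j N ≤ n → c * best n ≤ n
  best-small c j wins N small n le = ≤-trans (*-monoʳ-≤ c (minUpTo-≤ (λ j → exponent j n) (≤-trans (m≤m+n j _) le)))
   (*-cancelˡ-≤ 3 (≤-trans (≤-reflexive (trans (sym (*-assoc 3 c (exponent j n))) (split (3 * c) (suc j) s q (F (width j * n))))) (≤-trans (+-mono-≤ first (+-mono-≤ second third)) (≤-reflexive (three n)))))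
   where
   s = suc (j + j)
   instance
    nz : NonZero (2 ^ j)
    nz = m^n≢0 2 j
    nw : NonZero (width j)
    nw = >-nonZero (width>0 j)
   q : ℕ
   q = C * n / 2 ^ j
   split : ∀ a k s q z → a * (k + (suc (s * suc q) + z)) ≡ a * (k + suc s) + (a * (s * q) + a * z)
   split = solve-∀
   three : ∀ n → n + (n + n) ≡ 3 * n
   three = solve-∀
   first : 3 * c * (suc j + suc s) ≤ n
   first = ≤-trans (≤-trans (m≤n+m _ N) (m≤n+m _ j)) le
   second : 3 * c * (s * q) ≤ n
   second = *-cancelˡ-≤ C (≤-trans (≤-reflexive (eq C (3 * c) s q)) (≤-trans (*-monoˡ-≤ q wins) (≤-trans (≤-reflexive (*-comm (2 ^ j) q)) (m/n*n≤m (C * n) (2 ^ j)))))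
    where
    eq : ∀ C a s q → C * (a * (s * q)) ≡ a * C * s * q
    eq = solve-∀
   third : 3 * c * F (width j * n) ≤ n
   third = *-cancelˡ-≤ (width j) (≤-trans (≤-reflexive (sym (*-assoc (width j) (3 * c) _)))
    (small (width j * n) (≤-trans (≤-trans (≤-trans (m≤m+n N _) (m≤n+m _ j)) le) (m≤n*m n (width j)))))

  best-sublinear : Sublinear F → ∀ E → Sublinear (λ n → best n * E)
  best-sublinear sub E c = let j , wins = exponential-wins (3 * (c * E) * C) ; N , small = sub (width j * (3 * (c * E))) in
   threshold (c * E) j N , λ n le → ≤-trans (≤-reflexive (order c E (best n))) (best-small (c * E) j wins N small n le)
   where
   order : ∀ c E x → c * (x * E) ≡ c * E * x
   order = solve-∀

-- The lower bound under ETH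

module Subexponential where

 open import Data.Bool using (T)
 open import Data.Fin using (toℕ)
 open import Data.List.Properties using (length-filter)
 open import Data.Nat.DivMod using (m≡m%n+[m/n]*n; m%n<n)
 open import Data.Nat.Properties
 open Programs hiding (M; A; B)
 open PolynomialTime
 open RegularGraphs using (module Core; ¬T-false)
 open GluedCopies using (mem⁻)
 open FormulaToGraph using (module Reduction; length-product)
 open Sparsification
 open Parsing
 open Branching
 open LeafAnswers
 open Growth

 open Graph using (degree; order; edges)
 open PT

 pair-lengthʳ : ∀ w v → length v ≤ length ⟨ w , v ⟩
 pair-lengthʳ [] v = n≤1+n _
 pair-lengthʳ (b ∷ w) v = ≤-trans (pair-lengthʳ w v) (≤-trans (n≤1+n _) (n≤1+n _))

 pair-lengthˡ : ∀ w v → length w ≤ length ⟨ w , v ⟩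
 pair-lengthˡ [] v = z≤n
 pair-lengthˡ (b ∷ w) v = s≤s (≤-trans (pair-lengthˡ w v) (n≤1+n _))

 -- The order is written in unary and so is at most the length of the code; the number of edges is
 -- at most its square.
 graph-size : ∀ R x → let l = length (Problem.encode (R -freeEdgeDeletion) x) in Graph.size (proj₁ x) ≤ l + l * l
 graph-size R x@(G , k) = +-mono-≤ small (≤-trans (≤-trans (length-filter (T? ∘ (λ (u , v) → (toℕ u <ᵇ toℕ v) ∧ has (edges G) u v)) (cartesianProduct (allFin (order G)) (allFin (order G))))
  (≤-reflexive (trans (length-product (allFin (order G)) (allFin (order G))) (cong₂ _*_ (length-tabulate {n = order G} (λ i → i)) (length-tabulate {n = order G} (λ i → i)))))) (*-mono-≤ small small))
  where
  small : order G ≤ length (Problem.encode (R -freeEdgeDeletion) x)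
  small = ≤-trans (≤-reflexive (sym (length-replicate (order G)))) (≤-trans (pair-lengthˡ (unary (order G)) _) (pair-lengthʳ (encodeℕᵇ (fromℕ k)) (encodeGraph G)))

 pow : ∀ {a b} → a ≤ b → 2 ^ a ≤ 2 ^ b
 pow = ^-monoʳ-≤ 2

 -- The coefficient of n in 2n + 15 · 2n(1 + θ + θ²) with θ = 2^j: the budget of a leaf formula with
 -- n variables, hence 2n literals.
 width : ℕ → ℕ
 width j = 2 + 30 * (1 + (2 ^ j + 2 ^ j * 2 ^ j))

 -- Because θ² + 1 ≤ 2^(2j + 1) for θ = 2^j.
 nodes-≤ : ∀ j e → 2 * (1 * suc (2 ^ j * 2 ^ j) ^ e) ≤ 2 ^ suc (suc (j + j) * e)
 nodes-≤ j e = *-monoʳ-≤ 2 (≤-trans (≤-reflexive (*-identityˡ _)) (≤-trans (^-monoˡ-≤ e base) (≤-reflexive (^-*-assoc 2 (suc (j + j)) e))))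
  where
  base : suc (2 ^ j * 2 ^ j) ≤ 2 ^ suc (j + j)
  base = ≤-trans (≤-reflexive (cong suc (sym (^-distribˡ-+-* 2 j j)))) (≤-trans (+-monoˡ-≤ (2 ^ (j + j)) (m^n>0 2 (j + j))) (≤-reflexive (cong (2 ^ (j + j) +_) (sym (+-identityʳ _)))))

 split-sum : ∀ a b c {x y z P} → x ≤ 2 ^ a → y ≤ 2 ^ b → z ≤ 2 ^ c * P → x + (y + z) ≤ 2 ^ (a + (b + c)) * (2 + P)
 split-sum a b c {P = P} p q r = ≤-trans (+-mono-≤ (≤-trans p (pow (m≤m+n a _))) (+-mono-≤ (≤-trans q (pow (≤-trans (m≤m+n b c) (m≤n+m _ a)))) (≤-trans r (*-monoˡ-≤ P (pow (≤-trans (m≤n+m c b) (m≤n+m _ a)))))))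
  (≤-reflexive (eq (2 ^ (a + (b + c))) P))
  where
  eq : ∀ z P → z + (z + z * P) ≡ z * (2 + P)
  eq = solve-∀

 -- A polynomial of exponent e turns a factor 2^g of its argument into 2^(g · e). The final exponent
 -- is therefore `best` times a constant, which is still sublinear.
 at-scaled : ∀ p g x Y → x ≤ 2 ^ g * Y → at p x ≤ 2 ^ (g * PolyBound.exponent p) * at p Y
 at-scaled p g x Y le = ≤-trans (+-mono-≤ (*-monoʳ-≤ c (≤-trans (^-monoˡ-≤ e le) (≤-reflexive (trans (^-*-distrib e (2 ^ g) Y) (cong (_* Y ^ e) (^-*-assoc 2 g e))))))
  (≤-trans (≤-reflexive (sym (*-identityˡ c))) (*-monoˡ-≤ c (m^n>0 2 (g * e))))) (≤-reflexive (eq (2 ^ (g * e)) (Y ^ e) c))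
  where
  c = PolyBound.coefficient p
  e = PolyBound.exponent p
  eq : ∀ z y c → c * (z * y) + z * c ≡ z * (c * y + c)
  eq = solve-∀

 module _ (φ : 3CNF) where

  open 3CNF φ
  open Encoded φ

  literals-unique : Unique (literals w)
  literals-unique = cartesianProduct⁺ (upTo⁺ (numVars w)) (((λ ()) ∷ []) ∷ [] ∷ [])

  sparsify : ∀ j → ∃[ k ] Sparse.Explored (literals w) (triples w) (2 ^ j) ([] , []) k × k ≤ 2 ^ suc (suc (j + j) * depth 14 j variables)
  sparsify j = let k , ex , le = explore e 0 ([] , []) z≤n inv₀ (≤-trans deep (m≤n+m _ (Φ ([] , [])))) in k , ex , ≤-trans (n≤1+n k) (≤-trans le (nodes-≤ j e))
   where
   θ = 2 ^ j
   e = depth 14 j variables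
   instance
    nz : NonZero (2 ^ j)
    nz = m^n≢0 2 j
   open Sparse (literals w) (triples w) θ
   open Progress literals-unique (λ {a} {b} {c} → trip-sym θ {a} {b} {c}) (m^n>0 2 j)
   no-pair : ∀ {x y} → ¬ T (pr ([] , []) x y)
   no-pair {x} {y} t with () ← mem⁻ (ℓ ⊗ ℓ) (x , y) [] t
   inv₀ : Inv ([] , [])
   inv₀ = record { symmetric = λ {x} {y} _ _ t → ⊥-elim (no-pair {x} {y} t)
    ; sparse = λ {x} _ → ≤-trans (≤-reflexive (∑-zero (literals w) (λ {y} _ → cong ind (¬T-false (λ t → no-pair {x} {y} (proj₁ (lp⁻ ([] , []) x y t))))))) z≤n }
   enough : 14 * variables < e * θ
   enough = ≤-trans (s≤s (≤-reflexive (m≡m%n+[m/n]*n (14 * variables) θ))) (+-monoˡ-≤ (14 * variables / θ * θ) (m%n<n (14 * variables) θ))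
   -- After removal of a common factor θ: the potential is at most 7θ · 2n, and e was chosen with eθ
   -- > 14n.
   deep : Φmax < e * B + 0
   deep = ≤-trans (s≤s (≤-reflexive (trans (cong (7 * θ *_) length-literals) (eq₁ θ variables))))
    (≤-trans (*-monoʳ-< θ enough) (≤-reflexive (eq₂ θ e)))
    where
    eq₁ : ∀ θ v → 7 * θ * (2 * v) ≡ θ * (14 * v)
    eq₁ = solve-∀
    eq₂ : ∀ θ e → θ * (e * θ) ≡ e * (θ * θ) + 0
    eq₂ = solve-∀

 encoded-size : ∀ R {σ} {f : ⟦ σ ⟧ → Graph × ℕ} (F : PT σ (list 𝔹) (λ x → Problem.encode (R -freeEdgeDeletion) (f x))) x →
  Graph.size (proj₁ (f x)) ≤ ⟪ (X ⊞ X ⊠ X) ⊙ growth F ⟫ (size σ x)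
 encoded-size R {f = f} F x = ≤-trans (graph-size R (f x)) (⊙-≤ (X ⊞ X ⊠ X) (growth F) (≤-trans (length≤size 𝔹 (Problem.encode (R -freeEdgeDeletion) (f x))) (grow F x)))

 instance-size : ∀ R {f : Word × State → Graph × ℕ} {g h} → PT (list 𝔹 ⊗ stateτ) (list 𝔹) (λ x → Problem.encode (R -freeEdgeDeletion) (f x)) → PT (list 𝔹) (list ℓ) g → PT (list 𝔹) (list (ℓ ⊗ ℓ)) h →
  Σ Pol λ q → ∀ w S → size (list ℓ) (proj₁ S) ≤ size (list ℓ) (g w) → size (list (ℓ ⊗ ℓ)) (proj₂ S) ≤ size (list (ℓ ⊗ ℓ)) (h w) → Graph.size (proj₁ (f (w , S))) ≤ ⟪ q ⟫ (length w)
 instance-size R {f} F G H = ((X ⊞ X ⊠ X) ⊙ growth F) ⊙ q₂ ⊙ q₃ , λ w S s₁ s₂ → ≤-trans (encoded-size R {f = f} F (w , S)) (⊙-≤ ((X ⊞ X ⊠ X) ⊙ growth F) (q₂ ⊙ q₃) {n = length w}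
  (≤-trans (+-monoʳ-≤ (size (list 𝔹) w) (+-mono-≤ (≤-trans s₁ (grow G w)) (≤-trans s₂ (grow H w)))) (⊙-≤ q₂ q₃ {n = length w} (≤-reflexive (size-word w)))))
  where
  q₂ = X ⊞ (growth G ⊞ growth H)
  q₃ = K 2 ⊠ X ⊞ K 1

 module Transfer (R : Graph) (conn : Connected R) (r : ℕ) (reg : ∀ u → degree R u ≡ r) (2≤r : 2 ≤ r) (co : Core.Complement R conn r reg 2≤r)
  (f : ℕ → ℕ) (p : PolyBound) (sub : Sublinear f) (M : TM)
  (solves : ∀ x → ∃[ answer ] Outputs M (Problem.encode (R -freeEdgeDeletion) x) (2 ^ f (proj₂ x) * at p (Graph.size (proj₁ x))) [ answer ] × Reflects (Problem.Yes (R -freeEdgeDeletion) x) answer) where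

  cost : Graph × ℕ → ℕ
  cost x = 2 ^ f (proj₂ x) * at p (Graph.size (proj₁ x))

  open Reduction R conn r reg 2≤r co nat using (instance′; budget; budget-≤)
  open Solver R conn r reg 2≤r co M cost solves

  F : ℕ → ℕ
  F = runMax f

  open Exponent 14 width (λ j → s≤s z≤n) F using (exponent; best; best-sublinear)

  abstract
   sizeBound : Σ Pol λ q → ∀ w S → size (list ℓ) (proj₁ S) ≤ size (list ℓ) (literals w) → size (list (ℓ ⊗ ℓ)) (proj₂ S) ≤ size (list (ℓ ⊗ ℓ)) (cartesianProduct (literals w) (literals w)) →
    Graph.size (proj₁ (instance′ (leafFormula (w , S)))) ≤ ⟪ q ⟫ (length w)
   sizeBound = instance-size R {f = λ wS → instance′ (leafFormula wS)} leafWordP literalsP (productP literalsP literalsP)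

  sizePol : Pol
  sizePol = proj₁ sizeBound

  costPol : Pol
  costPol = polOf p ⊙ sizePol

  module _ (φ : 3CNF) (j : ℕ) where

   open 3CNF φ
   open Encoded φ

   leaf-budget : ∀ {S} → Search.Leaf (literals w , triples w , 2 ^ j) S → budget (leafFormula (w , S)) ≤ width j * variables
   leaf-budget {S} v = ≤-trans (budget-≤ (leafFormula (w , S)) (wellFormed φ (2 ^ j) S) (λ m → Leaves.leaf-width (literals w) (triples w) (2 ^ j) S m))
    (≤-trans (+-mono-≤ (≤-reflexive (cong (2 *_) (trans (length-upTo (numVars w)) numVars-encode)))
     (*-monoʳ-≤ 15 (≤-trans (Leaves.leaf-count (literals w) (triples w) (2 ^ j) v) (≤-reflexive (cong (_* (1 + (2 ^ j + 2 ^ j * 2 ^ j))) length-literals)))))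
     (≤-reflexive (eq variables (2 ^ j))))
    where
    eq : ∀ v θ → 2 * v + 15 * (2 * v * (1 + (θ + θ * θ))) ≡ (2 + 30 * (1 + (θ + θ * θ))) * v
    eq = solve-∀

   leaf-cost : ∀ {S} → Search.Leaf (literals w , triples w , 2 ^ j) S → Search.Small (literals w , triples w , 2 ^ j) S →
    cost (inst φ S) ≤ 2 ^ F (width j * variables) * ⟪ costPol ⟫ (length w)
   leaf-cost {S} v small = *-mono-≤ (pow (runMax-≤ f (leaf-budget v)))
    (≤-trans (≤-reflexive (sym (polOf-at p (Graph.size (proj₁ (inst φ S)))))) (⊙-≤ (polOf p) sizePol (proj₂ sizeBound w S (proj₁ small) (proj₂ small))))

   -- J must exceed θ for this threshold to be tried, and must be at least the number of nodes for
   -- the search to end and the cost of every leaf for all answers to arrive; the sum serves all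
   -- three.
   enough-time : ∃[ J ] J ≤ 2 ^ exponent j variables * (2 + ⟪ costPol ⟫ (length w)) × answers (w , J) ≢ []
   enough-time = let k , ex , k≤ = sparsify φ j in
    suc θ + (k + L) ,
    split-sum (suc j) (suc (suc (j + j) * depth 14 j variables)) (F (width j * variables)) (≤-trans (+-monoˡ-≤ θ (m^n>0 2 j)) (≤-reflexive (cong (θ +_) (sym (+-identityʳ θ))))) k≤ ≤-refl ,
    answers-complete φ θ (m≤m+n (suc θ) (k + L)) ex (≤-trans (m≤m+n k L) (m≤n+m (k + L) (suc θ)))
     (λ v small → ≤-trans (leaf-cost v small) (≤-trans (m≤n+m L k) (m≤n+m (k + L) (suc θ))))
    where
    θ = 2 ^ j
    L = 2 ^ F (width j * variables) * ⟪ costPol ⟫ (length w)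

  solvable : SubexpSolvable 3SAT 3CNF.variables (length ∘ encode3CNF)
  solvable = build (unboundedSearch answersP)
   where
   build : (Σ TM λ N → Σ Pol λ q → ∀ w J → answers (w , J) ≢ [] → ∃[ b ] (∃[ J₁ ] b ∈ answers (w , J₁)) × Outputs N w (⟪ q ⟫ (length w + J)) [ b ]) →
    SubexpSolvable 3SAT 3CNF.variables (length ∘ encode3CNF)
   build (N , q , runs) = (λ n → best n * E) , dominate total , best-sublinear (runMax-sublinear sub) E , N , solve
    where
    E = PolyBound.exponent (dominate q)
    Y total : Pol
    Y = K 2 ⊞ costPol ⊞ X
    total = polOf (dominate q) ⊙ Y
    solve : ∀ φ → ∃[ answer ] Outputs N (encode3CNF φ) (2 ^ (best (3CNF.variables φ) * E) * at (dominate total) (length (encode3CNF φ))) [ answer ] × Reflects (Satisfiable φ) answer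
    solve φ =
     -- This j enters only the estimate of J; the machine finds an answer without knowing it.
     let j , eq = minUpTo-attained (λ j → exponent j n) n
         J , J≤ , ne = enough-time φ j
         b , (J₁ , b∈) , s , d , s≤ , halts , out = runs w J ne
     in b , (s , d , ≤-trans s≤ (bound j J eq J≤) , halts , out) , answers-sound φ J₁ b∈
     where
     n = 3CNF.variables φ
     w = encode3CNF φ
     l = length w
     bound : ∀ j J → best n ≡ exponent j n → J ≤ 2 ^ exponent j n * (2 + ⟪ costPol ⟫ l) → ⟪ q ⟫ (l + J) ≤ 2 ^ (best n * E) * at (dominate total) l
     bound j J eq J≤ = ≤-trans (dominate-≤ q (l + J)) (≤-trans (at-scaled (dominate q) (best n) (l + J) (⟪ Y ⟫ l) sum≤)
      (*-monoʳ-≤ (2 ^ (best n * E)) (≤-trans (≤-reflexive (trans (sym (polOf-at (dominate q) (⟪ Y ⟫ l))) (sym (⊙-eval (polOf (dominate q)) Y l)))) (dominate-≤ total l))))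
      where
      sum≤ : l + J ≤ 2 ^ best n * ⟪ Y ⟫ l
      sum≤ = ≤-trans (+-mono-≤ (≤-trans (≤-reflexive (sym (*-identityˡ l))) (*-monoˡ-≤ l (m^n>0 2 (best n)))) (subst (λ g → J ≤ 2 ^ g * (2 + ⟪ costPol ⟫ l)) (sym eq) J≤))
       (≤-reflexive (trans (+-comm (2 ^ best n * l) _) (sym (*-distribˡ-+ (2 ^ best n) (2 + ⟪ costPol ⟫ l) l))))

 subexponential : (R : Graph) (conn : Connected R) (r : ℕ) (reg : ∀ u → degree R u ≡ r) (2≤r : 2 ≤ r) → Core.Complement R conn r reg 2≤r →
  ETH → ¬ SubexpSolvable (R -freeEdgeDeletion) proj₂ (Graph.size ∘ proj₁)
 subexponential R conn r reg 2≤r co eth (f , p , sub , M , solves) = eth (Transfer.solvable R conn r reg 2≤r co f p sub M solves)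

open RegularGraphs using (module Core; some-vertex; 2≤degree)
open Membership using (module Verifier)
open CookLevin using (module Hardness)
open Subexponential using (subexponential)

theorem4p8 : (R : Graph) → Connected R → Regular R → 2 ≤ ∣ Graph.edges R ∣ₑ → NPComplete (R -freeEdgeDeletion) × (ETH → ¬ SubexpSolvable (R -freeEdgeDeletion) proj₂ (Graph.size ∘ proj₁))
theorem4p8 R conn (r , reg) 2≤e = (Verifier.inNP R , Hardness.npHard R conn r reg 2≤r co) , subexponential R conn r reg 2≤r co
 where
 2≤r = 2≤degree R conn r reg 2≤e
 -- The search for the path may start at any vertex; an end of an edge provides one.
 co = Core.complement R conn r reg 2≤r (some-vertex R conn r reg 2≤e)
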